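{- Let $n\ge 1$ and let $\lambda$ be a partition of $n$. Let $\kappa_1\ge \kappa_2\ge\cdots\ge\kappa_n$ be the multiset of values $i-j$ over the cells $(i,j)$ of the diagram of $\lambda$ ($i$ the column index, $j$ the row index), arranged in non-increasing order, and set $c_i=\kappa_i+i-1$ for $1\le i\le n$, so that $\prod_{(i,j)\in\lambda}(\alpha+i-j)=\prod_{i=1}^n(\alpha+c_i-i+1)$ and $0\le c_1\le\cdots\le c_n\le n$. Then $$\langle \tilde{J}_{(n)}^{(\alpha)}(X),s_\lambda\rangle = \sum_{k=0}^n K_{\lambda,1^n}\, h_k(B(c_1,\ldots,c_n)) \binom{\alpha + k}{n} = \sum_{k=0}^n K_{\lambda,1^n}\, r_{n-k}(B(c_1,\ldots,c_n)) \binom{\alpha}{k}k!.$$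
   Context: Jack polynomials: over $\mathbb{Q}(\alpha)$, with $\alpha$ an indeterminate, let $\langle p_\lambda,p_\nu\rangle_\alpha=\delta_{\lambda\nu}z_\lambda\alpha^{\ell(\lambda)}$, where $z_\lambda=\prod_i i^{m_i}m_i!$ and $m_i$ is the number of parts of $\lambda$ equal to $i$. The integral form Jack symmetric functions $J_\mu^{(\alpha)}(X)$ are the unique family, indexed by partitions $\mu$, of symmetric functions that are pairwise orthogonal for $\langle\cdot,\cdot\rangle_\alpha$, are triangular (only monomial symmetric functions $m_\lambda$ with $\lambda\le\mu$ in dominance order appear in $J_\mu^{(\alpha)}$), and are normalized so that the coefficient of $m_{1^n}$ in $J_\mu^{(\alpha)}$ is $n!$ where $n=|\mu|$. For $\mu$ a partition of $n$, define $\tilde J_\mu^{(\alpha)}(X)=\alpha^nJ_\mu^{(1/\alpha)}(X)$. The bracket $\langle\cdot,\cdot\rangle$ (without subscript) is the Hall scalar product, for which Schur functions are orthonormal (extended linearly over $\mathbb{Q}(\alpha)$). Binomial coefficients $\binom{\alpha+k}{n}$ and $\binom{\alpha}{k}$ are polynomials in $\alpha$. Partition diagrams are drawn in French notation: rows left-justified, the $j$th row from the bottom having $\lambda_j$ cells; the cell $(i,j)$ is in column $i$ (from the left) and row $j$ (from the bottom). $K_{\lambda,1^n}$ is the number of standard Young tableaux of shape $\lambda$. Rook theory: for $0\le c_1\le\cdots\le c_n\le n$ integers, $B(c_1,\ldots,c_n)$ is the Ferrers board in the $n\times n$ grid consisting of the bottom $c_i$ cells of column $i$, for each $i$. For a board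 $B$ (a subset of the $n\times n$ grid), $r_k(B)$ is the number of ways to place $k$ nonattacking rooks (no two in the same row or column) on $B$, and $h_k(B)$ is the number of ways to place $n$ nonattacking rooks on the $n\times n$ grid with exactly $k$ of them on $B$. -}

module Defs where

open import Algebra.Bundles.Raw using (RawRing)
import Algebra.Definitions.RawSemiring as RawSemiringDefs
open import Data.Bool.Base using (Bool; T)
open import Data.Bool.Properties using (T?)
open import Data.Empty using (⊥-elim)
open import Data.Fin.Base as Fin using (Fin; toℕ)
import Data.Fin.Properties as Fin
open import Data.Integer.Base as ℤ using (ℤ; +_; _⊖_)
import Data.Integer.Properties as ℤ
open import Data.List.Base
  using (List; []; _∷_; _++_; map; foldr; length; filter; concat; zip; take;
         upTo; applyUpTo; allFin; replicate; reverse; cartesianProduct;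
         cartesianProductWith)
open import Data.List.Properties using (≡-dec)
open import Data.List.Relation.Unary.All as All using (All; []; _∷_)
import Data.List.Relation.Unary.All.Properties as All
open import Data.List.Relation.Unary.AllPairs as AllPairs using (AllPairs)
open import Data.List.Relation.Unary.Any using (Any; here; there)
import Data.List.Relation.Unary.Any.Properties as Any
open import Data.List.Relation.Unary.Linked as Linked using (Linked; []; [-]; _∷_)
open import Data.Nat.Base as ℕ using (ℕ; zero; suc; NonZero; _∸_; _!)
import Data.Nat.ListAction as ℕ using (sum; product)
import Data.Nat.Properties as ℕ
open import Data.Product.Base using (_×_; _,_; proj₁; proj₂; uncurry; ∃)
open import Data.Rational.Base as ℚ using (ℚ; 0ℚ; 1ℚ)
import Data.Rational.Properties as ℚ
open import Level using (0ℓ)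
open import Relation.Binary.PropositionalEquality
open import Relation.Nullary using (¬_; Dec; yes; no; does; ¬?; _×-dec_)
open import Relation.Unary using (Pred; Decidable)

-- Polynomials ℚ[α]: coefficient lists, constant coefficient first.
-- Trailing zeros are allowed, so equality is equality of coefficients.

Poly : Set
Poly = List ℚ

coeff : Poly → ℕ → ℚ
coeff []      _       = 0ℚ
coeff (a ∷ p) zero    = a
coeff (a ∷ p) (suc i) = coeff p i

infix 4 _≈ᵖ_
_≈ᵖ_ : Poly → Poly → Set
p ≈ᵖ q = ∀ i → coeff p i ≡ coeff q i

NonZeroᵖ : Poly → Set
NonZeroᵖ = Any (_≢ 0ℚ)

infixl 6 _+ᵖ_
infixl 7 _*ᵖ_

_+ᵖ_ : Poly → Poly → Poly
[]      +ᵖ q       = q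
(a ∷ p) +ᵖ []      = a ∷ p
(a ∷ p) +ᵖ (b ∷ q) = (a ℚ.+ b) ∷ (p +ᵖ q)

_*ᵖ_ : Poly → Poly → Poly
[]      *ᵖ q = []
(a ∷ p) *ᵖ q = map (a ℚ.*_) q +ᵖ (0ℚ ∷ p *ᵖ q)

-ᵖ_ : Poly → Poly
-ᵖ_ = map (λ a → ℚ.- a)

-- ℚ[α] has no zero divisors; needed for the denominators of sums and products
-- of fractions.

coeff-+ᵖ : ∀ p q i → coeff (p +ᵖ q) i ≡ coeff p i ℚ.+ coeff q i
coeff-+ᵖ []      q       i       = sym (ℚ.+-identityˡ _)
coeff-+ᵖ (a ∷ p) []      i       = sym (ℚ.+-identityʳ _)
coeff-+ᵖ (a ∷ p) (b ∷ q) zero    = refl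
coeff-+ᵖ (a ∷ p) (b ∷ q) (suc i) = coeff-+ᵖ p q i

coeff-scale : ∀ a q i → coeff (map (a ℚ.*_) q) i ≡ a ℚ.* coeff q i
coeff-scale a []      i       = sym (ℚ.*-zeroʳ a)
coeff-scale a (b ∷ q) zero    = refl
coeff-scale a (b ∷ q) (suc i) = coeff-scale a q i

coeff-*ᵖ-∷ : ∀ a p q i →
  coeff ((a ∷ p) *ᵖ q) i ≡ a ℚ.* coeff q i ℚ.+ coeff (0ℚ ∷ p *ᵖ q) i
coeff-*ᵖ-∷ a p q i = trans
  (coeff-+ᵖ (map (a ℚ.*_) q) (0ℚ ∷ p *ᵖ q) i)
  (cong (ℚ._+ coeff (0ℚ ∷ p *ᵖ q) i) (coeff-scale a q i))

*-nonZero : ∀ {a b} → a ≢ 0ℚ → b ≢ 0ℚ → a ℚ.* b ≢ 0ℚ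
*-nonZero {a} {b} a≢0 b≢0 ab≡0 = b≢0 (begin
  b                        ≡⟨ ℚ.*-identityˡ b ⟨
  1ℚ ℚ.* b                 ≡⟨ cong (ℚ._* b) (ℚ.*-inverseˡ a) ⟨
  ((ℚ.1/ a) ℚ.* a) ℚ.* b   ≡⟨ ℚ.*-assoc (ℚ.1/ a) a b ⟩
  (ℚ.1/ a) ℚ.* (a ℚ.* b)   ≡⟨ cong ((ℚ.1/ a) ℚ.*_) ab≡0 ⟩
  (ℚ.1/ a) ℚ.* 0ℚ          ≡⟨ ℚ.*-zeroʳ (ℚ.1/ a) ⟩
  0ℚ                       ∎)
  where
  open ≡-Reasoning
  instance
    nz : ℚ.NonZero a
    nz = ℚ.≢-nonZero a≢0

∃⇒NonZeroᵖ : ∀ p i → coeff p i ≢ 0ℚ → NonZeroᵖ p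
∃⇒NonZeroᵖ []      i       ≢0 = ⊥-elim (≢0 refl)
∃⇒NonZeroᵖ (a ∷ p) zero    ≢0 = here ≢0
∃⇒NonZeroᵖ (a ∷ p) (suc i) ≢0 = there (∃⇒NonZeroᵖ p i ≢0)

VanishesBelow : ℕ → Poly → Set
VanishesBelow j q = ∀ i → i ℕ.< j → coeff q i ≡ 0ℚ

lowest : ∀ {q} → NonZeroᵖ q → ∃ λ j → VanishesBelow j q × coeff q j ≢ 0ℚ
lowest (here b≢0) = 0 , (λ _ ()) , b≢0
lowest {b ∷ q} (there nz) with b ℚ.≟ 0ℚ
... | no  b≢0 = 0 , (λ _ ()) , b≢0
... | yes b≡0 with lowest nz
...   | j , below , ≢0 = suc j , below′ , ≢0
  where
  below′ : VanishesBelow (suc j) (b ∷ q)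
  below′ zero    _           = b≡0
  below′ (suc i) (ℕ.s≤s i<j) = below i i<j

*ᵖ-vanishes : ∀ p {q j} → VanishesBelow j q → VanishesBelow j (p *ᵖ q)
0∷*ᵖ-vanishes : ∀ p {q j} → VanishesBelow j q → VanishesBelow (suc j) (0ℚ ∷ p *ᵖ q)

*ᵖ-vanishes []      below i i<j = refl
*ᵖ-vanishes (a ∷ p) {q} below i i<j = trans (coeff-*ᵖ-∷ a p q i) (cong₂ ℚ._+_
  (trans (cong (a ℚ.*_) (below i i<j)) (ℚ.*-zeroʳ a))
  (0∷*ᵖ-vanishes p below i (ℕ.m<n⇒m<1+n i<j)))

0∷*ᵖ-vanishes p below zero    _           = refl
0∷*ᵖ-vanishes p below (suc i) (ℕ.s≤s i<j) = *ᵖ-vanishes p below i i<j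

*ᵖ-nonZero : ∀ {p q} → NonZeroᵖ p → NonZeroᵖ q → NonZeroᵖ (p *ᵖ q)
*ᵖ-nonZero {a ∷ p} {q} p≢0 q≢0 with a ℚ.≟ 0ℚ
*ᵖ-nonZero {a ∷ p} {q} (here a≢0)  q≢0 | yes a≡0 = ⊥-elim (a≢0 a≡0)
*ᵖ-nonZero {a ∷ p} {q} (there p≢0) q≢0 | yes a≡0 with lowest (*ᵖ-nonZero p≢0 q≢0)
... | j , _ , ≢0 = ∃⇒NonZeroᵖ ((a ∷ p) *ᵖ q) (suc j) λ eq → ≢0 (begin
    coeff (p *ᵖ q) j                               ≡⟨ ℚ.+-identityˡ _ ⟨
    0ℚ ℚ.+ coeff (p *ᵖ q) j                        ≡⟨ cong (ℚ._+ coeff (p *ᵖ q) j) (ℚ.*-zeroˡ (coeff q (suc j))) ⟨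
    0ℚ ℚ.* coeff q (suc j) ℚ.+ coeff (p *ᵖ q) j    ≡⟨ cong (λ x → x ℚ.* coeff q (suc j) ℚ.+ coeff (p *ᵖ q) j) a≡0 ⟨
    a ℚ.* coeff q (suc j) ℚ.+ coeff (p *ᵖ q) j     ≡⟨ coeff-*ᵖ-∷ a p q (suc j) ⟨
    coeff ((a ∷ p) *ᵖ q) (suc j)                   ≡⟨ eq ⟩
    0ℚ                                             ∎)
  where open ≡-Reasoning
*ᵖ-nonZero {a ∷ p} {q} _ q≢0 | no a≢0 with lowest q≢0
... | j , below , ≢0 = ∃⇒NonZeroᵖ ((a ∷ p) *ᵖ q) j λ eq → *-nonZero a≢0 ≢0 (begin
    a ℚ.* coeff q j                                ≡⟨ ℚ.+-identityʳ _ ⟨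
    a ℚ.* coeff q j ℚ.+ 0ℚ                         ≡⟨ cong (a ℚ.* coeff q j ℚ.+_) (0∷*ᵖ-vanishes p {q} below j ℕ.≤-refl) ⟨
    a ℚ.* coeff q j ℚ.+ coeff (0ℚ ∷ p *ᵖ q) j      ≡⟨ coeff-*ᵖ-∷ a p q j ⟨
    coeff ((a ∷ p) *ᵖ q) j                         ≡⟨ eq ⟩
    0ℚ                                             ∎)
  where open ≡-Reasoning

record ℚ⟨α⟩ : Set where
  constructor frac
  field
    num   : Poly
    den   : Poly
    den≢0 : NonZeroᵖ den

open ℚ⟨α⟩ public

1≢0ᵖ : NonZeroᵖ (1ℚ ∷ [])
1≢0ᵖ = here λ ()

fromPoly : Poly → ℚ⟨α⟩
fromPoly p = frac p (1ℚ ∷ []) 1≢0ᵖ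

ℚ⟨α⟩-rawRing : RawRing 0ℓ 0ℓ
ℚ⟨α⟩-rawRing = record
  { Carrier = ℚ⟨α⟩
  ; _≈_     = λ f g → num f *ᵖ den g ≈ᵖ num g *ᵖ den f
  ; _+_     = λ f g → frac (num f *ᵖ den g +ᵖ num g *ᵖ den f) (den f *ᵖ den g)
                           (*ᵖ-nonZero (den≢0 f) (den≢0 g))
  ; _*_     = λ f g → frac (num f *ᵖ num g) (den f *ᵖ den g)
                           (*ᵖ-nonZero (den≢0 f) (den≢0 g))
  ; -_      = λ f → frac (-ᵖ num f) (den f) (den≢0 f)
  ; 0#      = fromPoly []
  ; 1#      = fromPoly (1ℚ ∷ [])
  }

open RawRing ℚ⟨α⟩-rawRing public using (_≈_; _+_; _*_; -_; 0#; 1#)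
open RawSemiringDefs (RawRing.rawSemiring ℚ⟨α⟩-rawRing) public
  using (sum; product; _^_)

infixl 6 _-_
_-_ : ℚ⟨α⟩ → ℚ⟨α⟩ → ℚ⟨α⟩
f - g = f + (- g)

α : ℚ⟨α⟩
α = fromPoly (0ℚ ∷ 1ℚ ∷ [])

fromℚ : ℚ → ℚ⟨α⟩
fromℚ c = fromPoly (c ∷ [])

fromℤ : ℤ → ℚ⟨α⟩
fromℤ z = fromℚ (z ℚ./ 1)

fromℕ : ℕ → ℚ⟨α⟩
fromℕ m = fromℤ (+ m)

-- binom x k = x (x − 1) ⋯ (x − k + 1) / k!
binom : ℚ⟨α⟩ → ℕ → ℚ⟨α⟩
binom x zero    = 1#
binom x (suc k) = binom x k * (x - fromℕ k) * fromℚ (+ 1 ℚ./ suc k)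

-- The substitution α ↦ 1/α.  A coefficient list p of length L satisfies
-- p(1/α) = (reverse p)(α) / α^(L − 1), whence
--   num(1/α) / den(1/α)
--     = α^(length den) (reverse num)(α) / (α^(length num) (reverse den)(α)).
_[1/α] : ℚ⟨α⟩ → ℚ⟨α⟩
frac p q q≢0 [1/α] = frac
  (replicate (length q) 0ℚ ++ reverse p)
  (replicate (length p) 0ℚ ++ reverse q)
  (Any.++⁺ʳ (replicate (length p) 0ℚ) (Any.reverse⁺ q≢0))

record Partition (n : ℕ) : Set where
  constructor mkPartition
  field
    parts      : List ℕ
    decreasing : Linked ℕ._≥_ parts
    positive   : All (0 ℕ.<_) parts
    total      : ℕ.sum parts ≡ n

open Partition public

oneRow : ∀ n → .{{NonZero n}} → Partition n
oneRow n = mkPartition (n ∷ []) [-] (ℕ.>-nonZero⁻¹ n ∷ []) (ℕ.+-identityʳ n)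

oneColumn : ∀ n → Partition n
oneColumn n = mkPartition (replicate n 1) (dec n) (All.replicate⁺ n ℕ.z<s) (tot n)
  where
  dec : ∀ m → Linked ℕ._≥_ (replicate m 1)
  dec zero          = []
  dec (suc zero)    = [-]
  dec (suc (suc m)) = ℕ.≤-refl ∷ dec (suc m)

  tot : ∀ m → ℕ.sum (replicate m 1) ≡ m
  tot zero    = refl
  tot (suc m) = cong suc (tot m)

infix 4 _⊴_
_⊴_ : ∀ {n} → Partition n → Partition n → Set
μ ⊴ ν = ∀ i → ℕ.sum (take i (parts μ)) ℕ.≤ ℕ.sum (take i (parts ν))

multiplicity : ℕ → List ℕ → ℕ
multiplicity i xs = length (filter (i ℕ.≟_) xs)

z : ∀ {n} → Partition n → ℕ
z {n} μ = ℕ.product (applyUpTo (λ i → factor (suc i)) n)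
  where
  factor : ℕ → ℕ
  factor i = let m = multiplicity i (parts μ) in i ℕ.^ m ℕ.* m !

-- (i , j) is the cell in column i and row j, both counted from 1.
cells : ∀ {n} → Partition n → List (ℕ × ℕ)
cells μ = go 1 (parts μ)
  where
  go : ℕ → List ℕ → List (ℕ × ℕ)
  go j []       = []
  go j (l ∷ ls) = map (λ i → suc i , j) (upTo l) ++ go (suc j) ls

contents : ∀ {n} → Partition n → List ℤ
contents μ = map (uncurry _⊖_) (cells μ)

-- A filling is its list of rows from bottom to top, with entries
-- in {0, …, k − 1}.

Filling : Set
Filling = List (List ℕ)

-- zip truncates to the length of the upper row, i.e. to the columns that
-- meet both rows.
SemiStandard : Filling → Set
SemiStandard t =
  All (Linked ℕ._≤_) t ×
  Linked (λ lower upper → All (uncurry ℕ._<_) (zip lower upper)) t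

semiStandard? : Decidable SemiStandard
semiStandard? t =
  All.all? (Linked.linked? ℕ._≤?_) t ×-dec
  Linked.linked? (λ lower upper → All.all? (uncurry ℕ._<?_) (zip lower upper)) t

rowFillings : ℕ → ℕ → List (List ℕ)
rowFillings k zero    = [] ∷ []
rowFillings k (suc l) = cartesianProductWith _∷_ (upTo k) (rowFillings k l)

fillings : ℕ → List ℕ → List Filling
fillings k []       = [] ∷ []
fillings k (l ∷ ls) = cartesianProductWith _∷_ (rowFillings k l) (fillings k ls)

weight : ℕ → Filling → List ℕ
weight k t = map (λ i → multiplicity i (concat t)) (upTo k)

-- The number of semistandard tableaux of shape μ and weight a.
-- A semistandard tableau of weight 1ⁿ is a standard one.
Kostka : ∀ {n} → Partition n → List ℕ → ℕ
Kostka μ a = length (filter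
  (λ t → semiStandard? t ×-dec ≡-dec ℕ._≟_ (weight (length a) t) a)
  (fillings (length a) (parts μ)))

-- Homogeneous symmetric functions of degree n over ℚ(α)
-- in coordinates: f μ is the coefficient of the monomial symmetric function
-- m_μ in f, i.e. the coefficient of x^μ = x₁^μ₁ x₂^μ₂ ⋯ in f.

Λ : ℕ → Set
Λ n = Partition n → ℚ⟨α⟩

infix  4 _≈Λ_
infixl 6 _+Λ_
infixr 7 _·Λ_

_≈Λ_ : ∀ {n} → Λ n → Λ n → Set
f ≈Λ g = ∀ μ → f μ ≈ g μ

_+Λ_ : ∀ {n} → Λ n → Λ n → Λ n
(f +Λ g) μ = f μ + g μ

_·Λ_ : ∀ {n} → ℚ⟨α⟩ → Λ n → Λ n
(c ·Λ f) μ = c * f μ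

schur : ∀ {n} → Partition n → Λ n
schur ν μ = fromℕ (Kostka ν (parts μ))

-- Power series in x₁, x₂, … with natural coefficients; the argument
-- (a₁, …, a_k) stands for the monomial x₁^a₁ ⋯ x_k^a_k.
Series : Set
Series = List ℕ → ℕ

oneˢ : Series
oneˢ a = length (filter (≡-dec ℕ._≟_ a) (replicate (length a) 0 ∷ []))

splittings : List ℕ → List (List ℕ × List ℕ)
splittings []      = ([] , []) ∷ []
splittings (x ∷ a) = cartesianProductWith
  (λ i (b , c) → (i ∷ b) , (x ∸ i ∷ c)) (upTo (suc x)) (splittings a)

_*ˢ_ : Series → Series → Series
(f *ˢ g) a = ℕ.sum (map (λ (b , c) → f b ℕ.* g c) (splittings a))

-- p_r = x₁^r + x₂^r + ⋯ for r ≥ 1.  Only the variables occurring in the list a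
-- can contribute to the coefficient at a.
powerSumˢ : ℕ → Series
powerSumˢ r a = length (filter (≡-dec ℕ._≟_ a) (map exponents (upTo k)))
  where
  k : ℕ
  k = length a

  exponents : ℕ → List ℕ
  exponents i = replicate i 0 ++ r ∷ replicate (k ∸ suc i) 0

powerSum : ∀ {n} → Partition n → Λ n
powerSum ν μ = fromℕ (foldr _*ˢ_ oneˢ (map powerSumˢ (parts ν)) (parts μ))

record IsBilinear {n} (⟨_,_⟩ : Λ n → Λ n → ℚ⟨α⟩) : Set where
  field
    cong-≈     : ∀ {f f′ g g′} → f ≈Λ f′ → g ≈Λ g′ → ⟨ f , g ⟩ ≈ ⟨ f′ , g′ ⟩
    +-linearˡ  : ∀ f f′ g → ⟨ f +Λ f′ , g ⟩ ≈ ⟨ f , g ⟩ + ⟨ f′ , g ⟩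
    +-linearʳ  : ∀ f g g′ → ⟨ f , g +Λ g′ ⟩ ≈ ⟨ f , g ⟩ + ⟨ f , g′ ⟩
    ·-linearˡ  : ∀ c f g → ⟨ c ·Λ f , g ⟩ ≈ c * ⟨ f , g ⟩
    ·-linearʳ  : ∀ c f g → ⟨ f , c ·Λ g ⟩ ≈ c * ⟨ f , g ⟩

-- Since the Schur functions, respectively the power sums, form a basis, each
-- of the next two records determines its form uniquely.

record IsHallProduct {n} (⟨_,_⟩ : Λ n → Λ n → ℚ⟨α⟩) : Set where
  field
    isBilinear   : IsBilinear ⟨_,_⟩
    schur-norm   : ∀ μ → ⟨ schur μ , schur μ ⟩ ≈ 1#
    schur-orthog : ∀ μ ν → parts μ ≢ parts ν → ⟨ schur μ , schur ν ⟩ ≈ 0#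

record IsJackProduct {n} (⟨_,_⟩ : Λ n → Λ n → ℚ⟨α⟩) : Set where
  field
    isBilinear      : IsBilinear ⟨_,_⟩
    powerSum-norm   : ∀ μ →
      ⟨ powerSum μ , powerSum μ ⟩ ≈ fromℕ (z μ) * α ^ length (parts μ)
    powerSum-orthog : ∀ μ ν → parts μ ≢ parts ν →
      ⟨ powerSum μ , powerSum ν ⟩ ≈ 0#

record IsJackFamily {n} (⟨_,_⟩ : Λ n → Λ n → ℚ⟨α⟩) (J : Partition n → Λ n) : Set where
  field
    orthogonal : ∀ μ ν → parts μ ≢ parts ν → ⟨ J μ , J ν ⟩ ≈ 0#
    triangular : ∀ μ ν → ¬ (ν ⊴ μ) → J μ ν ≈ 0#
    normalized : ∀ μ → J μ (oneColumn n) ≈ fromℕ (n !)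

-- J̃_μ = αⁿ J_μ^(1/α), where J_μ^(1/α) is J_μ with α replaced by 1/α.
tilde : ∀ {n} → Λ n → Λ n
tilde {n} f μ = α ^ n * (f μ [1/α])

-- A cell of the n × n grid is (column , row), both counted
-- from 0, rows from the bottom.

Cell : ℕ → Set
Cell n = Fin n × Fin n

Board : ℕ → Set
Board n = Cell n → Bool

-- The bottom c i cells of each column i.
ferrers : ∀ {n} → (Fin n → ℤ) → Board n
ferrers c (i , j) = does (+ toℕ j ℤ.<? c i)

subsets : ∀ {A : Set} → List A → List (List A)
subsets []       = [] ∷ []
subsets (x ∷ xs) = map (x ∷_) (subsets xs) ++ subsets xs

NonAttacking : ∀ {n} → List (Cell n) → Set
NonAttacking = AllPairs (λ c d → proj₁ c ≢ proj₁ d × proj₂ c ≢ proj₂ d)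

nonAttacking? : ∀ {n} → Decidable (NonAttacking {n})
nonAttacking? = AllPairs.allPairs? λ c d →
  ¬? (proj₁ c Fin.≟ proj₁ d) ×-dec ¬? (proj₂ c Fin.≟ proj₂ d)

placements : ∀ n → ℕ → List (List (Cell n))
placements n k = filter (λ s → length s ℕ.≟ k ×-dec nonAttacking? s)
  (subsets (cartesianProduct (allFin n) (allFin n)))

rook : ∀ {n} → ℕ → Board n → ℕ
rook {n} k B = length (filter (All.all? (λ c → T? (B c))) (placements n k))

hit : ∀ {n} → ℕ → Board n → ℕ
hit {n} k B = length (filter
  (λ s → length (filter (λ c → T? (B c)) s) ℕ.≟ k) (placements n n))

-- Identities in ℚ(α) are proved by evaluating both sides at all large natural
-- numbers.
--
-- Let h_n[αX] be the degree n part of ∏ (1 − x_i)^(−α).  Its power sum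
-- expansion Σ α^ℓ(ν) z_ν⁻¹ p_ν shows that αⁿ n! h_n[X/α] pairs with every p_ν to
-- the same value under ⟨ , ⟩_α.  It is therefore orthogonal to all symmetric
-- functions without m_(n), in particular to the other Jack functions, and since
-- the form is anisotropic it is J_(n).  Hence J̃_(n) = n! h_n[αX].
--
-- The coefficients of n! h_n[αX] satisfy the recurrence of the operator
-- α p₁ + Σ x_i² ∂_i, and this operator sends s_μ to the sum of (α + c) s_λ over the
-- λ obtained from μ by adding a cell, c being the content of that cell.  So
-- the coefficient of s_λ is the number of standard tableaux times the product of
-- α + c over the cells of λ.  On Kostka numbers the action of the operator is a
-- commutation relation with the removal of horizontal strips.
--
-- The product of the α + c_i − i + 1 is the factorial rook polynomial of the
-- board B(c₁, …, c_n), and the hit numbers are brought in by induction on the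
-- columns with Pascal's rule.

module Submission where

open import Algebra.Bundles using (CommutativeRing)
import Algebra.Solver.Ring
open import Algebra.Solver.Ring.AlmostCommutativeRing using (fromCommutativeRing; _-Raw-AlmostCommutative⟶_)
open import Algebra.Structures using (IsCommutativeRing)
open import Data.Bool.Base using (true; false; T)
open import Data.Bool.Properties using (T?)
open import Data.Empty using (⊥; ⊥-elim)
open import Data.Fin.Base as Fin using (Fin; toℕ)
import Data.Fin.Properties as Fin
open import Data.Integer.Base as ℤ using (ℤ; +_; -[1+_]; _⊖_)
import Data.Integer.Properties as ℤ
open import Data.List.Base
  using (List; []; _∷_; _++_; _∷ʳ_; map; foldr; length; filter; concat; zip; zipWith;
         upTo; applyUpTo; allFin; replicate; reverse; cartesianProduct; tabulate;
         cartesianProductWith; deduplicate; lookup)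
import Data.List.Properties as List
open import Data.List.Membership.Propositional using (_∈_; _∉_)
import Data.List.Membership.Propositional.Properties as ∈
open import Data.List.Relation.Binary.Permutation.Propositional as ↭ using (_↭_)
import Data.List.Relation.Binary.Permutation.Propositional.Properties as ↭
open import Data.List.Relation.Unary.All as All using (All; []; _∷_)
import Data.List.Relation.Unary.All.Properties as All
open import Data.List.Relation.Unary.AllPairs as AllPairs using (AllPairs; []; _∷_)
import Data.List.Relation.Unary.AllPairs.Properties as AllPairs
open import Data.List.Relation.Unary.Any as Any using (Any; here; there)
import Data.List.Relation.Unary.Any.Properties as Any
open import Data.List.Relation.Unary.Linked as Linked using (Linked; []; [-]; _∷_)
import Data.List.Relation.Unary.Linked.Properties as Linked
open import Data.List.Relation.Unary.Unique.Propositional using (Unique)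
import Data.List.Relation.Unary.Unique.Propositional.Properties as Unique
open import Data.Maybe.Base as Maybe using (Maybe)
open import Data.Nat.Base as ℕ using (ℕ; zero; suc; NonZero; _∸_; _!)
import Data.Nat.ListAction as ℕ using (sum; product)
import Data.Nat.Properties as ℕ
open import Data.Product.Base using (_×_; _,_; proj₁; proj₂; uncurry; ∃)
open import Data.Rational.Base as ℚ using (ℚ; 0ℚ; 1ℚ)
import Data.Rational.Properties as ℚ
import Data.Rational.Unnormalised.Base as ℚᵘ
import Data.Rational.Unnormalised.Properties as ℚᵘ
open import Data.Sum.Base using (_⊎_; inj₁; inj₂)
open import Data.Unit.Base using (⊤; tt)
open import Function.Base using (_∘_; id; case_of_)
open import Level using (0ℓ)
open import Relation.Binary.Definitions using (DecidableEquality)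
open import Relation.Binary.PropositionalEquality hiding (setoid; J)
open import Relation.Nullary using (¬_; Dec; yes; no; does; ¬?; _×-dec_; contradiction)
open import Relation.Nullary.Decidable using (dec⇒maybe)
open import Relation.Unary using (Pred; Decidable)
open import Defs hiding (_+_; _*_; -_; _-_; _≈_; 0#; 1#; sum; product; _^_)

-- Equality in ℚ(α) is cross-multiplication, so even transitivity and the ring laws are read off
-- from values, and a fraction has a value only where its denominator does not vanish. The values of
-- J̃ at N are governed by those of J at 1/N.
--
-- The scalar products are arbitrary functions satisfying axioms, so the linear algebra is abstract:
-- a vector orthogonal to a family of the right size without isotropic vectors is zero, by a linear
-- dependence among d + 1 vectors. The form is anisotropic because the norms z_ν α^ℓ(ν) are positive
-- for positive α, which makes a vanishing weighted sum of squares vanish termwise at every large N.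
--
-- Kostka numbers count fillings; removing the largest entry brings them into recursive form. Shapes
-- are lists of rows that may contain zeros, and a list that fails to decrease has count 0, so cells
-- are added and removed row by row without distinguishing corners. Growth starts from n empty rows:
-- with fewer than n cells the last row is still empty, and no way of adding a cell is missed.

-- Bilinear forms and orthogonal bases over a discrete field

module Orthogonal (R : CommutativeRing 0ℓ 0ℓ) where

  open CommutativeRing R using
    (Carrier; _≈_; _+_; _*_; -_; 0#; 1#; setoid; +-cong; +-congˡ; +-congʳ; *-congˡ; *-congʳ; -‿cong; +-identityˡ; +-identityʳ;
     *-identityˡ; *-identityʳ; zeroˡ; zeroʳ; *-assoc; *-comm; +-comm; -‿inverseʳ; distribˡ;
     ring; semiring; +-commutativeMonoid)
    renaming (refl to ≈-refl; sym to ≈-sym; trans to ≈-trans; reflexive to ≈-reflexive)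
  open import Algebra.Properties.CommutativeMonoid.Sum +-commutativeMonoid using (sum; sum-cong-≋; sum-remove; ∑-distrib-+; sum-replicate-zero)
  open import Algebra.Properties.Semiring.Sum semiring using (*-distribˡ-sum; *-distribʳ-sum)
  open import Algebra.Properties.Ring ring using (-‿distribˡ-*; -1*x≈-x; x∙y⁻¹≈ε⇒x≈y)
  open import Data.Vec.Functional using (insertAt)
  import Data.Vec.Functional.Properties as Vector
  open import Relation.Binary.Reasoning.Setoid setoid

  Invertible : Carrier → Set
  Invertible x = ∃ λ y → x * y ≈ 1#

  invertible-cancel : ∀ {x} → Invertible x → ∀ {y z} → x * y ≈ x * z → y ≈ z
  invertible-cancel {x} (i , xi≈1) {y} {z} eq = begin
    y             ≈⟨ *-identityˡ y ⟨
    1# * y        ≈⟨ *-congʳ (≈-trans (≈-sym xi≈1) (*-comm x i)) ⟩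
    i * x * y     ≈⟨ *-assoc i x y ⟩
    i * (x * y)   ≈⟨ *-congˡ eq ⟩
    i * (x * z)   ≈⟨ *-assoc i x z ⟨
    i * x * z     ≈⟨ *-congʳ (≈-trans (*-comm i x) xi≈1) ⟩
    1# * z        ≈⟨ *-identityˡ z ⟩
    z             ∎

  sum-zero : ∀ {n} {f : Fin n → Carrier} → (∀ i → f i ≈ 0#) → sum f ≈ 0#
  sum-zero {n} f0 = ≈-trans (sum-cong-≋ f0) (sum-replicate-zero n)

  sum-single : ∀ {n} (k : Fin n) {f : Fin n → Carrier} → (∀ i → i ≢ k → f i ≈ 0#) → sum f ≈ f k
  sum-single {suc n} k {f} f0 = ≈-trans (sum-remove {i = k} f)
    (≈-trans (+-congˡ (sum-zero λ i → f0 (Fin.punchIn k i) (Fin.punchInᵢ≢i k i))) (+-identityʳ _))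

  module DiscreteField (zeroOrInvertible : ∀ x → x ≈ 0# ⊎ Invertible x) (1≉0 : ¬ 1# ≈ 0#) where

    ≉0⇒invertible : ∀ {x} → ¬ x ≈ 0# → Invertible x
    ≉0⇒invertible {x} x≉0 with zeroOrInvertible x
    ... | inj₁ x≈0 = contradiction x≈0 x≉0
    ... | inj₂ inv = inv

    findInvertible : ∀ {n} (f : Fin n → Carrier) → (∀ i → f i ≈ 0#) ⊎ (∃ λ i → Invertible (f i))
    findInvertible {zero}  f = inj₁ λ ()
    findInvertible {suc n} f with zeroOrInvertible (f Fin.zero) | findInvertible (f ∘ Fin.suc)
    ... | inj₂ inv | _              = inj₂ (Fin.zero , inv)
    ... | inj₁ _   | inj₂ (i , inv) = inj₂ (Fin.suc i , inv)
    ... | inj₁ z   | inj₁ zs        = inj₁ λ { Fin.zero → z ; (Fin.suc i) → zs i }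

    -- Gaussian elimination on the first coordinate.
    dependent : ∀ d (v : Fin (suc d) → Fin d → Carrier) →
      ∃ λ (c : Fin (suc d) → Carrier) → (∃ λ i → ¬ c i ≈ 0#) × (∀ j → sum (λ i → c i * v i j) ≈ 0#)
    dependent zero    v = (λ _ → 1#) , (Fin.zero , 1≉0) , λ ()
    dependent (suc d) v with findInvertible (λ i → v i Fin.zero)
    -- The first coordinate vanishes on all vectors; discarding it together with one vector leaves d
    -- + 1 vectors in dimension d.
    ... | inj₁ column≈0 with dependent d (λ i j → v (Fin.suc i) (Fin.suc j))
    ...   | c , (i , ci≉0) , c-dep = c′ , (Fin.suc i , ci≉0) , λ where
        Fin.zero    → sum-zero λ i → ≈-trans (*-congˡ (column≈0 i)) (zeroʳ (c′ i))
        (Fin.suc j) → ≈-trans (+-cong (zeroˡ _) (c-dep j)) (+-identityˡ 0#)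
      where
      c′ : Fin (suc (suc d)) → Carrier
      c′ Fin.zero    = 0#
      c′ (Fin.suc i) = c i
    dependent (suc d) v | inj₂ (r , y , ry≈1)
      with dependent d (λ i j → v (Fin.punchIn r i) (Fin.suc j) + - (v (Fin.punchIn r i) Fin.zero * y) * v r (Fin.suc j))
    ...   | c , (i , ci≉0) , c-dep = c′ , (Fin.punchIn r i , λ eq → ci≉0 (≈-trans (≈-sym (c′-punchIn i)) eq)) , λ where
        Fin.zero    → ≈-trans (expand Fin.zero) (≈-trans (sum-cong-≋ λ i → ≈-trans (*-congˡ (begin
            w i Fin.zero + - (w i Fin.zero * y) * v r Fin.zero       ≈⟨ +-congˡ (≈-trans (≈-sym (-‿distribˡ-* _ _)) (-‿cong (≈-trans (*-assoc _ y _)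
                                                                          (≈-trans (*-congˡ (≈-trans (*-comm y _) ry≈1)) (*-identityʳ _))))) ⟩
            w i Fin.zero + - w i Fin.zero                            ≈⟨ -‿inverseʳ _ ⟩
            0#                                                       ∎)) (zeroʳ (c i)))
          (sum-replicate-zero (suc d)))
        (Fin.suc j) → ≈-trans (expand (Fin.suc j)) (c-dep j)
      where
      w : Fin (suc d) → Fin (suc d) → Carrier
      w i = v (Fin.punchIn r i)

      -- The coefficient of the pivot vector collects the multiples of it that the elimination has
      -- subtracted from the other vectors.
      cr : Carrier
      cr = sum (λ i → c i * - (w i Fin.zero * y))

      c′ : Fin (suc (suc d)) → Carrier
      c′ = insertAt c r cr

      c′-punchIn : ∀ i → c′ (Fin.punchIn r i) ≈ c i
      c′-punchIn i = ≈-reflexive (Vector.insertAt-punchIn c r cr i)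

      expand : ∀ j → sum (λ i → c′ i * v i j) ≈ sum (λ i → c i * (w i j + - (w i Fin.zero * y) * v r j))
      expand j = begin
        sum (λ i → c′ i * v i j)
          ≈⟨ sum-remove {i = r} (λ i → c′ i * v i j) ⟩
        c′ r * v r j + sum (λ i → c′ (Fin.punchIn r i) * w i j)
          ≈⟨ +-cong (*-congʳ (≈-reflexive (Vector.insertAt-lookup c r cr))) (sum-cong-≋ λ i → *-congʳ {w i j} (c′-punchIn i)) ⟩
        cr * v r j + sum (λ i → c i * w i j)
          ≈⟨ +-congʳ (*-distribʳ-sum (v r j) (λ i → c i * - (w i Fin.zero * y))) ⟩
        sum (λ i → c i * - (w i Fin.zero * y) * v r j) + sum (λ i → c i * w i j)
          ≈⟨ ∑-distrib-+ (λ i → c i * - (w i Fin.zero * y) * v r j) (λ i → c i * w i j) ⟨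
        sum (λ i → c i * - (w i Fin.zero * y) * v r j + c i * w i j)
          ≈⟨ sum-cong-≋ (λ i → ≈-trans (+-comm _ _) (≈-trans (+-congˡ (*-assoc (c i) (- (w i Fin.zero * y)) (v r j))) (≈-sym (distribˡ (c i) (w i j) (- (w i Fin.zero * y) * v r j))))) ⟩
        sum (λ i → c i * (w i j + - (w i Fin.zero * y) * v r j)) ∎

    -- The set I indexes both the coordinates of a vector and the members of a family, so a family
    -- over I has as many members as the space has dimensions. The bijection with `Fin d` is there
    -- for summation and elimination.
    module Forms {I : Set} {d : ℕ} (at : Fin d → I) (index : I → Fin d) (at-index : ∀ μ → at (index μ) ≡ μ) (index-at : ∀ i → index (at i) ≡ i) where

      combination : ∀ {m} → (Fin m → Carrier) → (Fin m → I → Carrier) → I → Carrier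
      combination c v μ = sum (λ i → c i * v i μ)

      record Bilinear (⟨_,_⟩ : (I → Carrier) → (I → Carrier) → Carrier) : Set where
        field
          cong-form : ∀ {f f′ g g′} → (∀ μ → f μ ≈ f′ μ) → (∀ μ → g μ ≈ g′ μ) → ⟨ f , g ⟩ ≈ ⟨ f′ , g′ ⟩
          +-formˡ   : ∀ f f′ g → ⟨ (λ μ → f μ + f′ μ) , g ⟩ ≈ ⟨ f , g ⟩ + ⟨ f′ , g ⟩
          +-formʳ   : ∀ f g g′ → ⟨ f , (λ μ → g μ + g′ μ) ⟩ ≈ ⟨ f , g ⟩ + ⟨ f , g′ ⟩
          *-formˡ   : ∀ c f g → ⟨ (λ μ → c * f μ) , g ⟩ ≈ c * ⟨ f , g ⟩
          *-formʳ   : ∀ c f g → ⟨ f , (λ μ → c * g μ) ⟩ ≈ c * ⟨ f , g ⟩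

      module Form (⟨_,_⟩ : (I → Carrier) → (I → Carrier) → Carrier) (bilinear : Bilinear ⟨_,_⟩) where
        open Bilinear bilinear

        cong-formˡ : ∀ {f f′ g} → (∀ μ → f μ ≈ f′ μ) → ⟨ f , g ⟩ ≈ ⟨ f′ , g ⟩
        cong-formˡ eq = cong-form eq (λ _ → ≈-refl)

        cong-formʳ : ∀ {f g g′} → (∀ μ → g μ ≈ g′ μ) → ⟨ f , g ⟩ ≈ ⟨ f , g′ ⟩
        cong-formʳ eq = cong-form (λ _ → ≈-refl) eq

        zero-formˡ : ∀ g → ⟨ (λ _ → 0#) , g ⟩ ≈ 0#
        zero-formˡ g = ≈-trans (cong-formˡ λ μ → ≈-sym (zeroˡ (g μ))) (≈-trans (*-formˡ 0# g g) (zeroˡ _))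

        zero-formʳ : ∀ f → ⟨ f , (λ _ → 0#) ⟩ ≈ 0#
        zero-formʳ f = ≈-trans (cong-formʳ λ μ → ≈-sym (zeroˡ (f μ))) (≈-trans (*-formʳ 0# f f) (zeroˡ _))

        combination-formˡ : ∀ {m} (c : Fin m → Carrier) (v : Fin m → I → Carrier) g →
          ⟨ combination c v , g ⟩ ≈ sum (λ i → c i * ⟨ v i , g ⟩)
        combination-formˡ {zero}  c v g = zero-formˡ g
        combination-formˡ {suc m} c v g = ≈-trans (+-formˡ _ _ g)
          (+-cong (*-formˡ _ _ g) (combination-formˡ (c ∘ Fin.suc) (v ∘ Fin.suc) g))

        combination-formʳ : ∀ {m} (c : Fin m → Carrier) (v : Fin m → I → Carrier) f →
          ⟨ f , combination c v ⟩ ≈ sum (λ i → c i * ⟨ f , v i ⟩)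
        combination-formʳ {zero}  c v f = zero-formʳ f
        combination-formʳ {suc m} c v f = ≈-trans (+-formʳ f _ _)
          (+-cong (*-formʳ _ f _) (combination-formʳ (c ∘ Fin.suc) (v ∘ Fin.suc) f))

        -- An orthogonal family of the right cardinality without isotropic
        -- vectors is a basis.
        module Basis (e : I → I → Carrier) (orthogonal : ∀ μ ν → μ ≢ ν → ⟨ e μ , e ν ⟩ ≈ 0#)
                     (nonIsotropic : ∀ μ → ¬ ⟨ e μ , e μ ⟩ ≈ 0#) where

          private
            orthogonal-at : ∀ i k → i ≢ k → ⟨ e (at i) , e (at k) ⟩ ≈ 0#
            orthogonal-at i k i≢k = orthogonal (at i) (at k)
              λ eq → i≢k (trans (sym (index-at i)) (trans (cong index eq) (index-at k)))

          combination-form : ∀ c k → ⟨ combination c (e ∘ at) , e (at k) ⟩ ≈ c k * ⟨ e (at k) , e (at k) ⟩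
          combination-form c k = ≈-trans (combination-formˡ c (e ∘ at) (e (at k)))
            (sum-single k λ i i≢k → ≈-trans (*-congˡ (orthogonal-at i k i≢k)) (zeroʳ _))

          -- The vector w and the d vectors `e μ` satisfy a nontrivial linear relation. Pairing it
          -- with each `e μ` kills the coefficients of the `e μ`, so that of w is nonzero and w
          -- vanishes.
          orthogonal⇒zero : ∀ w → (∀ μ → ⟨ w , e μ ⟩ ≈ 0#) → ∀ μ → w μ ≈ 0#
          orthogonal⇒zero w w⊥e with dependent d (λ { Fin.zero j → w (at j) ; (Fin.suc i) j → e (at i) (at j) })
          ... | c , (i , ci≉0) , c-dep = w≈0
            where
            relation : ∀ μ → c Fin.zero * w μ + combination (c ∘ Fin.suc) (e ∘ at) μ ≈ 0#
            relation μ = subst (λ ν → c Fin.zero * w ν + combination (c ∘ Fin.suc) (e ∘ at) ν ≈ 0#) (at-index μ) (c-dep (index μ))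

            c-suc≈0 : ∀ k → c (Fin.suc k) ≈ 0#
            c-suc≈0 k = invertible-cancel (≉0⇒invertible (nonIsotropic (at k))) (begin
              ⟨ e (at k) , e (at k) ⟩ * c (Fin.suc k)
                ≈⟨ *-comm _ _ ⟩
              c (Fin.suc k) * ⟨ e (at k) , e (at k) ⟩
                ≈⟨ +-identityˡ _ ⟨
              0# + c (Fin.suc k) * ⟨ e (at k) , e (at k) ⟩
                ≈⟨ +-cong (≈-trans (*-congˡ (w⊥e (at k))) (zeroʳ _)) (combination-form (c ∘ Fin.suc) k) ⟨
              c Fin.zero * ⟨ w , e (at k) ⟩ + ⟨ combination (c ∘ Fin.suc) (e ∘ at) , e (at k) ⟩
                ≈⟨ +-congʳ (*-formˡ _ w _) ⟨
              ⟨ (λ μ → c Fin.zero * w μ) , e (at k) ⟩ + ⟨ combination (c ∘ Fin.suc) (e ∘ at) , e (at k) ⟩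
                ≈⟨ +-formˡ _ _ _ ⟨
              ⟨ (λ μ → c Fin.zero * w μ + combination (c ∘ Fin.suc) (e ∘ at) μ) , e (at k) ⟩
                ≈⟨ cong-formˡ relation ⟩
              ⟨ (λ _ → 0#) , e (at k) ⟩
                ≈⟨ zero-formˡ _ ⟩
              0#
                ≈⟨ zeroʳ _ ⟨
              ⟨ e (at k) , e (at k) ⟩ * 0# ∎)

            c-zero≉0 : ∀ i → ¬ c i ≈ 0# → ¬ c Fin.zero ≈ 0#
            c-zero≉0 Fin.zero    ci≉0 = ci≉0
            c-zero≉0 (Fin.suc i) ci≉0 = contradiction (c-suc≈0 i) ci≉0

            w≈0 : ∀ μ → w μ ≈ 0#
            w≈0 μ = invertible-cancel (≉0⇒invertible (c-zero≉0 i ci≉0)) (begin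
              c Fin.zero * w μ                                                ≈⟨ +-identityʳ _ ⟨
              c Fin.zero * w μ + 0#                                           ≈⟨ +-congˡ (sum-zero λ i → ≈-trans (*-congʳ (c-suc≈0 i)) (zeroˡ _)) ⟨
              c Fin.zero * w μ + combination (c ∘ Fin.suc) (e ∘ at) μ         ≈⟨ relation μ ⟩
              0#                                                              ≈⟨ zeroʳ _ ⟨
              c Fin.zero * 0#                                                 ∎)

          coordinate : (I → Carrier) → Fin d → Carrier
          coordinate f i = ⟨ f , e (at i) ⟩ * proj₁ (≉0⇒invertible (nonIsotropic (at i)))

          coordinate-* : ∀ f i → coordinate f i * ⟨ e (at i) , e (at i) ⟩ ≈ ⟨ f , e (at i) ⟩
          coordinate-* f i = ≈-trans (*-assoc _ _ _) (≈-trans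
            (*-congˡ (≈-trans (*-comm _ _) (proj₂ (≉0⇒invertible (nonIsotropic (at i)))))) (*-identityʳ _))

          -- The difference of the two sides is orthogonal to every `e μ`. It is written with the
          -- scalar `- 1#`, bilinearity being stated for sums and multiples only.
          expansion : ∀ f μ → f μ ≈ combination (coordinate f) (e ∘ at) μ
          expansion f μ = x∙y⁻¹≈ε⇒x≈y _ _ (≈-trans (+-congˡ (≈-sym (-1*x≈-x _))) (orthogonal⇒zero w w⊥e μ))
            where
            w : I → Carrier
            w μ = f μ + - 1# * combination (coordinate f) (e ∘ at) μ

            w⊥e-at : ∀ k → ⟨ w , e (at k) ⟩ ≈ 0#
            w⊥e-at k = begin
              ⟨ w , e (at k) ⟩
                ≈⟨ ≈-trans (+-formˡ f _ _) (+-congˡ (≈-trans (*-formˡ _ _ _) (-1*x≈-x _))) ⟩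
              ⟨ f , e (at k) ⟩ + - ⟨ combination (coordinate f) (e ∘ at) , e (at k) ⟩
                ≈⟨ +-congˡ (-‿cong (≈-trans (combination-form (coordinate f) k) (coordinate-* f k))) ⟩
              ⟨ f , e (at k) ⟩ + - ⟨ f , e (at k) ⟩
                ≈⟨ -‿inverseʳ _ ⟩
              0# ∎

            w⊥e : ∀ μ → ⟨ w , e μ ⟩ ≈ 0#
            w⊥e μ = subst (λ ν → ⟨ w , e ν ⟩ ≈ 0#) (at-index μ) (w⊥e-at (index μ))

          form-square : ∀ f → ⟨ f , f ⟩ ≈ sum (λ i → coordinate f i * coordinate f i * ⟨ e (at i) , e (at i) ⟩)
          form-square f = begin
            ⟨ f , f ⟩
              ≈⟨ ≈-trans (cong-formˡ (expansion f)) (combination-formˡ (coordinate f) (e ∘ at) f) ⟩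
            sum (λ i → coordinate f i * ⟨ e (at i) , f ⟩)
              ≈⟨ sum-cong-≋ (λ i → ≈-trans (*-congˡ (begin
                ⟨ e (at i) , f ⟩                                           ≈⟨ ≈-trans (cong-formʳ (expansion f)) (combination-formʳ (coordinate f) (e ∘ at) (e (at i))) ⟩
                sum (λ k → coordinate f k * ⟨ e (at i) , e (at k) ⟩)       ≈⟨ sum-single i (λ k k≢i → ≈-trans (*-congˡ (orthogonal-at i k (k≢i ∘ sym))) (zeroʳ _)) ⟩
                coordinate f i * ⟨ e (at i) , e (at i) ⟩                   ∎))
              (≈-sym (*-assoc _ _ _))) ⟩
            sum (λ i → coordinate f i * coordinate f i * ⟨ e (at i) , e (at i) ⟩) ∎

          -- In an orthogonal basis `⟨ f , f ⟩` is a weighted sum of squares of the coordinates. The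
          -- positivity argument that a general field lacks enters as the hypothesis on such sums.
          anisotropic : (∀ (a : Fin d → Carrier) → sum (λ i → a i * a i * ⟨ e (at i) , e (at i) ⟩) ≈ 0# → ∀ i → a i ≈ 0#) →
            ∀ f → ⟨ f , f ⟩ ≈ 0# → ∀ μ → f μ ≈ 0#
          anisotropic definite f ff≈0 μ = ≈-trans (expansion f μ) (sum-zero λ i →
            ≈-trans (*-congʳ (definite (coordinate f) (≈-trans (≈-sym (form-square f)) ff≈0) i)) (zeroˡ _))

          -- If all basis vectors have coefficient 1 at `top`, the sum of the coordinates of f is
          -- its coefficient there. The basis will be the power sums, in which x₁ⁿ has coefficient
          -- 1.
          form-constant : ∀ G C top → (∀ μ → ⟨ G , e μ ⟩ ≈ C) → (∀ μ → e μ top ≈ 1#) → ∀ f → ⟨ G , f ⟩ ≈ C * f top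
          form-constant G C top G-e e-top f = begin
            ⟨ G , f ⟩                                       ≈⟨ ≈-trans (cong-formʳ (expansion f)) (combination-formʳ (coordinate f) (e ∘ at) G) ⟩
            sum (λ i → coordinate f i * ⟨ G , e (at i) ⟩)   ≈⟨ sum-cong-≋ (λ i → ≈-trans (*-congˡ (G-e (at i))) (*-comm _ C)) ⟩
            sum (λ i → C * coordinate f i)                  ≈⟨ *-distribˡ-sum C (coordinate f) ⟨
            C * sum (coordinate f)                          ≈⟨ *-congˡ (sum-cong-≋ λ i → ≈-trans (*-congˡ (e-top (at i))) (*-identityʳ _)) ⟨
            C * combination (coordinate f) (e ∘ at) top     ≈⟨ *-congˡ (expansion f top) ⟨
            C * f top                                       ∎

        -- G and J top are proportional, being orthogonal to J μ for μ ≢ top.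
        orthogonal⇒equal : (J : I → I → Carrier) → (∀ μ ν → μ ≢ ν → ⟨ J μ , J ν ⟩ ≈ 0#) → (∀ μ → ¬ ⟨ J μ , J μ ⟩ ≈ 0#) →
          DecidableEquality I → ∀ top bottom G → (∀ μ → μ ≢ top → ⟨ G , J μ ⟩ ≈ 0#) →
          G bottom ≈ J top bottom → ¬ J top bottom ≈ 0# → ∀ μ → J top μ ≈ G μ
        orthogonal⇒equal J J-orth J-aniso _≟_ top bottom G G-orth G-bottom bottom≉0 μ =
          ≈-sym (invertible-cancel (≉0⇒invertible (J-aniso top)) (≈-trans (proportional μ) (*-congʳ GJ≈JJ)))
          where
          JJ GJ : Carrier
          JJ = ⟨ J top , J top ⟩
          GJ = ⟨ G , J top ⟩

          -- The component of G orthogonal to `J top`, with the denominator `JJ` cleared.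
          w : I → Carrier
          w μ = JJ * G μ + - GJ * J top μ

          w-form : ∀ g → ⟨ w , g ⟩ ≈ JJ * ⟨ G , g ⟩ + - GJ * ⟨ J top , g ⟩
          w-form g = ≈-trans (+-formˡ _ _ g) (+-cong (*-formˡ JJ G g) (*-formˡ (- GJ) (J top) g))

          w⊥J : ∀ μ → ⟨ w , J μ ⟩ ≈ 0#
          w⊥J μ with μ ≟ top
          ... | yes refl = begin
            ⟨ w , J top ⟩         ≈⟨ w-form (J top) ⟩
            JJ * GJ + - GJ * JJ   ≈⟨ +-cong (*-comm JJ GJ) (≈-sym (-‿distribˡ-* GJ JJ)) ⟩
            GJ * JJ + - (GJ * JJ) ≈⟨ -‿inverseʳ _ ⟩
            0#                    ∎
          ... | no μ≢top = begin
            ⟨ w , J μ ⟩           ≈⟨ w-form (J μ) ⟩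
            JJ * ⟨ G , J μ ⟩ + - GJ * ⟨ J top , J μ ⟩ ≈⟨ +-cong (≈-trans (*-congˡ (G-orth μ μ≢top)) (zeroʳ _)) (≈-trans (*-congˡ (J-orth top μ (μ≢top ∘ sym))) (zeroʳ _)) ⟩
            0# + 0#               ≈⟨ +-identityˡ 0# ⟩
            0#                    ∎

          proportional : ∀ μ → JJ * G μ ≈ GJ * J top μ
          proportional μ = x∙y⁻¹≈ε⇒x≈y _ _ (≈-trans (+-congˡ (-‿distribˡ-* GJ (J top μ))) (Basis.orthogonal⇒zero J J-orth J-aniso w w⊥J μ))

          -- The factor of proportionality is read off at `bottom`, where the two vectors agree and
          -- do not vanish.
          GJ≈JJ : GJ ≈ JJ
          GJ≈JJ = invertible-cancel (≉0⇒invertible bottom≉0) (begin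
            J top bottom * GJ     ≈⟨ *-comm _ _ ⟩
            GJ * J top bottom     ≈⟨ proportional bottom ⟨
            JJ * G bottom         ≈⟨ *-congˡ G-bottom ⟩
            JJ * J top bottom     ≈⟨ *-comm _ _ ⟩
            J top bottom * JJ     ∎)

-- Rational arithmetic and a ring solver

module Rationals where

  -- The field operations of ℚ are made opaque so that Agda does not unfold them
  -- when it solves for implicit arguments.

  opaque
    infixl 6 _+_
    infixl 7 _*_
    infix  8 -_

    _+_ : ℚ → ℚ → ℚ
    _+_ = ℚ._+_

    _*_ : ℚ → ℚ → ℚ
    _*_ = ℚ._*_

    -_ : ℚ → ℚ
    -_ = ℚ.-_

    ιℤ : ℤ → ℚ
    ιℤ i = i ℚ./ 1

    -- 0 ⁻¹ = 0
    _⁻¹ : ℚ → ℚ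
    x ⁻¹ with x ℚ.≟ 0ℚ
    ... | yes _  = 0ℚ
    ... | no x≢0 = ℚ.1/_ x {{ℚ.≢-nonZero x≢0}}

  infixl 6 _-_
  _-_ : ℚ → ℚ → ℚ
  x - y = x + - y

  ι : ℕ → ℚ
  ι m = ιℤ (+ m)

  0q 1q : ℚ
  0q = ι 0
  1q = ι 1

  opaque
    unfolding _+_ _⁻¹

    ιℤ-def : ∀ i → ιℤ i ≡ i ℚ./ 1
    ιℤ-def i = refl

    +-def : ∀ x y → x + y ≡ x ℚ.+ y
    +-def x y = refl

    *-def : ∀ x y → x * y ≡ x ℚ.* y
    *-def x y = refl

    neg-def : ∀ x → - x ≡ ℚ.- x
    neg-def x = refl

    isCommutativeRing : IsCommutativeRing _≡_ _+_ _*_ -_ 0q 1q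
    isCommutativeRing = ℚ.+-*-isCommutativeRing

    ⁻¹-inverse : ∀ {x} → x ≢ 0q → x * x ⁻¹ ≡ 1q
    ⁻¹-inverse {x} x≢0 with x ℚ.≟ 0ℚ
    ... | yes x≡0 = contradiction x≡0 x≢0
    ... | no  x≢0′ = ℚ.*-inverseʳ x {{ℚ.≢-nonZero x≢0′}}

    toℚᵘ-ιℤ : ∀ i → ℚ.toℚᵘ (ιℤ i) ≡ ℚᵘ.mkℚᵘ i 0
    toℚᵘ-ιℤ i = cong ℚ.toℚᵘ (ℚ.↥p/↧p≡p (ℚ.mkℚ i 0 (Coprime.sym (Coprime.1-coprimeTo _))))
      where import Data.Nat.Coprimality as Coprime

    ιℤ-+ : ∀ i j → ιℤ (i ℤ.+ j) ≡ ιℤ i + ιℤ j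
    ιℤ-+ i j = ℚ.toℚᵘ-injective (begin
      ℚ.toℚᵘ (ιℤ (i ℤ.+ j))                  ≡⟨ toℚᵘ-ιℤ (i ℤ.+ j) ⟩
      ℚᵘ.mkℚᵘ (i ℤ.+ j) 0                    ≡⟨ cong (λ k → ℚᵘ.mkℚᵘ k 0) (cong₂ ℤ._+_ (ℤ.*-identityʳ i) (ℤ.*-identityʳ j)) ⟨
      ℚᵘ.mkℚᵘ i 0 ℚᵘ.+ ℚᵘ.mkℚᵘ j 0           ≡⟨ cong₂ ℚᵘ._+_ (toℚᵘ-ιℤ i) (toℚᵘ-ιℤ j) ⟨
      ℚ.toℚᵘ (ιℤ i) ℚᵘ.+ ℚ.toℚᵘ (ιℤ j)       ≈⟨ ℚ.toℚᵘ-homo-+ (ιℤ i) (ιℤ j) ⟨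
      ℚ.toℚᵘ (ιℤ i ℚ.+ ιℤ j)                 ∎)
      where open ℚᵘ.≃-Reasoning

    ιℤ-* : ∀ i j → ιℤ (i ℤ.* j) ≡ ιℤ i * ιℤ j
    ιℤ-* i j = ℚ.toℚᵘ-injective (begin
      ℚ.toℚᵘ (ιℤ (i ℤ.* j))                  ≡⟨ toℚᵘ-ιℤ (i ℤ.* j) ⟩
      ℚᵘ.mkℚᵘ i 0 ℚᵘ.* ℚᵘ.mkℚᵘ j 0           ≡⟨ cong₂ ℚᵘ._*_ (toℚᵘ-ιℤ i) (toℚᵘ-ιℤ j) ⟨
      ℚ.toℚᵘ (ιℤ i) ℚᵘ.* ℚ.toℚᵘ (ιℤ j)       ≈⟨ ℚ.toℚᵘ-homo-* (ιℤ i) (ιℤ j) ⟨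
      ℚ.toℚᵘ (ιℤ i ℚ.* ιℤ j)                 ∎)
      where open ℚᵘ.≃-Reasoning

    ι-mono : ∀ {m n} → m ℕ.≤ n → ι m ℚ.≤ ι n
    ι-mono {m} {n} m≤n = ℚ.toℚᵘ-cancel-≤ (subst₂ ℚᵘ._≤_ (sym (toℚᵘ-ιℤ (+ m))) (sym (toℚᵘ-ιℤ (+ n)))
      (ℚᵘ.*≤* (ℤ.*-monoʳ-≤-nonNeg (+ 1) (ℤ.+≤+ m≤n))))

  open IsCommutativeRing isCommutativeRing public
    using (+-assoc; +-comm; +-identityˡ; +-identityʳ; *-assoc; *-comm; *-identityˡ; *-identityʳ;
           distribˡ; distribʳ; zeroˡ; zeroʳ; -‿inverseʳ; -‿inverseˡ)

  ℚ-commutativeRing : CommutativeRing 0ℓ 0ℓ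
  ℚ-commutativeRing = record { isCommutativeRing = isCommutativeRing }

  ιℤ-neg : ∀ i → ιℤ (ℤ.- i) ≡ - ιℤ i
  ιℤ-neg i = begin
    ιℤ (ℤ.- i)                       ≡⟨ +-identityʳ _ ⟨
    ιℤ (ℤ.- i) + 0q                  ≡⟨ cong (_+_ _) (-‿inverseʳ (ιℤ i)) ⟨
    ιℤ (ℤ.- i) + (ιℤ i + - ιℤ i)     ≡⟨ +-assoc _ _ _ ⟨
    ιℤ (ℤ.- i) + ιℤ i + - ιℤ i       ≡⟨ cong (_+ - ιℤ i) (ιℤ-+ (ℤ.- i) i) ⟨
    ιℤ (ℤ.- i ℤ.+ i) + - ιℤ i        ≡⟨ cong (λ k → ιℤ k + - ιℤ i) (ℤ.+-inverseˡ i) ⟩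
    0q + - ιℤ i                      ≡⟨ +-identityˡ _ ⟩
    - ιℤ i                           ∎
    where open ≡-Reasoning

  ιℤ-morphism : ℤ.+-*-rawRing -Raw-AlmostCommutative⟶ fromCommutativeRing ℚ-commutativeRing
  ιℤ-morphism = record { ⟦_⟧ = ιℤ ; +-homo = ιℤ-+ ; *-homo = ιℤ-* ; -‿homo = ιℤ-neg ; 0-homo = refl ; 1-homo = refl }

  ιℤ-coefficients : ∀ i j → Maybe (ιℤ i ≡ ιℤ j)
  ιℤ-coefficients i j = Maybe.map (cong ιℤ) (dec⇒maybe (i ℤ.≟ j))

  -- Integer coefficients let the solver compare constants by deciding equality in ℤ while the
  -- opaque operations of ℚ never reduce.
  module ℚ-Solver = Algebra.Solver.Ring ℤ.+-*-rawRing (fromCommutativeRing ℚ-commutativeRing) ιℤ-morphism ιℤ-coefficients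
  open ℚ-Solver public using (solve; _:+_; _:*_; _:-_; :-_; con; _:=_)

  ι-+ : ∀ m n → ι (m ℕ.+ n) ≡ ι m + ι n
  ι-+ m n = ιℤ-+ (+ m) (+ n)

  ι-* : ∀ m n → ι (m ℕ.* n) ≡ ι m * ι n
  ι-* m n = trans (cong ιℤ (ℤ.pos-* m n)) (ιℤ-* (+ m) (+ n))

  ι-suc : ∀ n → ι (suc n) ≡ 1q + ι n
  ι-suc = ι-+ 1

  ι-∸ : ∀ {m n} → n ℕ.≤ m → ι (m ∸ n) ≡ ι m - ι n
  ι-∸ {m} {n} n≤m = begin
    ι (m ∸ n)                  ≡⟨ solve 2 (λ x y → x := x :+ y :- y) refl (ι (m ∸ n)) (ι n) ⟩
    ι (m ∸ n) + ι n - ι n      ≡⟨ cong (_- ι n) (ι-+ (m ∸ n) n) ⟨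
    ι (m ∸ n ℕ.+ n) - ι n      ≡⟨ cong (λ k → ι k - ι n) (ℕ.m∸n+n≡m n≤m) ⟩
    ι m - ι n                  ∎
    where open ≡-Reasoning

  ι-injective : ∀ {m n} → ι m ≡ ι n → m ≡ n
  ι-injective {m} {n} eq = ℤ.+-injective (cong ℚᵘ.ℚᵘ.numerator
    (trans (sym (toℚᵘ-ιℤ (+ m))) (trans (cong ℚ.toℚᵘ eq) (toℚᵘ-ιℤ (+ n)))))

  ι-suc≢0 : ∀ n → ι (suc n) ≢ 0q
  ι-suc≢0 n eq = case ι-injective {suc n} {0} eq of λ ()

  ⁻¹-inverseˡ : ∀ {x} → x ≢ 0q → x ⁻¹ * x ≡ 1q
  ⁻¹-inverseˡ x≢0 = trans (*-comm _ _) (⁻¹-inverse x≢0)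

  *-cancelˡ : ∀ {x y z} → x ≢ 0q → x * y ≡ x * z → y ≡ z
  *-cancelˡ {x} {y} {z} x≢0 eq = begin
    y                 ≡⟨ *-identityˡ y ⟨
    1q * y            ≡⟨ cong (_* y) (⁻¹-inverseˡ x≢0) ⟨
    x ⁻¹ * x * y      ≡⟨ *-assoc _ _ _ ⟩
    x ⁻¹ * (x * y)    ≡⟨ cong (_*_ (x ⁻¹)) eq ⟩
    x ⁻¹ * (x * z)    ≡⟨ *-assoc _ _ _ ⟨
    x ⁻¹ * x * z      ≡⟨ cong (_* z) (⁻¹-inverseˡ x≢0) ⟩
    1q * z            ≡⟨ *-identityˡ z ⟩
    z                 ∎
    where open ≡-Reasoning

  *-≢0 : ∀ {x y} → x ≢ 0q → y ≢ 0q → x * y ≢ 0q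
  *-≢0 {x} x≢0 y≢0 eq = y≢0 (*-cancelˡ x≢0 (trans eq (sym (zeroʳ x))))

-- Finite sums, products and indicators

module Sums where
  open Rationals

  -- The Iverson bracket. Cardinalities become sums of brackets, and bijections become exchanges of
  -- summations.
  ⟦_⟧ : {P : Set} → Dec P → ℚ
  ⟦ yes _ ⟧ = 1q
  ⟦ no  _ ⟧ = 0q

  ⟦⟧-true : {P : Set} (p? : Dec P) → P → ⟦ p? ⟧ ≡ 1q
  ⟦⟧-true (yes _)  _ = refl
  ⟦⟧-true (no ¬p)  p = contradiction p ¬p

  ⟦⟧-false : {P : Set} (p? : Dec P) → ¬ P → ⟦ p? ⟧ ≡ 0q
  ⟦⟧-false (yes p) ¬p = contradiction p ¬p
  ⟦⟧-false (no _)  _  = refl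

  ⟦⟧-cong : {P Q : Set} (p? : Dec P) (q? : Dec Q) → (P → Q) → (Q → P) → ⟦ p? ⟧ ≡ ⟦ q? ⟧
  ⟦⟧-cong (yes p) q? f g = sym (⟦⟧-true q? (f p))
  ⟦⟧-cong (no ¬p) q? f g = sym (⟦⟧-false q? (¬p ∘ g))

  ⟦⟧-× : {P Q : Set} (p? : Dec P) (q? : Dec Q) → ⟦ p? ×-dec q? ⟧ ≡ ⟦ p? ⟧ * ⟦ q? ⟧
  ⟦⟧-× (yes _) (yes _) = sym (*-identityˡ _)
  ⟦⟧-× (yes _) (no _)  = sym (zeroʳ _)
  ⟦⟧-× (no _)  (yes _) = sym (zeroˡ _)
  ⟦⟧-× (no _)  (no _)  = sym (zeroˡ _)

  ⟦⟧-T? : {P : Set} (p? : Dec P) → ⟦ T? (does p?) ⟧ ≡ ⟦ p? ⟧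
  ⟦⟧-T? (yes _) = refl
  ⟦⟧-T? (no _)  = refl

  ⟦⟧*-true : {P : Set} (p? : Dec P) {a : ℚ} → P → ⟦ p? ⟧ * a ≡ a
  ⟦⟧*-true p? p = trans (cong (_* _) (⟦⟧-true p? p)) (*-identityˡ _)

  ⟦⟧*-false : {P : Set} (p? : Dec P) {a : ℚ} → ¬ P → ⟦ p? ⟧ * a ≡ 0q
  ⟦⟧*-false p? ¬p = trans (cong (_* _) (⟦⟧-false p? ¬p)) (zeroˡ _)

  -- A bracket makes its proposition available to the proof that the other factors agree; this is
  -- how side conditions of a sum are used.
  ⟦⟧*-cong : {P : Set} (p? : Dec P) {a b : ℚ} → (P → a ≡ b) → ⟦ p? ⟧ * a ≡ ⟦ p? ⟧ * b
  ⟦⟧*-cong (yes p) eq = cong (1q *_) (eq p)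
  ⟦⟧*-cong (no _)  eq = trans (zeroˡ _) (sym (zeroˡ _))

  private variable A B C : Set

  ∑ : List A → (A → ℚ) → ℚ
  ∑ []       f = 0q
  ∑ (x ∷ xs) f = f x + ∑ xs f

  ∑-cong∈ : ∀ (xs : List A) {f g : A → ℚ} → (∀ {x} → x ∈ xs → f x ≡ g x) → ∑ xs f ≡ ∑ xs g
  ∑-cong∈ []       eq = refl
  ∑-cong∈ (x ∷ xs) eq = cong₂ _+_ (eq (here refl)) (∑-cong∈ xs (eq ∘ there))

  ∑-cong : ∀ (xs : List A) {f g : A → ℚ} → (∀ x → f x ≡ g x) → ∑ xs f ≡ ∑ xs g
  ∑-cong xs eq = ∑-cong∈ xs (λ _ → eq _)

  ∑-zero : ∀ (xs : List A) → ∑ xs (λ _ → 0q) ≡ 0q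
  ∑-zero []       = refl
  ∑-zero (x ∷ xs) = trans (+-identityˡ _) (∑-zero xs)

  ∑-++ : ∀ (xs ys : List A) (f : A → ℚ) → ∑ (xs ++ ys) f ≡ ∑ xs f + ∑ ys f
  ∑-++ []       ys f = sym (+-identityˡ _)
  ∑-++ (x ∷ xs) ys f = trans (cong (_+_ _) (∑-++ xs ys f)) (sym (+-assoc _ _ _))

  ∑-map : ∀ (g : A → B) xs (f : B → ℚ) → ∑ (map g xs) f ≡ ∑ xs (f ∘ g)
  ∑-map g []       f = refl
  ∑-map g (x ∷ xs) f = cong (_+_ _) (∑-map g xs f)

  ∑-cartesianProductWith : ∀ (_∙_ : A → B → C) xs ys (f : C → ℚ) →
    ∑ (cartesianProductWith _∙_ xs ys) f ≡ ∑ xs (λ x → ∑ ys (λ y → f (x ∙ y)))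
  ∑-cartesianProductWith _∙_ []       ys f = refl
  ∑-cartesianProductWith _∙_ (x ∷ xs) ys f = trans
    (∑-++ (map (x ∙_) ys) _ f)
    (cong₂ _+_ (∑-map (x ∙_) ys f) (∑-cartesianProductWith _∙_ xs ys f))

  ∑-+ : ∀ (xs : List A) (f g : A → ℚ) → ∑ xs (λ x → f x + g x) ≡ ∑ xs f + ∑ xs g
  ∑-+ []       f g = sym (+-identityˡ _)
  ∑-+ (x ∷ xs) f g = trans (cong (_+_ _) (∑-+ xs f g)) 
    (solve 4 (λ a b c d → (a :+ b) :+ (c :+ d) := (a :+ c) :+ (b :+ d)) refl (f x) (g x) _ _)

  ∑-*ˡ : ∀ (c : ℚ) (xs : List A) (f : A → ℚ) → ∑ xs (λ x → c * f x) ≡ c * ∑ xs f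
  ∑-*ˡ c []       f = sym (zeroʳ c)
  ∑-*ˡ c (x ∷ xs) f = trans (cong (_+_ _) (∑-*ˡ c xs f)) (sym (distribˡ c _ _))

  ∑-*ʳ : ∀ (c : ℚ) (xs : List A) (f : A → ℚ) → ∑ xs (λ x → f x * c) ≡ ∑ xs f * c
  ∑-*ʳ c xs f = trans (∑-cong xs (λ x → *-comm (f x) c)) (trans (∑-*ˡ c xs f) (*-comm c _))

  ∑-- : ∀ (xs : List A) (f g : A → ℚ) → ∑ xs (λ x → f x - g x) ≡ ∑ xs f - ∑ xs g
  ∑-- []       f g = sym (-‿inverseʳ _)
  ∑-- (x ∷ xs) f g = trans (cong (_+_ _) (∑-- xs f g)) 
    (solve 4 (λ a b c d → (a :- b) :+ (c :- d) := (a :+ c) :- (b :+ d)) refl (f x) (g x) _ _)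

  ∑-swap : ∀ (xs : List A) (ys : List B) (f : A → B → ℚ) →
    ∑ xs (λ x → ∑ ys (f x)) ≡ ∑ ys (λ y → ∑ xs (λ x → f x y))
  ∑-swap []       ys f = sym (∑-zero ys)
  ∑-swap (x ∷ xs) ys f = trans (cong (_+_ _) (∑-swap xs ys f)) (sym (∑-+ ys (f x) _))

  ∑-filter : ∀ {P : Pred A 0ℓ} (P? : Decidable P) xs (f : A → ℚ) →
    ∑ (filter P? xs) f ≡ ∑ xs (λ x → ⟦ P? x ⟧ * f x)
  ∑-filter P? []       f = refl
  ∑-filter P? (x ∷ xs) f with P? x
  ... | yes _ = cong₂ _+_ (sym (*-identityˡ _)) (∑-filter P? xs f)
  ... | no  _ = trans (∑-filter P? xs f) (sym (trans (cong (_+ _) (zeroˡ _)) (+-identityˡ _)))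

  ι-length : ∀ (xs : List A) → ι (length xs) ≡ ∑ xs (λ _ → 1q)
  ι-length []       = refl
  ι-length (x ∷ xs) = trans (ι-suc (length xs)) (cong (_+_ 1q) (ι-length xs))

  ι-count : ∀ {P : Pred A 0ℓ} (P? : Decidable P) xs →
    ι (length (filter P? xs)) ≡ ∑ xs (λ x → ⟦ P? x ⟧)
  ι-count P? xs = trans (ι-length (filter P? xs))
    (trans (∑-filter P? xs _) (∑-cong xs (λ x → *-identityʳ _)))

  ι-sum : ∀ (f : A → ℕ) xs → ι (ℕ.sum (map f xs)) ≡ ∑ xs (ι ∘ f)
  ι-sum f []       = refl
  ι-sum f (x ∷ xs) = trans (ι-+ (f x) _) (cong (_+_ _) (ι-sum f xs))

  ∑-δ∉ : (_≟_ : DecidableEquality A) → ∀ {xs y} (f : A → ℚ) → y ∉ xs →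
    ∑ xs (λ x → ⟦ x ≟ y ⟧ * f x) ≡ 0q
  ∑-δ∉ _≟_ {xs} {y} f y∉ = trans
    (∑-cong∈ xs (λ {x} x∈ → ⟦⟧*-false (x ≟ y) λ where refl → y∉ x∈))
    (∑-zero xs)

  ∑-δ : (_≟_ : DecidableEquality A) → ∀ {xs y} (f : A → ℚ) → Unique xs → y ∈ xs →
    ∑ xs (λ x → ⟦ x ≟ y ⟧ * f x) ≡ f y
  ∑-δ _≟_ {x ∷ xs} f (x∉ ∷ _) (here refl) = trans
    (cong₂ _+_ (⟦⟧*-true (x ≟ x) refl) (∑-δ∉ _≟_ f (λ x∈ → All.lookup x∉ x∈ refl)))
    (+-identityʳ _)
  ∑-δ _≟_ {x ∷ xs} {y} f (x∉ ∷ u) (there y∈) = trans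
    (cong₂ _+_ (⟦⟧*-false (x ≟ y) (All.lookup x∉ y∈)) (∑-δ _≟_ f u y∈))
    (+-identityˡ _)

  ∑-upTo-last : ∀ n (f : ℕ → ℚ) → ∑ (upTo (suc n)) f ≡ ∑ (upTo n) f + f n
  ∑-upTo-last n f = begin
    ∑ (upTo (suc n)) f             ≡⟨ cong (λ l → ∑ l f) (List.upTo-∷ʳ n) ⟨
    ∑ (upTo n ∷ʳ n) f              ≡⟨ ∑-++ (upTo n) (n ∷ []) f ⟩
    ∑ (upTo n) f + (f n + 0q)      ≡⟨ cong (_+_ _) (+-identityʳ _) ⟩
    ∑ (upTo n) f + f n             ∎
    where open ≡-Reasoning

  ∑-upTo-first : ∀ n (f : ℕ → ℚ) → ∑ (upTo (suc n)) f ≡ f 0 + ∑ (upTo n) (f ∘ suc)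
  ∑-upTo-first n f = cong (_+_ (f 0)) (trans
    (cong (λ l → ∑ l f) (sym (List.map-applyUpTo id suc n))) (∑-map suc (upTo n) f))

  ∏ : List A → (A → ℚ) → ℚ
  ∏ []       f = 1q
  ∏ (x ∷ xs) f = f x * ∏ xs f

  ∏-cong : ∀ (xs : List A) {f g : A → ℚ} → (∀ x → f x ≡ g x) → ∏ xs f ≡ ∏ xs g
  ∏-cong []       eq = refl
  ∏-cong (x ∷ xs) eq = cong₂ _*_ (eq x) (∏-cong xs eq)

  ∏-map : ∀ (g : A → B) xs (f : B → ℚ) → ∏ (map g xs) f ≡ ∏ xs (f ∘ g)
  ∏-map g []       f = refl
  ∏-map g (x ∷ xs) f = cong (_*_ _) (∏-map g xs f)

  ∏-++ : ∀ (xs ys : List A) (f : A → ℚ) → ∏ (xs ++ ys) f ≡ ∏ xs f * ∏ ys f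
  ∏-++ []       ys f = sym (*-identityˡ _)
  ∏-++ (x ∷ xs) ys f = trans (cong (_*_ _) (∏-++ xs ys f)) (sym (*-assoc _ _ _))

  ∏-↭ : ∀ {xs ys : List A} (f : A → ℚ) → xs ↭ ys → ∏ xs f ≡ ∏ ys f
  ∏-↭ f ↭.refl         = refl
  ∏-↭ f (↭.prep x p)   = cong (_*_ (f x)) (∏-↭ f p)
  ∏-↭ f (↭.swap x y p) = trans (cong (λ z → f x * (f y * z)) (∏-↭ f p))
    (solve 3 (λ a b c → a :* (b :* c) := b :* (a :* c)) refl (f x) (f y) _)
  ∏-↭ f (↭.trans p q)  = trans (∏-↭ f p) (∏-↭ f q)

  ∑-allFin-suc : ∀ n (f : Fin (suc n) → ℚ) → ∑ (allFin (suc n)) f ≡ f Fin.zero + ∑ (allFin n) (f ∘ Fin.suc)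
  ∑-allFin-suc n f = cong (_+_ _) (trans (cong (λ l → ∑ l f) (sym (List.map-tabulate id Fin.suc))) (∑-map Fin.suc (allFin n) f))

  ∑-allFin-toℕ : ∀ n (f : ℕ → ℚ) → ∑ (allFin n) (f ∘ toℕ) ≡ ∑ (upTo n) f
  ∑-allFin-toℕ zero    f = refl
  ∑-allFin-toℕ (suc n) f = trans (∑-allFin-suc n (f ∘ toℕ))
    (trans (cong (_+_ _) (∑-allFin-toℕ n (f ∘ suc))) (sym (∑-upTo-first n f)))

  ∏-allFin-suc : ∀ n (f : Fin (suc n) → ℚ) → ∏ (allFin (suc n)) f ≡ f Fin.zero * ∏ (allFin n) (f ∘ Fin.suc)
  ∏-allFin-suc n f = cong (_*_ _) (trans (cong (λ l → ∏ l f) (sym (List.map-tabulate id Fin.suc))) (∏-map Fin.suc (allFin n) f))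

-- Rook numbers, hit numbers and the factorization for Ferrers boards

module Rook where
  open Rationals
  open Sums

  open import Data.List.Relation.Binary.Subset.Propositional using (_⊆_)

  falling : ℚ → ℕ → ℚ
  falling x zero    = 1q
  falling x (suc k) = x * falling (x - 1q) k

  -- `falling` grows at the front, as placing a rook in the first column requires, while `choose`
  -- grows at the end; this passes between the two.
  falling-last : ∀ x k → falling x (suc k) ≡ falling x k * (x - ι k)
  falling-last x zero    = solve 1 (λ x → x :* con (+ 1) := con (+ 1) :* (x :- con (+ 0))) refl x
  falling-last x (suc k) = begin
    x * falling (x - 1q) (suc k)                     ≡⟨ cong (_*_ x) (falling-last (x - 1q) k) ⟩
    x * (falling (x - 1q) k * (x - 1q - ι k))        ≡⟨ solve 3 (λ x f k → x :* (f :* (x :- con (+ 1) :- k)) := x :* f :* (x :- (con (+ 1) :+ k))) refl x _ (ι k) ⟩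
    falling x (suc k) * (x - (1q + ι k))             ≡⟨ cong (λ z → falling x (suc k) * (x - z)) (ι-suc k) ⟨
    falling x (suc k) * (x - ι (suc k))              ∎
    where open ≡-Reasoning

  choose : ℚ → ℕ → ℚ
  choose x zero    = 1q
  choose x (suc k) = choose x k * (x - ι k) * ι (suc k) ⁻¹

  ι-!≢0 : ∀ k → ι (k !) ≢ 0q
  ι-!≢0 k eq = ℕ.≢-nonZero⁻¹ (k !) {{ℕ._!≢0 k}} (ι-injective eq)

  choose-! : ∀ x k → choose x k * ι (k !) ≡ falling x k
  choose-! x zero    = *-identityˡ _
  choose-! x (suc k) = begin
    choose x k * (x - ι k) * ι (suc k) ⁻¹ * ι (suc k ℕ.* k !)              ≡⟨ cong (_*_ _) (ι-* (suc k) (k !)) ⟩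
    choose x k * (x - ι k) * ι (suc k) ⁻¹ * (ι (suc k) * ι (k !))          ≡⟨ solve 5 (λ c d i s f → c :* d :* i :* (s :* f) := c :* f :* d :* (s :* i)) refl (choose x k) (x - ι k) (ι (suc k) ⁻¹) (ι (suc k)) (ι (k !)) ⟩
    choose x k * ι (k !) * (x - ι k) * (ι (suc k) * ι (suc k) ⁻¹)          ≡⟨ cong₂ (λ a b → a * (x - ι k) * b) (choose-! x k) (⁻¹-inverse (ι-suc≢0 k)) ⟩
    falling x k * (x - ι k) * 1q                                           ≡⟨ *-identityʳ _ ⟩
    falling x k * (x - ι k)                                                ≡⟨ falling-last x k ⟨
    falling x (suc k)                                                      ∎
    where open ≡-Reasoning

  -- Pascal's rule as a finite difference: the effect of one more hit on the argument of the
  -- binomial. The factorial is cleared to reduce it to falling factorials.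
  choose-pascal : ∀ x k → choose (1q + x) (suc k) - choose x (suc k) ≡ choose x k
  choose-pascal x k = *-cancelˡ (ι-!≢0 (suc k)) (begin
    f * (choose (1q + x) (suc k) - choose x (suc k))            ≡⟨ solve 3 (λ f a b → f :* (a :- b) := a :* f :- b :* f) refl f _ _ ⟩
    choose (1q + x) (suc k) * f - choose x (suc k) * f          ≡⟨ cong₂ _-_ (choose-! _ (suc k)) (trans (choose-! x (suc k)) (falling-last x k)) ⟩
    (1q + x) * falling (1q + x - 1q) k - falling x k * (x - ι k) ≡⟨ cong (λ y → (1q + x) * falling y k - falling x k * (x - ι k)) (solve 1 (λ x → con (+ 1) :+ x :- con (+ 1) := x) refl x) ⟩
    (1q + x) * falling x k - falling x k * (x - ι k)            ≡⟨ solve 3 (λ x g k → (con (+ 1) :+ x) :* g :- g :* (x :- k) := (con (+ 1) :+ k) :* g) refl x _ (ι k) ⟩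
    (1q + ι k) * falling x k                                    ≡⟨ cong₂ _*_ (ι-suc k) (choose-! x k) ⟨
    ι (suc k) * (choose x k * ι (k !))                          ≡⟨ solve 3 (λ s c f → s :* (c :* f) := s :* f :* c) refl _ _ _ ⟩
    ι (suc k) * ι (k !) * choose x k                            ≡⟨ cong (_* choose x k) (ι-* (suc k) (k !)) ⟨
    f * choose x k                                              ∎)
    where
    open ≡-Reasoning
    f = ι (suc k !)

  private variable n : ℕ

  _∉?_ : (j : Fin n) (U : List (Fin n)) → Dec (j ∉ U)
  j ∉? U = ¬? (Any.any? (j Fin.≟_) U)

  -- Placements are summed column by column; U records the rows already occupied.

  Free : List (Fin n) → List (Cell n) → Set
  Free U s = NonAttacking s × All (λ c → proj₂ c ∉ U) s

  free? : (U : List (Fin n)) → Decidable (Free U)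
  free? U s = nonAttacking? s ×-dec All.all? (λ c → proj₂ c ∉? U) s

  columnSum : List (Fin n) → List (Fin n) → (List (Cell n) → ℚ) → ℚ
  columnSum []       U Φ = Φ []
  columnSum {n} (i ∷ cs) U Φ =
    columnSum cs U Φ + ∑ (allFin n) λ j → ⟦ j ∉? U ⟧ * columnSum cs (j ∷ U) (λ s → Φ ((i , j) ∷ s))

  ∈-subsets : ∀ {A : Set} {xs s : List A} → s ∈ subsets xs → s ⊆ xs
  ∈-subsets {xs = []} (here refl) ()
  ∈-subsets {xs = x ∷ xs} s∈ c∈ with ∈.∈-++⁻ (map (x ∷_) (subsets xs)) s∈
  ... | inj₂ s∈′ = there (∈-subsets s∈′ c∈)
  ... | inj₁ s∈′ with ∈.∈-map⁻ (x ∷_) s∈′ | c∈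
  ...   | _ , _ , refl   | here refl = here refl
  ...   | _ , t∈ , refl  | there c∈′ = there (∈-subsets t∈ c∈′)

  ∑-subsets-∷ : ∀ {A : Set} (x : A) xs (F : List A → ℚ) →
    ∑ (subsets (x ∷ xs)) F ≡ ∑ (subsets xs) (F ∘ (x ∷_)) + ∑ (subsets xs) F
  ∑-subsets-∷ x xs F = trans (∑-++ (map (x ∷_) (subsets xs)) _ F) (cong (_+ _) (∑-map (x ∷_) (subsets xs) F))

  ∑-subsets-vanish : ∀ {A : Set} (ys xs : List A) (F : List A → ℚ) →
    (∀ y s → y ∈ ys → F (y ∷ s) ≡ 0q) → ∑ (subsets (ys ++ xs)) F ≡ ∑ (subsets xs) F
  ∑-subsets-vanish []       xs F F0 = refl
  ∑-subsets-vanish (y ∷ ys) xs F F0 = begin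
    ∑ (subsets (y ∷ ys ++ xs)) F                            ≡⟨ ∑-subsets-∷ y (ys ++ xs) F ⟩
    ∑ (subsets (ys ++ xs)) (F ∘ (y ∷_)) + ∑ (subsets (ys ++ xs)) F
      ≡⟨ cong₂ _+_ (trans (∑-cong (subsets (ys ++ xs)) (λ s → F0 y s (here refl))) (∑-zero (subsets (ys ++ xs))))
                   (∑-subsets-vanish ys xs F (λ y s → F0 y s ∘ there)) ⟩
    0q + ∑ (subsets xs) F                                   ≡⟨ +-identityˡ _ ⟩
    ∑ (subsets xs) F                                        ∎
    where open ≡-Reasoning

  -- Subsets keep the order of the list, so the members taken from `ys` come first, and two of them
  -- make F vanish. Here `ys` will be a column of the board.
  ∑-subsets-≤1 : ∀ {A : Set} (ys xs : List A) (F : List A → ℚ) →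
    (∀ y y′ s → y ∈ ys → y′ ∈ ys → F (y ∷ y′ ∷ s) ≡ 0q) →
    ∑ (subsets (ys ++ xs)) F ≡ ∑ (subsets xs) F + ∑ ys (λ y → ∑ (subsets xs) (F ∘ (y ∷_)))
  ∑-subsets-≤1 []       xs F F0 = sym (+-identityʳ _)
  ∑-subsets-≤1 (y ∷ ys) xs F F0 = begin
    ∑ (subsets (y ∷ ys ++ xs)) F                            ≡⟨ ∑-subsets-∷ y (ys ++ xs) F ⟩
    ∑ (subsets (ys ++ xs)) (F ∘ (y ∷_)) + ∑ (subsets (ys ++ xs)) F
      ≡⟨ cong₂ _+_ (∑-subsets-vanish ys xs (F ∘ (y ∷_)) (λ y′ s y′∈ → F0 y y′ s (here refl) (there y′∈)))
                   (∑-subsets-≤1 ys xs F (λ y y′ s y∈ y′∈ → F0 y y′ s (there y∈) (there y′∈))) ⟩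
    ∑ (subsets xs) (F ∘ (y ∷_)) + (∑ (subsets xs) F + ∑ ys (λ y → ∑ (subsets xs) (F ∘ (y ∷_))))
      ≡⟨ solve 3 (λ a b c → a :+ (b :+ c) := b :+ (a :+ c)) refl _ _ _ ⟩
    ∑ (subsets xs) F + (∑ (subsets xs) (F ∘ (y ∷_)) + ∑ ys (λ y → ∑ (subsets xs) (F ∘ (y ∷_))))  ∎
    where open ≡-Reasoning

  grid : List (Fin n) → List (Cell n)
  grid {n} cs = cartesianProduct cs (allFin n)

  -- A column holds at most one rook of a nonattacking placement. Distinct columns let the condition
  -- on a placement split into one on its first rook and one on the remaining rooks.
  columnSum-correct : ∀ {cs : List (Fin n)} → Unique cs → ∀ U (Φ : List (Cell n) → ℚ) →
    ∑ (subsets (grid cs)) (λ s → ⟦ free? U s ⟧ * Φ s) ≡ columnSum cs U Φ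
  columnSum-correct [] U Φ = trans (+-identityʳ _) (⟦⟧*-true (free? U []) ([] , []))
  columnSum-correct {n} {i ∷ cs} (i∉ ∷ uniq) U Φ = begin
    ∑ (subsets (column ++ grid cs)) F
      ≡⟨ ∑-subsets-≤1 column (grid cs) F attack ⟩
    ∑ (subsets (grid cs)) F + ∑ column (λ c → ∑ (subsets (grid cs)) (F ∘ (c ∷_)))
      ≡⟨ cong₂ _+_ (columnSum-correct uniq U Φ) (∑-map (i ,_) (allFin n) _) ⟩
    columnSum cs U Φ + ∑ (allFin n) (λ j → ∑ (subsets (grid cs)) (λ s → F ((i , j) ∷ s)))
      ≡⟨ cong (_+_ _) (∑-cong (allFin n) λ j → begin
        ∑ (subsets (grid cs)) (λ s → F ((i , j) ∷ s))
          ≡⟨ ∑-cong∈ (subsets (grid cs)) (λ {s} s∈ → trans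
               (cong (_* _) (trans (⟦⟧-cong (free? U _) (j ∉? U ×-dec free? (j ∷ U) s) split (merge s∈)) (⟦⟧-× (j ∉? U) _)))
               (*-assoc _ _ _)) ⟩
        ∑ (subsets (grid cs)) (λ s → ⟦ j ∉? U ⟧ * (⟦ free? (j ∷ U) s ⟧ * Φ ((i , j) ∷ s)))
          ≡⟨ ∑-*ˡ ⟦ j ∉? U ⟧ (subsets (grid cs)) _ ⟩
        ⟦ j ∉? U ⟧ * ∑ (subsets (grid cs)) (λ s → ⟦ free? (j ∷ U) s ⟧ * Φ ((i , j) ∷ s))
          ≡⟨ cong (_*_ ⟦ j ∉? U ⟧) (columnSum-correct uniq (j ∷ U) (λ s → Φ ((i , j) ∷ s))) ⟩
        ⟦ j ∉? U ⟧ * columnSum cs (j ∷ U) (λ s → Φ ((i , j) ∷ s)) ∎) ⟩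
    columnSum (i ∷ cs) U Φ ∎
    where
    open ≡-Reasoning
    column = map (i ,_) (allFin n)

    F : List (Cell n) → ℚ
    F s = ⟦ free? U s ⟧ * Φ s

    attack : ∀ c c′ s → c ∈ column → c′ ∈ column → F (c ∷ c′ ∷ s) ≡ 0q
    attack c c′ s c∈ c′∈ with ∈.∈-map⁻ (i ,_) c∈ | ∈.∈-map⁻ (i ,_) c′∈
    ... | _ , _ , refl | _ , _ , refl = ⟦⟧*-false (free? U (c ∷ c′ ∷ s)) λ where
      (((≢ , _) ∷ _) ∷ _ , _) → ≢ refl

    split : ∀ {j s} → Free U ((i , j) ∷ s) → j ∉ U × Free (j ∷ U) s
    split (all ∷ na , j∉ ∷ ∉U) = j∉ , na , All.zipWith
      (λ { ((_ , j≢) , ∉U) (here refl) → j≢ refl ; ((_ , j≢) , ∉U) (there ∈U) → ∉U ∈U }) (all , ∉U)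

    -- The membership of s places its cells in the columns `cs`, which differ from i.
    merge : ∀ {j s} → s ∈ subsets (grid cs) → j ∉ U × Free (j ∷ U) s → Free U ((i , j) ∷ s)
    merge {j} {s} s∈ (j∉ , na , ∉jU) =
      All.tabulate (λ {c} c∈ →
        (λ { refl → All.lookup i∉ (proj₁ (∈.∈-cartesianProduct⁻ cs (allFin n) (∈-subsets s∈ c∈))) refl }) ,
        (λ { refl → All.lookup ∉jU c∈ (here refl) })) ∷ na ,
      j∉ ∷ All.map (λ ∉ ∈U → ∉ (there ∈U)) ∉jU

  columnSum-cong : ∀ (cs : List (Fin n)) U {Φ Ψ : List (Cell n) → ℚ} →
    (∀ s → length s ℕ.≤ length cs → Φ s ≡ Ψ s) → columnSum cs U Φ ≡ columnSum cs U Ψ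
  columnSum-cong []       U eq = eq [] ℕ.z≤n
  columnSum-cong {n} (i ∷ cs) U eq = cong₂ _+_
    (columnSum-cong cs U λ s le → eq s (ℕ.m≤n⇒m≤1+n le))
    (∑-cong (allFin n) λ j → cong (_*_ _) (columnSum-cong cs (j ∷ U) λ s le → eq _ (ℕ.s≤s le)))

  columnSum-*ˡ : ∀ (cs : List (Fin n)) U a (Φ : List (Cell n) → ℚ) →
    columnSum cs U (λ s → a * Φ s) ≡ a * columnSum cs U Φ
  columnSum-*ˡ []       U a Φ = refl
  columnSum-*ˡ {n} (i ∷ cs) U a Φ = trans
    (cong₂ _+_ (columnSum-*ˡ cs U a Φ) (trans
      (∑-cong (allFin n) λ j → trans (cong (_*_ _) (columnSum-*ˡ cs (j ∷ U) a _))
        (solve 3 (λ p a c → p :* (a :* c) := a :* (p :* c)) refl _ a _))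
      (∑-*ˡ a (allFin n) _)))
    (sym (distribˡ a _ _))

  module _ (B : Board n) where

    -- The sum of φ(number of rooks) over rook placements on B, of any size, in the columns `cs` and
    -- outside the rows U.
    partial : List (Fin n) → List (Fin n) → (ℕ → ℚ) → ℚ
    partial []       U φ = φ 0
    partial (i ∷ cs) U φ = partial cs U φ +
      ∑ (allFin n) λ j → ⟦ j ∉? U ⟧ * (⟦ T? (B (i , j)) ⟧ * partial cs (j ∷ U) (φ ∘ suc))

    -- The sum of ψ(number of hits) over placements of one rook in each column of `cs`, outside the
    -- rows U. A rook on the board enters as a correction to the off-board term, which exposes the
    -- difference to which Pascal's rule applies.
    full : List (Fin n) → List (Fin n) → (ℕ → ℚ) → ℚ
    full []       U ψ = ψ 0
    full (i ∷ cs) U ψ = ∑ (allFin n) λ j → ⟦ j ∉? U ⟧ *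
      (full cs (j ∷ U) ψ + ⟦ T? (B (i , j)) ⟧ * (full cs (j ∷ U) (ψ ∘ suc) - full cs (j ∷ U) ψ))

    onBoard? : Decidable (All (λ c → T (B c)))
    onBoard? = All.all? (λ c → T? (B c))

    hits : List (Cell n) → ℕ
    hits s = length (filter (λ c → T? (B c)) s)

    columnSum-partial : ∀ cs U (φ : ℕ → ℚ) →
      columnSum cs U (λ s → ⟦ onBoard? s ⟧ * φ (length s)) ≡ partial cs U φ
    columnSum-partial []       U φ = ⟦⟧*-true (onBoard? []) []
    columnSum-partial (i ∷ cs) U φ = cong₂ _+_ (columnSum-partial cs U φ)
      (∑-cong (allFin n) λ j → cong (_*_ ⟦ j ∉? U ⟧) (begin
        columnSum cs (j ∷ U) (λ s → ⟦ onBoard? ((i , j) ∷ s) ⟧ * φ (suc (length s)))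
          ≡⟨ columnSum-cong cs (j ∷ U) (λ s _ → trans (cong (_* _) (trans
               (⟦⟧-cong (onBoard? ((i , j) ∷ s)) (T? (B (i , j)) ×-dec onBoard? s) All.uncons (uncurry _∷_))
               (⟦⟧-× (T? (B (i , j))) (onBoard? s)))) (*-assoc _ _ _)) ⟩
        columnSum cs (j ∷ U) (λ s → ⟦ T? (B (i , j)) ⟧ * (⟦ onBoard? s ⟧ * φ (suc (length s))))
          ≡⟨ columnSum-*ˡ cs (j ∷ U) _ _ ⟩
        ⟦ T? (B (i , j)) ⟧ * columnSum cs (j ∷ U) (λ s → ⟦ onBoard? s ⟧ * φ (suc (length s)))
          ≡⟨ cong (_*_ _) (columnSum-partial cs (j ∷ U) (φ ∘ suc)) ⟩
        ⟦ T? (B (i , j)) ⟧ * partial cs (j ∷ U) (φ ∘ suc) ∎))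
      where open ≡-Reasoning

    columnSum-full : ∀ cs U (ψ : ℕ → ℚ) →
      columnSum cs U (λ s → ⟦ length s ℕ.≟ length cs ⟧ * ψ (hits s)) ≡ full cs U ψ
    columnSum-full []       U ψ = *-identityˡ _
    columnSum-full (i ∷ cs) U ψ = begin
      columnSum cs U (λ s → ⟦ length s ℕ.≟ suc (length cs) ⟧ * ψ (hits s)) + _
        ≡⟨ cong₂ _+_
             -- An empty column leaves too few rooks for a full placement.
             (trans (columnSum-cong cs U λ s le →
                      trans (⟦⟧*-false (length s ℕ.≟ _) (λ eq → ℕ.1+n≰n (subst (ℕ._≤ _) eq le))) (sym (zeroˡ 0q)))
                    (trans (columnSum-*ˡ cs U 0q (λ _ → 0q)) (zeroˡ _)))
             (∑-cong (allFin n) λ j → cong (_*_ ⟦ j ∉? U ⟧) (step j)) ⟩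
      0q + full (i ∷ cs) U ψ  ≡⟨ +-identityˡ _ ⟩
      full (i ∷ cs) U ψ       ∎
      where
      open ≡-Reasoning
      step : ∀ j → columnSum cs (j ∷ U) (λ s → ⟦ suc (length s) ℕ.≟ suc (length cs) ⟧ * ψ (hits ((i , j) ∷ s))) ≡
        full cs (j ∷ U) ψ + ⟦ T? (B (i , j)) ⟧ * (full cs (j ∷ U) (ψ ∘ suc) - full cs (j ∷ U) ψ)
      step j with B (i , j)
      ... | true = trans
        (columnSum-cong cs (j ∷ U) λ s _ → cong (_* _) (⟦⟧-cong (_ ℕ.≟ _) (length s ℕ.≟ length cs) ℕ.suc-injective (cong suc)))
        (trans (columnSum-full cs (j ∷ U) (ψ ∘ suc))
               (solve 2 (λ a b → a := b :+ con (+ 1) :* (a :- b)) refl _ _))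
      ... | false = trans
        (columnSum-cong cs (j ∷ U) λ s _ → cong (_* _) (⟦⟧-cong (_ ℕ.≟ _) (length s ℕ.≟ length cs) ℕ.suc-injective (cong suc)))
        (trans (columnSum-full cs (j ∷ U) ψ)
               (solve 2 (λ a b → a := a :+ con (+ 0) :* (b :- a)) refl _ _))

    partial-cong : ∀ cs U {φ φ′ : ℕ → ℚ} → (∀ t → t ℕ.≤ length cs → φ t ≡ φ′ t) →
      partial cs U φ ≡ partial cs U φ′
    partial-cong []       U eq = eq 0 ℕ.z≤n
    partial-cong (i ∷ cs) U eq = cong₂ _+_
      (partial-cong cs U λ t le → eq t (ℕ.m≤n⇒m≤1+n le))
      (∑-cong (allFin n) λ j → cong (_*_ _) (cong (_*_ _) (partial-cong cs (j ∷ U) λ t le → eq _ (ℕ.s≤s le))))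

    partial-*ˡ : ∀ cs U a (φ : ℕ → ℚ) → partial cs U (λ t → a * φ t) ≡ a * partial cs U φ
    partial-*ˡ []       U a φ = refl
    partial-*ˡ (i ∷ cs) U a φ = trans
      (cong₂ _+_ (partial-*ˡ cs U a φ) (trans
        (∑-cong (allFin n) λ j → trans (cong (λ z → _ * (_ * z)) (partial-*ˡ cs (j ∷ U) a _))
          (solve 4 (λ p b a c → p :* (b :* (a :* c)) := a :* (p :* (b :* c))) refl _ _ a _))
        (∑-*ˡ a (allFin n) _)))
      (sym (distribˡ a _ _))

    partial-zero : ∀ cs U → partial cs U (λ _ → 0q) ≡ 0q
    partial-zero cs U = trans (partial-cong cs U λ _ _ → sym (zeroˡ 0q)) (trans (partial-*ˡ cs U 0q _) (zeroˡ _))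

    -- Only the set of occupied rows matters, so two rows may be occupied in either order.
    partial-⊆ : ∀ cs {U V} (φ : ℕ → ℚ) → U ⊆ V → V ⊆ U → partial cs U φ ≡ partial cs V φ
    partial-⊆ []       φ U⊆V V⊆U = refl
    partial-⊆ (i ∷ cs) {U} {V} φ U⊆V V⊆U = cong₂ _+_ (partial-⊆ cs φ U⊆V V⊆U)
      (∑-cong (allFin n) λ j → cong₂ _*_
        (⟦⟧-cong (j ∉? U) (j ∉? V) (_∘ V⊆U) (_∘ U⊆V))
        (cong (_*_ _) (partial-⊆ cs (φ ∘ suc) (∷-⊆ U⊆V) (∷-⊆ V⊆U))))
      where
      ∷-⊆ : ∀ {j : Fin n} {U V} → U ⊆ V → j ∷ U ⊆ j ∷ V
      ∷-⊆ U⊆V (here eq)  = here eq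
      ∷-⊆ U⊆V (there j∈) = there (U⊆V j∈)

    full-- : ∀ cs U (ψ ψ′ : ℕ → ℚ) → full cs U (λ t → ψ t - ψ′ t) ≡ full cs U ψ - full cs U ψ′
    full-- []       U ψ ψ′ = refl
    full-- (i ∷ cs) U ψ ψ′ = trans
      (∑-cong (allFin n) λ j → trans
        (cong₂ (λ a b → ⟦ j ∉? U ⟧ * (a + ⟦ T? (B (i , j)) ⟧ * (b - a)))
          (full-- cs (j ∷ U) ψ ψ′) (full-- cs (j ∷ U) (ψ ∘ suc) (ψ′ ∘ suc)))
        (solve 6 (λ p q a a′ b b′ → p :* (a :- a′ :+ q :* (b :- b′ :- (a :- a′))) :=
          p :* (a :+ q :* (b :- a)) :- p :* (a′ :+ q :* (b′ :- a′))) refl _ _ _ _ _ _))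
      (∑-- (allFin n) _ _)

    full-cong : ∀ cs U {ψ ψ′ : ℕ → ℚ} → (∀ t → ψ t ≡ ψ′ t) → full cs U ψ ≡ full cs U ψ′
    full-cong []       U eq = eq 0
    full-cong (i ∷ cs) U eq = ∑-cong (allFin n) λ j → cong₂ (λ a b → ⟦ j ∉? U ⟧ * (a + ⟦ T? (B (i , j)) ⟧ * (b - a)))
      (full-cong cs (j ∷ U) eq) (full-cong cs (j ∷ U) (eq ∘ suc))

  -- Each row of U satisfies P and is listed once, so it takes away exactly one.
  count-outside : ∀ {P : Pred (Fin n) 0ℓ} (P? : Decidable P) {U} → Unique U → All P U →
    ∑ (allFin n) (λ j → ⟦ j ∉? U ⟧ * ⟦ P? j ⟧) ≡ ∑ (allFin n) (λ j → ⟦ P? j ⟧) - ι (length U)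
  count-outside {n} P? [] [] = trans
    (∑-cong (allFin n) λ j → ⟦⟧*-true (j ∉? []) (λ ()))
    (solve 1 (λ a → a := a :- con (+ 0)) refl _)
  count-outside {n} P? {u ∷ U} (u∉ ∷ uniq) (pu ∷ pU) = begin
    ∑ (allFin n) (λ j → ⟦ j ∉? (u ∷ U) ⟧ * ⟦ P? j ⟧)
      ≡⟨ ∑-cong (allFin n) remove ⟩
    ∑ (allFin n) (λ j → ⟦ j ∉? U ⟧ * ⟦ P? j ⟧ - ⟦ j Fin.≟ u ⟧ * 1q)
      ≡⟨ ∑-- (allFin n) _ _ ⟩
    ∑ (allFin n) (λ j → ⟦ j ∉? U ⟧ * ⟦ P? j ⟧) - ∑ (allFin n) (λ j → ⟦ j Fin.≟ u ⟧ * 1q)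
      ≡⟨ cong₂ _-_ (count-outside P? uniq pU) (∑-δ Fin._≟_ (λ _ → 1q) (Unique.allFin⁺ n) (∈.∈-allFin u)) ⟩
    ∑ (allFin n) (λ j → ⟦ P? j ⟧) - ι (length U) - 1q
      ≡⟨ solve 2 (λ s l → s :- l :- con (+ 1) := s :- (con (+ 1) :+ l)) refl _ (ι (length U)) ⟩
    ∑ (allFin n) (λ j → ⟦ P? j ⟧) - (1q + ι (length U))
      ≡⟨ cong (_-_ _) (ι-suc (length U)) ⟨
    ∑ (allFin n) (λ j → ⟦ P? j ⟧) - ι (suc (length U)) ∎
    where
    open ≡-Reasoning
    remove : ∀ j → ⟦ j ∉? (u ∷ U) ⟧ * ⟦ P? j ⟧ ≡ ⟦ j ∉? U ⟧ * ⟦ P? j ⟧ - ⟦ j Fin.≟ u ⟧ * 1q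
    remove j = case j Fin.≟ u of λ where
      (yes refl) → begin
        ⟦ u ∉? (u ∷ U) ⟧ * ⟦ P? u ⟧           ≡⟨ ⟦⟧*-false (u ∉? (u ∷ U)) (λ u∉ → u∉ (here refl)) ⟩
        0q                                    ≡⟨ solve 0 (con (+ 0) := con (+ 1) :* con (+ 1) :- con (+ 1) :* con (+ 1)) refl ⟩
        1q * 1q - 1q * 1q                     ≡⟨ cong₂ _-_ (cong₂ _*_ (⟦⟧-true (u ∉? U) (λ u∈ → All.lookup u∉ u∈ refl)) (⟦⟧-true (P? u) pu))
                                                           (cong (_* 1q) (⟦⟧-true (u Fin.≟ u) refl)) ⟨
        ⟦ u ∉? U ⟧ * ⟦ P? u ⟧ - ⟦ u Fin.≟ u ⟧ * 1q ∎
      (no j≢u) → begin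
        ⟦ j ∉? (u ∷ U) ⟧ * ⟦ P? j ⟧           ≡⟨ cong (_* ⟦ P? j ⟧) (⟦⟧-cong (j ∉? (u ∷ U)) (j ∉? U) (_∘ there)
                                                   λ { j∉ (here eq) → j≢u eq ; j∉ (there j∈) → j∉ j∈ }) ⟩
        ⟦ j ∉? U ⟧ * ⟦ P? j ⟧                 ≡⟨ solve 1 (λ a → a := a :- con (+ 0)) refl _ ⟩
        ⟦ j ∉? U ⟧ * ⟦ P? j ⟧ - 0q            ≡⟨ cong (_-_ _) (⟦⟧*-false (j Fin.≟ u) j≢u) ⟨
        ⟦ j ∉? U ⟧ * ⟦ P? j ⟧ - ⟦ j Fin.≟ u ⟧ * 1q ∎

  ∑-upTo-< : ∀ n d → d ℕ.≤ n → ∑ (upTo n) (λ j → ⟦ j ℕ.<? d ⟧) ≡ ι d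
  ∑-upTo-< zero    zero    _         = refl
  ∑-upTo-< (suc n) zero    _         = trans (∑-cong (upTo (suc n)) λ j → ⟦⟧-false (j ℕ.<? 0) λ ()) (∑-zero (upTo (suc n)))
  ∑-upTo-< (suc n) (suc d) (ℕ.s≤s d≤n) = begin
    ∑ (upTo (suc n)) (λ j → ⟦ j ℕ.<? suc d ⟧)         ≡⟨ ∑-upTo-first n _ ⟩
    1q + ∑ (upTo n) (λ j → ⟦ suc j ℕ.<? suc d ⟧)      ≡⟨ cong (_+_ _) (∑-cong (upTo n) λ j → ⟦⟧-cong (suc j ℕ.<? suc d) (j ℕ.<? d) ℕ.s≤s⁻¹ ℕ.s≤s) ⟩
    1q + ∑ (upTo n) (λ j → ⟦ j ℕ.<? d ⟧)              ≡⟨ cong (_+_ _) (∑-upTo-< n d d≤n) ⟩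
    1q + ι d                                          ≡⟨ ι-suc d ⟨
    ι (suc d)                                         ∎
    where open ≡-Reasoning

  ∉⇒Unique-∷ : ∀ {j : Fin n} {U} → j ∉ U → Unique U → Unique (j ∷ U)
  ∉⇒Unique-∷ j∉ uniq = All.tabulate (λ { x∈ refl → j∉ x∈ }) ∷ uniq

  ∑-free : ∀ {U : List (Fin n)} → Unique U → ∑ (allFin n) (λ j → ⟦ j ∉? U ⟧) ≡ ι n - ι (length U)
  ∑-free {n} {U} uniq = begin
    ∑ (allFin n) (λ j → ⟦ j ∉? U ⟧)                         ≡⟨ ∑-cong (allFin n) (λ j → *-identityʳ _) ⟨
    ∑ (allFin n) (λ j → ⟦ j ∉? U ⟧ * 1q)                    ≡⟨ count-outside {P = λ _ → ⊤} (λ _ → yes tt) uniq (All.tabulate λ _ → tt) ⟩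
    ∑ (allFin n) (λ j → 1q) - ι (length U)                  ≡⟨ cong (_- ι (length U)) (ι-length (allFin n)) ⟨
    ι (length (allFin n)) - ι (length U)                    ≡⟨ cong (λ m → ι m - ι (length U)) (List.length-tabulate {n = n} id) ⟩
    ι n - ι (length U)                                      ∎
    where open ≡-Reasoning

  module _ (B : Board n) where

    -- Each placement s counted by partial cs U is counted once for every row
    -- outside U that s leaves empty.
    partial-skip : ∀ cs {U} (φ : ℕ → ℚ) → Unique U →
      ∑ (allFin n) (λ j → ⟦ j ∉? U ⟧ * partial B cs (j ∷ U) φ) ≡
      partial B cs U (λ t → (ι n - ι (length U) - ι t) * φ t)
    partial-skip [] {U} φ uniq = begin
      ∑ (allFin n) (λ j → ⟦ j ∉? U ⟧ * φ 0)                ≡⟨ ∑-*ʳ (φ 0) (allFin n) _ ⟩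
      ∑ (allFin n) (λ j → ⟦ j ∉? U ⟧) * φ 0                ≡⟨ cong (_* φ 0) (∑-free uniq) ⟩
      (ι n - ι (length U)) * φ 0                           ≡⟨ cong (_* φ 0) (solve 1 (λ a → a := a :- con (+ 0)) refl _) ⟩
      (ι n - ι (length U) - ι 0) * φ 0                     ∎
      where open ≡-Reasoning
    partial-skip (i ∷ cs) {U} φ uniq = begin
      ∑ (allFin n) (λ j → ⟦ j ∉? U ⟧ * (partial B cs (j ∷ U) φ + ∑ (allFin n) (λ k → ⟦ k ∉? (j ∷ U) ⟧ * (b k * p (k ∷ j ∷ U)))))
        ≡⟨ ∑-cong (allFin n) (λ j → trans (distribˡ _ _ _) (cong (_+_ _) (sym (∑-*ˡ _ (allFin n) _)))) ⟩
      ∑ (allFin n) (λ j → ⟦ j ∉? U ⟧ * partial B cs (j ∷ U) φ + ∑ (allFin n) (λ k → ⟦ j ∉? U ⟧ * (⟦ k ∉? (j ∷ U) ⟧ * (b k * p (k ∷ j ∷ U)))))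
        ≡⟨ ∑-+ (allFin n) _ _ ⟩
      ∑ (allFin n) (λ j → ⟦ j ∉? U ⟧ * partial B cs (j ∷ U) φ) + ∑ (allFin n) (λ j → ∑ (allFin n) (λ k → ⟦ j ∉? U ⟧ * (⟦ k ∉? (j ∷ U) ⟧ * (b k * p (k ∷ j ∷ U)))))
        ≡⟨ cong₂ _+_ (partial-skip cs φ uniq) (∑-swap (allFin n) (allFin n) _) ⟩
      partial B cs U (λ t → (ι n - ι (length U) - ι t) * φ t) + ∑ (allFin n) (λ k → ∑ (allFin n) (λ j → ⟦ j ∉? U ⟧ * (⟦ k ∉? (j ∷ U) ⟧ * (b k * p (k ∷ j ∷ U)))))
        ≡⟨ cong (_+_ _) (∑-cong (allFin n) λ k → begin
          ∑ (allFin n) (λ j → ⟦ j ∉? U ⟧ * (⟦ k ∉? (j ∷ U) ⟧ * (b k * p (k ∷ j ∷ U))))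
            ≡⟨ ∑-cong (allFin n) (λ j → begin
              ⟦ j ∉? U ⟧ * (⟦ k ∉? (j ∷ U) ⟧ * (b k * p (k ∷ j ∷ U)))
                ≡⟨ *-assoc _ _ _ ⟨
              ⟦ j ∉? U ⟧ * ⟦ k ∉? (j ∷ U) ⟧ * (b k * p (k ∷ j ∷ U))
                -- The skipped row j and the row k of the rook are chosen in the opposite order, so
                -- that the induction applies to the rows occupied after the rook.
                ≡⟨ cong₂ (λ a q → a * (b k * q)) (exchange j k)
                     (partial-⊆ B cs (φ ∘ suc) swap-⊆ swap-⊆) ⟩
              ⟦ k ∉? U ⟧ * ⟦ j ∉? (k ∷ U) ⟧ * (b k * p (j ∷ k ∷ U))
                ≡⟨ solve 4 (λ x y b p → x :* y :* (b :* p) := x :* b :* (y :* p)) refl _ _ (b k) _ ⟩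
              ⟦ k ∉? U ⟧ * b k * (⟦ j ∉? (k ∷ U) ⟧ * p (j ∷ k ∷ U)) ∎) ⟩
          ∑ (allFin n) (λ j → ⟦ k ∉? U ⟧ * b k * (⟦ j ∉? (k ∷ U) ⟧ * p (j ∷ k ∷ U)))
            ≡⟨ ∑-*ˡ _ (allFin n) _ ⟩
          ⟦ k ∉? U ⟧ * b k * ∑ (allFin n) (λ j → ⟦ j ∉? (k ∷ U) ⟧ * p (j ∷ k ∷ U))
            ≡⟨ *-assoc _ _ _ ⟩
          ⟦ k ∉? U ⟧ * (b k * ∑ (allFin n) (λ j → ⟦ j ∉? (k ∷ U) ⟧ * p (j ∷ k ∷ U)))
            ≡⟨ ⟦⟧*-cong (k ∉? U) (λ k∉ → cong (_*_ (b k)) (trans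
                 (partial-skip cs (φ ∘ suc) (∉⇒Unique-∷ k∉ uniq))
                 (partial-cong B cs (k ∷ U) λ t _ → cong (_* φ (suc t)) (begin
                   ι n - ι (suc (length U)) - ι t       ≡⟨ cong (λ l → ι n - l - ι t) (ι-suc (length U)) ⟩
                   ι n - (1q + ι (length U)) - ι t      ≡⟨ solve 3 (λ n u t → n :- (con (+ 1) :+ u) :- t := n :- u :- (con (+ 1) :+ t)) refl (ι n) _ (ι t) ⟩
                   ι n - ι (length U) - (1q + ι t)      ≡⟨ cong (_-_ _) (ι-suc t) ⟨
                   ι n - ι (length U) - ι (suc t)       ∎)))) ⟩
          ⟦ k ∉? U ⟧ * (b k * partial B cs (k ∷ U) (λ t → (ι n - ι (length U) - ι (suc t)) * φ (suc t))) ∎) ⟩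
      partial B (i ∷ cs) U (λ t → (ι n - ι (length U) - ι t) * φ t) ∎
      where
      open ≡-Reasoning
      b : Fin n → ℚ
      b k = ⟦ T? (B (i , k)) ⟧

      p : List (Fin n) → ℚ
      p V = partial B cs V (φ ∘ suc)

      swap-⊆ : ∀ {j k : Fin n} → j ∷ k ∷ U ⊆ k ∷ j ∷ U
      swap-⊆ (here eq)          = there (here eq)
      swap-⊆ (there (here eq))  = here eq
      swap-⊆ (there (there x∈)) = there (there x∈)

      exchange′ : ∀ {j k : Fin n} → j ∉ U × k ∉ j ∷ U → k ∉ U × j ∉ k ∷ U
      exchange′ (j∉ , k∉) = k∉ ∘ there , λ { (here refl) → k∉ (here refl) ; (there j∈) → j∉ j∈ }

      exchange : ∀ j k → ⟦ j ∉? U ⟧ * ⟦ k ∉? (j ∷ U) ⟧ ≡ ⟦ k ∉? U ⟧ * ⟦ j ∉? (k ∷ U) ⟧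
      exchange j k = trans (sym (⟦⟧-× (j ∉? U) (k ∉? (j ∷ U)))) (trans
        (⟦⟧-cong (j ∉? U ×-dec k ∉? (j ∷ U)) (k ∉? U ×-dec j ∉? (k ∷ U)) exchange′ exchange′)
        (⟦⟧-× (k ∉? U) (j ∉? (k ∷ U))))

  -- chooseBelow x r t = choose x (r − t), and 0 for t > r.
  chooseBelow : ℚ → ℕ → ℕ → ℚ
  chooseBelow x r       zero    = choose x r
  chooseBelow x zero    (suc t) = 0q
  chooseBelow x (suc r) (suc t) = chooseBelow x r t

  chooseBelow-≤ : ∀ x {r t} → t ℕ.≤ r → chooseBelow x r t ≡ choose x (r ∸ t)
  chooseBelow-≤ x ℕ.z≤n       = refl
  chooseBelow-≤ x (ℕ.s≤s t≤r) = chooseBelow-≤ x t≤r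

  module _ (B : Board n) (x : ℚ) where

    -- Induction on the columns; Pascal's rule accounts for a rook on the board.
    full-choose : ∀ cs {U} r → Unique U → length cs ℕ.+ length U ≡ n →
      full B cs U (λ t → choose (ι t + x) r) ≡
      partial B cs U (λ t → ι ((length cs ∸ t) !) * chooseBelow x r t)
    full-choose-difference : ∀ cs {U} r → Unique U → length cs ℕ.+ length U ≡ n →
      full B cs U (λ t → choose (ι (suc t) + x) r - choose (ι t + x) r) ≡
      partial B cs U (λ t → ι ((length cs ∸ t) !) * chooseBelow x r (suc t))

    -- For r = 0 both binomials are 1, and `chooseBelow x 0 (suc t)` is 0.
    full-choose-difference cs {U} zero uniq eq = trans
      (full-- B cs U (λ _ → 1q) (λ _ → 1q))
      (trans (-‿inverseʳ _) (sym (trans (partial-cong B cs U λ t _ → zeroʳ _) (partial-zero B cs U))))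
    full-choose-difference cs {U} (suc r) uniq eq = trans
      (full-cong B cs U λ t → trans
        (cong (λ y → choose y (suc r) - choose (ι t + x) (suc r)) (trans (cong (_+ x) (ι-suc t)) (+-assoc 1q (ι t) x)))
        (choose-pascal (ι t + x) r))
      (full-choose cs r uniq eq)

    full-choose []       r uniq eq = trans (cong (λ y → choose y r) (+-identityˡ x)) (sym (*-identityˡ _))
    full-choose (i ∷ cs) {U} r uniq eq = begin
      ∑ (allFin n) (λ j → ⟦ j ∉? U ⟧ * (full B cs (j ∷ U) ψ + b j * (full B cs (j ∷ U) (ψ ∘ suc) - full B cs (j ∷ U) ψ)))
        ≡⟨ ∑-cong (allFin n) (λ j → trans
             (⟦⟧*-cong (j ∉? U) λ j∉ → cong₂ (λ y z → y + b j * z)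
               (full-choose cs r (∉⇒Unique-∷ j∉ uniq) eq′)
               (trans (sym (full-- B cs (j ∷ U) (ψ ∘ suc) ψ)) (full-choose-difference cs r (∉⇒Unique-∷ j∉ uniq) eq′)))
             (distribˡ _ _ _)) ⟩
      ∑ (allFin n) (λ j → ⟦ j ∉? U ⟧ * partial B cs (j ∷ U) φ + ⟦ j ∉? U ⟧ * (b j * partial B cs (j ∷ U) φ′))
        ≡⟨ ∑-+ (allFin n) _ _ ⟩
      ∑ (allFin n) (λ j → ⟦ j ∉? U ⟧ * partial B cs (j ∷ U) φ) + ∑ (allFin n) (λ j → ⟦ j ∉? U ⟧ * (b j * partial B cs (j ∷ U) φ′))
        ≡⟨ cong (_+ ∑ (allFin n) (λ j → ⟦ j ∉? U ⟧ * (b j * partial B cs (j ∷ U) φ′)))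
             -- Summing over all rows j outside U supplies the factor n - |U| - t, the number of
             -- rows still empty, which is m - t + 1 and raises the factorial by one step.
             (trans (partial-skip B cs φ uniq) (partial-cong B cs U λ t t≤ → begin
          (ι n - ι (length U) - ι t) * (ι ((m ∸ t) !) * c t)    ≡⟨ *-assoc _ _ _ ⟨
          (ι n - ι (length U) - ι t) * ι ((m ∸ t) !) * c t      ≡⟨ cong (λ y → y * ι ((m ∸ t) !) * c t) (empty t≤) ⟩
          ι (suc (m ∸ t)) * ι ((m ∸ t) !) * c t                 ≡⟨ cong (_* c t) (ι-* (suc (m ∸ t)) ((m ∸ t) !)) ⟨
          ι (suc (m ∸ t) !) * c t                               ≡⟨ cong (λ l → ι (l !) * c t) (ℕ.+-∸-assoc 1 t≤) ⟨
          ι ((suc m ∸ t) !) * c t                               ∎)) ⟩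
      partial B (i ∷ cs) U (λ t → ι ((suc m ∸ t) !) * c t) ∎
      where
      open ≡-Reasoning
      m = length cs

      c ψ φ φ′ : ℕ → ℚ
      c = chooseBelow x r
      ψ t = choose (ι t + x) r
      φ t = ι ((m ∸ t) !) * c t
      φ′ t = ι ((m ∸ t) !) * c (suc t)

      b : Fin n → ℚ
      b j = ⟦ T? (B (i , j)) ⟧

      eq′ : m ℕ.+ suc (length U) ≡ n
      eq′ = trans (ℕ.+-suc m _) eq

      empty : ∀ {t} → t ℕ.≤ m → ι n - ι (length U) - ι t ≡ ι (suc (m ∸ t))
      empty {t} t≤m = begin
        ι n - ι (length U) - ι t                        ≡⟨ cong (λ k → ι k - ι (length U) - ι t) eq ⟨
        ι (suc m ℕ.+ length U) - ι (length U) - ι t     ≡⟨ cong (λ y → y - ι (length U) - ι t) (ι-+ (suc m) (length U)) ⟩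
        ι (suc m) + ι (length U) - ι (length U) - ι t   ≡⟨ solve 3 (λ m u t → m :+ u :- u :- t := m :- t) refl _ _ _ ⟩
        ι (suc m) - ι t                                 ≡⟨ ι-∸ (ℕ.m≤n⇒m≤1+n t≤m) ⟨
        ι (suc m ∸ t)                                   ≡⟨ cong ι (ℕ.+-∸-assoc 1 t≤m) ⟩
        ι (suc (m ∸ t))                                 ∎

  module _ (c : Fin n → ℤ) (0≤c : ∀ i → + 0 ℤ.≤ c i) (c≤n : ∀ i → c i ℤ.≤ + n) where

    private
      B : Board n
      B = ferrers c

      Below : Fin n → Fin n → Set
      Below i j = + toℕ j ℤ.< c i

      below? : ∀ i j → Dec (Below i j)
      below? i j = + toℕ j ℤ.<? c i

      ⟦B⟧ : ∀ i j → ⟦ T? (B (i , j)) ⟧ ≡ ⟦ below? i j ⟧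
      ⟦B⟧ i j = ⟦⟧-T? (below? i j)

    -- The factorized rook polynomial, with the shift by the column index carried in y.
    staircase : ℚ → List (Fin n) → ℚ
    staircase y []       = 1q
    staircase y (i ∷ cs) = (y + ιℤ (c i)) * staircase (y - 1q) cs

    staircase-∏ : ∀ m y (g : Fin m → Fin n) →
      staircase y (tabulate g) ≡ ∏ (allFin m) (λ i → y + (ιℤ (c (g i)) - ι (toℕ i)))
    staircase-∏ zero    y g = refl
    staircase-∏ (suc m) y g = trans (cong₂ _*_
        (solve 2 (λ y c → y :+ c := y :+ (c :- con (+ 0))) refl _ _)
        (trans (staircase-∏ m (y - 1q) (g ∘ Fin.suc)) (∏-cong (allFin m) λ i → trans
          (solve 3 (λ y c i → y :- con (+ 1) :+ (c :- i) := y :+ (c :- (con (+ 1) :+ i))) refl _ _ _)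
          (cong (λ z → y + (ιℤ (c (g (Fin.suc i))) - z)) (sym (ι-suc (toℕ i)))))))
      (sym (∏-allFin-suc m _))

    -- All rows occupied so far meet column i inside the board, so exactly |U| of its c i cells are
    -- lost.
    row-count : ∀ i {U} → Unique U → All (Below i) U →
      ∑ (allFin n) (λ j → ⟦ j ∉? U ⟧ * ⟦ T? (B (i , j)) ⟧) ≡ ιℤ (c i) - ι (length U)
    row-count i {U} uniq below = begin
      ∑ (allFin n) (λ j → ⟦ j ∉? U ⟧ * ⟦ T? (B (i , j)) ⟧)     ≡⟨ ∑-cong (allFin n) (λ j → cong (_*_ _) (⟦B⟧ i j)) ⟩
      ∑ (allFin n) (λ j → ⟦ j ∉? U ⟧ * ⟦ below? i j ⟧)         ≡⟨ count-outside (below? i) uniq below ⟩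
      ∑ (allFin n) (λ j → ⟦ below? i j ⟧) - ι (length U)       ≡⟨ cong (_- ι (length U)) (∑-cong (allFin n) λ j → ⟦⟧-cong (below? i j) (toℕ j ℕ.<? ∣c∣)
                                                                    (ℤ.drop‿+<+ ∘ subst (+ toℕ j ℤ.<_) (sym ∣c∣≡c)) (subst (+ toℕ j ℤ.<_) ∣c∣≡c ∘ ℤ.+<+)) ⟩
      ∑ (allFin n) (λ j → ⟦ toℕ j ℕ.<? ∣c∣ ⟧) - ι (length U)   ≡⟨ cong (_- ι (length U)) (trans (∑-allFin-toℕ n (λ j → ⟦ j ℕ.<? ∣c∣ ⟧))
                                                                    (∑-upTo-< n ∣c∣ (ℤ.drop‿+≤+ (subst (ℤ._≤ + n) (sym ∣c∣≡c) (c≤n i))))) ⟩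
      ι ∣c∣ - ι (length U)                                     ≡⟨ cong (λ k → ιℤ k - ι (length U)) ∣c∣≡c ⟩
      ιℤ (c i) - ι (length U)                                  ∎
      where
      open ≡-Reasoning
      ∣c∣ = ℤ.∣ c i ∣
      ∣c∣≡c : + ∣c∣ ≡ c i
      ∣c∣≡c = ℤ.0≤i⇒+∣i∣≡i (0≤c i)

    -- A rook in a column takes a row away from each later column.
    partial-falling : ∀ cs {U} x → AllPairs (λ i i′ → c i ℤ.≤ c i′) cs → Unique U → All (λ i → All (Below i) U) cs →
      partial B cs U (λ t → falling x (length cs ∸ t)) ≡ staircase (x - ι (length U)) cs
    partial-falling []       x _ _ _ = refl
    partial-falling (i ∷ cs) {U} x (i≤ ∷ sorted) uniq (bi ∷ below) = begin
      partial B cs U (λ t → falling x (suc m ∸ t)) + ∑ (allFin n) (λ j → ⟦ j ∉? U ⟧ * (b j * partial B cs (j ∷ U) (λ t → falling x (m ∸ t))))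
        ≡⟨ cong₂ _+_
             (trans (partial-cong B cs U λ t t≤ → cong (falling x) (ℕ.+-∸-assoc 1 t≤))
               (trans (partial-*ˡ B cs U x _) (cong (_*_ x) (partial-falling cs (x - 1q) sorted uniq below))))
             (∑-cong (allFin n) λ j → trans (⟦⟧*-cong (j ∉? U) (step j)) (sym (*-assoc _ _ _))) ⟩
      x * staircase (x - 1q - u) cs + ∑ (allFin n) (λ j → ⟦ j ∉? U ⟧ * b j * staircase (x - u - 1q) cs)
        ≡⟨ cong₂ (λ y z → x * staircase y cs + z)
             (solve 2 (λ x u → x :- con (+ 1) :- u := x :- u :- con (+ 1)) refl x u)
             (trans (∑-*ʳ _ (allFin n) _) (cong (_* staircase (x - u - 1q) cs) (row-count i uniq bi))) ⟩
      x * staircase (x - u - 1q) cs + (ιℤ (c i) - u) * staircase (x - u - 1q) cs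
        ≡⟨ solve 4 (λ x c u s → x :* s :+ (c :- u) :* s := (x :- u :+ c) :* s) refl x _ u _ ⟩
      (x - u + ιℤ (c i)) * staircase (x - u - 1q) cs ∎
      where
      open ≡-Reasoning
      m = length cs
      u = ι (length U)

      b : Fin n → ℚ
      b j = ⟦ T? (B (i , j)) ⟧

      step : ∀ j → j ∉ U → b j * partial B cs (j ∷ U) (λ t → falling x (m ∸ t)) ≡ b j * staircase (x - u - 1q) cs
      step j j∉ = trans (cong (_* partial B cs (j ∷ U) _) (⟦B⟧ i j)) (trans
        -- A rook on the board lies below c i, hence below every later c, which preserves the
        -- invariant that occupied rows meet the later columns inside the board.
        (⟦⟧*-cong (below? i j) λ j< → begin
          partial B cs (j ∷ U) (λ t → falling x (m ∸ t))
            ≡⟨ partial-falling cs x sorted (∉⇒Unique-∷ j∉ uniq)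
                 (All.zipWith (λ (le , b) → ℤ.<-≤-trans j< le ∷ b) (i≤ , below)) ⟩
          staircase (x - ι (suc (length U))) cs
            ≡⟨ cong (λ y → staircase y cs) (trans (cong (_-_ x) (ι-suc (length U)))
                 (solve 2 (λ x u → x :- (con (+ 1) :+ u) := x :- u :- con (+ 1)) refl x u)) ⟩
          staircase (x - u - 1q) cs ∎)
        (cong (_* staircase (x - u - 1q) cs) (sym (⟦B⟧ i j))))

  module _ (B : Board n) where
    open ≡-Reasoning

    private
      S : List (List (Cell n))
      S = subsets (grid (allFin n))

      len : length (allFin n) ≡ n
      len = List.length-tabulate id

      ⟦placement⟧ : ∀ k (s : List (Cell n)) → ⟦ length s ℕ.≟ k ×-dec nonAttacking? s ⟧ ≡ ⟦ length s ℕ.≟ k ⟧ * ⟦ free? [] s ⟧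
      ⟦placement⟧ k s = trans (⟦⟧-× (length s ℕ.≟ k) (nonAttacking? s)) (cong (_*_ _)
        (⟦⟧-cong (nonAttacking? s) (free? [] s) (λ na → na , All.tabulate λ _ ()) proj₁))

    -- A placement of t rooks is counted for the single index k = n - t; exchanging the sums turns
    -- the weight of the index into a weight of the placement.
    rook-sum : ∀ (w : ℕ → ℚ) →
      ∑ (upTo (suc n)) (λ k → ι (rook (n ∸ k) B) * w k) ≡ partial B (allFin n) [] (λ t → w (n ∸ t))
    rook-sum w = begin
      ∑ (upTo (suc n)) (λ k → ι (rook (n ∸ k) B) * w k)
        ≡⟨ ∑-cong (upTo (suc n)) (λ k → begin
          ι (rook (n ∸ k) B) * w k
            ≡⟨ cong (_* w k) (trans (ι-count (onBoard? B) (placements n (n ∸ k)))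
                 (trans (∑-filter (λ s → length s ℕ.≟ (n ∸ k) ×-dec nonAttacking? s) S _)
                        (∑-cong S λ s → cong (_* ⟦ onBoard? B s ⟧) (⟦placement⟧ (n ∸ k) s)))) ⟩
          ∑ S (λ s → ⟦ length s ℕ.≟ n ∸ k ⟧ * ⟦ free? [] s ⟧ * ⟦ onBoard? B s ⟧) * w k
            ≡⟨ ∑-*ʳ (w k) S _ ⟨
          ∑ S (λ s → ⟦ length s ℕ.≟ n ∸ k ⟧ * ⟦ free? [] s ⟧ * ⟦ onBoard? B s ⟧ * w k)
            ≡⟨ ∑-cong S (λ s → solve 4 (λ l f o w → l :* f :* o :* w := f :* (o :* (l :* w))) refl _ _ _ (w k)) ⟩
          ∑ S (λ s → ⟦ free? [] s ⟧ * (⟦ onBoard? B s ⟧ * (⟦ length s ℕ.≟ n ∸ k ⟧ * w k))) ∎) ⟩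
      ∑ (upTo (suc n)) (λ k → ∑ S (λ s → ⟦ free? [] s ⟧ * (⟦ onBoard? B s ⟧ * (⟦ length s ℕ.≟ n ∸ k ⟧ * w k))))
        ≡⟨ ∑-swap (upTo (suc n)) S _ ⟩
      ∑ S (λ s → ∑ (upTo (suc n)) (λ k → ⟦ free? [] s ⟧ * (⟦ onBoard? B s ⟧ * (⟦ length s ℕ.≟ n ∸ k ⟧ * w k))))
        ≡⟨ ∑-cong S (λ s → trans (∑-*ˡ _ (upTo (suc n)) _) (cong (_*_ _) (∑-*ˡ _ (upTo (suc n)) _))) ⟩
      ∑ S (λ s → ⟦ free? [] s ⟧ * (⟦ onBoard? B s ⟧ * φ (length s)))
        ≡⟨ columnSum-correct (Unique.allFin⁺ n) [] _ ⟩
      columnSum (allFin n) [] (λ s → ⟦ onBoard? B s ⟧ * φ (length s))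
        ≡⟨ columnSum-partial B (allFin n) [] φ ⟩
      partial B (allFin n) [] φ
        ≡⟨ partial-cong B (allFin n) [] (λ t t≤ → pick (subst (t ℕ.≤_) len t≤)) ⟩
      partial B (allFin n) [] (λ t → w (n ∸ t)) ∎
      where
      φ : ℕ → ℚ
      φ t = ∑ (upTo (suc n)) (λ k → ⟦ t ℕ.≟ n ∸ k ⟧ * w k)

      pick : ∀ {t} → t ℕ.≤ n → φ t ≡ w (n ∸ t)
      pick {t} t≤n = trans
        (∑-cong∈ (upTo (suc n)) λ {k} k∈ → cong (_* w k) (⟦⟧-cong (t ℕ.≟ n ∸ k) (k ℕ.≟ n ∸ t)
          (λ { refl → sym (ℕ.m∸[m∸n]≡n (ℕ.s≤s⁻¹ (∈.∈-upTo⁻ k∈))) })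
          (λ { refl → sym (ℕ.m∸[m∸n]≡n t≤n) })))
        (∑-δ ℕ._≟_ w (Unique.upTo⁺ (suc n)) (∈.∈-upTo⁺ (ℕ.s≤s (ℕ.m∸n≤m n t))))

    hit-sum : ∀ (w : ℕ → ℚ) →
      ∑ (upTo (suc n)) (λ k → ι (hit k B) * w k) ≡ full B (allFin n) [] w
    hit-sum w = begin
      ∑ (upTo (suc n)) (λ k → ι (hit k B) * w k)
        ≡⟨ ∑-cong (upTo (suc n)) (λ k → begin
          ι (hit k B) * w k
            ≡⟨ cong (_* w k) (trans (ι-count (λ s → hits B s ℕ.≟ k) (placements n n))
                 (trans (∑-filter (λ s → length s ℕ.≟ n ×-dec nonAttacking? s) S _)
                        (∑-cong S λ s → cong (_* ⟦ hits B s ℕ.≟ k ⟧) (⟦placement⟧ n s)))) ⟩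
          ∑ S (λ s → ⟦ length s ℕ.≟ n ⟧ * ⟦ free? [] s ⟧ * ⟦ hits B s ℕ.≟ k ⟧) * w k
            ≡⟨ ∑-*ʳ (w k) S _ ⟨
          ∑ S (λ s → ⟦ length s ℕ.≟ n ⟧ * ⟦ free? [] s ⟧ * ⟦ hits B s ℕ.≟ k ⟧ * w k)
            ≡⟨ ∑-cong S (λ s → trans (solve 4 (λ l f h w → l :* f :* h :* w := f :* (l :* (h :* w))) refl _ _ _ (w k))
                 (cong (λ z → ⟦ free? [] s ⟧ * (⟦ length s ℕ.≟ n ⟧ * (z * w k))) (⟦⟧-cong (hits B s ℕ.≟ k) (k ℕ.≟ hits B s) sym sym))) ⟩
          ∑ S (λ s → ⟦ free? [] s ⟧ * (⟦ length s ℕ.≟ n ⟧ * (⟦ k ℕ.≟ hits B s ⟧ * w k))) ∎) ⟩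
      ∑ (upTo (suc n)) (λ k → ∑ S (λ s → ⟦ free? [] s ⟧ * (⟦ length s ℕ.≟ n ⟧ * (⟦ k ℕ.≟ hits B s ⟧ * w k))))
        ≡⟨ ∑-swap (upTo (suc n)) S _ ⟩
      ∑ S (λ s → ∑ (upTo (suc n)) (λ k → ⟦ free? [] s ⟧ * (⟦ length s ℕ.≟ n ⟧ * (⟦ k ℕ.≟ hits B s ⟧ * w k))))
        ≡⟨ ∑-cong S (λ s → trans (∑-*ˡ _ (upTo (suc n)) _) (cong (_*_ _) (trans (∑-*ˡ _ (upTo (suc n)) _)
             -- A placement of n rooks has at most n hits, so its number of hits is one of the
             -- indices.
             (⟦⟧*-cong (length s ℕ.≟ n) λ l → ∑-δ ℕ._≟_ w (Unique.upTo⁺ (suc n))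
               (∈.∈-upTo⁺ (ℕ.s≤s (subst (hits B s ℕ.≤_) l (List.length-filter (λ c → T? (B c)) s)))))))) ⟩
      ∑ S (λ s → ⟦ free? [] s ⟧ * (⟦ length s ℕ.≟ n ⟧ * w (hits B s)))
        ≡⟨ columnSum-correct (Unique.allFin⁺ n) [] _ ⟩
      columnSum (allFin n) [] (λ s → ⟦ length s ℕ.≟ n ⟧ * w (hits B s))
        ≡⟨ cong (λ m → columnSum (allFin n) [] (λ s → ⟦ length s ℕ.≟ m ⟧ * w (hits B s))) len ⟨
      columnSum (allFin n) [] (λ s → ⟦ length s ℕ.≟ length (allFin n) ⟧ * w (hits B s))
        ≡⟨ columnSum-full B (allFin n) [] w ⟩
      full B (allFin n) [] w ∎

    -- `full-choose` with r = n weights a placement of t rooks on the board by (n - t)! times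
    -- `choose x (n ∸ t)`, which is the term k = n - t on the right. This is the relation between
    -- hit and rook numbers for an arbitrary board.
    hit≡rook : ∀ x → ∑ (upTo (suc n)) (λ k → ι (hit k B) * choose (x + ι k) n) ≡
                     ∑ (upTo (suc n)) (λ k → ι (rook (n ∸ k) B) * (choose x k * ι (k !)))
    hit≡rook x = begin
      ∑ (upTo (suc n)) (λ k → ι (hit k B) * choose (x + ι k) n)
        ≡⟨ hit-sum _ ⟩
      full B (allFin n) [] (λ t → choose (x + ι t) n)
        ≡⟨ full-cong B (allFin n) [] (λ t → cong (λ y → choose y n) (+-comm x (ι t))) ⟩
      full B (allFin n) [] (λ t → choose (ι t + x) n)
        ≡⟨ full-choose B x (allFin n) n [] (trans (ℕ.+-identityʳ _) len) ⟩
      partial B (allFin n) [] (λ t → ι ((length (allFin n) ∸ t) !) * chooseBelow x n t)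
        ≡⟨ partial-cong B (allFin n) [] (λ t t≤ → trans
             (cong₂ (λ m c → ι ((m ∸ t) !) * c) len (chooseBelow-≤ x (subst (t ℕ.≤_) len t≤)))
             (*-comm _ _)) ⟩
      partial B (allFin n) [] (λ t → choose x (n ∸ t) * ι ((n ∸ t) !))
        ≡⟨ rook-sum (λ k → choose x k * ι (k !)) ⟨
      ∑ (upTo (suc n)) (λ k → ι (rook (n ∸ k) B) * (choose x k * ι (k !))) ∎

  -- The Goldman-Joichi-White factorization: the binomials times k! are falling factorials, and
  -- `partial-falling` is applied with no row occupied.
  rook-factorization : ∀ (c : Fin n → ℤ) → (∀ i → + 0 ℤ.≤ c i) → (∀ i j → i Fin.≤ j → c i ℤ.≤ c j) → (∀ i → c i ℤ.≤ + n) → ∀ x →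
    ∑ (upTo (suc n)) (λ k → ι (rook (n ∸ k) (ferrers c)) * (choose x k * ι (k !))) ≡
    ∏ (allFin n) (λ i → x + (ιℤ (c i) - ι (toℕ i)))
  rook-factorization {n} c 0≤c mono c≤n x = begin
    ∑ (upTo (suc n)) (λ k → ι (rook (n ∸ k) B) * (choose x k * ι (k !)))   ≡⟨ rook-sum B _ ⟩
    partial B (allFin n) [] (λ t → choose x (n ∸ t) * ι ((n ∸ t) !))       ≡⟨ partial-cong B (allFin n) [] (λ t _ → choose-! x (n ∸ t)) ⟩
    partial B (allFin n) [] (λ t → falling x (n ∸ t))                      ≡⟨ cong (λ m → partial B (allFin n) [] (λ t → falling x (m ∸ t))) (List.length-tabulate {n = n} id) ⟨
    partial B (allFin n) [] (λ t → falling x (length (allFin n) ∸ t))      ≡⟨ partial-falling c 0≤c c≤n (allFin n) x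
                                                                                (AllPairs.tabulate⁺-< λ i<j → mono _ _ (ℕ.<⇒≤ i<j))
                                                                                [] (All.tabulate λ _ → []) ⟩
    staircase c 0≤c c≤n (x - 0q) (allFin n)                                    ≡⟨ cong (λ y → staircase c 0≤c c≤n y (allFin n)) (solve 1 (λ x → x :- con (+ 0) := x) refl x) ⟩
    staircase c 0≤c c≤n x (allFin n)                                           ≡⟨ staircase-∏ c 0≤c c≤n n x id ⟩
    ∏ (allFin n) (λ i → x + (ιℤ (c i) - ι (toℕ i)))                         ∎
    where
    open ≡-Reasoning
    B : Board n
    B = ferrers c

-- Horizontal strips and the recursive tableau count

module Strips where
  open Rationals
  open Sums
  open Rook

  private variable
    l m : ℕ
    ls ρ : List ℕ

  firstPart : List ℕ → ℕ
  firstPart []      = 0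
  firstPart (l ∷ _) = l

  Decreasing : List ℕ → Set
  Decreasing = Linked ℕ._≥_

  decreasing? : Decidable Decreasing
  decreasing? = Linked.linked? ℕ._≥?_

  uncons : Decreasing (l ∷ ls) → firstPart ls ℕ.≤ l × Decreasing ls
  uncons [-]       = ℕ.z≤n , []
  uncons (l≥ ∷ ls) = l≥ , ls

  cons : firstPart ls ℕ.≤ l → Decreasing ls → Decreasing (l ∷ ls)
  cons {[]}    _  _  = [-]
  cons {_ ∷ _} l≥ ls = l≥ ∷ ls

  -- λ / ρ is a horizontal strip; ρ keeps the rows that have become empty.
  data Strip : List ℕ → List ℕ → Set where
    []  : Strip [] []
    _∷_ : firstPart ls ℕ.≤ m × m ℕ.≤ l → Strip ls ρ → Strip (l ∷ ls) (m ∷ ρ)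

  firstPart-mono : Strip ls ρ → firstPart ρ ℕ.≤ firstPart ls
  firstPart-mono []              = ℕ.z≤n
  firstPart-mono ((_ , m≤l) ∷ _) = m≤l

  Strip⇒decreasingˡ : Strip ls ρ → Decreasing ls
  Strip⇒decreasingˡ []             = []
  Strip⇒decreasingˡ ((p≤ , ≤l) ∷ s) = cons (ℕ.≤-trans p≤ ≤l) (Strip⇒decreasingˡ s)

  Strip⇒decreasingʳ : Strip ls ρ → Decreasing ρ
  Strip⇒decreasingʳ []            = []
  Strip⇒decreasingʳ ((p≤ , _) ∷ s) = cons (ℕ.≤-trans (firstPart-mono s) p≤) (Strip⇒decreasingʳ s)

  Strip⇒sum≤ : Strip ls ρ → ℕ.sum ρ ℕ.≤ ℕ.sum ls
  Strip⇒sum≤ []             = ℕ.z≤n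
  Strip⇒sum≤ ((_ , ≤l) ∷ s) = ℕ.+-mono-≤ ≤l (Strip⇒sum≤ s)

  -- The sum of g over all ρ with `Strip ls ρ`. The rows of ρ vary independently, each between the
  -- next row of `ls` and its own, and the range is empty if `ls` does not decrease.
  ∑strip : List ℕ → (List ℕ → ℚ) → ℚ
  ∑strip []       g = g []
  ∑strip (l ∷ ls) g = ∑ (upTo (suc l)) λ m → ⟦ firstPart ls ℕ.≤? m ⟧ * ∑strip ls (λ ρ → g (m ∷ ρ))

  ∑strip-cong : ∀ ls {g h : List ℕ → ℚ} → (∀ {ρ} → Strip ls ρ → g ρ ≡ h ρ) → ∑strip ls g ≡ ∑strip ls h
  ∑strip-cong []       eq = eq []
  ∑strip-cong (l ∷ ls) eq = ∑-cong∈ (upTo (suc l)) λ m∈ → ⟦⟧*-cong (firstPart ls ℕ.≤? _) λ p≤ →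
    ∑strip-cong ls λ s → eq ((p≤ , ℕ.s≤s⁻¹ (∈.∈-upTo⁻ m∈)) ∷ s)

  ∑strip-+ : ∀ ls (g h : List ℕ → ℚ) → ∑strip ls (λ ρ → g ρ + h ρ) ≡ ∑strip ls g + ∑strip ls h
  ∑strip-+ []       g h = refl
  ∑strip-+ (l ∷ ls) g h = trans
    (∑-cong (upTo (suc l)) λ m → trans (cong (_*_ _) (∑strip-+ ls _ _)) (distribˡ _ _ _))
    (∑-+ (upTo (suc l)) _ _)

  ∑strip-*ˡ : ∀ c ls (g : List ℕ → ℚ) → ∑strip ls (λ ρ → c * g ρ) ≡ c * ∑strip ls g
  ∑strip-*ˡ c []       g = refl
  ∑strip-*ˡ c (l ∷ ls) g = trans
    (∑-cong (upTo (suc l)) λ m → trans (cong (_*_ _) (∑strip-*ˡ c ls _))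
      (solve 3 (λ p c s → p :* (c :* s) := c :* (p :* s)) refl _ c _))
    (∑-*ˡ c (upTo (suc l)) _)

  ∑strip-zero : ∀ ls → ∑strip ls (λ _ → 0q) ≡ 0q
  ∑strip-zero ls = trans (∑strip-cong ls λ _ → sym (zeroˡ 0q)) (trans (∑strip-*ˡ 0q ls (λ _ → 0q)) (zeroˡ _))

  ∑strip-∑ : ∀ {A : Set} ls (xs : List A) (g : A → List ℕ → ℚ) →
    ∑strip ls (λ ρ → ∑ xs (λ x → g x ρ)) ≡ ∑ xs (λ x → ∑strip ls (g x))
  ∑strip-∑ ls []       g = ∑strip-zero ls
  ∑strip-∑ ls (x ∷ xs) g = trans (∑strip-+ ls _ _) (cong (_+_ _) (∑strip-∑ ls xs g))

  ∑strip-nonDecreasing : ∀ ls {g : List ℕ → ℚ} → ¬ Decreasing ls → ∑strip ls g ≡ 0q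
  ∑strip-nonDecreasing ls ¬dec = trans
    (∑strip-cong ls λ s → contradiction (Strip⇒decreasingˡ s) ¬dec) (∑strip-zero ls)

  ∑strip-∷ʳ0 : ∀ ls (g : List ℕ → ℚ) → ∑strip (ls ∷ʳ 0) g ≡ ∑strip ls (g ∘ (_∷ʳ 0))
  ∑strip-∷ʳ0 []       g = trans (+-identityʳ _) (*-identityˡ _)
  ∑strip-∷ʳ0 (l ∷ ls) g = ∑-cong (upTo (suc l)) λ m → cong₂ _*_
    (cong (λ p → ⟦ p ℕ.≤? m ⟧) (firstPart-∷ʳ0 ls)) (∑strip-∷ʳ0 ls (g ∘ (m ∷_)))
    where
    firstPart-∷ʳ0 : ∀ ls → firstPart (ls ∷ʳ 0) ≡ firstPart ls
    firstPart-∷ʳ0 []      = refl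
    firstPart-∷ʳ0 (_ ∷ _) = refl

  -- The number of semistandard tableaux of shape ls whose weight is the
  -- reversal of bs.
  tableaux : List ℕ → List ℕ → ℚ
  tableaux ls []       = ⟦ ℕ.sum ls ℕ.≟ 0 ⟧
  tableaux ls (b ∷ bs) = ∑strip ls λ ρ → ⟦ ℕ.sum ls ℕ.≟ ℕ.sum ρ ℕ.+ b ⟧ * tableaux ρ bs

  sum≡0⇒decreasing : ∀ ls → ℕ.sum ls ≡ 0 → Decreasing ls
  sum≡0⇒decreasing []             eq = []
  sum≡0⇒decreasing (_ ∷ [])       eq = [-]
  sum≡0⇒decreasing (zero ∷ zero ∷ ls) eq = ℕ.z≤n ∷ sum≡0⇒decreasing (zero ∷ ls) eq

  -- Allows sums over shapes to run over all ways of changing a row, legal or not.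
  tableaux-nonDecreasing : ∀ ls bs → ¬ Decreasing ls → tableaux ls bs ≡ 0q
  tableaux-nonDecreasing ls []       ¬dec = ⟦⟧-false (ℕ.sum ls ℕ.≟ 0) (¬dec ∘ sum≡0⇒decreasing ls)
  tableaux-nonDecreasing ls (b ∷ bs) ¬dec = ∑strip-nonDecreasing ls ¬dec

  sum-∷ʳ0 : ∀ ls → ℕ.sum (ls ∷ʳ 0) ≡ ℕ.sum ls
  sum-∷ʳ0 []       = refl
  sum-∷ʳ0 (l ∷ ls) = cong (l ℕ.+_) (sum-∷ʳ0 ls)

  tableaux-∷ʳ0 : ∀ ls bs → tableaux (ls ∷ʳ 0) bs ≡ tableaux ls bs
  tableaux-∷ʳ0 ls []       = cong (λ k → ⟦ k ℕ.≟ 0 ⟧) (sum-∷ʳ0 ls)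
  tableaux-∷ʳ0 ls (b ∷ bs) = trans (∑strip-∷ʳ0 ls _) (∑strip-cong ls λ {ρ} _ → cong₂ _*_
    (cong₂ (λ i j → ⟦ i ℕ.≟ j ℕ.+ b ⟧) (sum-∷ʳ0 ls) (sum-∷ʳ0 ρ)) (tableaux-∷ʳ0 ρ bs))

  ++-replicate0 : ∀ (P : List ℕ → ℚ) → (∀ ls → P (ls ∷ʳ 0) ≡ P ls) → ∀ k ls → P (ls ++ replicate k 0) ≡ P ls
  ++-replicate0 P eq zero    ls = cong P (List.++-identityʳ ls)
  ++-replicate0 P eq (suc k) ls = trans
    (cong P (sym (List.++-assoc ls (0 ∷ []) (replicate k 0))))
    (trans (++-replicate0 P eq k (ls ∷ʳ 0)) (eq ls))

-- Kostka numbers from the enumeration of fillings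

module Tableaux where
  open Rationals
  open Sums
  open Rook
  open Strips

  private variable
    r : List ℕ

  increasing? : Decidable (Linked ℕ._≤_)
  increasing? = Linked.linked? ℕ._≤?_

  ∈-rowFillings : ∀ k l {r} → r ∈ rowFillings k l → length r ≡ l × All (ℕ._< k) r
  ∈-rowFillings k zero    (here refl) = refl , []
  ∈-rowFillings k (suc l) r∈ with ∈.∈-cartesianProductWith⁻ _∷_ (upTo k) (rowFillings k l) r∈
  ... | _ , _ , x∈ , r∈′ , refl with ∈-rowFillings k l r∈′
  ...   | len , <k = cong suc len , ∈.∈-upTo⁻ x∈ ∷ <k

  increasing-tail : ∀ {x} → Linked ℕ._≤_ (x ∷ r) → Linked ℕ._≤_ r
  increasing-tail [-]      = []
  increasing-tail (_ ∷ is) = is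

  increasing-++⁻ : ∀ r s → Linked ℕ._≤_ (r ++ s) → Linked ℕ._≤_ r
  increasing-++⁻ []          s _        = []
  increasing-++⁻ (x ∷ [])    s _        = [-]
  increasing-++⁻ (x ∷ y ∷ r) s (≤ ∷ is) = ≤ ∷ increasing-++⁻ (y ∷ r) s is

  increasing-replicate : ∀ j k → Linked ℕ._≤_ (replicate j k)
  increasing-replicate zero          k = []
  increasing-replicate (suc zero)    k = [-]
  increasing-replicate (suc (suc j)) k = ℕ.≤-refl ∷ increasing-replicate (suc j) k

  increasing-++-replicate : ∀ j k → All (ℕ._< k) r → Linked ℕ._≤_ r → Linked ℕ._≤_ (r ++ replicate j k)
  increasing-++-replicate j       k []             []       = increasing-replicate j k
  increasing-++-replicate zero    k (x<k ∷ [])     [-]      = [-]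
  increasing-++-replicate (suc j) k (x<k ∷ [])     [-]      = ℕ.<⇒≤ x<k ∷ increasing-replicate (suc j) k
  increasing-++-replicate j       k (x<k ∷ r<k)    (≤ ∷ is) = ≤ ∷ increasing-++-replicate j k r<k is

  ∑-rowFillings-∷ : ∀ k l (g : List ℕ → ℚ) →
    ∑ (rowFillings k (suc l)) g ≡ ∑ (upTo k) (λ x → ∑ (rowFillings k l) (λ r → g (x ∷ r)))
  ∑-rowFillings-∷ k l g = ∑-cartesianProductWith _∷_ (upTo k) (rowFillings k l) g

  -- The entries are at most k and nothing smaller may follow k, so only the constant row survives.
  ∑-rowFillings-top : ∀ k l (g : List ℕ → ℚ) →
    ∑ (rowFillings (suc k) l) (λ r → ⟦ increasing? (k ∷ r) ⟧ * g r) ≡ g (replicate l k)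
  ∑-rowFillings-top k zero    g = trans (+-identityʳ _) (⟦⟧*-true (increasing? (k ∷ [])) [-])
  ∑-rowFillings-top k (suc l) g = begin
    ∑ (rowFillings (suc k) (suc l)) (λ r → ⟦ increasing? (k ∷ r) ⟧ * g r)
      ≡⟨ ∑-rowFillings-∷ (suc k) l _ ⟩
    ∑ (upTo (suc k)) (λ x → ∑ (rowFillings (suc k) l) (λ r → ⟦ increasing? (k ∷ x ∷ r) ⟧ * g (x ∷ r)))
      ≡⟨ ∑-upTo-last k _ ⟩
    ∑ (upTo k) (λ x → ∑ (rowFillings (suc k) l) (λ r → ⟦ increasing? (k ∷ x ∷ r) ⟧ * g (x ∷ r))) +
      ∑ (rowFillings (suc k) l) (λ r → ⟦ increasing? (k ∷ k ∷ r) ⟧ * g (k ∷ r))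
      ≡⟨ cong₂ _+_
           (trans (∑-cong∈ (upTo k) λ {x} x∈ → trans
             (∑-cong (rowFillings (suc k) l) λ r → ⟦⟧*-false (increasing? (k ∷ x ∷ r)) λ where
               (k≤x ∷ _) → ℕ.<⇒≱ (∈.∈-upTo⁻ x∈) k≤x)
             (∑-zero (rowFillings (suc k) l))) (∑-zero (upTo k)))
           (trans (∑-cong (rowFillings (suc k) l) λ r → cong (_* g (k ∷ r))
             (⟦⟧-cong (increasing? (k ∷ k ∷ r)) (increasing? (k ∷ r)) increasing-tail (ℕ.≤-refl ∷_)))
             (∑-rowFillings-top k l (g ∘ (k ∷_)))) ⟩
    0q + g (replicate (suc l) k)
      ≡⟨ +-identityˡ _ ⟩
    g (replicate (suc l) k) ∎
    where open ≡-Reasoning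

  -- In a weakly increasing row the copies of the largest letter k form the end; m is the number of
  -- smaller entries.
  ∑-rowFillings-split : ∀ k l (g : List ℕ → ℚ) →
    ∑ (rowFillings (suc k) l) (λ r → ⟦ increasing? r ⟧ * g r) ≡
    ∑ (upTo (suc l)) (λ m → ∑ (rowFillings k m) (λ r → ⟦ increasing? r ⟧ * g (r ++ replicate (l ∸ m) k)))
  ∑-rowFillings-split k zero    g = sym (+-identityʳ _)
  ∑-rowFillings-split k (suc l) g = begin
    ∑ (rowFillings (suc k) (suc l)) (λ r → ⟦ increasing? r ⟧ * g r)
      ≡⟨ ∑-rowFillings-∷ (suc k) l _ ⟩
    ∑ (upTo (suc k)) (λ x → ∑ (rowFillings (suc k) l) (λ r → ⟦ increasing? (x ∷ r) ⟧ * g (x ∷ r)))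
      ≡⟨ ∑-upTo-last k _ ⟩
    ∑ (upTo k) (λ x → ∑ (rowFillings (suc k) l) (λ r → ⟦ increasing? (x ∷ r) ⟧ * g (x ∷ r))) +
      ∑ (rowFillings (suc k) l) (λ r → ⟦ increasing? (k ∷ r) ⟧ * g (k ∷ r))
      ≡⟨ cong₂ _+_ (∑-cong∈ (upTo k) below) (∑-rowFillings-top k l (g ∘ (k ∷_))) ⟩
    ∑ (upTo k) (λ x → ∑ (upTo (suc l)) (λ m → ∑ (rowFillings k m) (λ r → ⟦ increasing? (x ∷ r) ⟧ * g (x ∷ r ++ replicate (l ∸ m) k)))) +
      g (replicate (suc l) k)
      ≡⟨ +-comm _ _ ⟩
    g (replicate (suc l) k) +
      ∑ (upTo k) (λ x → ∑ (upTo (suc l)) (λ m → ∑ (rowFillings k m) (λ r → ⟦ increasing? (x ∷ r) ⟧ * g (x ∷ r ++ replicate (l ∸ m) k))))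
      ≡⟨ cong₂ _+_ (sym (trans (+-identityʳ _) (⟦⟧*-true (increasing? []) []))) (trans
           (∑-swap (upTo k) (upTo (suc l)) _)
           (∑-cong (upTo (suc l)) λ m → sym (∑-rowFillings-∷ k m _))) ⟩
    ∑ (rowFillings k 0) (λ r → ⟦ increasing? r ⟧ * g (r ++ replicate (suc l) k)) +
      ∑ (upTo (suc l)) (λ m → ∑ (rowFillings k (suc m)) (λ r → ⟦ increasing? r ⟧ * g (r ++ replicate (l ∸ m) k)))
      ≡⟨ ∑-upTo-first (suc l) _ ⟨
    ∑ (upTo (suc (suc l))) (λ m → ∑ (rowFillings k m) (λ r → ⟦ increasing? r ⟧ * g (r ++ replicate (suc l ∸ m) k))) ∎
    where
    open ≡-Reasoning

    below : ∀ {x} → x ∈ upTo k →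
      ∑ (rowFillings (suc k) l) (λ r → ⟦ increasing? (x ∷ r) ⟧ * g (x ∷ r)) ≡
      ∑ (upTo (suc l)) (λ m → ∑ (rowFillings k m) (λ r → ⟦ increasing? (x ∷ r) ⟧ * g (x ∷ r ++ replicate (l ∸ m) k)))
    below {x} x∈ = begin
      ∑ (rowFillings (suc k) l) (λ r → ⟦ increasing? (x ∷ r) ⟧ * g (x ∷ r))
        -- The induction hypothesis needs the factor for r alone, which is therefore split off from
        -- that for `x ∷ r`.
        ≡⟨ ∑-cong (rowFillings (suc k) l) (λ r → trans (cong (_* g (x ∷ r)) (trans
             (⟦⟧-cong (increasing? (x ∷ r)) (increasing? r ×-dec increasing? (x ∷ r)) (λ i → increasing-tail i , i) proj₂)
             (⟦⟧-× (increasing? r) (increasing? (x ∷ r))))) (*-assoc _ _ _)) ⟩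
      ∑ (rowFillings (suc k) l) (λ r → ⟦ increasing? r ⟧ * (⟦ increasing? (x ∷ r) ⟧ * g (x ∷ r)))
        ≡⟨ ∑-rowFillings-split k l (λ r → ⟦ increasing? (x ∷ r) ⟧ * g (x ∷ r)) ⟩
      ∑ (upTo (suc l)) (λ m → ∑ (rowFillings k m) (λ r → ⟦ increasing? r ⟧ *
        (⟦ increasing? (x ∷ r ++ replicate (l ∸ m) k) ⟧ * g (x ∷ r ++ replicate (l ∸ m) k))))
        ≡⟨ ∑-cong (upTo (suc l)) (λ m → ∑-cong∈ (rowFillings k m) λ {r} r∈ → trans (sym (*-assoc _ _ _))
             (cong (_* g (x ∷ r ++ replicate (l ∸ m) k)) (trans
               (sym (⟦⟧-× (increasing? r) (increasing? (x ∷ r ++ replicate (l ∸ m) k))))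
               (⟦⟧-cong (increasing? r ×-dec increasing? (x ∷ r ++ replicate (l ∸ m) k)) (increasing? (x ∷ r))
                 (λ (_ , i) → increasing-++⁻ (x ∷ r) _ i)
                 (λ i → increasing-tail i , increasing-++-replicate (l ∸ m) k (∈.∈-upTo⁻ x∈ ∷ proj₂ (∈-rowFillings k m r∈)) i))))) ⟩
      ∑ (upTo (suc l)) (λ m → ∑ (rowFillings k m) (λ r → ⟦ increasing? (x ∷ r) ⟧ * g (x ∷ r ++ replicate (l ∸ m) k))) ∎

  Stacked : List ℕ → List ℕ → Set
  Stacked lower upper = All (uncurry ℕ._<_) (zip lower upper)

  stacked? : ∀ r s → Dec (Stacked r s)
  stacked? r s = All.all? (uncurry ℕ._<?_) (zip r s)

  zip-[] : ∀ (r : List ℕ) → Stacked r []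
  zip-[] []      = []
  zip-[] (_ ∷ _) = []

  -- Nothing that is at most k can stand above a k, so the whole upper row lies over entries of r.
  -- The first hypothesis prevents `zip` from hiding upper cells without support.
  stacked-replicate⁻ : ∀ r s i j k → length s ℕ.+ i ℕ.≤ length r ℕ.+ j → All (ℕ._< k) s →
    Stacked (r ++ replicate j k) (s ++ replicate i k) → length s ℕ.+ i ℕ.≤ length r × Stacked r s
  stacked-replicate⁻ []      []      zero    j       k _  _  _ = ℕ.z≤n , []
  stacked-replicate⁻ []      []      (suc i) (suc j) k _  _  (k<k ∷ _) = contradiction k<k (ℕ.<-irrefl refl)
  stacked-replicate⁻ []      (y ∷ s) i       (suc j) k _  (y<k ∷ _) (k<y ∷ _) = contradiction k<y (ℕ.<-asym y<k)
  stacked-replicate⁻ (x ∷ r) []      zero    j       k _  _  _ = ℕ.z≤n , []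
  stacked-replicate⁻ (x ∷ r) []      (suc i) j       k (ℕ.s≤s le) [] (_ ∷ st) =
    ℕ.s≤s (proj₁ (stacked-replicate⁻ r [] i j k le [] st)) , []
  stacked-replicate⁻ (x ∷ r) (y ∷ s) i       j       k (ℕ.s≤s le) (_ ∷ s<k) (x<y ∷ st) with stacked-replicate⁻ r s i j k le s<k st
  ... | len , st′ = ℕ.s≤s len , x<y ∷ st′

  stacked-replicate⁺ : ∀ r s i j k → length s ℕ.+ i ℕ.≤ length r → All (ℕ._< k) r →
    Stacked r s → Stacked (r ++ replicate j k) (s ++ replicate i k)
  stacked-replicate⁺ r       []      zero    j k _            _           _  = zip-[] (r ++ replicate j k)
  stacked-replicate⁺ (x ∷ r) []      (suc i) j k (ℕ.s≤s len) (x<k ∷ r<k) _  = x<k ∷ stacked-replicate⁺ r [] i j k len r<k (zip-[] r)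
  stacked-replicate⁺ (x ∷ r) (y ∷ s) i       j k (ℕ.s≤s len) (_ ∷ r<k) (x<y ∷ st) = x<y ∷ stacked-replicate⁺ r s i j k len r<k st

  Supports : List ℕ → Filling → Set
  Supports r []      = ⊤
  Supports r (s ∷ _) = Stacked r s

  supports? : ∀ r t → Dec (Supports r t)
  supports? r []      = yes tt
  supports? r (s ∷ _) = stacked? r s

  ⟦semiStandard⟧-∷ : ∀ r t → ⟦ semiStandard? (r ∷ t) ⟧ ≡ ⟦ increasing? r ⟧ * (⟦ semiStandard? t ⟧ * ⟦ supports? r t ⟧)
  ⟦semiStandard⟧-∷ r t = trans
    (⟦⟧-cong (semiStandard? (r ∷ t)) (increasing? r ×-dec semiStandard? t ×-dec supports? r t) (split t) (merge t))
    (trans (⟦⟧-× (increasing? r) (semiStandard? t ×-dec supports? r t)) (cong (_*_ _) (⟦⟧-× (semiStandard? t) (supports? r t))))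
    where
    split : ∀ t → SemiStandard (r ∷ t) → Linked ℕ._≤_ r × SemiStandard t × Supports r t
    split []      (i ∷ _  , _)        = i , ([] , []) , tt
    split (s ∷ t) (i ∷ is , st ∷ sts) = i , (is , sts) , st

    merge : ∀ t → Linked ℕ._≤_ r × SemiStandard t × Supports r t → SemiStandard (r ∷ t)
    merge []      (i , _ , _)          = i ∷ [] , [-]
    merge (s ∷ t) (i , (is , sts) , st) = i ∷ is , st ∷ sts

  -- Fills up the rows to the lengths ls with the new largest entry k.
  pad : ℕ → List ℕ → Filling → Filling
  pad k = zipWith (λ l r → r ++ replicate (l ∸ length r) k)

  ∈-fillings : ∀ k ls {t} → t ∈ fillings k ls → map length t ≡ ls × All (All (ℕ._< k)) t
  ∈-fillings k []       (here refl) = refl , []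
  ∈-fillings k (l ∷ ls) t∈ with ∈.∈-cartesianProductWith⁻ _∷_ (rowFillings k l) (fillings k ls) t∈
  ... | _ , _ , r∈ , t∈′ , refl with ∈-rowFillings k l r∈ | ∈-fillings k ls t∈′
  ...   | len , <k | lens , <ks = cong₂ _∷_ len lens , <k ∷ <ks

  -- Column strictness survives the padding exactly when the upper row does not reach beyond the old
  -- part of the lower one. This is the origin of the interlacing condition for horizontal strips.
  ⟦supports⟧-pad : ∀ k l m ls ρ {r t} → m ℕ.≤ l → firstPart ls ℕ.≤ l → Strip ls ρ →
    r ∈ rowFillings k m → t ∈ fillings k ρ →
    ⟦ supports? (r ++ replicate (l ∸ m) k) (pad k ls t) ⟧ ≡ ⟦ firstPart ls ℕ.≤? m ⟧ * ⟦ supports? r t ⟧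
  ⟦supports⟧-pad k l m []       []      _   _   []  _  (here refl) = sym (trans (*-identityʳ _) (⟦⟧-true (0 ℕ.≤? m) ℕ.z≤n))
  ⟦supports⟧-pad k l m (l₂ ∷ ls) (m₂ ∷ ρ) {r} m≤l l₂≤l ((_ , m₂≤l₂) ∷ _) r∈ t∈
    with ∈-rowFillings k m r∈ | ∈.∈-cartesianProductWith⁻ _∷_ (rowFillings k m₂) (fillings k ρ) t∈
  ... | refl , r<k | s , t , s∈ , _ , refl with ∈-rowFillings k m₂ s∈
  ...   | refl , s<k = trans
    (⟦⟧-cong (stacked? (r ++ replicate (l ∸ length r) k) (s ++ replicate (l₂ ∸ length s) k)) (l₂ ℕ.≤? length r ×-dec stacked? r s)
      (λ st → let len , st′ = stacked-replicate⁻ r s (l₂ ∸ length s) (l ∸ length r) k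
                    (subst₂ ℕ._≤_ (sym padded) (sym (ℕ.m+[n∸m]≡n m≤l)) l₂≤l) s<k st
              in subst (ℕ._≤ length r) padded len , st′)
      (λ (len , st) → stacked-replicate⁺ r s (l₂ ∸ length s) (l ∸ length r) k (subst (ℕ._≤ length r) (sym padded) len) r<k st))
    (⟦⟧-× (l₂ ℕ.≤? length r) (stacked? r s))
    where
    padded : length s ℕ.+ (l₂ ∸ length s) ≡ l₂
    padded = ℕ.m+[n∸m]≡n m₂≤l₂

  ∑-fillings-∷ : ∀ k l ls (g : Filling → ℚ) →
    ∑ (fillings k (l ∷ ls)) g ≡ ∑ (rowFillings k l) (λ r → ∑ (fillings k ls) (λ t → g (r ∷ t)))
  ∑-fillings-∷ k l ls g = ∑-cartesianProductWith _∷_ (rowFillings k l) (fillings k ls) g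

  -- In a semistandard tableau the copies of the largest letter k occupy a horizontal strip, and
  -- erasing them leaves a semistandard tableau of the smaller shape ρ.
  ∑-fillings-split : ∀ k {ls} → Decreasing ls → (G : Filling → ℚ) →
    ∑ (fillings (suc k) ls) (λ t → ⟦ semiStandard? t ⟧ * G t) ≡
    ∑strip ls (λ ρ → ∑ (fillings k ρ) (λ t → ⟦ semiStandard? t ⟧ * G (pad k ls t)))
  ∑-fillings-split k {[]}     _   G = refl
  ∑-fillings-split k {l ∷ ls} dec G with uncons dec
  ... | first≤l , dec′ = begin
    ∑ (fillings (suc k) (l ∷ ls)) (λ t → ⟦ semiStandard? t ⟧ * G t)
      ≡⟨ ∑-fillings-∷ (suc k) l ls _ ⟩
    ∑ (rowFillings (suc k) l) (λ r → ∑ (fillings (suc k) ls) (λ t → ⟦ semiStandard? (r ∷ t) ⟧ * G (r ∷ t)))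
      ≡⟨ ∑-cong (rowFillings (suc k) l) (λ r → ∑-cong (fillings (suc k) ls) λ t → trans (cong (_* G (r ∷ t)) (⟦semiStandard⟧-∷ r t))
           (solve 4 (λ i s c g → i :* (s :* c) :* g := s :* (i :* (c :* g))) refl _ _ _ _)) ⟩
    ∑ (rowFillings (suc k) l) (λ r → ∑ (fillings (suc k) ls) (λ t → ⟦ semiStandard? t ⟧ * (⟦ increasing? r ⟧ * (⟦ supports? r t ⟧ * G (r ∷ t)))))
      ≡⟨ ∑-swap (rowFillings (suc k) l) (fillings (suc k) ls) _ ⟩
    ∑ (fillings (suc k) ls) (λ t → ∑ (rowFillings (suc k) l) (λ r → ⟦ semiStandard? t ⟧ * (⟦ increasing? r ⟧ * (⟦ supports? r t ⟧ * G (r ∷ t)))))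
      ≡⟨ ∑-cong (fillings (suc k) ls) (λ t → trans (∑-*ˡ _ (rowFillings (suc k) l) _)
           (cong (_*_ _) (∑-rowFillings-split k l (λ r → ⟦ supports? r t ⟧ * G (r ∷ t))))) ⟩
    ∑ (fillings (suc k) ls) (λ t → ⟦ semiStandard? t ⟧ * G′ t)
      -- The sum over the bottom row is absorbed into the weight `G′`, so that the induction applies
      -- to the rows above it.
      ≡⟨ ∑-fillings-split k dec′ G′ ⟩
    ∑strip ls (λ ρ → ∑ (fillings k ρ) (λ t → ⟦ semiStandard? t ⟧ * G′ (pad k ls t)))
      ≡⟨ ∑strip-cong ls (λ {ρ} strip → trans
           (∑-cong∈ (fillings k ρ) λ {t} t∈ → trans
             (cong (_*_ ⟦ semiStandard? t ⟧) (∑-cong∈ (upTo (suc l)) λ {m} m∈ → ∑-cong∈ (rowFillings k m) λ {r} r∈ → 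
               trans (cong (λ z → ⟦ increasing? r ⟧ * (z * H m r t)) (⟦supports⟧-pad k l m ls ρ (ℕ.s≤s⁻¹ (∈.∈-upTo⁻ m∈)) first≤l strip r∈ t∈))
                 (solve 4 (λ i p c g → i :* (p :* c :* g) := p :* (i :* (c :* g))) refl _ _ _ _)))
             (trans (sym (∑-*ˡ _ (upTo (suc l)) _))
               (∑-cong (upTo (suc l)) λ m → trans (cong (_*_ _) (∑-*ˡ _ (rowFillings k m) _))
                 (solve 3 (λ s p x → s :* (p :* x) := p :* (s :* x)) refl _ _ _))))
           (∑-swap (fillings k ρ) (upTo (suc l)) _)) ⟩
    ∑strip ls (λ ρ → ∑ (upTo (suc l)) (λ m → ∑ (fillings k ρ) (λ t → ⟦ firstPart ls ℕ.≤? m ⟧ * (⟦ semiStandard? t ⟧ *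
      ∑ (rowFillings k m) (λ r → ⟦ increasing? r ⟧ * (⟦ supports? r t ⟧ * H m r t))))))
      ≡⟨ ∑strip-∑ ls (upTo (suc l)) _ ⟩
    ∑ (upTo (suc l)) (λ m → ∑strip ls (λ ρ → ∑ (fillings k ρ) (λ t → ⟦ firstPart ls ℕ.≤? m ⟧ * (⟦ semiStandard? t ⟧ *
      ∑ (rowFillings k m) (λ r → ⟦ increasing? r ⟧ * (⟦ supports? r t ⟧ * H m r t))))))
      ≡⟨ ∑-cong∈ (upTo (suc l)) (λ {m} m∈ → trans
           (∑strip-cong ls λ {ρ} _ → ∑-*ˡ _ (fillings k ρ) _)
           (trans (∑strip-*ˡ _ ls _) (cong (_*_ _) (∑strip-cong ls λ {ρ} _ → begin
             ∑ (fillings k ρ) (λ t → ⟦ semiStandard? t ⟧ * ∑ (rowFillings k m) (λ r → ⟦ increasing? r ⟧ * (⟦ supports? r t ⟧ * H m r t)))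
               ≡⟨ ∑-cong (fillings k ρ) (λ t → sym (∑-*ˡ _ (rowFillings k m) _)) ⟩
             ∑ (fillings k ρ) (λ t → ∑ (rowFillings k m) (λ r → ⟦ semiStandard? t ⟧ * (⟦ increasing? r ⟧ * (⟦ supports? r t ⟧ * H m r t))))
               ≡⟨ ∑-swap (fillings k ρ) (rowFillings k m) _ ⟩
             ∑ (rowFillings k m) (λ r → ∑ (fillings k ρ) (λ t → ⟦ semiStandard? t ⟧ * (⟦ increasing? r ⟧ * (⟦ supports? r t ⟧ * H m r t))))
               ≡⟨ ∑-cong∈ (rowFillings k m) (λ {r} r∈ → ∑-cong (fillings k ρ) λ t → trans
                    (solve 4 (λ i s c g → s :* (i :* (c :* g)) := i :* (s :* c) :* g) refl ⟦ increasing? r ⟧ ⟦ semiStandard? t ⟧ ⟦ supports? r t ⟧ (H m r t))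
                    (cong₂ _*_ (sym (⟦semiStandard⟧-∷ r t))
                      (cong (λ n → G ((r ++ replicate (l ∸ n) k) ∷ pad k ls t)) (sym (proj₁ (∈-rowFillings k m r∈)))))) ⟩
             ∑ (rowFillings k m) (λ r → ∑ (fillings k ρ) (λ t → ⟦ semiStandard? (r ∷ t) ⟧ * G (pad k (l ∷ ls) (r ∷ t))))
               ≡⟨ ∑-fillings-∷ k m ρ _ ⟨
             ∑ (fillings k (m ∷ ρ)) (λ t → ⟦ semiStandard? t ⟧ * G (pad k (l ∷ ls) t)) ∎)))) ⟩
    ∑strip (l ∷ ls) (λ ρ → ∑ (fillings k ρ) (λ t → ⟦ semiStandard? t ⟧ * G (pad k (l ∷ ls) t))) ∎
    where
    open ≡-Reasoning

    G′ : Filling → ℚ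
    G′ t = ∑ (upTo (suc l)) λ m → ∑ (rowFillings k m) λ r → ⟦ increasing? r ⟧ *
      (⟦ supports? (r ++ replicate (l ∸ m) k) t ⟧ * G ((r ++ replicate (l ∸ m) k) ∷ t))

    H : ℕ → List ℕ → Filling → ℚ
    H m r t = G ((r ++ replicate (l ∸ m) k) ∷ pad k ls t)

  multiplicity-++ : ∀ i xs ys → multiplicity i (xs ++ ys) ≡ multiplicity i xs ℕ.+ multiplicity i ys
  multiplicity-++ i xs ys = trans (cong length (List.filter-++ (i ℕ.≟_) xs ys)) (List.length-++ (filter (i ℕ.≟_) xs))

  multiplicity-∉ : ∀ {i xs} → All (i ≢_) xs → multiplicity i xs ≡ 0
  multiplicity-∉ ∉ = cong length (List.filter-none (_ ℕ.≟_) ∉)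

  multiplicity-replicate : ∀ k j → multiplicity k (replicate j k) ≡ j
  multiplicity-replicate k j = trans
    (cong length (List.filter-all (k ℕ.≟_) (All.replicate⁺ j refl))) (List.length-replicate j)

  multiplicity-pad-< : ∀ {i k ls ρ t} → i ℕ.< k → Strip ls ρ → map length t ≡ ρ →
    multiplicity i (concat (pad k ls t)) ≡ multiplicity i (concat t)
  multiplicity-pad-< {t = []} _ [] refl = refl
  multiplicity-pad-< {i} {k} {l ∷ ls} {t = r ∷ t} i<k (_ ∷ strip) refl = begin
    multiplicity i ((r ++ replicate j k) ++ concat (pad k ls t))                          ≡⟨ multiplicity-++ i (r ++ replicate j k) _ ⟩
    multiplicity i (r ++ replicate j k) ℕ.+ multiplicity i (concat (pad k ls t))          ≡⟨ cong₂ ℕ._+_ (multiplicity-++ i r _) (multiplicity-pad-< i<k strip refl) ⟩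
    multiplicity i r ℕ.+ multiplicity i (replicate j k) ℕ.+ multiplicity i (concat t)     ≡⟨ cong (λ x → multiplicity i r ℕ.+ x ℕ.+ multiplicity i (concat t)) (multiplicity-∉ (All.replicate⁺ j (ℕ.<⇒≢ i<k))) ⟩
    multiplicity i r ℕ.+ 0 ℕ.+ multiplicity i (concat t)                                  ≡⟨ cong (ℕ._+ multiplicity i (concat t)) (ℕ.+-identityʳ _) ⟩
    multiplicity i r ℕ.+ multiplicity i (concat t)                                        ≡⟨ multiplicity-++ i r (concat t) ⟨
    multiplicity i (r ++ concat t)                                                        ∎
    where
    open ≡-Reasoning
    j = l ∸ length r

  multiplicity-pad : ∀ {k ls ρ t} → Strip ls ρ → map length t ≡ ρ → All (All (ℕ._< k)) t →
    ℕ.sum ρ ℕ.+ multiplicity k (concat (pad k ls t)) ≡ ℕ.sum ls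
  multiplicity-pad {t = []} [] refl [] = refl
  multiplicity-pad {k} {l ∷ ls} {t = r ∷ t} ((_ , m≤l) ∷ strip) refl (r<k ∷ t<k) = begin
    (length r ℕ.+ R) ℕ.+ multiplicity k ((r ++ replicate j k) ++ concat (pad k ls t))      ≡⟨ cong (length r ℕ.+ R ℕ.+_) (multiplicity-++ k (r ++ replicate j k) _) ⟩
    (length r ℕ.+ R) ℕ.+ (multiplicity k (r ++ replicate j k) ℕ.+ P)                       ≡⟨ cong (λ x → length r ℕ.+ R ℕ.+ (x ℕ.+ P)) (begin
      multiplicity k (r ++ replicate j k)                        ≡⟨ multiplicity-++ k r _ ⟩
      multiplicity k r ℕ.+ multiplicity k (replicate j k)        ≡⟨ cong₂ ℕ._+_ (multiplicity-∉ (All.map (λ x<k → ℕ.>⇒≢ x<k) r<k)) (multiplicity-replicate k j) ⟩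
      j                                                          ∎) ⟩
    (length r ℕ.+ R) ℕ.+ (j ℕ.+ P)                                                         ≡⟨ interchange (length r) R j P ⟩
    (length r ℕ.+ j) ℕ.+ (R ℕ.+ P)                                                         ≡⟨ cong₂ ℕ._+_ (ℕ.m+[n∸m]≡n m≤l) (multiplicity-pad strip refl t<k) ⟩
    l ℕ.+ ℕ.sum ls                                                                  ∎
    where
    open ≡-Reasoning
    open import Algebra.Properties.CommutativeSemigroup ℕ.+-commutativeSemigroup using (interchange)
    j = l ∸ length r
    R = ℕ.sum (map length t)
    P = multiplicity k (concat (pad k ls t))

  weight-suc : ∀ k t → weight (suc k) t ≡ map (λ i → multiplicity i (concat t)) (upTo k) ∷ʳ multiplicity k (concat t)
  weight-suc k t = trans (cong (map _) (sym (List.upTo-∷ʳ k))) (List.map-++ _ (upTo k) (k ∷ []))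

  hasWeight? : ∀ k a t → Dec (weight k t ≡ a)
  hasWeight? k a t = List.≡-dec ℕ._≟_ (weight k t) a

  -- The copies of k number |ls| - |ρ| and give the last entry of the weight; the multiplicities of
  -- smaller letters are those before the padding.
  ⟦hasWeight⟧-pad : ∀ {k ls ρ t} a b → Strip ls ρ → t ∈ fillings k ρ →
    ⟦ hasWeight? (suc k) (a ∷ʳ b) (pad k ls t) ⟧ ≡ ⟦ ℕ.sum ls ℕ.≟ ℕ.sum ρ ℕ.+ b ⟧ * ⟦ hasWeight? k a t ⟧
  ⟦hasWeight⟧-pad {k} {ls} {ρ} {t} a b strip t∈ = trans
    (⟦⟧-cong (hasWeight? (suc k) (a ∷ʳ b) (pad k ls t)) (ℕ.sum ls ℕ.≟ ℕ.sum ρ ℕ.+ b ×-dec hasWeight? k a t) split merge)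
    (⟦⟧-× (ℕ.sum ls ℕ.≟ ℕ.sum ρ ℕ.+ b) (hasWeight? k a t))
    where
    lens = proj₁ (∈-fillings k ρ t∈)

    last : ℕ.sum ρ ℕ.+ multiplicity k (concat (pad k ls t)) ≡ ℕ.sum ls
    last = multiplicity-pad strip lens (proj₂ (∈-fillings k ρ t∈))

    weight-pad : weight (suc k) (pad k ls t) ≡ weight k t ∷ʳ multiplicity k (concat (pad k ls t))
    weight-pad = trans (weight-suc k (pad k ls t)) (cong (_∷ʳ multiplicity k (concat (pad k ls t)))
      (List.map-cong-local (All.tabulate λ i∈ → multiplicity-pad-< (∈.∈-upTo⁻ i∈) strip lens)))

    split : weight (suc k) (pad k ls t) ≡ a ∷ʳ b → ℕ.sum ls ≡ ℕ.sum ρ ℕ.+ b × weight k t ≡ a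
    split eq with List.∷ʳ-injective (weight k t) a (trans (sym weight-pad) eq)
    ... | w≡a , refl = sym last , w≡a

    merge : ℕ.sum ls ≡ ℕ.sum ρ ℕ.+ b × weight k t ≡ a → weight (suc k) (pad k ls t) ≡ a ∷ʳ b
    merge (sum≡ , refl) = trans weight-pad (cong (weight k t ∷ʳ_) (ℕ.+-cancelˡ-≡ (ℕ.sum ρ) _ _ (trans last sum≡)))

  ∑-fillings-0 : ∀ ls → ∑ (fillings 0 ls) (λ t → ⟦ semiStandard? t ⟧ * ⟦ hasWeight? 0 [] t ⟧) ≡ ⟦ ℕ.sum ls ℕ.≟ 0 ⟧
  ∑-fillings-0 []           = trans (+-identityʳ _) (*-identityˡ _)
  ∑-fillings-0 (suc l ∷ ls) = refl
  ∑-fillings-0 (zero ∷ ls)  = begin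
    ∑ (fillings 0 (0 ∷ ls)) (λ t → ⟦ semiStandard? t ⟧ * ⟦ hasWeight? 0 [] t ⟧)
      ≡⟨ trans (∑-fillings-∷ 0 0 ls _) (+-identityʳ _) ⟩
    ∑ (fillings 0 ls) (λ t → ⟦ semiStandard? ([] ∷ t) ⟧ * 1q)
      ≡⟨ ∑-cong (fillings 0 ls) (λ t → cong (_* 1q) (trans (⟦semiStandard⟧-∷ [] t) (trans
           (⟦⟧*-true (increasing? []) []) (trans (cong (_*_ _) (⟦⟧-true (supports? [] t) (support t))) (*-identityʳ _))))) ⟩
    ∑ (fillings 0 ls) (λ t → ⟦ semiStandard? t ⟧ * 1q)
      ≡⟨ ∑-fillings-0 ls ⟩
    ⟦ ℕ.sum ls ℕ.≟ 0 ⟧ ∎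
    where
    open ≡-Reasoning
    support : ∀ t → Supports [] t
    support []      = tt
    support (_ ∷ _) = []

  -- The largest letter is removed first, and its multiplicity stands last in the weight; hence the
  -- reversal.
  ∑-fillings-tableaux : ∀ bs {ls} → Decreasing ls →
    ∑ (fillings (length bs) ls) (λ t → ⟦ semiStandard? t ⟧ * ⟦ hasWeight? (length bs) (reverse bs) t ⟧) ≡ tableaux ls bs
  ∑-fillings-tableaux []       {ls} dec = ∑-fillings-0 ls
  ∑-fillings-tableaux (b ∷ bs) {ls} dec = begin
    ∑ (fillings (suc k) ls) (λ t → ⟦ semiStandard? t ⟧ * ⟦ hasWeight? (suc k) (reverse (b ∷ bs)) t ⟧)
      ≡⟨ cong (λ a → ∑ (fillings (suc k) ls) (λ t → ⟦ semiStandard? t ⟧ * ⟦ hasWeight? (suc k) a t ⟧)) (List.unfold-reverse b bs) ⟩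
    ∑ (fillings (suc k) ls) (λ t → ⟦ semiStandard? t ⟧ * ⟦ hasWeight? (suc k) (reverse bs ∷ʳ b) t ⟧)
      ≡⟨ ∑-fillings-split k dec _ ⟩
    ∑strip ls (λ ρ → ∑ (fillings k ρ) (λ t → ⟦ semiStandard? t ⟧ * ⟦ hasWeight? (suc k) (reverse bs ∷ʳ b) (pad k ls t) ⟧))
      ≡⟨ ∑strip-cong ls (λ {ρ} strip → begin
        ∑ (fillings k ρ) (λ t → ⟦ semiStandard? t ⟧ * ⟦ hasWeight? (suc k) (reverse bs ∷ʳ b) (pad k ls t) ⟧)
          ≡⟨ ∑-cong∈ (fillings k ρ) (λ t∈ → trans (cong (_*_ _) (⟦hasWeight⟧-pad (reverse bs) b strip t∈))
               (solve 3 (λ s p w → s :* (p :* w) := p :* (s :* w)) refl _ _ _)) ⟩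
        ∑ (fillings k ρ) (λ t → ⟦ ℕ.sum ls ℕ.≟ ℕ.sum ρ ℕ.+ b ⟧ * (⟦ semiStandard? t ⟧ * ⟦ hasWeight? k (reverse bs) t ⟧))
          ≡⟨ ∑-*ˡ _ (fillings k ρ) _ ⟩
        ⟦ ℕ.sum ls ℕ.≟ ℕ.sum ρ ℕ.+ b ⟧ * ∑ (fillings k ρ) (λ t → ⟦ semiStandard? t ⟧ * ⟦ hasWeight? k (reverse bs) t ⟧)
          ≡⟨ cong (_*_ _) (∑-fillings-tableaux bs (Strip⇒decreasingʳ strip)) ⟩
        ⟦ ℕ.sum ls ℕ.≟ ℕ.sum ρ ℕ.+ b ⟧ * tableaux ρ bs ∎) ⟩
    tableaux ls (b ∷ bs) ∎
    where
    open ≡-Reasoning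
    k = length bs

  ι-Kostka : ∀ {n} (μ : Partition n) a → ι (Kostka μ a) ≡ tableaux (parts μ) (reverse a)
  ι-Kostka μ a = begin
    ι (Kostka μ a)
      ≡⟨ ι-count (λ t → semiStandard? t ×-dec hasWeight? (length a) a t) (fillings (length a) (parts μ)) ⟩
    ∑ (fillings (length a) (parts μ)) (λ t → ⟦ semiStandard? t ×-dec hasWeight? (length a) a t ⟧)
      ≡⟨ ∑-cong (fillings (length a) (parts μ)) (λ t → ⟦⟧-× (semiStandard? t) (hasWeight? (length a) a t)) ⟩
    ∑ (fillings (length a) (parts μ)) (λ t → ⟦ semiStandard? t ⟧ * ⟦ hasWeight? (length a) a t ⟧)
      ≡⟨ cong₂ (λ k a′ → ∑ (fillings k (parts μ)) (λ t → ⟦ semiStandard? t ⟧ * ⟦ hasWeight? k a′ t ⟧))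
           (List.length-reverse a) (List.reverse-involutive a) ⟨
    ∑ (fillings (length (reverse a)) (parts μ)) (λ t → ⟦ semiStandard? t ⟧ * ⟦ hasWeight? (length (reverse a)) (reverse (reverse a)) t ⟧)
      ≡⟨ ∑-fillings-tableaux (reverse a) (decreasing μ) ⟩
    tableaux (parts μ) (reverse a) ∎
    where open ≡-Reasoning

-- Adding a cell and its commutation with removing horizontal strips

module Growth where
  open Rationals
  open Sums
  open Rook
  open Strips

  private variable
    l : ℕ
    ls ρ : List ℕ

  -- y is x minus the row index, so that y + ι l is x plus the content of the cell
  -- added at the end of a row of length l.
  ∑add : ℚ → List ℕ → (List ℕ → ℚ) → ℚ
  ∑add y []       g = 0q
  ∑add y (l ∷ ls) g = (y + ι l) * g (suc l ∷ ls) + ∑add (y - 1q) ls (λ ls′ → g (l ∷ ls′))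

  ∑add-cong : ∀ y ls {g h : List ℕ → ℚ} →
    (∀ ls′ → ℕ.sum ls′ ≡ suc (ℕ.sum ls) → length ls′ ≡ length ls → g ls′ ≡ h ls′) → ∑add y ls g ≡ ∑add y ls h
  ∑add-cong y []       eq = refl
  ∑add-cong y (l ∷ ls) eq = cong₂ _+_
    (cong (_*_ _) (eq (suc l ∷ ls) refl refl))
    (∑add-cong (y - 1q) ls λ ls′ s len → eq (l ∷ ls′) (trans (cong (l ℕ.+_) s) (ℕ.+-suc l _)) (cong suc len))

  ∑add-+ : ∀ y ls (g h : List ℕ → ℚ) → ∑add y ls (λ ls′ → g ls′ + h ls′) ≡ ∑add y ls g + ∑add y ls h
  ∑add-+ y []       g h = sym (+-identityˡ _)
  ∑add-+ y (l ∷ ls) g h = trans (cong (_+_ _) (∑add-+ (y - 1q) ls _ _))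
    (solve 5 (λ w a b c d → w :* (a :+ b) :+ (c :+ d) := w :* a :+ c :+ (w :* b :+ d)) refl _ _ _ _ _)

  ∑add-*ˡ : ∀ y c ls (g : List ℕ → ℚ) → ∑add y ls (λ ls′ → c * g ls′) ≡ c * ∑add y ls g
  ∑add-*ˡ y c []       g = sym (zeroʳ c)
  ∑add-*ˡ y c (l ∷ ls) g = trans (cong (_+_ _) (∑add-*ˡ (y - 1q) c ls _))
    (solve 4 (λ w c a b → w :* (c :* a) :+ c :* b := c :* (w :* a :+ b)) refl _ c _ _)

  ∑add-zero : ∀ y ls → ∑add y ls (λ _ → 0q) ≡ 0q
  ∑add-zero y ls = trans (∑add-cong y ls λ _ _ _ → sym (zeroˡ 0q)) (trans (∑add-*ˡ y 0q ls (λ _ → 0q)) (zeroˡ _))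

  ∑add-∑ : ∀ {A : Set} y ls (xs : List A) (g : A → List ℕ → ℚ) →
    ∑add y ls (λ ls′ → ∑ xs (λ x → g x ls′)) ≡ ∑ xs (λ x → ∑add y ls (g x))
  ∑add-∑ y ls []       g = ∑add-zero y ls
  ∑add-∑ y ls (x ∷ xs) g = trans (∑add-+ y ls _ _) (cong (_+_ _) (∑add-∑ y ls xs g))

  -- An empty last row leaves room for a cell in a new row, so `∑add` covers every way of adding a
  -- cell.
  data EndsInZero : List ℕ → Set where
    [0] : EndsInZero (0 ∷ [])
    _∷_ : ∀ l → EndsInZero ls → EndsInZero (l ∷ ls)

  Strip⇒endsInZero : Strip ls ρ → EndsInZero ls → EndsInZero ρ
  Strip⇒endsInZero ((_ , ℕ.z≤n) ∷ []) [0] = [0]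
  Strip⇒endsInZero (_ ∷ s) (l ∷ e) = _ ∷ Strip⇒endsInZero s e

  telescope : ∀ {p l} → p ℕ.≤ l → (f : ℕ → ℚ) →
    ∑ (upTo (suc l)) (λ m → ⟦ p ℕ.≤? m ⟧ * (f (suc m) - f m)) ≡ f (suc l) - f p
  telescope {p} {l} p≤l f with ℕ.m≤n⇒m<n∨m≡n p≤l
  telescope {p} {suc l} p≤l f | inj₁ (ℕ.s≤s p≤l′) = trans (∑-upTo-last (suc l) _) (trans
    (cong₂ _+_ (telescope p≤l′ f) (⟦⟧*-true (p ℕ.≤? suc l) p≤l))
    (solve 3 (λ a b c → b :- c :+ (a :- b) := a :- c) refl _ _ _))
  telescope {p} {.p} p≤l f | inj₂ refl = trans (∑-upTo-last p _) (trans
    (cong₂ _+_ (trans (∑-cong∈ (upTo p) λ m∈ → ⟦⟧*-false (p ℕ.≤? _) (ℕ.<⇒≱ (∈.∈-upTo⁻ m∈))) (∑-zero (upTo p)))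
               (⟦⟧*-true (p ℕ.≤? p) ℕ.≤-refl))
    (+-identityˡ _))

  ∑-≤-suc : ∀ {p l} → p ℕ.≤ l → (f : ℕ → ℚ) →
    ∑ (upTo (suc l)) (λ m → ⟦ suc p ℕ.≤? m ⟧ * f m) ≡ ∑ (upTo (suc l)) (λ m → ⟦ p ℕ.≤? m ⟧ * f m) - f p
  ∑-≤-suc {p} {l} p≤l f = begin
    ∑ (upTo (suc l)) (λ m → ⟦ suc p ℕ.≤? m ⟧ * f m)
      ≡⟨ ∑-cong (upTo (suc l)) (λ m → trans (cong (_* f m) (lemma m)) (solve 3 (λ a b f → (a :- b) :* f := a :* f :- b :* f) refl _ _ (f m))) ⟩
    ∑ (upTo (suc l)) (λ m → ⟦ p ℕ.≤? m ⟧ * f m - ⟦ m ℕ.≟ p ⟧ * f m)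
      ≡⟨ ∑-- (upTo (suc l)) _ _ ⟩
    ∑ (upTo (suc l)) (λ m → ⟦ p ℕ.≤? m ⟧ * f m) - ∑ (upTo (suc l)) (λ m → ⟦ m ℕ.≟ p ⟧ * f m)
      ≡⟨ cong (_-_ _) (∑-δ ℕ._≟_ f (Unique.upTo⁺ (suc l)) (∈.∈-upTo⁺ (ℕ.s≤s p≤l))) ⟩
    ∑ (upTo (suc l)) (λ m → ⟦ p ℕ.≤? m ⟧ * f m) - f p ∎
    where
    open ≡-Reasoning
    lemma : ∀ m → ⟦ suc p ℕ.≤? m ⟧ ≡ ⟦ p ℕ.≤? m ⟧ - ⟦ m ℕ.≟ p ⟧
    lemma m with m ℕ.≟ p
    ... | yes refl = trans (⟦⟧-false (suc p ℕ.≤? p) (ℕ.<-irrefl refl))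
                           (sym (trans (cong (_- 1q) (⟦⟧-true (p ℕ.≤? p) ℕ.≤-refl)) (-‿inverseʳ 1q)))
    ... | no  m≢p  = trans (⟦⟧-cong (suc p ℕ.≤? m) (p ℕ.≤? m) ℕ.<⇒≤ λ p≤m → ℕ.≤∧≢⇒< p≤m (m≢p ∘ sym))
                           (solve 1 (λ a → a := a :- con (+ 0)) refl _)

  ∑strip-linear : ∀ ls a b (f g h : List ℕ → ℚ) →
    ∑strip ls (λ ρ → a * f ρ + (g ρ + b * h ρ)) ≡ a * ∑strip ls f + (∑strip ls g + b * ∑strip ls h)
  ∑strip-linear ls a b f g h = trans (∑strip-+ ls _ _) (cong₂ _+_ (∑strip-*ˡ a ls f)
    (trans (∑strip-+ ls g _) (cong (_+_ _) (∑strip-*ˡ b ls h))))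

  -- The commutation relation behind the theorem.  Both sides are compared row by
  -- row; the difference telescopes.
  ∑add-∑strip : ∀ x {ls} → EndsInZero ls → Decreasing ls → (h : List ℕ → ℚ) → (∀ ρ → ¬ Decreasing ρ → h ρ ≡ 0q) →
    ∑add x ls (λ ls′ → ∑strip ls′ h) ≡
    ∑strip ls (λ ρ → ∑add x ρ h + (x + ι (ℕ.sum ls) - ι (ℕ.sum ρ)) * h ρ)
  -- A single empty row: after the addition it has length 1, with the two strips 0 and 1.
  ∑add-∑strip x [0] dec h h0 = solve 3
    (λ x a b → (x :+ con (+ 0)) :* (con (+ 1) :* a :+ (con (+ 1) :* b :+ con (+ 0))) :+ con (+ 0) :=
      con (+ 1) :* ((x :+ con (+ 0)) :* b :+ con (+ 0) :+ (x :+ con (+ 0) :- con (+ 0)) :* a) :+ con (+ 0))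
    refl x (h (0 ∷ [])) (h (1 ∷ []))
  ∑add-∑strip x {l ∷ ls@(p ∷ ps)} (.l ∷ e) dec h h0 with uncons dec
  ... | p≤l , dec′ = begin
    (x + ι l) * ∑ (upTo (suc (suc l))) (λ m → ⟦ p ℕ.≤? m ⟧ * Q m) + ∑add y ls (λ ls′ → ∑strip (l ∷ ls′) h)
      ≡⟨ cong₂ (λ a b → (x + ι l) * a + b)
           (trans (∑-upTo-last (suc l) _) (cong (_+_ _) (⟦⟧*-true (p ℕ.≤? suc l) (ℕ.m≤n⇒m≤1+n p≤l))))
           lower-rows ⟩
    (x + ι l) * (∑ M (λ m → ⟦ p ℕ.≤? m ⟧ * Q m) + Q (suc l)) + (∑ M (λ m → ⟦ p ℕ.≤? m ⟧ * R m) - (y + ι p) * Q p)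
      ≡⟨ solve 6 (λ x l s q r z → (x :+ l) :* (s :+ q) :+ (r :- z) := (x :+ l) :* s :+ r :+ ((x :+ l) :* q :- z)) refl
           x (ι l) _ (Q (suc l)) _ _ ⟩
    (x + ι l) * ∑ M (λ m → ⟦ p ℕ.≤? m ⟧ * Q m) + ∑ M (λ m → ⟦ p ℕ.≤? m ⟧ * R m) + ((x + ι l) * Q (suc l) - (y + ι p) * Q p)
      ≡⟨ cong₂ _+_
           (trans (cong (_+ ∑ M (λ m → ⟦ p ℕ.≤? m ⟧ * R m)) (sym (∑-*ˡ (x + ι l) M _))) (sym (∑-+ M _ _)))
           (trans (cong (_- (y + ι p) * Q p) (shift l)) (sym (telescope p≤l f))) ⟩
    ∑ M (λ m → (x + ι l) * (⟦ p ℕ.≤? m ⟧ * Q m) + ⟦ p ℕ.≤? m ⟧ * R m) + ∑ M (λ m → ⟦ p ℕ.≤? m ⟧ * (f (suc m) - f m))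
      ≡⟨ ∑-+ M _ _ ⟨
    ∑ M (λ m → (x + ι l) * (⟦ p ℕ.≤? m ⟧ * Q m) + ⟦ p ℕ.≤? m ⟧ * R m + ⟦ p ℕ.≤? m ⟧ * (f (suc m) - f m))
      ≡⟨ ∑-cong M (λ m → begin
        (x + ι l) * (⟦ p ℕ.≤? m ⟧ * Q m) + ⟦ p ℕ.≤? m ⟧ * R m + ⟦ p ℕ.≤? m ⟧ * (f (suc m) - f m)
          ≡⟨ cong (λ z → (x + ι l) * (⟦ p ℕ.≤? m ⟧ * Q m) + ⟦ p ℕ.≤? m ⟧ * R m + ⟦ p ℕ.≤? m ⟧ * (z - f m)) (sym (shift m)) ⟩
        (x + ι l) * (⟦ p ℕ.≤? m ⟧ * Q m) + ⟦ p ℕ.≤? m ⟧ * R m + ⟦ p ℕ.≤? m ⟧ * ((x + ι m) * Q (suc m) - f m)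
          ≡⟨ solve 7 (λ x l m d q r q′ → (x :+ l) :* (d :* q) :+ d :* r :+ d :* ((x :+ m) :* q′ :- (x :- con (+ 1) :+ m) :* q) :=
               d :* ((x :+ m) :* q′ :+ (r :+ (con (+ 1) :+ l :- m) :* q))) refl x (ι l) (ι m) ⟦ p ℕ.≤? m ⟧ (Q m) (R m) (Q (suc m)) ⟩
        ⟦ p ℕ.≤? m ⟧ * ((x + ι m) * Q (suc m) + (R m + (1q + ι l - ι m) * Q m))
          ≡⟨ cong (_*_ ⟦ p ℕ.≤? m ⟧) (sym (regroup m)) ⟩
        ⟦ p ℕ.≤? m ⟧ * ∑strip ls (λ ρ → ∑add x (m ∷ ρ) h + (x + ι (l ℕ.+ ℕ.sum ls) - ι (m ℕ.+ ℕ.sum ρ)) * h (m ∷ ρ)) ∎) ⟩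
    ∑strip (l ∷ ls) (λ ρ → ∑add x ρ h + (x + ι (l ℕ.+ ℕ.sum ls) - ι (ℕ.sum ρ)) * h ρ) ∎
    where
    open ≡-Reasoning
    y = x - 1q
    M = upTo (suc l)

    -- Here m is the first row of ρ. `Q` sums over the rows below it, `R` is the right side of the
    -- relation for those rows, and f is the quantity that telescopes, since x + m = y + (m + 1).
    Q R f : ℕ → ℚ
    Q m = ∑strip ls (λ ρ → h (m ∷ ρ))
    R m = ∑strip ls (λ ρ → ∑add y ρ (λ ρ′ → h (m ∷ ρ′)) + (y + ι (ℕ.sum ls) - ι (ℕ.sum ρ)) * h (m ∷ ρ))
    f m = (y + ι m) * Q m

    shift : ∀ m → (x + ι m) * Q (suc m) ≡ f (suc m)
    shift m = cong (_* Q (suc m)) (trans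
      (solve 2 (λ x m → x :+ m := x :- con (+ 1) :+ (con (+ 1) :+ m)) refl x (ι m)) (cong (_+_ y) (sym (ι-suc m))))

    regroup : ∀ m →
      ∑strip ls (λ ρ → ∑add x (m ∷ ρ) h + (x + ι (l ℕ.+ ℕ.sum ls) - ι (m ℕ.+ ℕ.sum ρ)) * h (m ∷ ρ)) ≡
      (x + ι m) * Q (suc m) + (R m + (1q + ι l - ι m) * Q m)
    regroup m = begin
      ∑strip ls (λ ρ → ∑add x (m ∷ ρ) h + (x + ι (l ℕ.+ ℕ.sum ls) - ι (m ℕ.+ ℕ.sum ρ)) * h (m ∷ ρ))
        ≡⟨ ∑strip-cong ls (λ {ρ} _ → trans
             (cong₂ (λ a b → ∑add x (m ∷ ρ) h + (x + a - b) * h (m ∷ ρ)) (ι-+ l (ℕ.sum ls)) (ι-+ m (ℕ.sum ρ)))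
             (solve 8 (λ x l m s r a b q → (x :+ m) :* a :+ b :+ (x :+ (l :+ s) :- (m :+ r)) :* q :=
                (x :+ m) :* a :+ (b :+ (x :- con (+ 1) :+ s :- r) :* q :+ (con (+ 1) :+ l :- m) :* q)) refl
                x (ι l) (ι m) (ι (ℕ.sum ls)) (ι (ℕ.sum ρ)) _ _ _)) ⟩
      ∑strip ls (λ ρ → (x + ι m) * h (suc m ∷ ρ) +
        (∑add y ρ (λ ρ′ → h (m ∷ ρ′)) + (y + ι (ℕ.sum ls) - ι (ℕ.sum ρ)) * h (m ∷ ρ) + (1q + ι l - ι m) * h (m ∷ ρ)))
        ≡⟨ ∑strip-linear ls (x + ι m) (1q + ι l - ι m) (λ ρ → h (suc m ∷ ρ))
             (λ ρ → ∑add y ρ (λ ρ′ → h (m ∷ ρ′)) + (y + ι (ℕ.sum ls) - ι (ℕ.sum ρ)) * h (m ∷ ρ)) (λ ρ → h (m ∷ ρ)) ⟩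
      (x + ι m) * Q (suc m) + (R m + (1q + ι l - ι m) * Q m) ∎

    tail-nonDecreasing : ∀ m ρ → ¬ Decreasing ρ → h (m ∷ ρ) ≡ 0q
    tail-nonDecreasing m ρ ¬dec = h0 (m ∷ ρ) (¬dec ∘ proj₂ ∘ uncons)

    -- The additional second row of length p + 1 would exceed the first row p, where h vanishes.
    full-length : ∑strip (suc p ∷ ps) (λ ρ → h (p ∷ ρ)) ≡ Q p
    full-length = trans (∑-upTo-last (suc p) _) (trans
      (cong (_+_ (Q p)) (trans
        (cong (_*_ _) (trans
          (∑strip-cong ps λ {ρ} _ → h0 (p ∷ suc p ∷ ρ) λ where (p≥ ∷ _) → ℕ.<-irrefl refl p≥)
          (∑strip-zero ps)))
        (zeroʳ _)))
      (+-identityʳ _))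

    -- Lengthening the second row from p to p + 1 forbids m = p in the first row. The lost term is
    -- the lower boundary of the telescoping sum.
    lower-rows : ∑add y ls (λ ls′ → ∑strip (l ∷ ls′) h) ≡ ∑ M (λ m → ⟦ p ℕ.≤? m ⟧ * R m) - (y + ι p) * Q p
    lower-rows = begin
      (y + ι p) * ∑ M (λ m → ⟦ suc p ℕ.≤? m ⟧ * ∑strip (suc p ∷ ps) (λ ρ → h (m ∷ ρ))) + below
        ≡⟨ cong (λ a → (y + ι p) * a + below) (trans (∑-≤-suc p≤l _) (cong (_-_ _) full-length)) ⟩
      (y + ι p) * (∑ M (λ m → ⟦ p ℕ.≤? m ⟧ * ∑strip (suc p ∷ ps) (λ ρ → h (m ∷ ρ))) - Q p) + below
        ≡⟨ solve 4 (λ w s q b → w :* (s :- q) :+ b := w :* s :+ b :- w :* q) refl _ _ (Q p) below ⟩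
      ∑add y ls (λ ls′ → ∑ M (λ m → ⟦ p ℕ.≤? m ⟧ * ∑strip ls′ (λ ρ → h (m ∷ ρ)))) - (y + ι p) * Q p
        ≡⟨ cong (_- (y + ι p) * Q p) (∑add-∑ y ls M λ m ls′ → ⟦ p ℕ.≤? m ⟧ * ∑strip ls′ (λ ρ → h (m ∷ ρ))) ⟩
      ∑ M (λ m → ∑add y ls (λ ls′ → ⟦ p ℕ.≤? m ⟧ * ∑strip ls′ (λ ρ → h (m ∷ ρ)))) - (y + ι p) * Q p
        ≡⟨ cong (_- (y + ι p) * Q p) (∑-cong M λ m → trans (∑add-*ˡ y _ ls λ ls′ → ∑strip ls′ (λ ρ → h (m ∷ ρ)))
             (cong (_*_ _) (∑add-∑strip y e dec′ (h ∘ (m ∷_)) (tail-nonDecreasing m)))) ⟩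
      ∑ M (λ m → ⟦ p ℕ.≤? m ⟧ * R m) - (y + ι p) * Q p ∎
      where
      below = ∑add (y - 1q) ps (λ ps′ → ∑ M (λ m → ⟦ p ℕ.≤? m ⟧ * ∑strip (p ∷ ps′) (λ ρ → h (m ∷ ρ))))

  -- The operator α p₁ + Σ x_i² ∂_i on coefficients: the one at `bs` collects those with an exponent
  -- b + 1 lowered to b, with weight x from p₁ and b from the derivative.
  ∑lower : ℚ → List ℕ → (List ℕ → ℚ) → ℚ
  ∑lower x []           g = 0q
  ∑lower x (zero ∷ bs)  g = ∑lower x bs (g ∘ (zero ∷_))
  ∑lower x (suc b ∷ bs) g = (x + ι b) * g (b ∷ bs) + ∑lower x bs (g ∘ (suc b ∷_))

  ∑lower-cong : ∀ x bs {g h : List ℕ → ℚ} → (∀ bs′ → suc (ℕ.sum bs′) ≡ ℕ.sum bs → g bs′ ≡ h bs′) → ∑lower x bs g ≡ ∑lower x bs h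
  ∑lower-cong x []           eq = refl
  ∑lower-cong x (zero ∷ bs)  eq = ∑lower-cong x bs (λ bs′ → eq (zero ∷ bs′))
  ∑lower-cong x (suc b ∷ bs) eq = cong₂ _+_ (cong (_*_ _) (eq (b ∷ bs) refl))
    (∑lower-cong x bs λ bs′ s → eq (suc b ∷ bs′) (cong suc (trans (sym (ℕ.+-suc b _)) (cong (b ℕ.+_) s))))

  -- The linear functional is arbitrary because the exchange is made both for `∑strip` and for
  -- `walk`.
  ∑lower-linear : (L : (List ℕ → ℚ) → ℚ) → (∀ {g h} → (∀ ls → g ls ≡ h ls) → L g ≡ L h) →
    (∀ g h → L (λ ls → g ls + h ls) ≡ L g + L h) → (∀ c g → L (λ ls → c * g ls) ≡ c * L g) →
    ∀ x bs (g : List ℕ → List ℕ → ℚ) → ∑lower x bs (λ bs′ → L (g bs′)) ≡ L (λ ls → ∑lower x bs (λ bs′ → g bs′ ls))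
  ∑lower-linear L L-cong L-+ L-* x = go
    where
    L0 : L (λ _ → 0q) ≡ 0q
    L0 = trans (L-cong λ _ → sym (zeroˡ 0q)) (trans (L-* 0q (λ _ → 0q)) (zeroˡ _))

    go : ∀ bs (g : List ℕ → List ℕ → ℚ) → ∑lower x bs (λ bs′ → L (g bs′)) ≡ L (λ ls → ∑lower x bs (λ bs′ → g bs′ ls))
    go []           g = sym L0
    go (zero ∷ bs)  g = go bs (g ∘ (zero ∷_))
    go (suc b ∷ bs) g = trans (cong₂ _+_ (sym (L-* _ _)) (go bs (g ∘ (suc b ∷_)))) (sym (L-+ _ _))

  ∑lower-*ˡ : ∀ x c bs (g : List ℕ → ℚ) → ∑lower x bs (λ bs′ → c * g bs′) ≡ c * ∑lower x bs g
  ∑lower-*ˡ x c []           g = sym (zeroʳ c)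
  ∑lower-*ˡ x c (zero ∷ bs)  g = ∑lower-*ˡ x c bs (g ∘ (zero ∷_))
  ∑lower-*ˡ x c (suc b ∷ bs) g = trans (cong (_+_ _) (∑lower-*ˡ x c bs (g ∘ (suc b ∷_))))
    (solve 4 (λ w c a b → w :* (c :* a) :+ c :* b := c :* (w :* a :+ b)) refl _ c _ _)

  -- The action of the operator on a Schur function, coefficient by coefficient. Induction on the
  -- letters: the strip of the largest one is moved past the new cell by `∑add-∑strip`.
  ∑add-tableaux : ∀ x {ls} → EndsInZero ls → Decreasing ls → ∀ bs →
    ∑add x ls (λ ls′ → tableaux ls′ bs) ≡ ∑lower x bs (tableaux ls)
  ∑add-tableaux x {ls} e dec [] = trans
    (∑add-cong x ls λ ls′ s _ → ⟦⟧-false (ℕ.sum ls′ ℕ.≟ 0) λ s′ → case trans (sym s) s′ of λ ())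
    (∑add-zero x ls)
  ∑add-tableaux x {ls} e dec (b ∷ bs) = begin
    ∑add x ls (λ ls′ → ∑strip ls′ (λ ρ → ⟦ ℕ.sum ls′ ℕ.≟ ℕ.sum ρ ℕ.+ b ⟧ * tableaux ρ bs))
      ≡⟨ ∑add-cong x ls (λ ls′ s _ → cong (λ k → ∑strip ls′ (λ ρ → ⟦ k ℕ.≟ ℕ.sum ρ ℕ.+ b ⟧ * tableaux ρ bs)) s) ⟩
    ∑add x ls (λ ls′ → ∑strip ls′ h)
      ≡⟨ ∑add-∑strip x e dec h (λ ρ ¬dec → trans (cong (_*_ _) (tableaux-nonDecreasing ρ bs ¬dec)) (zeroʳ _)) ⟩
    ∑strip ls (λ ρ → ∑add x ρ h + (x + ι (ℕ.sum ls) - ι (ℕ.sum ρ)) * h ρ)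
      ≡⟨ ∑strip-+ ls _ _ ⟩
    ∑strip ls (λ ρ → ∑add x ρ h) + ∑strip ls (λ ρ → (x + ι (ℕ.sum ls) - ι (ℕ.sum ρ)) * h ρ)
      ≡⟨ cong (_+ ∑strip ls (λ ρ → (x + ι (ℕ.sum ls) - ι (ℕ.sum ρ)) * h ρ)) (begin
        ∑strip ls (λ ρ → ∑add x ρ h)
          ≡⟨ ∑strip-cong ls (λ {ρ} strip → begin
            ∑add x ρ h
              ≡⟨ ∑add-cong x ρ (λ ρ′ s _ → cong (_* tableaux ρ′ bs) (trans
                   (cong (λ k → ⟦ suc (ℕ.sum ls) ℕ.≟ k ℕ.+ b ⟧) s)
                   (⟦⟧-cong (suc (ℕ.sum ls) ℕ.≟ suc (ℕ.sum ρ) ℕ.+ b) (ℕ.sum ls ℕ.≟ ℕ.sum ρ ℕ.+ b) ℕ.suc-injective (cong suc)))) ⟩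
            ∑add x ρ (λ ρ′ → ⟦ ℕ.sum ls ℕ.≟ ℕ.sum ρ ℕ.+ b ⟧ * tableaux ρ′ bs)
              ≡⟨ ∑add-*ˡ x _ ρ _ ⟩
            ⟦ ℕ.sum ls ℕ.≟ ℕ.sum ρ ℕ.+ b ⟧ * ∑add x ρ (λ ρ′ → tableaux ρ′ bs)
              ≡⟨ cong (_*_ _) (∑add-tableaux x (Strip⇒endsInZero strip e) (Strip⇒decreasingʳ strip) bs) ⟩
            ⟦ ℕ.sum ls ℕ.≟ ℕ.sum ρ ℕ.+ b ⟧ * ∑lower x bs (tableaux ρ)
              ≡⟨ ∑lower-*ˡ x _ bs _ ⟨
            ∑lower x bs (λ bs′ → ⟦ ℕ.sum ls ℕ.≟ ℕ.sum ρ ℕ.+ b ⟧ * tableaux ρ bs′) ∎) ⟩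
        ∑strip ls (λ ρ → ∑lower x bs (λ bs′ → ⟦ ℕ.sum ls ℕ.≟ ℕ.sum ρ ℕ.+ b ⟧ * tableaux ρ bs′))
          ≡⟨ ∑lower-linear (∑strip ls) (λ eq → ∑strip-cong ls λ _ → eq _) (∑strip-+ ls) (λ c → ∑strip-*ˡ c ls) x bs _ ⟨
        ∑lower x bs (λ bs′ → tableaux ls (b ∷ bs′)) ∎) ⟩
    ∑lower x bs (λ bs′ → tableaux ls (b ∷ bs′)) + ∑strip ls (λ ρ → (x + ι (ℕ.sum ls) - ι (ℕ.sum ρ)) * h ρ)
      ≡⟨ head b ⟩
    ∑lower x (b ∷ bs) (tableaux ls) ∎
    where
    open ≡-Reasoning
    h : List ℕ → ℚ
    h ρ = ⟦ suc (ℕ.sum ls) ℕ.≟ ℕ.sum ρ ℕ.+ b ⟧ * tableaux ρ bs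

    -- The extra term of the commutation relation lowers the first exponent. For exponent 0 no strip
    -- has the required size; for b + 1 the strips have b cells, so the coefficient x + |ls| - |ρ|
    -- is x + b.
    head : ∀ b →
      ∑lower x bs (λ bs′ → tableaux ls (b ∷ bs′)) +
      ∑strip ls (λ ρ → (x + ι (ℕ.sum ls) - ι (ℕ.sum ρ)) * (⟦ suc (ℕ.sum ls) ℕ.≟ ℕ.sum ρ ℕ.+ b ⟧ * tableaux ρ bs)) ≡
      ∑lower x (b ∷ bs) (tableaux ls)
    head zero = trans (cong (_+_ _) (trans
      (∑strip-cong ls λ {ρ} strip → trans
        (cong (_*_ _) (⟦⟧*-false (suc (ℕ.sum ls) ℕ.≟ ℕ.sum ρ ℕ.+ 0) λ eq →
          ℕ.1+n≰n (subst (ℕ._≤ ℕ.sum ls) (sym (trans eq (ℕ.+-identityʳ _))) (Strip⇒sum≤ strip))))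
        (zeroʳ _))
      (∑strip-zero ls))) (+-identityʳ _)
    head (suc b) = trans (+-comm _ _) (cong (_+ ∑lower x bs (λ bs′ → tableaux ls (suc b ∷ bs′))) (trans
      (∑strip-cong ls λ {ρ} _ → begin
        (x + ι (ℕ.sum ls) - ι (ℕ.sum ρ)) * (⟦ suc (ℕ.sum ls) ℕ.≟ ℕ.sum ρ ℕ.+ suc b ⟧ * tableaux ρ bs)
          ≡⟨ cong (λ d → (x + ι (ℕ.sum ls) - ι (ℕ.sum ρ)) * (d * tableaux ρ bs))
               (⟦⟧-cong (suc (ℕ.sum ls) ℕ.≟ ℕ.sum ρ ℕ.+ suc b) (ℕ.sum ls ℕ.≟ ℕ.sum ρ ℕ.+ b)
                 (λ eq → ℕ.suc-injective (trans eq (ℕ.+-suc _ b))) (λ eq → trans (cong suc eq) (sym (ℕ.+-suc _ b)))) ⟩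
        (x + ι (ℕ.sum ls) - ι (ℕ.sum ρ)) * (⟦ ℕ.sum ls ℕ.≟ ℕ.sum ρ ℕ.+ b ⟧ * tableaux ρ bs)
          ≡⟨ solve 3 (λ w d t → w :* (d :* t) := d :* (w :* t)) refl _ _ _ ⟩
        ⟦ ℕ.sum ls ℕ.≟ ℕ.sum ρ ℕ.+ b ⟧ * ((x + ι (ℕ.sum ls) - ι (ℕ.sum ρ)) * tableaux ρ bs)
          ≡⟨ ⟦⟧*-cong (ℕ.sum ls ℕ.≟ ℕ.sum ρ ℕ.+ b) (λ eq → cong (_* tableaux ρ bs) (trans
               (cong (λ k → x + k - ι (ℕ.sum ρ)) (trans (cong ι eq) (ι-+ (ℕ.sum ρ) b)))
               (solve 3 (λ x r b → x :+ (r :+ b) :- r := x :+ b) refl x _ _))) ⟩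
        ⟦ ℕ.sum ls ℕ.≟ ℕ.sum ρ ℕ.+ b ⟧ * ((x + ι b) * tableaux ρ bs)
          ≡⟨ solve 3 (λ w d t → w :* (d :* t) := d :* (w :* t)) refl _ _ _ ⟩
        (x + ι b) * (⟦ ℕ.sum ls ℕ.≟ ℕ.sum ρ ℕ.+ b ⟧ * tableaux ρ bs) ∎)
      (∑strip-*ˡ (x + ι b) ls _)))

-- Iterating the growth operator from the empty shape

module Walks where
  open Rationals
  open Sums
  open Rook
  open Strips
  open Growth

  zeros : ℕ → List ℕ
  zeros N = replicate N 0

  zeros-decreasing : ∀ N → Decreasing (zeros N)
  zeros-decreasing zero          = []
  zeros-decreasing (suc zero)    = [-]
  zeros-decreasing (suc (suc N)) = ℕ.z≤n ∷ zeros-decreasing (suc N)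

  sum-zeros : ∀ N → ℕ.sum (zeros N) ≡ 0
  sum-zeros zero    = refl
  sum-zeros (suc N) = sum-zeros N

  sum≡0⇒zeros : ∀ ls → ℕ.sum ls ≡ 0 → zeros (length ls) ≡ ls
  sum≡0⇒zeros []          eq = refl
  sum≡0⇒zeros (zero ∷ ls) eq = cong (0 ∷_) (sum≡0⇒zeros ls eq)

  -- The weighted number of chains ∅ = λ⁰ ⊂ λ¹ ⊂ ⋯ ⊂ λⁿ of partitions with at most
  -- N rows, adding one cell at a time, evaluated against g.
  walk : ℚ → ℕ → ℕ → (List ℕ → ℚ) → ℚ
  walk x N zero    g = g (zeros N)
  walk x N (suc n) g = walk x N n λ ls → ∑add x ls λ ls′ → ⟦ decreasing? ls′ ⟧ * g ls′

  walk-cong : ∀ x N n {g h : List ℕ → ℚ} →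
    (∀ ls → Decreasing ls → ℕ.sum ls ≡ n → length ls ≡ N → g ls ≡ h ls) → walk x N n g ≡ walk x N n h
  walk-cong x N zero    eq = eq (zeros N) (zeros-decreasing N) (sum-zeros N) (List.length-replicate N)
  walk-cong x N (suc n) eq = walk-cong x N n λ ls dec s len → ∑add-cong x ls λ ls′ s′ len′ →
    ⟦⟧*-cong (decreasing? ls′) λ dec′ → eq ls′ dec′ (trans s′ (cong suc s)) (trans len′ len)

  walk-cong′ : ∀ x N n {g h : List ℕ → ℚ} → (∀ ls → g ls ≡ h ls) → walk x N n g ≡ walk x N n h
  walk-cong′ x N n eq = walk-cong x N n λ ls _ _ _ → eq ls

  walk-+ : ∀ x N n (g h : List ℕ → ℚ) → walk x N n (λ ls → g ls + h ls) ≡ walk x N n g + walk x N n h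
  walk-+ x N zero    g h = refl
  walk-+ x N (suc n) g h = trans
    (walk-cong′ x N n λ ls → trans (∑add-cong x ls λ ls′ _ _ → distribˡ _ _ _) (∑add-+ x ls _ _))
    (walk-+ x N n _ _)

  walk-*ˡ : ∀ x N n c (g : List ℕ → ℚ) → walk x N n (λ ls → c * g ls) ≡ c * walk x N n g
  walk-*ˡ x N zero    c g = refl
  walk-*ˡ x N (suc n) c g = trans
    (walk-cong′ x N n λ ls → trans
      (∑add-cong x ls λ ls′ _ _ → solve 3 (λ d c g → d :* (c :* g) := c :* (d :* g)) refl _ c _)
      (∑add-*ˡ x c ls _))
    (walk-*ˡ x N n c _)

  walk-zero : ∀ x N n → walk x N n (λ _ → 0q) ≡ 0q
  walk-zero x N n = trans (walk-cong′ x N n λ _ → sym (zeroˡ 0q)) (trans (walk-*ˡ x N n 0q (λ _ → 0q)) (zeroˡ _))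

  walk-∑ : ∀ {A : Set} x N n (xs : List A) (g : A → List ℕ → ℚ) →
    walk x N n (λ ls → ∑ xs (λ a → g a ls)) ≡ ∑ xs (λ a → walk x N n (g a))
  walk-∑ x N n []       g = walk-zero x N n
  walk-∑ x N n (a ∷ xs) g = trans (walk-+ x N n _ _) (cong (_+_ _) (walk-∑ x N n xs g))

  firstPart≡0⇒sum≡0 : ∀ {ls} → Decreasing ls → firstPart ls ℕ.≤ 0 → ℕ.sum ls ≡ 0
  firstPart≡0⇒sum≡0 {[]}     _   _      = refl
  firstPart≡0⇒sum≡0 {_ ∷ ls} dec ℕ.z≤n = firstPart≡0⇒sum≡0 (proj₂ (uncons dec)) (proj₁ (uncons dec))

  -- Fewer cells than rows leave the last row of a partition empty; this supplies the hypothesis of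
  -- `∑add-tableaux` along a walk.
  sum<length⇒endsInZero : ∀ {ls} → Decreasing ls → ℕ.sum ls ℕ.< length ls → EndsInZero ls
  sum<length⇒endsInZero {zero ∷ []}      _   _  = [0]
  sum<length⇒endsInZero {suc l ∷ []}     _   (ℕ.s≤s ())
  sum<length⇒endsInZero {zero ∷ p ∷ ps}  dec _  = zero ∷ sum<length⇒endsInZero (proj₂ (uncons dec))
    (subst (ℕ._< suc (length ps)) (sym (firstPart≡0⇒sum≡0 (proj₂ (uncons dec)) (proj₁ (uncons dec)))) ℕ.z<s)
  sum<length⇒endsInZero {suc l ∷ p ∷ ps} dec lt = suc l ∷ sum<length⇒endsInZero (proj₂ (uncons dec))
    (ℕ.≤-<-trans (ℕ.m≤n+m _ l) (ℕ.s<s⁻¹ lt))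

  ∑strip-zeros : ∀ N (g : List ℕ → ℚ) → ∑strip (zeros N) g ≡ g (zeros N)
  ∑strip-zeros zero    g = refl
  ∑strip-zeros (suc N) g = trans (+-identityʳ _) (trans
    (⟦⟧*-true (firstPart (zeros N) ℕ.≤? 0) (first N)) (∑strip-zeros N (g ∘ (0 ∷_))))
    where
    first : ∀ N → firstPart (zeros N) ℕ.≤ 0
    first zero    = ℕ.z≤n
    first (suc N) = ℕ.z≤n

  tableaux-zeros : ∀ N bs → ℕ.sum bs ≡ 0 → tableaux (zeros N) bs ≡ 1q
  tableaux-zeros N []          eq = ⟦⟧-true (ℕ.sum (zeros N) ℕ.≟ 0) (sum-zeros N)
  tableaux-zeros N (zero ∷ bs) eq = trans (∑strip-zeros N _) (trans
    (⟦⟧*-true (ℕ.sum (zeros N) ℕ.≟ ℕ.sum (zeros N) ℕ.+ 0) (sym (ℕ.+-identityʳ _))) (tableaux-zeros N bs eq))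

  -- multichoose x a = x (x + 1) ⋯ (x + a − 1) / a!
  multichoose : ℚ → ℕ → ℚ
  multichoose x zero    = 1q
  multichoose x (suc a) = multichoose x a * ((x + ι a) * ι (suc a) ⁻¹)

  multichoose-suc : ∀ x a → ι (suc a) * multichoose x (suc a) ≡ (x + ι a) * multichoose x a
  multichoose-suc x a = trans
    (solve 4 (λ s m w i → s :* (m :* (w :* i)) := s :* i :* (w :* m)) refl _ _ _ _)
    (trans (cong (_* ((x + ι a) * multichoose x a)) (⁻¹-inverse (ι-suc≢0 a))) (*-identityˡ _))

  ∏-sum≡0 : ∀ x bs → ℕ.sum bs ≡ 0 → ∏ bs (multichoose x) ≡ 1q
  ∏-sum≡0 x []          eq = refl
  ∏-sum≡0 x (zero ∷ bs) eq = trans (*-identityˡ _) (∏-sum≡0 x bs eq)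

  -- By `multichoose-suc`, lowering an exponent b + 1 returns the whole product times b + 1, and the
  -- exponents add up to the degree.
  ∑lower-∏ : ∀ x bs → ∑lower x bs (λ bs′ → ∏ bs′ (multichoose x)) ≡ ι (ℕ.sum bs) * ∏ bs (multichoose x)
  ∑lower-∏ x []           = sym (zeroˡ _)
  ∑lower-∏ x (zero ∷ bs)  = trans (∑lower-*ˡ x 1q bs _) (trans (cong (_*_ 1q) (∑lower-∏ x bs))
    (solve 2 (λ s p → con (+ 1) :* (s :* p) := s :* (con (+ 1) :* p)) refl _ _))
  ∑lower-∏ x (suc b ∷ bs) = begin
    (x + ι b) * (multichoose x b * P) + ∑lower x bs (λ bs′ → m * ∏ bs′ (multichoose x))
      ≡⟨ cong₂ _+_ (trans (sym (*-assoc _ _ _)) (cong (_* P) (sym (multichoose-suc x b))))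
                   (trans (∑lower-*ˡ x m bs _) (cong (_*_ m) (∑lower-∏ x bs))) ⟩
    ι (suc b) * m * P + m * (ι (ℕ.sum bs) * P)
      ≡⟨ solve 4 (λ b m p s → b :* m :* p :+ m :* (s :* p) := (b :+ s) :* (m :* p)) refl _ m P _ ⟩
    (ι (suc b) + ι (ℕ.sum bs)) * (m * P)
      ≡⟨ cong (_* (m * P)) (ι-+ (suc b) (ℕ.sum bs)) ⟨
    ι (suc b ℕ.+ ℕ.sum bs) * (m * P) ∎
    where
    open ≡-Reasoning
    m = multichoose x (suc b)
    P = ∏ bs (multichoose x)

  -- The last step of the walk, passed through the tableau count, becomes `∑lower` on the weight, so
  -- both sides obey the same recurrence. The bound n ≤ N keeps an empty row before every step.
  walk-tableaux : ∀ x N n bs → n ℕ.≤ N → ℕ.sum bs ≡ n →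
    walk x N n (λ ls → tableaux ls bs) ≡ ι (n !) * ∏ bs (multichoose x)
  walk-tableaux x N zero    bs _   sum≡ = trans (tableaux-zeros N bs sum≡)
    (sym (trans (*-identityˡ _) (∏-sum≡0 x bs sum≡)))
  walk-tableaux x N (suc n) bs n<N sum≡ = begin
    walk x N n (λ ls → ∑add x ls (λ ls′ → ⟦ decreasing? ls′ ⟧ * tableaux ls′ bs))
      ≡⟨ walk-cong x N n (λ ls dec s len → trans
           (∑add-cong x ls λ ls′ _ _ → absorb ls′)
           (∑add-tableaux x (sum<length⇒endsInZero dec (subst₂ ℕ._<_ (sym s) (sym len) n<N)) dec bs)) ⟩
    walk x N n (λ ls → ∑lower x bs (tableaux ls))
      ≡⟨ ∑lower-linear (walk x N n) (walk-cong′ x N n) (walk-+ x N n) (walk-*ˡ x N n) x bs (λ bs′ ls → tableaux ls bs′) ⟨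
    ∑lower x bs (λ bs′ → walk x N n (λ ls → tableaux ls bs′))
      ≡⟨ ∑lower-cong x bs (λ bs′ s → walk-tableaux x N n bs′ (ℕ.<⇒≤ n<N) (ℕ.suc-injective (trans s sum≡))) ⟩
    ∑lower x bs (λ bs′ → ι (n !) * ∏ bs′ (multichoose x))
      ≡⟨ trans (∑lower-*ˡ x (ι (n !)) bs _) (cong (_*_ (ι (n !))) (trans (∑lower-∏ x bs) (cong (λ k → ι k * ∏ bs (multichoose x)) sum≡))) ⟩
    ι (n !) * (ι (suc n) * ∏ bs (multichoose x))
      ≡⟨ solve 3 (λ f s p → f :* (s :* p) := s :* f :* p) refl _ _ _ ⟩
    ι (suc n) * ι (n !) * ∏ bs (multichoose x)
      ≡⟨ cong (_* ∏ bs (multichoose x)) (ι-* (suc n) (n !)) ⟨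
    ι (suc n !) * ∏ bs (multichoose x) ∎
    where
    open ≡-Reasoning
    absorb : ∀ ls → ⟦ decreasing? ls ⟧ * tableaux ls bs ≡ tableaux ls bs
    absorb ls with decreasing? ls
    ... | yes _   = *-identityˡ _
    ... | no ¬dec = trans (zeroˡ _) (sym (tableaux-nonDecreasing ls bs ¬dec))

  ∑remove : List ℕ → (List ℕ → ℚ) → ℚ
  ∑remove []           g = 0q
  ∑remove (zero ∷ ls)  g = ∑remove ls (g ∘ (zero ∷_))
  ∑remove (suc l ∷ ls) g = g (l ∷ ls) + ∑remove ls (g ∘ (suc l ∷_))

  -- The adjoint of `∑add`; the weight belongs to the cell that is removed.
  ∑remove-weighted : ℚ → List ℕ → (List ℕ → ℚ) → ℚ
  ∑remove-weighted y []           g = 0q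
  ∑remove-weighted y (zero ∷ ls)  g = ∑remove-weighted (y - 1q) ls (g ∘ (zero ∷_))
  ∑remove-weighted y (suc l ∷ ls) g = (y + ι l) * g (l ∷ ls) + ∑remove-weighted (y - 1q) ls (g ∘ (suc l ∷_))

  ∑remove-weighted-cong : ∀ y ls {g h : List ℕ → ℚ} →
    (∀ ls′ → suc (ℕ.sum ls′) ≡ ℕ.sum ls → length ls′ ≡ length ls → g ls′ ≡ h ls′) →
    ∑remove-weighted y ls g ≡ ∑remove-weighted y ls h
  ∑remove-weighted-cong y []           eq = refl
  ∑remove-weighted-cong y (zero ∷ ls)  eq = ∑remove-weighted-cong (y - 1q) ls (λ ls′ s len → eq (zero ∷ ls′) s (cong suc len))
  ∑remove-weighted-cong y (suc l ∷ ls) eq = cong₂ _+_ (cong (_*_ _) (eq (l ∷ ls) refl refl))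
    (∑remove-weighted-cong (y - 1q) ls λ ls′ s len →
      eq (suc l ∷ ls′) (cong suc (trans (sym (ℕ.+-suc l _)) (cong (l ℕ.+_) s))) (cong suc len))

  ∑remove-weighted-linear : (L : (List ℕ → ℚ) → ℚ) → (∀ {g h} → (∀ ls → g ls ≡ h ls) → L g ≡ L h) →
    (∀ g h → L (λ ls → g ls + h ls) ≡ L g + L h) → (∀ c g → L (λ ls → c * g ls) ≡ c * L g) →
    ∀ y μ (g : List ℕ → List ℕ → ℚ) →
    ∑remove-weighted y μ (λ μ′ → L (g μ′)) ≡ L (λ ls → ∑remove-weighted y μ (λ μ′ → g μ′ ls))
  ∑remove-weighted-linear L L-cong L-+ L-* = go
    where
    L0 : L (λ _ → 0q) ≡ 0q
    L0 = trans (L-cong λ _ → sym (zeroˡ 0q)) (trans (L-* 0q (λ _ → 0q)) (zeroˡ _))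

    go : ∀ y μ (g : List ℕ → List ℕ → ℚ) →
      ∑remove-weighted y μ (λ μ′ → L (g μ′)) ≡ L (λ ls → ∑remove-weighted y μ (λ μ′ → g μ′ ls))
    go y []          g = sym L0
    go y (zero ∷ μ)  g = go (y - 1q) μ (g ∘ (zero ∷_))
    go y (suc m ∷ μ) g = trans (cong₂ _+_ (sym (L-* _ _)) (go (y - 1q) μ (g ∘ (suc m ∷_)))) (sym (L-+ _ _))

  ∑remove-weighted-*ˡ : ∀ y c μ (g : List ℕ → ℚ) → ∑remove-weighted y μ (λ μ′ → c * g μ′) ≡ c * ∑remove-weighted y μ g
  ∑remove-weighted-*ˡ y c []          g = sym (zeroʳ c)
  ∑remove-weighted-*ˡ y c (zero ∷ μ)  g = ∑remove-weighted-*ˡ (y - 1q) c μ (g ∘ (zero ∷_))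
  ∑remove-weighted-*ˡ y c (suc m ∷ μ) g = trans (cong (_+_ _) (∑remove-weighted-*ˡ (y - 1q) c μ (g ∘ (suc m ∷_))))
    (solve 4 (λ w c a b → w :* (c :* a) :+ c :* b := c :* (w :* a :+ b)) refl _ c _ _)

  ∑remove-weighted-zero : ∀ y μ {g : List ℕ → ℚ} → (∀ μ′ → length μ′ ≡ length μ → g μ′ ≡ 0q) → ∑remove-weighted y μ g ≡ 0q
  ∑remove-weighted-zero y μ g0 = trans (∑remove-weighted-cong y μ λ μ′ _ len → trans (g0 μ′ len) (sym (zeroˡ 0q)))
    (trans (∑remove-weighted-*ˡ y 0q μ (λ _ → 0q)) (zeroˡ _))

  _≟ℓ_ : DecidableEquality (List ℕ)
  _≟ℓ_ = List.≡-dec ℕ._≟_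

  ⟦∷≟∷⟧ : ∀ l m ls ms → ⟦ (l ∷ ls) ≟ℓ (m ∷ ms) ⟧ ≡ ⟦ l ℕ.≟ m ⟧ * ⟦ ls ≟ℓ ms ⟧
  ⟦∷≟∷⟧ l m ls ms = trans
    (⟦⟧-cong ((l ∷ ls) ≟ℓ (m ∷ ms)) (l ℕ.≟ m ×-dec ls ≟ℓ ms) List.∷-injective (λ (p , q) → cong₂ _∷_ p q))
    (⟦⟧-× (l ℕ.≟ m) (ls ≟ℓ ms))

  -- Adding a cell to `ls` gives μ exactly when removing that cell from μ gives `ls`, and then the
  -- weight is the same whether read off `ls` or μ.
  ∑add-δ : ∀ y ls μ → ∑add y ls (λ ls′ → ⟦ ls′ ≟ℓ μ ⟧) ≡ ∑remove-weighted y μ (λ μ′ → ⟦ ls ≟ℓ μ′ ⟧)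
  ∑add-δ y []       μ = sym (∑remove-weighted-zero′ y μ)
    where
    ∑remove-weighted-zero′ : ∀ y μ → ∑remove-weighted y μ (λ μ′ → ⟦ [] ≟ℓ μ′ ⟧) ≡ 0q
    ∑remove-weighted-zero′ y []      = refl
    ∑remove-weighted-zero′ y (m ∷ μ) = ∑remove-weighted-zero y (m ∷ μ) λ where (_ ∷ _) _ → refl
  ∑add-δ y (l ∷ ls) [] = trans (∑add-cong y (l ∷ ls) {λ ls′ → ⟦ ls′ ≟ℓ [] ⟧} {λ _ → 0q} λ where (_ ∷ _) _ _ → refl) (∑add-zero y (l ∷ ls))
  ∑add-δ y (l ∷ ls) (m ∷ μ) = trans
    (cong (_+_ _) (begin
      ∑add (y - 1q) ls (λ ls′ → ⟦ (l ∷ ls′) ≟ℓ (m ∷ μ) ⟧)             ≡⟨ ∑add-cong (y - 1q) ls (λ ls′ _ _ → ⟦∷≟∷⟧ l m ls′ μ) ⟩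
      ∑add (y - 1q) ls (λ ls′ → ⟦ l ℕ.≟ m ⟧ * ⟦ ls′ ≟ℓ μ ⟧)           ≡⟨ ∑add-*ˡ (y - 1q) ⟦ l ℕ.≟ m ⟧ ls _ ⟩
      ⟦ l ℕ.≟ m ⟧ * ∑add (y - 1q) ls (λ ls′ → ⟦ ls′ ≟ℓ μ ⟧)           ≡⟨ cong (_*_ _) (∑add-δ (y - 1q) ls μ) ⟩
      ⟦ l ℕ.≟ m ⟧ * ∑remove-weighted (y - 1q) μ (λ μ′ → ⟦ ls ≟ℓ μ′ ⟧) ≡⟨ ∑remove-weighted-*ˡ (y - 1q) ⟦ l ℕ.≟ m ⟧ μ _ ⟨
      ∑remove-weighted (y - 1q) μ (λ μ′ → ⟦ l ℕ.≟ m ⟧ * ⟦ ls ≟ℓ μ′ ⟧) ≡⟨ ∑remove-weighted-cong (y - 1q) μ (λ μ′ _ _ → ⟦∷≟∷⟧ l m ls μ′) ⟨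
      ∑remove-weighted (y - 1q) μ (λ μ′ → ⟦ (l ∷ ls) ≟ℓ (m ∷ μ′) ⟧)   ∎))
    (first-row m)
    where
    open ≡-Reasoning
    first-row : ∀ m → (y + ι l) * ⟦ (suc l ∷ ls) ≟ℓ (m ∷ μ) ⟧ + ∑remove-weighted (y - 1q) μ (λ μ′ → ⟦ (l ∷ ls) ≟ℓ (m ∷ μ′) ⟧) ≡
      ∑remove-weighted y (m ∷ μ) (λ μ′ → ⟦ (l ∷ ls) ≟ℓ μ′ ⟧)
    first-row zero    = trans
      (cong (_+ ∑remove-weighted (y - 1q) μ (λ μ′ → ⟦ (l ∷ ls) ≟ℓ (0 ∷ μ′) ⟧))
        (trans (cong (_*_ _) (⟦⟧-false ((suc l ∷ ls) ≟ℓ (0 ∷ μ)) λ ())) (zeroʳ _)))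
      (+-identityˡ _)
    first-row (suc m) = cong (_+ ∑remove-weighted (y - 1q) μ (λ μ′ → ⟦ (l ∷ ls) ≟ℓ (suc m ∷ μ′) ⟧)) (begin
      (y + ι l) * ⟦ (suc l ∷ ls) ≟ℓ (suc m ∷ μ) ⟧    ≡⟨ cong (_*_ _) (⟦⟧-cong ((suc l ∷ ls) ≟ℓ (suc m ∷ μ)) ((l ∷ ls) ≟ℓ (m ∷ μ)) (λ { refl → refl }) (λ { refl → refl })) ⟩
      (y + ι l) * ⟦ (l ∷ ls) ≟ℓ (m ∷ μ) ⟧            ≡⟨ *-comm _ _ ⟩
      ⟦ (l ∷ ls) ≟ℓ (m ∷ μ) ⟧ * (y + ι l)            ≡⟨ ⟦⟧*-cong ((l ∷ ls) ≟ℓ (m ∷ μ)) (λ { refl → refl }) ⟩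
      ⟦ (l ∷ ls) ≟ℓ (m ∷ μ) ⟧ * (y + ι m)            ≡⟨ *-comm _ _ ⟩
      (y + ι m) * ⟦ (l ∷ ls) ≟ℓ (m ∷ μ) ⟧            ∎)

  rowProduct : ℚ → ℕ → ℚ
  rowProduct y zero    = 1q
  rowProduct y (suc l) = rowProduct y l * (y + ι l)

  -- The product of y plus the content over all cells; contents drop by one from each row to the
  -- next.
  contentProduct : ℚ → List ℕ → ℚ
  contentProduct y []       = 1q
  contentProduct y (l ∷ ls) = rowProduct y l * contentProduct (y - 1q) ls

  contentProduct-zeros : ∀ y N → contentProduct y (zeros N) ≡ 1q
  contentProduct-zeros y zero    = refl
  contentProduct-zeros y (suc N) = trans (*-identityˡ _) (contentProduct-zeros (y - 1q) N)

  -- The weight of the removed cell is the factor that the smaller content product lacks.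
  ∑remove-contentProduct : ∀ y μ (g : List ℕ → ℚ) →
    ∑remove-weighted y μ (λ μ′ → g μ′ * contentProduct y μ′) ≡ ∑remove μ g * contentProduct y μ
  ∑remove-contentProduct y []          g = sym (zeroˡ _)
  ∑remove-contentProduct y (zero ∷ μ)  g = trans
    (∑remove-weighted-cong (y - 1q) μ λ μ′ _ _ → solve 2 (λ a b → a :* (con (+ 1) :* b) := a :* b) refl _ _)
    (trans (∑remove-contentProduct (y - 1q) μ (g ∘ (zero ∷_)))
      (solve 2 (λ a b → a :* b := a :* (con (+ 1) :* b)) refl _ _))
  ∑remove-contentProduct y (suc m ∷ μ) g = begin
    (y + ι m) * (g (m ∷ μ) * (rowProduct y m * C)) + ∑remove-weighted (y - 1q) μ (λ μ′ → g (suc m ∷ μ′) * (r * contentProduct (y - 1q) μ′))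
      ≡⟨ cong (_+_ _) (trans
           (∑remove-weighted-cong (y - 1q) μ λ μ′ _ _ → solve 3 (λ g r c → g :* (r :* c) := r :* (g :* c)) refl _ r _)
           (trans (∑remove-weighted-*ˡ (y - 1q) r μ _) (cong (_*_ r) (∑remove-contentProduct (y - 1q) μ (g ∘ (suc m ∷_)))))) ⟩
    (y + ι m) * (g (m ∷ μ) * (rowProduct y m * C)) + r * (∑remove μ (g ∘ (suc m ∷_)) * C)
      ≡⟨ solve 5 (λ w g p c d → w :* (g :* (p :* c)) :+ p :* w :* (d :* c) := (g :+ d) :* (p :* w :* c)) refl (y + ι m) _ (rowProduct y m) C _ ⟩
    (g (m ∷ μ) + ∑remove μ (g ∘ (suc m ∷_))) * (r * C) ∎
    where
    open ≡-Reasoning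
    r = rowProduct y (suc m)
    C = contentProduct (y - 1q) μ

  ∑strip-none : ∀ {ls} → Decreasing ls → (g : List ℕ → ℚ) →
    ∑strip ls (λ ρ → ⟦ ℕ.sum ls ℕ.≟ ℕ.sum ρ ⟧ * g ρ) ≡ g ls
  ∑strip-none {[]}     dec g = *-identityˡ _
  ∑strip-none {l ∷ ls} dec g = trans (∑-upTo-last l _) (trans (cong₂ _+_
    (trans (∑-cong∈ (upTo l) λ {m} m∈ → trans (cong (_*_ _) (trans
        (∑strip-cong ls λ {ρ} strip → ⟦⟧*-false (l ℕ.+ ℕ.sum ls ℕ.≟ m ℕ.+ ℕ.sum ρ)
          (ℕ.>⇒≢ (ℕ.+-mono-<-≤ (∈.∈-upTo⁻ m∈) (Strip⇒sum≤ strip))))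
        (∑strip-zero ls))) (zeroʳ _)) (∑-zero (upTo l)))
    (trans (⟦⟧*-true (firstPart ls ℕ.≤? l) (proj₁ (uncons dec))) (trans
      (∑strip-cong ls λ {ρ} _ → cong (_* g (l ∷ ρ)) (⟦⟧-cong (l ℕ.+ ℕ.sum ls ℕ.≟ l ℕ.+ ℕ.sum ρ) (ℕ.sum ls ℕ.≟ ℕ.sum ρ)
        (ℕ.+-cancelˡ-≡ l _ _) (cong (l ℕ.+_))))
      (∑strip-none (proj₂ (uncons dec)) (g ∘ (l ∷_))))))
    (+-identityˡ _))

  -- A strip with one cell is a removable cell. `∑remove` shortens every nonempty row, but g
  -- vanishes wherever the result is not a partition.
  ∑strip-one : ∀ {ls} → Decreasing ls → (g : List ℕ → ℚ) → (∀ ρ → ¬ Decreasing ρ → g ρ ≡ 0q) →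
    ∑strip ls (λ ρ → ⟦ ℕ.sum ls ℕ.≟ ℕ.sum ρ ℕ.+ 1 ⟧ * g ρ) ≡ ∑remove ls g
  ∑strip-one {[]}        dec g g0 = zeroˡ _
  ∑strip-one {zero ∷ ls} dec g g0 = trans (+-identityʳ _) (trans
    (⟦⟧*-true (firstPart ls ℕ.≤? 0) (proj₁ (uncons dec)))
    (∑strip-one (proj₂ (uncons dec)) (g ∘ (zero ∷_)) λ ρ ¬dec → g0 (0 ∷ ρ) (¬dec ∘ proj₂ ∘ uncons)))
  ∑strip-one {suc l ∷ ls} dec g g0 = begin
    ∑ (upTo (suc (suc l))) (λ m → ⟦ firstPart ls ℕ.≤? m ⟧ * row m)
      ≡⟨ trans (∑-upTo-last (suc l) _) (cong (_+ ⟦ firstPart ls ℕ.≤? suc l ⟧ * row (suc l)) (∑-upTo-last l _)) ⟩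
    ∑ (upTo l) (λ m → ⟦ firstPart ls ℕ.≤? m ⟧ * row m) + ⟦ firstPart ls ℕ.≤? l ⟧ * row l + ⟦ firstPart ls ℕ.≤? suc l ⟧ * row (suc l)
      ≡⟨ cong₂ _+_ (cong₂ _+_ short (trans (cong (_*_ _) exact) absorb))
           (trans (⟦⟧*-true (firstPart ls ℕ.≤? suc l) (proj₁ (uncons dec))) long) ⟩
    0q + g (l ∷ ls) + ∑remove ls (g ∘ (suc l ∷_))
      ≡⟨ cong (_+ ∑remove ls (g ∘ (suc l ∷_))) (+-identityˡ _) ⟩
    g (l ∷ ls) + ∑remove ls (g ∘ (suc l ∷_)) ∎
    where
    open ≡-Reasoning
    row : ℕ → ℚ
    row m = ∑strip ls (λ ρ → ⟦ suc l ℕ.+ ℕ.sum ls ℕ.≟ m ℕ.+ ℕ.sum ρ ℕ.+ 1 ⟧ * g (m ∷ ρ))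

    short : ∑ (upTo l) (λ m → ⟦ firstPart ls ℕ.≤? m ⟧ * row m) ≡ 0q
    short = trans (∑-cong∈ (upTo l) λ {m} m∈ → trans (cong (_*_ _) (trans
        (∑strip-cong ls λ {ρ} strip → ⟦⟧*-false (suc l ℕ.+ ℕ.sum ls ℕ.≟ m ℕ.+ ℕ.sum ρ ℕ.+ 1) λ eq →
          ℕ.>⇒≢ (ℕ.+-mono-<-≤ (∈.∈-upTo⁻ m∈) (Strip⇒sum≤ strip)) (ℕ.suc-injective (trans eq (ℕ.+-comm _ 1))))
        (∑strip-zero ls))) (zeroʳ _)) (∑-zero (upTo l))

    exact : row l ≡ g (l ∷ ls)
    exact = trans
      (∑strip-cong ls λ {ρ} _ → cong (_* g (l ∷ ρ)) (⟦⟧-cong (suc l ℕ.+ ℕ.sum ls ℕ.≟ l ℕ.+ ℕ.sum ρ ℕ.+ 1) (ℕ.sum ls ℕ.≟ ℕ.sum ρ)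
        (λ eq → ℕ.+-cancelˡ-≡ l _ _ (ℕ.suc-injective (trans eq (ℕ.+-comm _ 1))))
        (λ eq → trans (cong (λ k → suc l ℕ.+ k) eq) (ℕ.+-comm 1 _))))
      (∑strip-none (proj₂ (uncons dec)) (g ∘ (l ∷_)))

    absorb : ⟦ firstPart ls ℕ.≤? l ⟧ * g (l ∷ ls) ≡ g (l ∷ ls)
    absorb with firstPart ls ℕ.≤? l
    ... | yes _   = *-identityˡ _
    ... | no  p≰l = trans (zeroˡ _) (sym (g0 (l ∷ ls) (p≰l ∘ proj₁ ∘ uncons)))

    long : row (suc l) ≡ ∑remove ls (g ∘ (suc l ∷_))
    long = trans
      (∑strip-cong ls λ {ρ} _ → cong (_* g (suc l ∷ ρ)) (⟦⟧-cong (suc l ℕ.+ ℕ.sum ls ℕ.≟ suc l ℕ.+ ℕ.sum ρ ℕ.+ 1) (ℕ.sum ls ℕ.≟ ℕ.sum ρ ℕ.+ 1)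
        (λ eq → ℕ.+-cancelˡ-≡ (suc l) _ _ (trans eq (ℕ.+-assoc (suc l) _ 1)))
        (λ eq → trans (cong (λ k → suc l ℕ.+ k) eq) (sym (ℕ.+-assoc (suc l) _ 1)))))
      (∑strip-one (proj₂ (uncons dec)) (g ∘ (suc l ∷_)) λ ρ ¬dec → g0 (suc l ∷ ρ) (¬dec ∘ proj₂ ∘ uncons))

  -- All chains from ∅ to μ add the same cells and have weight `contentProduct x μ`, and the chains
  -- are the standard tableaux of shape μ. The induction removes the cell added last.
  walk-δ : ∀ x N n μ → length μ ≡ N → ℕ.sum μ ≡ n →
    walk x N n (λ ls → ⟦ ls ≟ℓ μ ⟧) ≡ tableaux μ (replicate n 1) * contentProduct x μ
  walk-δ x N zero    μ refl sum≡ = begin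
    ⟦ zeros N ≟ℓ μ ⟧                          ≡⟨ ⟦⟧-true (zeros N ≟ℓ μ) (sum≡0⇒zeros μ sum≡) ⟩
    1q                                        ≡⟨ *-identityˡ 1q ⟨
    1q * 1q                                   ≡⟨ cong₂ _*_ (⟦⟧-true (ℕ.sum μ ℕ.≟ 0) sum≡) (contentProduct-zeros x N) ⟨
    tableaux μ [] * contentProduct x (zeros N) ≡⟨ cong (λ ν → tableaux μ [] * contentProduct x ν) (sum≡0⇒zeros μ sum≡) ⟩
    tableaux μ [] * contentProduct x μ        ∎
    where open ≡-Reasoning
  walk-δ x N (suc n) μ len sum≡ with decreasing? μ
  ... | no ¬dec = trans
    (walk-cong′ x N n λ ls → trans (∑add-cong x ls λ ls′ _ _ → vanish ls′) (∑add-zero x ls))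
    (trans (walk-zero x N n) (sym (trans (cong (_* contentProduct x μ) (tableaux-nonDecreasing μ (1 ∷ replicate n 1) ¬dec)) (zeroˡ _))))
    where
    vanish : ∀ ls → ⟦ decreasing? ls ⟧ * ⟦ ls ≟ℓ μ ⟧ ≡ 0q
    vanish ls = trans (sym (⟦⟧-× (decreasing? ls) (ls ≟ℓ μ)))
      (⟦⟧-false (decreasing? ls ×-dec ls ≟ℓ μ) λ { (dec , refl) → ¬dec dec })
  ... | yes dec = begin
    walk x N n (λ ls → ∑add x ls (λ ls′ → ⟦ decreasing? ls′ ⟧ * ⟦ ls′ ≟ℓ μ ⟧))
      ≡⟨ walk-cong′ x N n (λ ls → trans
           (∑add-cong x ls λ ls′ _ _ → trans (sym (⟦⟧-× (decreasing? ls′) (ls′ ≟ℓ μ)))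
             (⟦⟧-cong (decreasing? ls′ ×-dec ls′ ≟ℓ μ) (ls′ ≟ℓ μ) proj₂ λ { refl → dec , refl }))
           (∑add-δ x ls μ)) ⟩
    walk x N n (λ ls → ∑remove-weighted x μ (λ μ′ → ⟦ ls ≟ℓ μ′ ⟧))
      ≡⟨ ∑remove-weighted-linear (walk x N n) (walk-cong′ x N n) (walk-+ x N n) (walk-*ˡ x N n) x μ (λ μ′ ls → ⟦ ls ≟ℓ μ′ ⟧) ⟨
    ∑remove-weighted x μ (λ μ′ → walk x N n (λ ls → ⟦ ls ≟ℓ μ′ ⟧))
      ≡⟨ ∑remove-weighted-cong x μ (λ μ′ s len′ → walk-δ x N n μ′ (trans len′ len) (ℕ.suc-injective (trans s sum≡))) ⟩
    ∑remove-weighted x μ (λ μ′ → tableaux μ′ (replicate n 1) * contentProduct x μ′)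
      ≡⟨ ∑remove-contentProduct x μ (λ μ′ → tableaux μ′ (replicate n 1)) ⟩
    ∑remove μ (λ μ′ → tableaux μ′ (replicate n 1)) * contentProduct x μ
      ≡⟨ cong (_* contentProduct x μ) (∑strip-one dec (λ μ′ → tableaux μ′ (replicate n 1)) (λ ρ → tableaux-nonDecreasing ρ (replicate n 1))) ⟨
    tableaux μ (replicate (suc n) 1) * contentProduct x μ ∎
    where open ≡-Reasoning

-- From zero-padded rows to partitions of n

module Partitions where
  open Rationals
  open Sums
  open Rook
  open Strips
  open Walks

  open import Data.List.Base using (concatMap)
  import Data.List.Relation.Unary.Unique.DecPropositional.Properties as DecUnique
  open import Data.Nat.ListAction.Properties using (sum-++)

  private variable
    m n : ℕ

  partition-≡ : {μ ν : Partition n} → parts μ ≡ parts ν → μ ≡ ν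
  partition-≡ {μ = mkPartition ps d p t} {mkPartition .ps d′ p′ t′} refl
    with Linked.irrelevant ℕ.≤-irrelevant d d′ | All.irrelevant ℕ.≤-irrelevant p p′ | ℕ.≡-irrelevant t t′
  ... | refl | refl | refl = refl

  _≟ₚ_ : DecidableEquality (Partition n)
  μ ≟ₚ ν with List.≡-dec ℕ._≟_ (parts μ) (parts ν)
  ... | yes eq = yes (partition-≡ eq)
  ... | no  ≢  = no (≢ ∘ cong parts)

  IsPartition : ℕ → List ℕ → Set
  IsPartition n xs = Decreasing xs × All (0 ℕ.<_) xs × ℕ.sum xs ≡ n

  isPartition? : ∀ n → Decidable (IsPartition n)
  isPartition? n xs = decreasing? xs ×-dec All.all? (0 ℕ.<?_) xs ×-dec ℕ.sum xs ℕ.≟ n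

  fromParts : ∀ n → List ℕ → List (Partition n)
  fromParts n xs with isPartition? n xs
  ... | yes (d , p , t) = mkPartition xs d p t ∷ []
  ... | no  _           = []

  ∈-fromParts : (μ : Partition n) → μ ∈ fromParts n (parts μ)
  ∈-fromParts {n} μ with isPartition? n (parts μ)
  ... | yes _ = here (partition-≡ refl)
  ... | no ¬p = contradiction (decreasing μ , positive μ , total μ) ¬p

  opaque
    -- All lists of at most n parts, each at most n, are tested. Deduplication makes the enumeration
    -- repetition-free, and it is used only through membership and uniqueness.
    partitions : ∀ n → List (Partition n)
    partitions n = deduplicate _≟ₚ_ (concatMap (fromParts n) (concatMap (rowFillings (suc n)) (upTo (suc n))))

  length≤sum : ∀ {xs} → All (0 ℕ.<_) xs → length xs ℕ.≤ ℕ.sum xs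
  length≤sum []       = ℕ.z≤n
  length≤sum (p ∷ ps) = ℕ.+-mono-≤ p (length≤sum ps)

  ∈⇒≤sum : ∀ {x xs} → x ∈ xs → x ℕ.≤ ℕ.sum xs
  ∈⇒≤sum (here refl) = ℕ.m≤m+n _ _
  ∈⇒≤sum {xs = y ∷ _} (there x∈) = ℕ.≤-trans (∈⇒≤sum x∈) (ℕ.m≤n+m _ y)

  length-parts : (μ : Partition n) → length (parts μ) ℕ.≤ n
  length-parts μ = subst (length (parts μ) ℕ.≤_) (total μ) (length≤sum (positive μ))

  ∈-rowFillings⁺ : ∀ {k xs} → All (ℕ._< k) xs → xs ∈ rowFillings k (length xs)
  ∈-rowFillings⁺ []       = here refl
  ∈-rowFillings⁺ (p ∷ ps) = ∈.∈-cartesianProductWith⁺ _∷_ (∈.∈-upTo⁺ p) (∈-rowFillings⁺ ps)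

  opaque
    unfolding partitions

    ∈-partitions : (μ : Partition n) → μ ∈ partitions n
    ∈-partitions {n} μ = ∈.∈-deduplicate⁺ _≟ₚ_ (∈.∈-concatMap⁺ (fromParts n) (Any.map (λ { refl → ∈-fromParts μ })
      (∈.∈-concatMap⁺ (rowFillings (suc n)) (Any.map (λ { refl → ∈-rowFillings⁺ bound }) (∈.∈-upTo⁺ (ℕ.s≤s (length-parts μ)))))))
      where
      bound : All (ℕ._< suc n) (parts μ)
      bound = All.tabulate λ {x} x∈ → ℕ.s≤s (subst (x ℕ.≤_) (total μ) (∈⇒≤sum x∈))

    partitions-unique : ∀ n → Unique (partitions n)
    partitions-unique n = DecUnique.deduplicate-! _≟ₚ_ _

  ∑-partitions-δ : (μ : Partition n) (f : Partition n → ℚ) → ∑ (partitions n) (λ ν → ⟦ ν ≟ₚ μ ⟧ * f ν) ≡ f μ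
  ∑-partitions-δ {n} μ f = ∑-δ _≟ₚ_ f (partitions-unique n) (∈-partitions μ)

  -- The shapes reached by a walk have exactly n rows; with zeros appended a partition can be
  -- compared with them.
  padded : Partition n → List ℕ
  padded {n} μ = parts μ ++ zeros (n ∸ length (parts μ))

  length-padded : (μ : Partition n) → length (padded μ) ≡ n
  length-padded {n} μ = trans (List.length-++ (parts μ))
    (trans (cong (length (parts μ) ℕ.+_) (List.length-replicate _)) (ℕ.m+[n∸m]≡n (length-parts μ)))

  sum-padded : (μ : Partition n) → ℕ.sum (padded μ) ≡ n
  sum-padded {n} μ = trans (sum-++ (parts μ) _)
    (trans (cong (ℕ.sum (parts μ) ℕ.+_) (sum-zeros (n ∸ length (parts μ)))) (trans (ℕ.+-identityʳ _) (total μ)))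

  nonzero : List ℕ → List ℕ
  nonzero = filter (0 ℕ.<?_)

  nonzero-zeros : ∀ k → nonzero (zeros k) ≡ []
  nonzero-zeros zero    = refl
  nonzero-zeros (suc k) = nonzero-zeros k

  nonzero-padded : (μ : Partition n) → nonzero (padded μ) ≡ parts μ
  nonzero-padded {n} μ = begin
    nonzero (padded μ)                         ≡⟨ List.filter-++ (0 ℕ.<?_) (parts μ) _ ⟩
    nonzero (parts μ) ++ nonzero (zeros (n ∸ length (parts μ)))     ≡⟨ cong₂ _++_ (List.filter-all (0 ℕ.<?_) (positive μ)) (nonzero-zeros (n ∸ length (parts μ))) ⟩
    parts μ ++ []                              ≡⟨ List.++-identityʳ _ ⟩
    parts μ                                    ∎
    where open ≡-Reasoning

  nonzero-++-zeros : ∀ {ls} → Decreasing ls → nonzero ls ++ zeros (length ls ∸ length (nonzero ls)) ≡ ls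
  nonzero-++-zeros {[]}         dec = refl
  nonzero-++-zeros {suc l ∷ ls} dec = cong (suc l ∷_) (nonzero-++-zeros (proj₂ (uncons dec)))
  nonzero-++-zeros {zero ∷ ls}  dec = trans
    (cong (λ xs → xs ++ zeros (suc (length ls) ∸ length xs)) (trans
      (cong nonzero (sym (sum≡0⇒zeros ls sum≡0))) (nonzero-zeros (length ls))))
    (cong (0 ∷_) (sum≡0⇒zeros ls sum≡0))
    where
    sum≡0 : ℕ.sum ls ≡ 0
    sum≡0 = firstPart≡0⇒sum≡0 (proj₂ (uncons dec)) (proj₁ (uncons dec))

  unpadded : ∀ {ls} → Decreasing ls → ℕ.sum ls ≡ n → length ls ≡ n → ∃ λ (μ : Partition n) → padded μ ≡ ls
  unpadded {n} {ls} dec sum≡ refl = μ , nonzero-++-zeros dec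
    where
    μ : Partition n
    μ = mkPartition (nonzero ls) (Linked.filter⁺ (0 ℕ.<?_) (λ p q → ℕ.≤-trans q p) dec) (All.all-filter (0 ℕ.<?_) ls) (begin
      ℕ.sum (nonzero ls)                                        ≡⟨ ℕ.+-identityʳ _ ⟨
      ℕ.sum (nonzero ls) ℕ.+ 0                                  ≡⟨ cong (ℕ.sum (nonzero ls) ℕ.+_) (sum-zeros (length ls ∸ length (nonzero ls))) ⟨
      ℕ.sum (nonzero ls) ℕ.+ ℕ.sum (zeros (length ls ∸ length (nonzero ls))) ≡⟨ sum-++ (nonzero ls) _ ⟨
      ℕ.sum (nonzero ls ++ zeros (length ls ∸ length (nonzero ls))) ≡⟨ cong ℕ.sum (nonzero-++-zeros dec) ⟩
      ℕ.sum ls                                                  ≡⟨ sum≡ ⟩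
      n                                                         ∎)
      where open ≡-Reasoning

  contentProduct-∷ʳ0 : ∀ y ls → contentProduct y (ls ∷ʳ 0) ≡ contentProduct y ls
  contentProduct-∷ʳ0 y []       = *-identityˡ _
  contentProduct-∷ʳ0 y (l ∷ ls) = cong (_*_ _) (contentProduct-∷ʳ0 (y - 1q) ls)

  -- The function g is expanded in delta functions at padded partitions, which `walk-δ` evaluates.
  -- Its insensitivity to trailing zeros allows passing from `padded μ` to `parts μ`.
  walk-partitions : ∀ x n (g : List ℕ → ℚ) → (∀ ls → g (ls ∷ʳ 0) ≡ g ls) →
    walk x n n g ≡ ∑ (partitions n) (λ μ → tableaux (parts μ) (replicate n 1) * contentProduct x (parts μ) * g (parts μ))
  walk-partitions x n g g-∷ʳ0 = begin
    walk x n n g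
      ≡⟨ walk-cong x n n (λ ls dec s len → expand (unpadded dec s len)) ⟩
    walk x n n (λ ls → ∑ (partitions n) (λ μ → g (parts μ) * ⟦ ls ≟ℓ padded μ ⟧))
      ≡⟨ walk-∑ x n n (partitions n) _ ⟩
    ∑ (partitions n) (λ μ → walk x n n (λ ls → g (parts μ) * ⟦ ls ≟ℓ padded μ ⟧))
      ≡⟨ ∑-cong (partitions n) (λ μ → trans (walk-*ˡ x n n (g (parts μ)) _) (trans (*-comm _ _)
           (cong (_* g (parts μ)) (trans (walk-δ x n n (padded μ) (length-padded μ) (sum-padded μ))
             (cong₂ _*_
               (++-replicate0 (λ ls → tableaux ls (replicate n 1)) (λ ls → tableaux-∷ʳ0 ls (replicate n 1)) (n ∸ length (parts μ)) (parts μ))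
               (++-replicate0 (contentProduct x) (contentProduct-∷ʳ0 x) (n ∸ length (parts μ)) (parts μ))))))) ⟩
    ∑ (partitions n) (λ μ → tableaux (parts μ) (replicate n 1) * contentProduct x (parts μ) * g (parts μ)) ∎
    where
    open ≡-Reasoning
    expand : ∀ {ls} → (∃ λ (ν : Partition n) → padded ν ≡ ls) → g ls ≡ ∑ (partitions n) (λ μ → g (parts μ) * ⟦ ls ≟ℓ padded μ ⟧)
    expand (ν , refl) = sym (begin
      ∑ (partitions n) (λ μ → g (parts μ) * ⟦ padded ν ≟ℓ padded μ ⟧)
        ≡⟨ ∑-cong (partitions n) (λ μ → trans (*-comm _ _) (cong (_* g (parts μ)) (⟦⟧-cong (padded ν ≟ℓ padded μ) (μ ≟ₚ ν)
             (λ eq → partition-≡ (trans (sym (nonzero-padded μ)) (trans (cong nonzero (sym eq)) (nonzero-padded ν))))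
             (λ eq → cong padded (sym eq))))) ⟩
      ∑ (partitions n) (λ μ → ⟦ μ ≟ₚ ν ⟧ * g (parts μ))
        ≡⟨ ∑-partitions-δ ν (g ∘ parts) ⟩
      g (parts ν)
        ≡⟨ ++-replicate0 g g-∷ʳ0 (n ∸ length (parts ν)) (parts ν) ⟨
      g (padded ν) ∎)

  -- The coefficients of n! h_n[x X] in the Schur basis.
  schur-expansion : ∀ x n bs → ℕ.sum bs ≡ n →
    ∑ (partitions n) (λ μ → tableaux (parts μ) (replicate n 1) * contentProduct x (parts μ) * tableaux (parts μ) bs) ≡
    ι (n !) * ∏ bs (multichoose x)
  schur-expansion x n bs sum≡ = trans
    (sym (walk-partitions x n (λ ls → tableaux ls bs) (λ ls → tableaux-∷ʳ0 ls bs)))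
    (walk-tableaux x n n bs ℕ.≤-refl sum≡)

-- The power sum expansion of h_n[β X]

module PowerSums where
  open Rationals
  open Sums
  open Rook
  open Strips
  open Tableaux
  open Walks
  open Partitions

  open import Data.Nat.ListAction.Properties using (product-++)

  private variable
    k m n : ℕ

  -- Multiplication by the power sum p_k, in terms of monomial coefficients.
  ∑shift : ℕ → List ℕ → (List ℕ → ℚ) → ℚ
  ∑shift k []      g = 0q
  ∑shift k (x ∷ a) g = ⟦ k ℕ.≤? x ⟧ * g (x ∸ k ∷ a) + ∑shift k a (g ∘ (x ∷_))

  powerSumCoeff : List ℕ → List ℕ → ℚ
  powerSumCoeff []       a = ⟦ a ≟ℓ zeros (length a) ⟧
  powerSumCoeff (k ∷ ks) a = ∑shift k a (powerSumCoeff ks)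

  ∑shift-cong : ∀ k a {g h : List ℕ → ℚ} → (∀ a′ → k ℕ.+ ℕ.sum a′ ≡ ℕ.sum a → g a′ ≡ h a′) → ∑shift k a g ≡ ∑shift k a h
  ∑shift-cong k []      eq = refl
  ∑shift-cong k (x ∷ a) eq = cong₂ _+_
    (⟦⟧*-cong (k ℕ.≤? x) λ k≤x → eq (x ∸ k ∷ a) (trans (sym (ℕ.+-assoc k (x ∸ k) _)) (cong (ℕ._+ ℕ.sum a) (ℕ.m+[n∸m]≡n k≤x))))
    (∑shift-cong k a λ a′ s → eq (x ∷ a′) (trans (x∙yz≈y∙xz k x _) (cong (x ℕ.+_) s)))
    where open import Algebra.Properties.CommutativeSemigroup ℕ.+-commutativeSemigroup using (x∙yz≈y∙xz)

  ∑shift-cong′ : ∀ k a {g h : List ℕ → ℚ} → (∀ a′ → g a′ ≡ h a′) → ∑shift k a g ≡ ∑shift k a h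
  ∑shift-cong′ k a eq = ∑shift-cong k a λ a′ _ → eq a′

  ∑shift-+ : ∀ k a (g h : List ℕ → ℚ) → ∑shift k a (λ a′ → g a′ + h a′) ≡ ∑shift k a g + ∑shift k a h
  ∑shift-+ k []      g h = sym (+-identityˡ _)
  ∑shift-+ k (x ∷ a) g h = trans (cong (_+_ _) (∑shift-+ k a _ _))
    (solve 5 (λ w a b c d → w :* (a :+ b) :+ (c :+ d) := w :* a :+ c :+ (w :* b :+ d)) refl _ _ _ _ _)

  ∑shift-*ˡ : ∀ k a c (g : List ℕ → ℚ) → ∑shift k a (λ a′ → c * g a′) ≡ c * ∑shift k a g
  ∑shift-*ˡ k []      c g = sym (zeroʳ c)
  ∑shift-*ˡ k (x ∷ a) c g = trans (cong (_+_ _) (∑shift-*ˡ k a c _))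
    (solve 4 (λ w c a b → w :* (c :* a) :+ c :* b := c :* (w :* a :+ b)) refl _ c _ _)

  ∑shift-zero : ∀ k a → ∑shift k a (λ _ → 0q) ≡ 0q
  ∑shift-zero k a = trans (∑shift-cong′ k a λ _ → sym (zeroˡ 0q)) (trans (∑shift-*ˡ k a 0q (λ _ → 0q)) (zeroˡ _))

  ∑shift-∑ : ∀ {A : Set} k a (xs : List A) (g : A → List ℕ → ℚ) →
    ∑shift k a (λ a′ → ∑ xs (λ x → g x a′)) ≡ ∑ xs (λ x → ∑shift k a (g x))
  ∑shift-∑ k a []       g = ∑shift-zero k a
  ∑shift-∑ k a (x ∷ xs) g = trans (∑shift-+ k a _ _) (cong (_+_ _) (∑shift-∑ k a xs g))

  -- Multiplications by two power sums commute. A part inserted into a partition lands in the middle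
  -- of the product and has to be moved to the front.
  ∑shift-comm : ∀ j k a (g : List ℕ → ℚ) →
    ∑shift j a (λ a′ → ∑shift k a′ g) ≡ ∑shift k a (λ a′ → ∑shift j a′ g)
  ∑shift-comm j k []      g = refl
  ∑shift-comm j k (x ∷ a) g = begin
    ⟦ j ℕ.≤? x ⟧ * (⟦ k ℕ.≤? x ∸ j ⟧ * g (x ∸ j ∸ k ∷ a) + L) + ∑shift j a (λ a′ → ⟦ k ℕ.≤? x ⟧ * g (x ∸ k ∷ a′) + ∑shift k a′ (g ∘ (x ∷_)))
      ≡⟨ cong (_+_ _) (trans (∑shift-+ j a _ _) (cong (_+ JK) (∑shift-*ˡ j a _ _))) ⟩
    ⟦ j ℕ.≤? x ⟧ * (⟦ k ℕ.≤? x ∸ j ⟧ * g (x ∸ j ∸ k ∷ a) + L) + (⟦ k ℕ.≤? x ⟧ * K + JK)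
      ≡⟨ solve 7 (λ a b c d e f h → a :* (b :* c :+ d) :+ (e :* f :+ h) := a :* b :* c :+ a :* d :+ e :* f :+ h) refl _ _ _ L _ K JK ⟩
    ⟦ j ℕ.≤? x ⟧ * ⟦ k ℕ.≤? x ∸ j ⟧ * g (x ∸ j ∸ k ∷ a) + ⟦ j ℕ.≤? x ⟧ * L + ⟦ k ℕ.≤? x ⟧ * K + JK
      ≡⟨ cong₂ (λ p q → p + ⟦ j ℕ.≤? x ⟧ * L + ⟦ k ℕ.≤? x ⟧ * K + q)
           (cong₂ (λ d y → d * g (y ∷ a)) both (trans (ℕ.∸-+-assoc x j k) (trans (cong (x ∸_) (ℕ.+-comm j k)) (sym (ℕ.∸-+-assoc x k j)))))
           (∑shift-comm j k a (g ∘ (x ∷_))) ⟩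
    ⟦ k ℕ.≤? x ⟧ * ⟦ j ℕ.≤? x ∸ k ⟧ * g (x ∸ k ∸ j ∷ a) + ⟦ j ℕ.≤? x ⟧ * L + ⟦ k ℕ.≤? x ⟧ * K + KJ
      ≡⟨ solve 7 (λ a b c d e f h → a :* b :* c :+ e :* f :+ a :* d :+ h := a :* (b :* c :+ d) :+ (e :* f :+ h)) refl _ _ _ K _ L KJ ⟩
    ⟦ k ℕ.≤? x ⟧ * (⟦ j ℕ.≤? x ∸ k ⟧ * g (x ∸ k ∸ j ∷ a) + K) + (⟦ j ℕ.≤? x ⟧ * L + KJ)
      ≡⟨ cong (_+_ _) (trans (∑shift-+ k a _ _) (cong (_+ KJ) (∑shift-*ˡ k a _ _))) ⟨
    ⟦ k ℕ.≤? x ⟧ * (⟦ j ℕ.≤? x ∸ k ⟧ * g (x ∸ k ∸ j ∷ a) + K) + ∑shift k a (λ a′ → ⟦ j ℕ.≤? x ⟧ * g (x ∸ j ∷ a′) + ∑shift j a′ (g ∘ (x ∷_))) ∎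
    where
    open ≡-Reasoning
    L = ∑shift k a (g ∘ (x ∸ j ∷_))
    K = ∑shift j a (g ∘ (x ∸ k ∷_))
    JK = ∑shift j a (λ a′ → ∑shift k a′ (g ∘ (x ∷_)))
    KJ = ∑shift k a (λ a′ → ∑shift j a′ (g ∘ (x ∷_)))

    swap : ∀ {j k} → j ℕ.≤ x × k ℕ.≤ x ∸ j → k ℕ.≤ x × j ℕ.≤ x ∸ k
    swap {j} {k} (j≤ , k≤) = ℕ.≤-trans k≤ (ℕ.m∸n≤m x j) ,
      ℕ.m+n≤o⇒m≤o∸n j (subst (ℕ._≤ x) (ℕ.+-comm k j) (ℕ.≤-trans (ℕ.+-monoˡ-≤ j k≤) (ℕ.≤-reflexive (ℕ.m∸n+n≡m j≤))))

    both : ⟦ j ℕ.≤? x ⟧ * ⟦ k ℕ.≤? x ∸ j ⟧ ≡ ⟦ k ℕ.≤? x ⟧ * ⟦ j ℕ.≤? x ∸ k ⟧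
    both = trans (sym (⟦⟧-× (j ℕ.≤? x) (k ℕ.≤? x ∸ j))) (trans
      (⟦⟧-cong (j ℕ.≤? x ×-dec k ℕ.≤? x ∸ j) (k ℕ.≤? x ×-dec j ℕ.≤? x ∸ k) swap swap)
      (⟦⟧-× (k ℕ.≤? x) (j ℕ.≤? x ∸ k)))

  ι-oneˢ : ∀ a → ι (oneˢ a) ≡ powerSumCoeff [] a
  ι-oneˢ a = trans (ι-count (a ≟ℓ_) (zeros (length a) ∷ [])) (+-identityʳ _)

  ∑-splittings-one : ∀ a (H : List ℕ → ℚ) →
    ∑ (splittings a) (λ (b , c) → ⟦ b ≟ℓ zeros (length b) ⟧ * H c) ≡ H a
  ∑-splittings-one []      H = trans (+-identityʳ _) (*-identityˡ _)
  ∑-splittings-one (x ∷ a) H = begin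
    ∑ (splittings (x ∷ a)) (λ (b , c) → ⟦ b ≟ℓ zeros (length b) ⟧ * H c)
      ≡⟨ ∑-cartesianProductWith _ (upTo (suc x)) (splittings a) _ ⟩
    ∑ (upTo (suc x)) (λ i → ∑ (splittings a) (λ (b , c) → ⟦ (i ∷ b) ≟ℓ zeros (suc (length b)) ⟧ * H (x ∸ i ∷ c)))
      ≡⟨ ∑-cong (upTo (suc x)) (λ i → trans
           (∑-cong (splittings a) λ (b , c) → trans (cong (_* H (x ∸ i ∷ c)) (⟦∷≟∷⟧ i 0 b (zeros (length b)))) (*-assoc _ _ _))
           (trans (∑-*ˡ ⟦ i ℕ.≟ 0 ⟧ (splittings a) _) (cong (_*_ _) (∑-splittings-one a (λ c → H (x ∸ i ∷ c)))))) ⟩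
    ∑ (upTo (suc x)) (λ i → ⟦ i ℕ.≟ 0 ⟧ * H (x ∸ i ∷ a))
      ≡⟨ ∑-δ ℕ._≟_ (λ i → H (x ∸ i ∷ a)) (Unique.upTo⁺ (suc x)) (here refl) ⟩
    H (x ∷ a) ∎
    where open ≡-Reasoning

  ι-powerSumˢ : ∀ k a → ι (powerSumˢ k a) ≡ ∑ (upTo (length a)) (λ i → ⟦ a ≟ℓ (zeros i ++ k ∷ zeros (length a ∸ suc i)) ⟧)
  ι-powerSumˢ k a = trans (ι-count (a ≟ℓ_) (map exponents (upTo (length a)))) (∑-map exponents (upTo (length a)) _)
    where
    exponents : ℕ → List ℕ
    exponents i = zeros i ++ k ∷ zeros (length a ∸ suc i)

  -- The k-th power belongs either to the first variable or to a later one.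
  ι-powerSumˢ-∷ : ∀ k i b → ι (powerSumˢ k (i ∷ b)) ≡ ⟦ i ℕ.≟ k ⟧ * ⟦ b ≟ℓ zeros (length b) ⟧ + ⟦ i ℕ.≟ 0 ⟧ * ι (powerSumˢ k b)
  ι-powerSumˢ-∷ k i b = begin
    ι (powerSumˢ k (i ∷ b))
      ≡⟨ trans (ι-powerSumˢ k (i ∷ b)) (∑-upTo-first (length b) _) ⟩
    ⟦ (i ∷ b) ≟ℓ (k ∷ zeros (length b)) ⟧ + ∑ (upTo (length b)) (λ j → ⟦ (i ∷ b) ≟ℓ (0 ∷ zeros j ++ k ∷ zeros (length b ∸ suc j)) ⟧)
      ≡⟨ cong₂ _+_ (⟦∷≟∷⟧ i k b _) (trans (∑-cong (upTo (length b)) λ j → ⟦∷≟∷⟧ i 0 b _) (∑-*ˡ ⟦ i ℕ.≟ 0 ⟧ (upTo (length b)) _)) ⟩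
    ⟦ i ℕ.≟ k ⟧ * ⟦ b ≟ℓ zeros (length b) ⟧ + ⟦ i ℕ.≟ 0 ⟧ * ∑ (upTo (length b)) (λ j → ⟦ b ≟ℓ (zeros j ++ k ∷ zeros (length b ∸ suc j)) ⟧)
      ≡⟨ cong (λ s → ⟦ i ℕ.≟ k ⟧ * ⟦ b ≟ℓ zeros (length b) ⟧ + ⟦ i ℕ.≟ 0 ⟧ * s) (ι-powerSumˢ k b) ⟨
    ⟦ i ℕ.≟ k ⟧ * ⟦ b ≟ℓ zeros (length b) ⟧ + ⟦ i ℕ.≟ 0 ⟧ * ι (powerSumˢ k b) ∎
    where open ≡-Reasoning

  ∑-splittings-powerSum : ∀ k a (G : List ℕ → ℚ) →
    ∑ (splittings a) (λ (b , c) → ι (powerSumˢ k b) * G c) ≡ ∑shift k a G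
  ∑-splittings-powerSum k []      G = trans (+-identityʳ _) (zeroˡ _)
  ∑-splittings-powerSum k (x ∷ a) G = begin
    ∑ (splittings (x ∷ a)) (λ (b , c) → ι (powerSumˢ k b) * G c)
      ≡⟨ ∑-cartesianProductWith _ (upTo (suc x)) (splittings a) _ ⟩
    ∑ (upTo (suc x)) (λ i → ∑ (splittings a) (λ (b , c) → ι (powerSumˢ k (i ∷ b)) * G (x ∸ i ∷ c)))
      ≡⟨ ∑-cong (upTo (suc x)) (λ i → trans
           (∑-cong (splittings a) λ (b , c) → trans (cong (_* G (x ∸ i ∷ c)) (ι-powerSumˢ-∷ k i b))
             (solve 5 (λ p q r s g → (p :* q :+ r :* s) :* g := p :* (q :* g) :+ r :* (s :* g)) refl _ _ _ _ _))
           (trans (∑-+ (splittings a) _ _) (cong₂ _+_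
             (trans (∑-*ˡ ⟦ i ℕ.≟ k ⟧ (splittings a) _) (cong (_*_ _) (∑-splittings-one a (λ c → G (x ∸ i ∷ c)))))
             (trans (∑-*ˡ ⟦ i ℕ.≟ 0 ⟧ (splittings a) _) (cong (_*_ _) (∑-splittings-powerSum k a (λ c → G (x ∸ i ∷ c)))))))) ⟩
    ∑ (upTo (suc x)) (λ i → ⟦ i ℕ.≟ k ⟧ * G (x ∸ i ∷ a) + ⟦ i ℕ.≟ 0 ⟧ * ∑shift k a (λ c → G (x ∸ i ∷ c)))
      ≡⟨ ∑-+ (upTo (suc x)) _ _ ⟩
    ∑ (upTo (suc x)) (λ i → ⟦ i ℕ.≟ k ⟧ * G (x ∸ i ∷ a)) + ∑ (upTo (suc x)) (λ i → ⟦ i ℕ.≟ 0 ⟧ * ∑shift k a (λ c → G (x ∸ i ∷ c)))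
      ≡⟨ cong₂ _+_ pick (∑-δ ℕ._≟_ (λ i → ∑shift k a (λ c → G (x ∸ i ∷ c))) (Unique.upTo⁺ (suc x)) (here refl)) ⟩
    ⟦ k ℕ.≤? x ⟧ * G (x ∸ k ∷ a) + ∑shift k a (λ c → G (x ∷ c)) ∎
    where
    open ≡-Reasoning
    pick : ∑ (upTo (suc x)) (λ i → ⟦ i ℕ.≟ k ⟧ * G (x ∸ i ∷ a)) ≡ ⟦ k ℕ.≤? x ⟧ * G (x ∸ k ∷ a)
    pick with k ℕ.≤? x
    ... | yes k≤x = trans (∑-δ ℕ._≟_ (λ i → G (x ∸ i ∷ a)) (Unique.upTo⁺ (suc x)) (∈.∈-upTo⁺ (ℕ.s≤s k≤x))) (sym (*-identityˡ _))
    ... | no  k≰x = trans (∑-δ∉ ℕ._≟_ (λ i → G (x ∸ i ∷ a)) λ k∈ → k≰x (ℕ.s≤s⁻¹ (∈.∈-upTo⁻ k∈))) (sym (zeroˡ _))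

  ι-powerSums : ∀ ks a → ι (foldr _*ˢ_ oneˢ (map powerSumˢ ks) a) ≡ powerSumCoeff ks a
  ι-powerSums []       a = ι-oneˢ a
  ι-powerSums (k ∷ ks) a = begin
    ι ((powerSumˢ k *ˢ g) a)
      ≡⟨ ι-sum (λ (b , c) → powerSumˢ k b ℕ.* g c) (splittings a) ⟩
    ∑ (splittings a) (λ (b , c) → ι (powerSumˢ k b ℕ.* g c))
      ≡⟨ ∑-cong (splittings a) (λ (b , c) → trans (ι-* (powerSumˢ k b) (g c)) (cong (_*_ _) (ι-powerSums ks c))) ⟩
    ∑ (splittings a) (λ (b , c) → ι (powerSumˢ k b) * powerSumCoeff ks c)
      ≡⟨ ∑-splittings-powerSum k a (powerSumCoeff ks) ⟩
    ∑shift k a (powerSumCoeff ks) ∎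
    where
    open ≡-Reasoning
    g = foldr _*ˢ_ oneˢ (map powerSumˢ ks)

  insert : ℕ → List ℕ → List ℕ
  insert k []       = k ∷ []
  insert k (x ∷ xs) with x ℕ.≤? k
  ... | yes _ = k ∷ x ∷ xs
  ... | no  _ = x ∷ insert k xs

  remove : ℕ → List ℕ → List ℕ
  remove k []       = []
  remove k (x ∷ xs) with k ℕ.≟ x
  ... | yes _ = xs
  ... | no  _ = x ∷ remove k xs

  insert-↭ : ∀ k xs → insert k xs ↭ k ∷ xs
  insert-↭ k []       = ↭.refl
  insert-↭ k (x ∷ xs) with x ℕ.≤? k
  ... | yes _ = ↭.refl
  ... | no  _ = ↭.trans (↭.prep x (insert-↭ k xs)) (↭.swap x k ↭.refl)

  insert-decreasing : ∀ k {xs} → Decreasing xs → Decreasing (insert k xs)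
  insert-decreasing k {[]}     dec = [-]
  insert-decreasing k {x ∷ xs} dec with x ℕ.≤? k
  ... | yes x≤k = x≤k ∷ dec
  ... | no  x≰k = cons (first xs (proj₁ (uncons dec))) (insert-decreasing k (proj₂ (uncons dec)))
    where
    first : ∀ xs → firstPart xs ℕ.≤ x → firstPart (insert k xs) ℕ.≤ x
    first []       _  = ℕ.<⇒≤ (ℕ.≰⇒> x≰k)
    first (y ∷ xs) y≤ with y ℕ.≤? k
    ... | yes _ = ℕ.<⇒≤ (ℕ.≰⇒> x≰k)
    ... | no  _ = y≤

  remove-insert : ∀ k xs → remove k (insert k xs) ≡ xs
  remove-insert k [] with k ℕ.≟ k
  ... | yes _   = refl
  ... | no  k≢k = contradiction refl k≢k
  remove-insert k (x ∷ xs) with x ℕ.≤? k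
  remove-insert k (x ∷ xs) | yes _ with k ℕ.≟ k
  ... | yes _   = refl
  ... | no  k≢k = contradiction refl k≢k
  remove-insert k (x ∷ xs) | no x≰k with k ℕ.≟ x
  ... | yes refl = contradiction ℕ.≤-refl x≰k
  ... | no  _    = cong (x ∷_) (remove-insert k xs)

  insert-remove : ∀ k {xs} → Decreasing xs → k ∈ xs → insert k (remove k xs) ≡ xs
  insert-remove k {x ∷ xs} dec k∈ with k ℕ.≟ x
  insert-remove k {x ∷ []}     dec k∈ | yes refl = refl
  insert-remove k {x ∷ y ∷ xs} (y≤x ∷ _) k∈ | yes refl with y ℕ.≤? x
  ... | yes _   = refl
  ... | no  y≰x = contradiction y≤x y≰x
  insert-remove k {x ∷ xs} dec (here refl) | no k≢x = contradiction refl k≢x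
  insert-remove k {x ∷ xs} dec (there k∈)  | no k≢x with x ℕ.≤? k
  ... | no  _   = cong (x ∷_) (insert-remove k (proj₂ (uncons dec)) k∈)
  ... | yes x≤k = contradiction (ℕ.≤-antisym (bound dec k∈) x≤k) k≢x
    where
    bound : ∀ {x xs k} → Decreasing (x ∷ xs) → k ∈ xs → k ℕ.≤ x
    bound (y≤x ∷ _)  (here refl) = y≤x
    bound (y≤x ∷ ds) (there k∈)  = ℕ.≤-trans (bound ds k∈) y≤x

  remove-decreasing : ∀ k {xs} → Decreasing xs → Decreasing (remove k xs)
  remove-decreasing k {[]}     dec = []
  remove-decreasing k {x ∷ xs} dec with k ℕ.≟ x
  ... | yes _ = proj₂ (uncons dec)
  ... | no  _ = cons (first xs dec) (remove-decreasing k (proj₂ (uncons dec)))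
    where
    first : ∀ xs → Decreasing (x ∷ xs) → firstPart (remove k xs) ℕ.≤ x
    first []       _ = ℕ.z≤n
    first (y ∷ xs) (y≤x ∷ dec) with k ℕ.≟ y
    ... | yes _ = ℕ.≤-trans (proj₁ (uncons dec)) y≤x
    ... | no  _ = y≤x

  remove-↭ : ∀ {k xs} → k ∈ xs → k ∷ remove k xs ↭ xs
  remove-↭ {k} {x ∷ xs} k∈ with k ℕ.≟ x
  remove-↭ k∈          | yes refl = ↭.refl
  remove-↭ (here refl) | no  k≢k  = contradiction refl k≢k
  remove-↭ {k} {x ∷ xs} (there k∈) | no _ = ↭.trans (↭.swap k x ↭.refl) (↭.prep x (remove-↭ k∈))

  insertPart : ∀ k → 0 ℕ.< k → k ℕ.+ m ≡ n → Partition m → Partition n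
  insertPart k 0<k refl μ = mkPartition (insert k (parts μ)) (insert-decreasing k (decreasing μ))
    (↭.All-resp-↭ (↭.↭-sym (insert-↭ k (parts μ))) (0<k ∷ positive μ))
    (trans (sum-↭ (insert-↭ k (parts μ))) (cong (k ℕ.+_) (total μ)))
    where open import Data.Nat.ListAction.Properties using (sum-↭)

  removePart : ∀ k → k ℕ.+ m ≡ n → (μ : Partition n) → k ∈ parts μ → Partition m
  removePart k refl μ k∈ = mkPartition (remove k (parts μ)) (remove-decreasing k (decreasing μ))
    (All.tail (↭.All-resp-↭ (↭.↭-sym (remove-↭ k∈)) (positive μ)))
    (ℕ.+-cancelˡ-≡ k _ _ (trans (sum-↭ (remove-↭ k∈)) (total μ)))
    where open import Data.Nat.ListAction.Properties using (sum-↭)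

  parts-insertPart : ∀ k 0<k (eq : k ℕ.+ m ≡ n) (μ : Partition m) → parts (insertPart k 0<k eq μ) ≡ insert k (parts μ)
  parts-insertPart k 0<k refl μ = refl

  parts-removePart : ∀ k (eq : k ℕ.+ m ≡ n) (μ : Partition n) k∈ → parts (removePart k eq μ k∈) ≡ remove k (parts μ)
  parts-removePart k refl μ k∈ = refl

  -- Inserting k is a bijection from partitions of m onto the partitions of n that contain k, and F
  -- vanishes on the others.
  ∑-insertPart : ∀ k (0<k : 0 ℕ.< k) (eq : k ℕ.+ m ≡ n) (F : Partition n → ℚ) →
    (∀ μ → k ∉ parts μ → F μ ≡ 0q) → ∑ (partitions n) F ≡ ∑ (partitions m) (F ∘ insertPart k 0<k eq)
  ∑-insertPart {m} {n} k 0<k eq F F0 = begin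
    ∑ (partitions n) F
      ≡⟨ ∑-cong (partitions n) preimage ⟩
    ∑ (partitions n) (λ μ → ∑ (partitions m) (λ ν → ⟦ μ ≟ₚ ins ν ⟧ * F μ))
      ≡⟨ ∑-swap (partitions n) (partitions m) _ ⟩
    ∑ (partitions m) (λ ν → ∑ (partitions n) (λ μ → ⟦ μ ≟ₚ ins ν ⟧ * F μ))
      ≡⟨ ∑-cong (partitions m) (λ ν → ∑-partitions-δ (ins ν) F) ⟩
    ∑ (partitions m) (F ∘ ins) ∎
    where
    open ≡-Reasoning
    ins : Partition m → Partition n
    ins = insertPart k 0<k eq

    preimage : ∀ μ → F μ ≡ ∑ (partitions m) (λ ν → ⟦ μ ≟ₚ ins ν ⟧ * F μ)
    preimage μ with Any.any? (k ℕ.≟_) (parts μ)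
    ... | no k∉ = trans (F0 μ k∉) (sym (trans (∑-cong (partitions m) λ ν → trans (cong (_*_ _) (F0 μ k∉)) (zeroʳ _)) (∑-zero (partitions m))))
    ... | yes k∈ = sym (trans
      (∑-cong (partitions m) λ ν → cong (_* F μ) (⟦⟧-cong (μ ≟ₚ ins ν) (ν ≟ₚ removePart k eq μ k∈)
        (λ μ≡ → partition-≡ (sym (trans (parts-removePart k eq μ k∈) (trans (cong (remove k) (trans (cong parts μ≡) (parts-insertPart k 0<k eq ν))) (remove-insert k (parts ν))))))
        (λ ν≡ → partition-≡ (sym (trans (parts-insertPart k 0<k eq ν) (trans (cong (insert k) (trans (cong parts ν≡) (parts-removePart k eq μ k∈)))
          (insert-remove k (decreasing μ) k∈)))))))
      (∑-partitions-δ (removePart k eq μ k∈) (λ _ → F μ)))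

  multiplicity-∷ : ∀ i x xs → multiplicity i (x ∷ xs) ≡ multiplicity i (x ∷ []) ℕ.+ multiplicity i xs
  multiplicity-∷ i x xs = multiplicity-++ i (x ∷ []) xs

  ι-multiplicity-singleton : ∀ i x → ι (multiplicity i (x ∷ [])) ≡ ⟦ i ℕ.≟ x ⟧
  ι-multiplicity-singleton i x = trans (ι-count (i ℕ.≟_) (x ∷ [])) (+-identityʳ _)

  ∑-multiplicity : ∀ n {xs} → All (0 ℕ.<_) xs → All (ℕ._≤ n) xs →
    ∑ (upTo n) (λ k → ι (suc k) * ι (multiplicity (suc k) xs)) ≡ ι (ℕ.sum xs)
  ∑-multiplicity n []  []  = trans (∑-cong (upTo n) λ k → zeroʳ _) (∑-zero (upTo n))
  ∑-multiplicity n {suc x ∷ xs} (_ ∷ ps) (x<n ∷ bs) = begin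
    ∑ (upTo n) (λ k → ι (suc k) * ι (multiplicity (suc k) (suc x ∷ xs)))
      ≡⟨ ∑-cong (upTo n) (λ k → trans
           (cong (_*_ (ι (suc k))) (trans (cong ι (multiplicity-∷ (suc k) (suc x) xs)) (trans (ι-+ (multiplicity (suc k) (suc x ∷ [])) _)
             (cong (_+ ι (multiplicity (suc k) xs)) (trans (ι-multiplicity-singleton (suc k) (suc x))
               (⟦⟧-cong (suc k ℕ.≟ suc x) (k ℕ.≟ x) ℕ.suc-injective (cong suc)))))))
           (solve 3 (λ s d m → s :* (d :+ m) := d :* s :+ s :* m) refl _ _ _)) ⟩
    ∑ (upTo n) (λ k → ⟦ k ℕ.≟ x ⟧ * ι (suc k) + ι (suc k) * ι (multiplicity (suc k) xs))
      ≡⟨ ∑-+ (upTo n) _ _ ⟩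
    ∑ (upTo n) (λ k → ⟦ k ℕ.≟ x ⟧ * ι (suc k)) + ∑ (upTo n) (λ k → ι (suc k) * ι (multiplicity (suc k) xs))
      ≡⟨ cong₂ _+_ (∑-δ ℕ._≟_ (ι ∘ suc) (Unique.upTo⁺ n) (∈.∈-upTo⁺ x<n)) (∑-multiplicity n ps bs) ⟩
    ι (suc x) + ι (ℕ.sum xs)
      ≡⟨ ι-+ (suc x) (ℕ.sum xs) ⟨
    ι (ℕ.sum (suc x ∷ xs)) ∎
    where open ≡-Reasoning

  multiplicity-insert : ∀ i k xs → multiplicity i (insert k xs) ≡ multiplicity i (k ∷ xs)
  multiplicity-insert i k xs = ↭.↭-length (↭.filter-↭ (i ℕ.≟_) (insert-↭ k xs))

  zFactor : (ℕ → ℕ) → ℕ → ℕ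
  zFactor mult i = suc i ℕ.^ mult (suc i) ℕ.* mult (suc i) !

  -- The number z with its range and multiplicities as parameters, because the products for
  -- partitions of m and of n have different lengths.
  zUpTo : ℕ → (ℕ → ℕ) → ℕ
  zUpTo N mult = ℕ.product (applyUpTo (zFactor mult) N)

  zUpTo-suc : ∀ N mult → zUpTo (suc N) mult ≡ zUpTo N mult ℕ.* zFactor mult N
  zUpTo-suc N mult = begin
    ℕ.product (applyUpTo (zFactor mult) (suc N))             ≡⟨ cong ℕ.product (List.applyUpTo-∷ʳ (zFactor mult) N) ⟨
    ℕ.product (applyUpTo (zFactor mult) N ∷ʳ zFactor mult N) ≡⟨ product-++ (applyUpTo (zFactor mult) N) _ ⟩
    zUpTo N mult ℕ.* (zFactor mult N ℕ.* 1)                  ≡⟨ cong (zUpTo N mult ℕ.*_) (ℕ.*-identityʳ _) ⟩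
    zUpTo N mult ℕ.* zFactor mult N                          ∎
    where open ≡-Reasoning

  zUpTo-cong : ∀ N {f g : ℕ → ℕ} → (∀ i → i ℕ.≤ N → f i ≡ g i) → zUpTo N f ≡ zUpTo N g
  zUpTo-cong zero    eq = refl
  zUpTo-cong (suc N) {f} {g} eq = trans (zUpTo-suc N f) (trans (cong₂ ℕ._*_
    (zUpTo-cong N (λ i i≤ → eq i (ℕ.m≤n⇒m≤1+n i≤))) (cong (λ m → suc N ℕ.^ m ℕ.* m !) (eq (suc N) ℕ.≤-refl)))
    (sym (zUpTo-suc N g)))

  zUpTo-extend : ∀ j N {f : ℕ → ℕ} → (∀ i → N ℕ.< i → f i ≡ 0) → zUpTo (j ℕ.+ N) f ≡ zUpTo N f
  zUpTo-extend zero    N f0 = refl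
  zUpTo-extend (suc j) N {f} f0 = trans (zUpTo-suc (j ℕ.+ N) f) (trans
    (cong₂ ℕ._*_ (zUpTo-extend j N f0) (cong (λ m → suc (j ℕ.+ N) ℕ.^ m ℕ.* m !) (f0 _ (ℕ.s≤s (ℕ.m≤n+m N j)))))
    (ℕ.*-identityʳ _))

  -- Only the factor of the part k + 1 changes; it gains one factor k + 1 from the power and the new
  -- multiplicity from the factorial.
  zUpTo-increment : ∀ N k {f g : ℕ → ℕ} → k ℕ.< N → g (suc k) ≡ suc (f (suc k)) → (∀ i → i ≢ suc k → g i ≡ f i) →
    zUpTo N g ≡ suc k ℕ.* g (suc k) ℕ.* zUpTo N f
  zUpTo-increment (suc N) k {f} {g} (ℕ.s≤s k≤N) gk g≡f with ℕ.m≤n⇒m<n∨m≡n k≤N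
  ... | inj₁ k<N = begin
    zUpTo (suc N) g                                            ≡⟨ zUpTo-suc N g ⟩
    zUpTo N g ℕ.* zFactor g N                                  ≡⟨ cong₂ ℕ._*_ (zUpTo-increment N k k<N gk g≡f)
                                                                    (cong (λ m → suc N ℕ.^ m ℕ.* m !) (g≡f (suc N) (ℕ.>⇒≢ (ℕ.s≤s k<N)))) ⟩
    suc k ℕ.* g (suc k) ℕ.* zUpTo N f ℕ.* zFactor f N          ≡⟨ ℕ.*-assoc (suc k ℕ.* g (suc k)) (zUpTo N f) (zFactor f N) ⟩
    suc k ℕ.* g (suc k) ℕ.* (zUpTo N f ℕ.* zFactor f N)        ≡⟨ cong (suc k ℕ.* g (suc k) ℕ.*_) (zUpTo-suc N f) ⟨
    suc k ℕ.* g (suc k) ℕ.* zUpTo (suc N) f                    ∎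
    where open ≡-Reasoning
  ... | inj₂ refl = begin
    zUpTo (suc k) g                                            ≡⟨ zUpTo-suc k g ⟩
    zUpTo k g ℕ.* zFactor g k                                  ≡⟨ cong₂ ℕ._*_ (zUpTo-cong k (λ i i≤ → g≡f i (ℕ.<⇒≢ (ℕ.s≤s i≤))))
                                                                    (cong (λ m → suc k ℕ.^ m ℕ.* m !) gk) ⟩
    zUpTo k f ℕ.* (suc k ℕ.* suc k ℕ.^ c ℕ.* (suc c ℕ.* c !))  ≡⟨ cong (zUpTo k f ℕ.*_) (ℕ.[m*n]*[o*p]≡[m*o]*[n*p] (suc k) (suc k ℕ.^ c) (suc c) (c !)) ⟩
    zUpTo k f ℕ.* (suc k ℕ.* suc c ℕ.* zFactor f k)            ≡⟨ x∙yz≈y∙xz (zUpTo k f) (suc k ℕ.* suc c) (zFactor f k) ⟩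
    suc k ℕ.* suc c ℕ.* (zUpTo k f ℕ.* zFactor f k)            ≡⟨ cong₂ (λ a b → suc k ℕ.* a ℕ.* b) gk (zUpTo-suc k f) ⟨
    suc k ℕ.* g (suc k) ℕ.* zUpTo (suc k) f                    ∎
    where
    open ≡-Reasoning
    open import Algebra.Properties.CommutativeSemigroup ℕ.*-commutativeSemigroup using (x∙yz≈y∙xz)
    c = f (suc k)

  z-nonZero : (μ : Partition n) → z μ ≢ 0
  z-nonZero {n} μ = go n
    where
    mult = λ i → multiplicity i (parts μ)
    go : ∀ N → zUpTo N mult ≢ 0
    go zero    ()
    go (suc N) eq with ℕ.m*n≡0⇒m≡0∨n≡0 (zUpTo N mult) (trans (sym (zUpTo-suc N mult)) eq)
    ... | inj₁ z≡0 = go N z≡0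
    ... | inj₂ f≡0 with ℕ.m*n≡0⇒m≡0∨n≡0 (suc N ℕ.^ mult (suc N)) f≡0
    ...   | inj₁ p≡0 = case ℕ.m^n≡0⇒m≡0 (suc N) (mult (suc N)) p≡0 of λ ()
    ...   | inj₂ m≡0 = ℕ.≢-nonZero⁻¹ (mult (suc N) !) {{ℕ._!≢0 (mult (suc N))}} m≡0

  z-insertPart : ∀ k (eq : suc k ℕ.+ m ≡ n) (μ : Partition m) → let ν = insertPart (suc k) ℕ.z<s eq μ in
    z ν ≡ suc k ℕ.* multiplicity (suc k) (parts ν) ℕ.* z μ
  z-insertPart {m} k refl μ = begin
    zUpTo (suc k ℕ.+ m) g                                  ≡⟨ zUpTo-increment (suc k ℕ.+ m) k (ℕ.s≤s (ℕ.m≤m+n k m)) at-k elsewhere ⟩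
    suc k ℕ.* g (suc k) ℕ.* zUpTo (suc k ℕ.+ m) f          ≡⟨ cong (suc k ℕ.* g (suc k) ℕ.*_) (zUpTo-extend (suc k) m absent) ⟩
    suc k ℕ.* g (suc k) ℕ.* z μ                            ∎
    where
    open ≡-Reasoning
    f g : ℕ → ℕ
    f i = multiplicity i (parts μ)
    g i = multiplicity i (insert (suc k) (parts μ))

    at-k : g (suc k) ≡ suc (f (suc k))
    at-k = trans (multiplicity-insert (suc k) (suc k) (parts μ)) (cong length (List.filter-accept (suc k ℕ.≟_) {xs = parts μ} refl))

    elsewhere : ∀ i → i ≢ suc k → g i ≡ f i
    elsewhere i i≢ = trans (multiplicity-insert i (suc k) (parts μ)) (cong length (List.filter-reject (i ℕ.≟_) {xs = parts μ} i≢))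

    absent : ∀ i → m ℕ.< i → f i ≡ 0
    absent i m<i = multiplicity-∉ {xs = parts μ} (All.tabulate λ { x∈ refl → ℕ.<⇒≱ m<i (subst (i ℕ.≤_) (total μ) (∈⇒≤sum x∈)) })

  _^q_ : ℚ → ℕ → ℚ
  x ^q zero  = 1q
  x ^q suc k = x * x ^q k

  infixr 8 _^q_

  -- In each variable this is t F′ = β (t + t² + ⋯) F for F = (1 - t)^(-β). The bound on N ensures
  -- that every shift not exceeding an exponent occurs.
  ∏-multichoose-shift : ∀ β N a → ℕ.sum a ℕ.≤ N →
    ∑ (upTo N) (λ k → β * ∑shift (suc k) a (λ a′ → ∏ a′ (multichoose β))) ≡ ι (ℕ.sum a) * ∏ a (multichoose β)
  ∏-multichoose-shift β N []      _  = trans (∑-cong (upTo N) λ _ → zeroʳ β) (trans (∑-zero (upTo N)) (sym (zeroˡ _)))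
  ∏-multichoose-shift β N (x ∷ a) le = begin
    ∑ (upTo N) (λ k → β * (⟦ suc k ℕ.≤? x ⟧ * (mc (x ∸ suc k) * P) + ∑shift (suc k) a (λ a′ → mc x * ∏ a′ mc)))
      ≡⟨ ∑-cong (upTo N) (λ k → trans (cong (λ s → β * (⟦ suc k ℕ.≤? x ⟧ * (mc (x ∸ suc k) * P) + s)) (∑shift-*ˡ (suc k) a (mc x) _))
           (solve 6 (λ b d m p q s → b :* (d :* (m :* p) :+ q :* s) := d :* (b :* m) :* p :+ q :* (b :* s)) refl β _ _ P (mc x) _)) ⟩
    ∑ (upTo N) (λ k → ⟦ suc k ℕ.≤? x ⟧ * (β * mc (x ∸ suc k)) * P + mc x * (β * ∑shift (suc k) a (λ a′ → ∏ a′ mc)))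
      ≡⟨ trans (∑-+ (upTo N) _ _) (cong₂ _+_ (∑-*ʳ P (upTo N) _) (∑-*ˡ (mc x) (upTo N) _)) ⟩
    ∑ (upTo N) (λ k → ⟦ suc k ℕ.≤? x ⟧ * (β * mc (x ∸ suc k))) * P + mc x * ∑ (upTo N) (λ k → β * ∑shift (suc k) a (λ a′ → ∏ a′ mc))
      ≡⟨ cong₂ (λ s t → s * P + mc x * t) (row N x (ℕ.m+n≤o⇒m≤o x le)) (∏-multichoose-shift β N a (ℕ.m+n≤o⇒n≤o x le)) ⟩
    ι x * mc x * P + mc x * (ι (ℕ.sum a) * P)
      ≡⟨ solve 4 (λ x m p s → x :* m :* p :+ m :* (s :* p) := (x :+ s) :* (m :* p)) refl (ι x) (mc x) P _ ⟩
    (ι x + ι (ℕ.sum a)) * (mc x * P)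
      ≡⟨ cong (_* (mc x * P)) (ι-+ x (ℕ.sum a)) ⟨
    ι (x ℕ.+ ℕ.sum a) * (mc x * P) ∎
    where
    open ≡-Reasoning
    mc = multichoose β
    P = ∏ a mc

    row : ∀ N x → x ℕ.≤ N → ∑ (upTo N) (λ k → ⟦ suc k ℕ.≤? x ⟧ * (β * mc (x ∸ suc k))) ≡ ι x * mc x
    row N       zero    _         = trans (∑-cong (upTo N) λ k → ⟦⟧*-false (suc k ℕ.≤? 0) λ ()) (trans (∑-zero (upTo N)) (sym (zeroˡ _)))
    row (suc N) (suc x) (ℕ.s≤s x≤N) = begin
      ∑ (upTo (suc N)) (λ k → ⟦ suc k ℕ.≤? suc x ⟧ * (β * mc (x ∸ k)))
        ≡⟨ ∑-upTo-first N _ ⟩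
      1q * (β * mc x) + ∑ (upTo N) (λ k → ⟦ suc (suc k) ℕ.≤? suc x ⟧ * (β * mc (x ∸ suc k)))
        ≡⟨ cong₂ _+_ (*-identityˡ _) (trans
             (∑-cong (upTo N) λ k → cong (_* (β * mc (x ∸ suc k))) (⟦⟧-cong (suc (suc k) ℕ.≤? suc x) (suc k ℕ.≤? x) ℕ.s≤s⁻¹ ℕ.s≤s))
             (row N x x≤N)) ⟩
      β * mc x + ι x * mc x
        ≡⟨ distribʳ _ _ _ ⟨
      (β + ι x) * mc x
        ≡⟨ multichoose-suc β x ⟨
      ι (suc x) * mc (suc x) ∎

  -- The coefficient of p_μ in h_n[β X].
  zWeight : ℚ → Partition n → ℚ
  zWeight β μ = β ^q length (parts μ) * ι (z μ) ⁻¹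

  -- The factor (k + 1) m with m the multiplicity in ν is z_ν / z_μ, and the new part brings one
  -- factor β.
  zWeight-insertPart : ∀ β k (eq : suc k ℕ.+ m ≡ n) (μ : Partition m) → let ν = insertPart (suc k) ℕ.z<s eq μ in
    ι (suc k) * ι (multiplicity (suc k) (parts ν)) * zWeight β ν ≡ β * zWeight β μ
  zWeight-insertPart β k eq μ = begin
    A * (β ^q length (parts ν) * ι (z ν) ⁻¹)
      ≡⟨ cong (λ l → A * (β ^q l * ι (z ν) ⁻¹)) (trans (cong length (parts-insertPart (suc k) ℕ.z<s eq μ)) (↭.↭-length (insert-↭ (suc k) (parts μ)))) ⟩
    A * (β * β ^q length (parts μ) * ι (z ν) ⁻¹)
      ≡⟨ solve 4 (λ a b p i → a :* (b :* p :* i) := b :* (p :* (a :* i))) refl A β _ _ ⟩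
    β * (β ^q length (parts μ) * (A * ι (z ν) ⁻¹))
      ≡⟨ cong (λ i → β * (β ^q length (parts μ) * i)) (*-cancelˡ (zμ≢0 μ) (begin
        ι (z μ) * (A * ι (z ν) ⁻¹)   ≡⟨ solve 3 (λ m a i → m :* (a :* i) := a :* m :* i) refl _ A _ ⟩
        A * ι (z μ) * ι (z ν) ⁻¹     ≡⟨ cong (_* ι (z ν) ⁻¹) zν ⟨
        ι (z ν) * ι (z ν) ⁻¹         ≡⟨ ⁻¹-inverse (zμ≢0 ν) ⟩
        1q                           ≡⟨ ⁻¹-inverse (zμ≢0 μ) ⟨
        ι (z μ) * ι (z μ) ⁻¹         ∎)) ⟩
    β * zWeight β μ ∎
    where
    open ≡-Reasoning
    ν = insertPart (suc k) ℕ.z<s eq μ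
    A = ι (suc k) * ι (multiplicity (suc k) (parts ν))

    zμ≢0 : ∀ {n} (μ : Partition n) → ι (z μ) ≢ 0q
    zμ≢0 μ eq = z-nonZero μ (ι-injective eq)

    zν : ι (z ν) ≡ A * ι (z μ)
    zν = trans (cong ι (z-insertPart k eq μ)) (trans (ι-* (suc k ℕ.* multiplicity (suc k) (parts ν)) (z μ)) (cong (_* ι (z μ)) (ι-* (suc k) _)))

  powerSumCoeff-insert : ∀ k ks a → powerSumCoeff (insert k ks) a ≡ ∑shift k a (powerSumCoeff ks)
  powerSumCoeff-insert k []       a = refl
  powerSumCoeff-insert k (x ∷ ks) a with x ℕ.≤? k
  ... | yes _ = refl
  ... | no  _ = trans (∑shift-cong′ x a (powerSumCoeff-insert k ks)) (∑shift-comm x k a (powerSumCoeff ks))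

  -- The power sum expansion of h_n[β X].  Multiply by n, write n as the sum of
  -- the parts of μ, and remove a part k from μ.
  powerSum-expansion : ∀ β n a → ℕ.sum a ≡ n →
    ∑ (partitions n) (λ μ → zWeight β μ * powerSumCoeff (parts μ) a) ≡ ∏ a (multichoose β)
  powerSum-expansion β n = <-rec (λ n → ∀ a → ℕ.sum a ≡ n →
    ∑ (partitions n) (λ μ → zWeight β μ * powerSumCoeff (parts μ) a) ≡ ∏ a (multichoose β)) step n
    where
    open import Data.Nat.Induction using (<-rec)
    open ≡-Reasoning

    ∅ : Partition 0
    ∅ = mkPartition [] [] [] refl

    ≡∅ : (μ : Partition 0) → μ ≡ ∅
    ≡∅ (mkPartition []           _ _       _)  = partition-≡ refl
    ≡∅ (mkPartition (suc _ ∷ _)  _ _       ())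
    ≡∅ (mkPartition (zero ∷ _)   _ (() ∷ _) _)

    step : ∀ n → (∀ {m} → m ℕ.< n → ∀ a → ℕ.sum a ≡ m →
        ∑ (partitions m) (λ μ → zWeight β μ * powerSumCoeff (parts μ) a) ≡ ∏ a (multichoose β)) →
      ∀ a → ℕ.sum a ≡ n → ∑ (partitions n) (λ μ → zWeight β μ * powerSumCoeff (parts μ) a) ≡ ∏ a (multichoose β)
    step zero rec a sum≡ = begin
      ∑ (partitions 0) (λ μ → zWeight β μ * powerSumCoeff (parts μ) a)
        ≡⟨ ∑-cong (partitions 0) (λ μ → sym (⟦⟧*-true (μ ≟ₚ ∅) (≡∅ μ))) ⟩
      ∑ (partitions 0) (λ μ → ⟦ μ ≟ₚ ∅ ⟧ * (zWeight β μ * powerSumCoeff (parts μ) a))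
        ≡⟨ ∑-partitions-δ ∅ (λ μ → zWeight β μ * powerSumCoeff (parts μ) a) ⟩
      1q * 1q ⁻¹ * ⟦ a ≟ℓ zeros (length a) ⟧
        ≡⟨ cong₂ _*_ (⁻¹-inverse (ι-suc≢0 0)) (⟦⟧-true (a ≟ℓ zeros (length a)) (sym (sum≡0⇒zeros a sum≡))) ⟩
      1q * 1q
        ≡⟨ *-identityˡ 1q ⟩
      1q
        ≡⟨ ∏-sum≡0 β a sum≡ ⟨
      ∏ a (multichoose β) ∎
    step n@(suc n′) rec a sum≡ = *-cancelˡ (ι-suc≢0 _) (begin
      ι n * ∑ (partitions n) (λ μ → zWeight β μ * powerSumCoeff (parts μ) a)
        ≡⟨ ∑-*ˡ (ι n) (partitions n) _ ⟨
      ∑ (partitions n) (λ μ → ι n * (zWeight β μ * powerSumCoeff (parts μ) a))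
        ≡⟨ ∑-cong (partitions n) (λ μ → trans
             (cong (_* (zWeight β μ * powerSumCoeff (parts μ) a)) (sym (trans
               (∑-multiplicity n (positive μ) (All.tabulate λ {x} x∈ → subst (x ℕ.≤_) (total μ) (∈⇒≤sum x∈))) (cong ι (total μ)))))
             (sym (∑-*ʳ _ (upTo n) _))) ⟩
      ∑ (partitions n) (λ μ → ∑ (upTo n) (λ k → F k μ))
        ≡⟨ ∑-swap (partitions n) (upTo n) _ ⟩
      ∑ (upTo n) (λ k → ∑ (partitions n) (F k))
        ≡⟨ ∑-cong∈ (upTo n) (λ {k} k∈ → by-part k (∈.∈-upTo⁻ k∈)) ⟩
      ∑ (upTo n) (λ k → β * ∑shift (suc k) a (λ a′ → ∏ a′ (multichoose β)))
        ≡⟨ ∏-multichoose-shift β n a (ℕ.≤-reflexive sum≡) ⟩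
      ι (ℕ.sum a) * ∏ a (multichoose β)
        ≡⟨ cong (λ s → ι s * ∏ a (multichoose β)) sum≡ ⟩
      ι n * ∏ a (multichoose β) ∎)
      where
      F : ℕ → Partition n → ℚ
      F k μ = ι (suc k) * ι (multiplicity (suc k) (parts μ)) * (zWeight β μ * powerSumCoeff (parts μ) a)

      F0 : ∀ k μ → suc k ∉ parts μ → F k μ ≡ 0q
      F0 k μ k∉ = trans (cong (λ c → ι (suc k) * ι c * (zWeight β μ * powerSumCoeff (parts μ) a))
          (multiplicity-∉ (All.tabulate λ { x∈ refl → k∉ x∈ })))
        (solve 2 (λ s w → s :* con (+ 0) :* w := con (+ 0)) refl _ _)

      by-part : ∀ k → k ℕ.< n → ∑ (partitions n) (F k) ≡ β * ∑shift (suc k) a (λ a′ → ∏ a′ (multichoose β))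
      by-part k k<n = begin
        ∑ (partitions n) (F k)
          ≡⟨ ∑-insertPart (suc k) ℕ.z<s eq (F k) (F0 k) ⟩
        ∑ (partitions r) (λ μ → F k (ins μ))
          ≡⟨ ∑-cong (partitions r) (λ μ → begin
            ι (suc k) * ι (multiplicity (suc k) (parts (ins μ))) * (zWeight β (ins μ) * powerSumCoeff (parts (ins μ)) a)
              ≡⟨ *-assoc _ _ _ ⟨
            ι (suc k) * ι (multiplicity (suc k) (parts (ins μ))) * zWeight β (ins μ) * powerSumCoeff (parts (ins μ)) a
              ≡⟨ cong₂ _*_ (zWeight-insertPart β k eq μ)
                   (trans (cong (λ ks → powerSumCoeff ks a) (parts-insertPart (suc k) ℕ.z<s eq μ)) (powerSumCoeff-insert (suc k) (parts μ) a)) ⟩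
            β * zWeight β μ * ∑shift (suc k) a (powerSumCoeff (parts μ))
              ≡⟨ trans (*-assoc _ _ _) (cong (_*_ β) (sym (∑shift-*ˡ (suc k) a _ _))) ⟩
            β * ∑shift (suc k) a (λ a′ → zWeight β μ * powerSumCoeff (parts μ) a′) ∎) ⟩
        ∑ (partitions r) (λ μ → β * ∑shift (suc k) a (λ a′ → zWeight β μ * powerSumCoeff (parts μ) a′))
          ≡⟨ trans (∑-*ˡ β (partitions r) _) (cong (_*_ β) (sym (∑shift-∑ (suc k) a (partitions r) _))) ⟩
        β * ∑shift (suc k) a (λ a′ → ∑ (partitions r) (λ μ → zWeight β μ * powerSumCoeff (parts μ) a′))
          ≡⟨ cong (_*_ β) (∑shift-cong (suc k) a λ a′ s → rec (ℕ.s≤s (ℕ.m∸n≤m n′ k)) a′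
               (ℕ.+-cancelˡ-≡ (suc k) _ _ (trans s (trans sum≡ (sym eq))))) ⟩
        β * ∑shift (suc k) a (λ a′ → ∏ a′ (multichoose β)) ∎
        where
        r = n ∸ suc k
        eq : suc k ℕ.+ r ≡ n
        eq = ℕ.m+[n∸m]≡n k<n
        ins : Partition r → Partition n
        ins = insertPart (suc k) ℕ.z<s eq

-- Values of polynomials and rational functions at large naturals

module Fractions where
  open Rationals
  open Sums
  open Rook
  open PowerSums

  open import Relation.Binary.Definitions using (tri<; tri≈; tri>)

  eval : Poly → ℚ → ℚ
  eval []      x = 0q
  eval (a ∷ p) x = a + x * eval p x

  opaque
    unfolding _+_ ιℤ

    0ℚ≡0q : 0ℚ ≡ 0q
    0ℚ≡0q = refl

    1ℚ≡1q : 1ℚ ≡ 1q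
    1ℚ≡1q = refl

  eval-+ᵖ : ∀ p q x → eval (p +ᵖ q) x ≡ eval p x + eval q x
  eval-+ᵖ []      q       x = sym (+-identityˡ _)
  eval-+ᵖ (a ∷ p) []      x = sym (+-identityʳ _)
  eval-+ᵖ (a ∷ p) (b ∷ q) x = trans
    (cong₂ _+_ (sym (+-def a b)) (cong (_*_ x) (eval-+ᵖ p q x)))
    (solve 5 (λ a b x p q → a :+ b :+ x :* (p :+ q) := a :+ x :* p :+ (b :+ x :* q)) refl a b x _ _)

  eval-scale : ∀ a q x → eval (map (a ℚ.*_) q) x ≡ a * eval q x
  eval-scale a []      x = sym (zeroʳ a)
  eval-scale a (b ∷ q) x = trans (cong₂ _+_ (sym (*-def a b)) (cong (_*_ x) (eval-scale a q x)))
    (solve 4 (λ a b x q → a :* b :+ x :* (a :* q) := a :* (b :+ x :* q)) refl a b x _)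

  eval-*ᵖ : ∀ p q x → eval (p *ᵖ q) x ≡ eval p x * eval q x
  eval-*ᵖ []      q x = sym (zeroˡ _)
  eval-*ᵖ (a ∷ p) q x = begin
    eval (map (a ℚ.*_) q +ᵖ (0ℚ ∷ p *ᵖ q)) x              ≡⟨ eval-+ᵖ (map (a ℚ.*_) q) (0ℚ ∷ p *ᵖ q) x ⟩
    eval (map (a ℚ.*_) q) x + (0ℚ + x * eval (p *ᵖ q) x)  ≡⟨ cong₂ _+_ (eval-scale a q x) (cong₂ _+_ 0ℚ≡0q (cong (_*_ x) (eval-*ᵖ p q x))) ⟩
    a * eval q x + (0q + x * (eval p x * eval q x))       ≡⟨ solve 4 (λ a q x p → a :* q :+ (con (+ 0) :+ x :* (p :* q)) := (a :+ x :* p) :* q) refl a (eval q x) x (eval p x) ⟩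
    (a + x * eval p x) * eval q x                         ∎
    where open ≡-Reasoning

  eval--ᵖ : ∀ p x → eval (-ᵖ p) x ≡ - eval p x
  eval--ᵖ []      x = solve 0 (con (+ 0) := :- con (+ 0)) refl
  eval--ᵖ (a ∷ p) x = trans (cong₂ _+_ (sym (neg-def a)) (cong (_*_ x) (eval--ᵖ p x)))
    (solve 3 (λ a x p → :- a :+ x :* (:- p) := :- (a :+ x :* p)) refl a x _)

  eval-cong : ∀ p q x → p ≈ᵖ q → eval p x ≡ eval q x
  eval-cong []      []      x eq = refl
  eval-cong []      (b ∷ q) x eq = sym (trans (cong₂ (λ b v → b + x * v) (trans (sym (eq 0)) 0ℚ≡0q) (sym (eval-cong [] q x (eq ∘ suc))))
    (solve 1 (λ x → con (+ 0) :+ x :* con (+ 0) := con (+ 0)) refl x))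
  eval-cong (a ∷ p) []      x eq = trans (cong₂ (λ a v → a + x * v) (trans (eq 0) 0ℚ≡0q) (eval-cong p [] x (eq ∘ suc)))
    (solve 1 (λ x → con (+ 0) :+ x :* con (+ 0) := con (+ 0)) refl x)
  eval-cong (a ∷ p) (b ∷ q) x eq = cong₂ (λ a v → a + x * v) (eq 0) (eval-cong p q x (eq ∘ suc))

  coeff--ᵖ : ∀ p i → coeff (-ᵖ p) i ≡ ℚ.- coeff p i
  coeff--ᵖ []      i       = refl
  coeff--ᵖ (a ∷ p) zero    = refl
  coeff--ᵖ (a ∷ p) (suc i) = coeff--ᵖ p i

  zero? : ∀ p → (p ≈ᵖ []) ⊎ NonZeroᵖ p
  zero? []      = inj₁ λ _ → refl
  zero? (a ∷ p) with a ℚ.≟ 0ℚ | zero? p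
  ... | no a≢0  | _         = inj₂ (here a≢0)
  ... | yes _   | inj₂ p≢0  = inj₂ (there p≢0)
  ... | yes a≡0 | inj₁ p≈0  = inj₁ λ { zero → a≡0 ; (suc i) → p≈0 i }

  Eventually : (ℕ → Set) → Set
  Eventually P = ∃ λ N₀ → ∀ N → N₀ ℕ.≤ N → P N

  infixl 4 _<&>_
  _<&>_ : {P Q : ℕ → Set} → Eventually P → (∀ {N} → P N → Q N) → Eventually Q
  (N₀ , p) <&> f = N₀ , λ N le → f (p N le)

  both : {P Q : ℕ → Set} → Eventually P → Eventually Q → Eventually (λ N → P N × Q N)
  both (M , p) (N , q) = M ℕ.⊔ N , λ K le → p K (ℕ.≤-trans (ℕ.m≤m⊔n M N) le) , q K (ℕ.≤-trans (ℕ.m≤n⊔m M N) le)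

  opaque
    unfolding _+_ ιℤ

    archimedean : ∀ r → ∃ λ M → r ℚ.≤ ι M
    archimedean r@(ℚ.mkℚ n d _) = ℤ.∣ n ∣ , ℚ.toℚᵘ-cancel-≤ (subst (ℚ.toℚᵘ r ℚᵘ.≤_) (sym (toℚᵘ-ιℤ (+ ℤ.∣ n ∣))) (ℚᵘ.*≤* (bound n)))
      where
      bound : ∀ n → n ℤ.* + 1 ℤ.≤ + ℤ.∣ n ∣ ℤ.* + suc d
      bound (+ m)    = subst₂ ℤ._≤_ (sym (ℤ.*-identityʳ (+ m))) (ℤ.pos-* m (suc d)) (ℤ.+≤+ (ℕ.m≤m*n m (suc d)))
      bound -[1+ m ] = subst (ℤ._≤ + suc m ℤ.* + suc d) (sym (ℤ.*-identityʳ -[1+ m ])) (subst (-[1+ m ] ℤ.≤_) (ℤ.pos-* (suc m) (suc d)) ℤ.-≤+)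

    archimedean-* : ∀ r c → 0ℚ ℚ.< c → Eventually λ N → r ℚ.≤ ι N ℚ.* c
    archimedean-* r c 0<c = proj₁ bound , λ N le → begin
      r                         ≡⟨ ℚ.*-identityʳ r ⟨
      r ℚ.* 1ℚ                  ≡⟨ cong (r ℚ.*_) (ℚ.*-inverseˡ c) ⟨
      r ℚ.* (ℚ.1/ c ℚ.* c)      ≡⟨ ℚ.*-assoc r (ℚ.1/ c) c ⟨
      r ℚ.* ℚ.1/ c ℚ.* c        ≤⟨ ℚ.*-monoʳ-≤-nonNeg c {r ℚ.* ℚ.1/ c} {ι N} (ℚ.≤-trans (proj₂ bound) (ι-mono le)) ⟩
      ι N ℚ.* c                 ∎
      where
      open ℚ.≤-Reasoning
      instance
        c>0 : ℚ.Positive c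
        c>0 = ℚ.positive 0<c
        c≥0 : ℚ.NonNegative c
        c≥0 = ℚ.pos⇒nonNeg c
        c≢0 : ℚ.NonZero c
        c≢0 = ℚ.pos⇒nonZero c
      bound : ∃ λ M → r ℚ.* ℚ.1/ c ℚ.≤ ι M
      bound = archimedean (r ℚ.* ℚ.1/ c)

    0<∣_∣ : ∀ {a} → a ≢ 0ℚ → 0ℚ ℚ.< ℚ.∣ a ∣
    0<∣_∣ {a} a≢0 with ℚ.<-cmp 0ℚ ℚ.∣ a ∣
    ... | tri< 0<a _ _ = 0<a
    ... | tri≈ _ 0≡a _ = contradiction (ℚ.∣p∣≡0⇒p≡0 a (sym 0≡a)) a≢0
    ... | tri> _ _ a<0 = ⊥-elim (ℚ.<-irrefl refl (ℚ.≤-<-trans (ℚ.0≤∣p∣ a) a<0))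

    -- A bound instead of mere nonvanishing makes the induction work: if the polynomial after the
    -- constant term stays above c in absolute value, N c eventually exceeds 1 + |a|, so the
    -- constant term a cannot bring the value below 1.
    eval-bounded-below : ∀ {p} → NonZeroᵖ p → ∃ λ c → 0ℚ ℚ.< c × Eventually λ N → c ℚ.≤ ℚ.∣ eval p (ι N) ∣
    eval-bounded-below {a ∷ p} p≢0 with zero? p
    ... | inj₁ p≈0 = ℚ.∣ a ∣ , 0<∣ a≢0 p≢0 ∣ , 0 , λ N _ → ℚ.≤-reflexive (cong ℚ.∣_∣ (sym (begin
        a ℚ.+ ι N ℚ.* eval p (ι N)   ≡⟨ cong (λ v → a ℚ.+ ι N ℚ.* v) (eval-cong p [] (ι N) p≈0) ⟩
        a ℚ.+ ι N ℚ.* 0ℚ             ≡⟨ cong (a ℚ.+_) (ℚ.*-zeroʳ (ι N)) ⟩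
        a ℚ.+ 0ℚ                     ≡⟨ ℚ.+-identityʳ a ⟩
        a                            ∎)))
      where
      open ≡-Reasoning
      vanishing : ∀ {p} → NonZeroᵖ p → p ≈ᵖ [] → ⊥
      vanishing (here b≢0)  p≈0 = b≢0 (p≈0 0)
      vanishing (there p≢0) p≈0 = vanishing p≢0 (p≈0 ∘ suc)

      a≢0 : ∀ {a} → NonZeroᵖ (a ∷ p) → a ≢ 0ℚ
      a≢0 (here a≢0)  = a≢0
      a≢0 (there p≢0) = ⊥-elim (vanishing p≢0 p≈0)
    ... | inj₂ p≢0′ with eval-bounded-below p≢0′
    ...   | c , 0<c , bound = 1ℚ , ℚ.positive⁻¹ 1ℚ , (both bound (archimedean-* (1ℚ ℚ.+ ℚ.∣ a ∣) c 0<c) <&> λ {N} (c≤v , large) → step N c≤v large)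
      where
      open ℚ.≤-Reasoning
      step : ∀ N → c ℚ.≤ ℚ.∣ eval p (ι N) ∣ → 1ℚ ℚ.+ ℚ.∣ a ∣ ℚ.≤ ι N ℚ.* c → 1ℚ ℚ.≤ ℚ.∣ a ℚ.+ ι N ℚ.* eval p (ι N) ∣
      step N c≤v large = begin
        1ℚ                                          ≡⟨ cancel 1ℚ ⟨
        1ℚ ℚ.+ ℚ.∣ a ∣ ℚ.- ℚ.∣ a ∣                  ≤⟨ ℚ.+-monoˡ-≤ (ℚ.- ℚ.∣ a ∣) (begin
          1ℚ ℚ.+ ℚ.∣ a ∣                              ≤⟨ large ⟩
          ι N ℚ.* c                                   ≤⟨ ℚ.*-monoˡ-≤-nonNeg (ι N) c≤v ⟩
          ι N ℚ.* ℚ.∣ v ∣                             ≡⟨ cong (ℚ._* ℚ.∣ v ∣) (ℚ.0≤p⇒∣p∣≡p 0≤N) ⟨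
          ℚ.∣ ι N ∣ ℚ.* ℚ.∣ v ∣                       ≡⟨ ℚ.∣p*q∣≡∣p∣*∣q∣ (ι N) v ⟨
          ℚ.∣ ι N ℚ.* v ∣                             ≡⟨ cong ℚ.∣_∣ (cancel′ (ι N ℚ.* v)) ⟨
          ℚ.∣ (a ℚ.+ ι N ℚ.* v) ℚ.- a ∣               ≤⟨ ℚ.∣p-q∣≤∣p∣+∣q∣ (a ℚ.+ ι N ℚ.* v) a ⟩
          ℚ.∣ a ℚ.+ ι N ℚ.* v ∣ ℚ.+ ℚ.∣ a ∣           ∎) ⟩
        ℚ.∣ a ℚ.+ ι N ℚ.* v ∣ ℚ.+ ℚ.∣ a ∣ ℚ.- ℚ.∣ a ∣ ≡⟨ cancel _ ⟩
        ℚ.∣ a ℚ.+ ι N ℚ.* v ∣                       ∎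
        where
        v : ℚ
        v = eval p (ι N)
        0≤N : 0ℚ ℚ.≤ ι N
        0≤N = ι-mono {0} {N} ℕ.z≤n
        instance
          N≥0 : ℚ.NonNegative (ι N)
          N≥0 = ℚ.nonNegative 0≤N
        cancel : ∀ y → y ℚ.+ ℚ.∣ a ∣ ℚ.- ℚ.∣ a ∣ ≡ y
        cancel y = solve 2 (λ y a → y :+ a :- a := y) refl y ℚ.∣ a ∣
        cancel′ : ∀ y → (a ℚ.+ y) ℚ.- a ≡ y
        cancel′ y = solve 2 (λ y a → a :+ y :- a := y) refl y a

    eventually-≢0 : ∀ {p} → NonZeroᵖ p → Eventually λ N → eval p (ι N) ≢ 0q
    eventually-≢0 p≢0 with eval-bounded-below p≢0
    ... | c , 0<c , bound = bound <&> λ c≤v v≡0 → ℚ.<-irrefl refl (ℚ.<-≤-trans 0<c (subst (λ v → c ℚ.≤ ℚ.∣ v ∣) v≡0 c≤v))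

  -- If a coefficient differed, p - q would be a nonzero polynomial and would not vanish at large N.
  ≈ᵖ-from-values : ∀ p q → Eventually (λ N → eval p (ι N) ≡ eval q (ι N)) → p ≈ᵖ q
  ≈ᵖ-from-values p q eq i with coeff p i ℚ.≟ coeff q i
  ... | yes p≡q = p≡q
  ... | no  p≢q with both eq (eventually-≢0 (∃⇒NonZeroᵖ (p +ᵖ -ᵖ q) i difference))
    where
    open import Algebra.Properties.Group ℚ.+-0-group using (x∙y⁻¹≈ε⇒x≈y)
    difference : coeff (p +ᵖ -ᵖ q) i ≢ 0ℚ
    difference d≡0 = p≢q (x∙y⁻¹≈ε⇒x≈y (coeff p i) (coeff q i)
      (trans (cong (ℚ._+_ (coeff p i)) (sym (coeff--ᵖ q i))) (trans (sym (coeff-+ᵖ p (-ᵖ q) i)) d≡0)))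
  ...   | N , values = ⊥-elim (proj₂ (values N ℕ.≤-refl) (begin
      eval (p +ᵖ -ᵖ q) (ι N)             ≡⟨ trans (eval-+ᵖ p (-ᵖ q) (ι N)) (cong (_+_ _) (eval--ᵖ q (ι N))) ⟩
      eval p (ι N) - eval q (ι N)        ≡⟨ cong (_- eval q (ι N)) (proj₁ (values N ℕ.≤-refl)) ⟩
      eval q (ι N) - eval q (ι N)        ≡⟨ -‿inverseʳ _ ⟩
      0q                                 ∎))
    where open ≡-Reasoning

  -- A relation rather than a function, so that poles need no default value; the equation is cleared
  -- of the denominator.
  record Value (f : ℚ⟨α⟩) (x v : ℚ) : Set where
    constructor value
    field
      regular : eval (den f) x ≢ 0q
      equation : eval (num f) x ≡ v * eval (den f) x

  open Value

  private variable
    f g : ℚ⟨α⟩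
    x u v w : ℚ

  Value-subst : v ≡ w → Value f x v → Value f x w
  Value-subst refl F = F

  eventually-value : ∀ f → Eventually λ N → ∃ λ v → Value f (ι N) v
  eventually-value f = eventually-≢0 (den≢0 f) <&> λ {N} d≢0 → eval (num f) (ι N) * eval (den f) (ι N) ⁻¹ , value d≢0 (sym (begin
    eval (num f) (ι N) * eval (den f) (ι N) ⁻¹ * eval (den f) (ι N)     ≡⟨ *-assoc _ _ _ ⟩
    eval (num f) (ι N) * (eval (den f) (ι N) ⁻¹ * eval (den f) (ι N))   ≡⟨ cong (_*_ _) (⁻¹-inverseˡ d≢0) ⟩
    eval (num f) (ι N) * 1q                                             ≡⟨ *-identityʳ _ ⟩
    eval (num f) (ι N)                                                  ∎))
    where open ≡-Reasoning

  Value-≈ : ∀ {f g} → f Defs.≈ g → Value f x v → Value g x w → v ≡ w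
  Value-≈ {x} {v} {w} {f} {g} f≈g F G = *-cancelˡ (*-≢0 (regular F) (regular G)) (begin
    D * E * v                        ≡⟨ solve 3 (λ d e v → d :* e :* v := v :* d :* e) refl D E v ⟩
    v * D * E                        ≡⟨ cong (_* E) (equation F) ⟨
    eval (num f) x * E               ≡⟨ eval-*ᵖ (num f) (den g) x ⟨
    eval (num f *ᵖ den g) x          ≡⟨ eval-cong (num f *ᵖ den g) (num g *ᵖ den f) x f≈g ⟩
    eval (num g *ᵖ den f) x          ≡⟨ eval-*ᵖ (num g) (den f) x ⟩
    eval (num g) x * D               ≡⟨ cong (_* D) (equation G) ⟩
    w * E * D                        ≡⟨ solve 3 (λ d e w → w :* e :* d := d :* e :* w) refl D E w ⟩
    D * E * w                        ∎)
    where
    open ≡-Reasoning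
    D = eval (den f) x
    E = eval (den g) x

  ≈-from-values : ∀ f g → Eventually (λ N → ∃ λ v → Value f (ι N) v × Value g (ι N) v) → f Defs.≈ g
  ≈-from-values f g values = ≈ᵖ-from-values (num f *ᵖ den g) (num g *ᵖ den f) (values <&> λ {N} (v , F , G) → begin
    eval (num f *ᵖ den g) (ι N)                 ≡⟨ eval-*ᵖ (num f) (den g) (ι N) ⟩
    eval (num f) (ι N) * eval (den g) (ι N)     ≡⟨ cong (_* eval (den g) (ι N)) (equation F) ⟩
    v * eval (den f) (ι N) * eval (den g) (ι N) ≡⟨ solve 3 (λ v d e → v :* d :* e := v :* e :* d) refl v _ _ ⟩
    v * eval (den g) (ι N) * eval (den f) (ι N) ≡⟨ cong (_* eval (den f) (ι N)) (equation G) ⟨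
    eval (num g) (ι N) * eval (den f) (ι N)     ≡⟨ eval-*ᵖ (num g) (den f) (ι N) ⟨
    eval (num g *ᵖ den f) (ι N)                 ∎)
    where open ≡-Reasoning

  Value-poly : ∀ p x → Value (fromPoly p) x (eval p x)
  Value-poly p x = value (λ eq → ι-suc≢0 0 (trans (sym one) eq)) (sym (trans (cong (_*_ _) one) (*-identityʳ _)))
    where
    one : eval (1ℚ ∷ []) x ≡ 1q
    one = trans (cong (λ o → o + x * 0q) 1ℚ≡1q) (solve 1 (λ x → con (+ 1) :+ x :* con (+ 0) := con (+ 1)) refl x)

  Value-fromℚ : ∀ c x → Value (fromℚ c) x c
  Value-fromℚ c x = Value-subst (solve 2 (λ c x → c :+ x :* con (+ 0) := c) refl c x) (Value-poly (c ∷ []) x)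

  Value-fromℤ : ∀ i x → Value (fromℤ i) x (ιℤ i)
  Value-fromℤ i x = Value-subst (sym (ιℤ-def i)) (Value-fromℚ (i ℚ./ 1) x)

  Value-0 : ∀ x → Value Defs.0# x 0q
  Value-0 x = Value-poly [] x

  Value-1 : ∀ x → Value Defs.1# x 1q
  Value-1 x = Value-subst 1ℚ≡1q (Value-fromℚ 1ℚ x)

  Value-α : ∀ x → Value α x x
  Value-α x = Value-subst (trans (cong₂ (λ z o → z + x * (o + x * 0q)) 0ℚ≡0q 1ℚ≡1q)
    (solve 1 (λ x → con (+ 0) :+ x :* (con (+ 1) :+ x :* con (+ 0)) := x) refl x)) (Value-poly (0ℚ ∷ 1ℚ ∷ []) x)

  Value-* : Value f x v → Value g x w → Value (f Defs.* g) x (v * w)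
  Value-* {f} {x} {v} {g} {w} F G = value
    (λ eq → *-≢0 (regular F) (regular G) (trans (sym (eval-*ᵖ (den f) (den g) x)) eq))
    (begin
      eval (num f *ᵖ num g) x                           ≡⟨ eval-*ᵖ (num f) (num g) x ⟩
      eval (num f) x * eval (num g) x                   ≡⟨ cong₂ _*_ (equation F) (equation G) ⟩
      v * eval (den f) x * (w * eval (den g) x)         ≡⟨ solve 4 (λ v d w e → v :* d :* (w :* e) := v :* w :* (d :* e)) refl v _ w _ ⟩
      v * w * (eval (den f) x * eval (den g) x)         ≡⟨ cong (_*_ (v * w)) (eval-*ᵖ (den f) (den g) x) ⟨
      v * w * eval (den f *ᵖ den g) x                   ∎)
    where open ≡-Reasoning

  Value-+ : Value f x v → Value g x w → Value (f Defs.+ g) x (v + w)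
  Value-+ {f} {x} {v} {g} {w} F G = value
    (λ eq → *-≢0 (regular F) (regular G) (trans (sym (eval-*ᵖ (den f) (den g) x)) eq))
    (begin
      eval (num f *ᵖ den g +ᵖ num g *ᵖ den f) x         ≡⟨ trans (eval-+ᵖ (num f *ᵖ den g) (num g *ᵖ den f) x) (cong₂ _+_ (eval-*ᵖ (num f) (den g) x) (eval-*ᵖ (num g) (den f) x)) ⟩
      eval (num f) x * eval (den g) x + eval (num g) x * eval (den f) x ≡⟨ cong₂ (λ a b → a * eval (den g) x + b * eval (den f) x) (equation F) (equation G) ⟩
      v * eval (den f) x * eval (den g) x + w * eval (den g) x * eval (den f) x ≡⟨ solve 4 (λ v d w e → v :* d :* e :+ w :* e :* d := (v :+ w) :* (d :* e)) refl v _ w _ ⟩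
      (v + w) * (eval (den f) x * eval (den g) x)       ≡⟨ cong (_*_ (v + w)) (eval-*ᵖ (den f) (den g) x) ⟨
      (v + w) * eval (den f *ᵖ den g) x                 ∎)
    where open ≡-Reasoning

  Value-neg : Value f x v → Value (Defs.- f) x (- v)
  Value-neg {f} {x} {v} F = value (regular F) (trans (eval--ᵖ (num f) x) (trans (cong -_ (equation F))
    (solve 2 (λ v d → :- (v :* d) := (:- v) :* d) refl v _)))

  Value-^ : ∀ k → Value f x v → Value (f Defs.^ k) x (v ^q k)
  Value-^ zero    F = Value-1 _
  Value-^ (suc k) F = Value-* F (Value-^ k F)

  Value-binom : ∀ k → Value f x v → Value (binom f k) x (choose v k)
  Value-binom zero    F = Value-1 _
  Value-binom (suc k) F = Value-* (Value-* (Value-binom k F) (Value-+ F (Value-neg (Value-fromℤ (+ k) _))))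
    (Value-subst (inverse k) (Value-fromℚ _ _))
    where
    opaque
      unfolding _*_ ιℤ _⁻¹
      inverse : ∀ k → + 1 ℚ./ suc k ≡ ι (suc k) ⁻¹
      inverse k = *-cancelˡ (ι-suc≢0 k) (trans (ℚ.toℚᵘ-injective (begin
        ℚ.toℚᵘ (ι (suc k) ℚ.* (+ 1 ℚ./ suc k))                       ≈⟨ ℚ.toℚᵘ-homo-* (ι (suc k)) (+ 1 ℚ./ suc k) ⟩
        ℚ.toℚᵘ (ι (suc k)) ℚᵘ.* ℚ.toℚᵘ (+ 1 ℚ./ suc k)               ≈⟨ ℚᵘ.*-cong (ℚᵘ.≃-reflexive (toℚᵘ-ιℤ (+ suc k))) (ℚ.toℚᵘ-fromℚᵘ (ℚᵘ.mkℚᵘ (+ 1) k)) ⟩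
        ℚᵘ.mkℚᵘ (+ suc k) 0 ℚᵘ.* ℚᵘ.mkℚᵘ (+ 1) k                     ≈⟨ ℚᵘ.*≡* (solve-ℤ k) ⟩
        ℚ.toℚᵘ 1ℚ                                                    ∎))
        (sym (⁻¹-inverse (ι-suc≢0 k))))
        where
        open ℚᵘ.≃-Reasoning
        solve-ℤ : ∀ k → (+ suc k ℤ.* + 1) ℤ.* + 1 ≡ + 1 ℤ.* (+ 1 ℤ.* + suc k)
        solve-ℤ k = trans (ℤ.*-identityʳ _) (trans (ℤ.*-comm (+ suc k) (+ 1)) (sym (ℤ.*-identityˡ _)))

  Value-sum : ∀ {n} {fs : Fin n → ℚ⟨α⟩} {vs : Fin n → ℚ} → (∀ i → Value (fs i) x (vs i)) → Value (Defs.sum fs) x (∑ (allFin n) vs)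
  Value-sum {n = zero}  F = Value-0 _
  Value-sum {n = suc n} F = Value-subst (sym (∑-allFin-suc n _)) (Value-+ (F Fin.zero) (Value-sum (F ∘ Fin.suc)))

  Value-product : ∀ {n} {fs : Fin n → ℚ⟨α⟩} {vs : Fin n → ℚ} → (∀ i → Value (fs i) x (vs i)) → Value (Defs.product fs) x (∏ (allFin n) vs)
  Value-product {n = zero}  F = Value-1 _
  Value-product {n = suc n} F = Value-subst (sym (∏-allFin-suc n _)) (Value-* (F Fin.zero) (Value-product (F ∘ Fin.suc)))

  Value-foldr-* : ∀ {A : Set} {fs : A → ℚ⟨α⟩} {vs : A → ℚ} → (∀ a → Value (fs a) x (vs a)) → ∀ as →
    Value (foldr Defs._*_ Defs.1# (map fs as)) x (∏ as vs)
  Value-foldr-* F []       = Value-1 _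
  Value-foldr-* F (a ∷ as) = Value-* (F a) (Value-foldr-* F as)

  eval-shift : ∀ k p x → eval (replicate k 0ℚ ++ p) x ≡ x ^q k * eval p x
  eval-shift zero    p x = sym (*-identityˡ _)
  eval-shift (suc k) p x = trans (cong₂ (λ z v → z + x * v) 0ℚ≡0q (eval-shift k p x))
    (solve 3 (λ x k v → con (+ 0) :+ x :* (k :* v) := x :* k :* v) refl x _ _)

  eval-++ : ∀ p q x → eval (p ++ q) x ≡ eval p x + x ^q length p * eval q x
  eval-++ []      q x = solve 1 (λ v → v := con (+ 0) :+ con (+ 1) :* v) refl _
  eval-++ (a ∷ p) q x = trans (cong (λ v → a + x * v) (eval-++ p q x))
    (solve 5 (λ a x p k q → a :+ x :* (p :+ k :* q) := a :+ x :* p :+ x :* k :* q) refl a x _ _ _)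

  -- Reversal gives x^(L - 1) p(1/x) for length L; one more factor x keeps the exponent natural for
  -- the empty list too.
  eval-reverse : ∀ p {x} → x ≢ 0q → x * eval (reverse p) x ≡ x ^q length p * eval p (x ⁻¹)
  eval-reverse []      {x} x≢0 = solve 1 (λ x → x :* con (+ 0) := con (+ 1) :* con (+ 0)) refl x
  eval-reverse (a ∷ p) {x} x≢0 = begin
    x * eval (reverse (a ∷ p)) x
      ≡⟨ cong (λ q → x * eval q x) (List.unfold-reverse a p) ⟩
    x * eval (reverse p ∷ʳ a) x
      ≡⟨ cong (_*_ x) (trans (eval-++ (reverse p) (a ∷ []) x) (cong (λ k → eval (reverse p) x + x ^q k * (a + x * 0q)) (List.length-reverse p))) ⟩
    x * (eval (reverse p) x + x ^q length p * (a + x * 0q))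
      ≡⟨ solve 4 (λ x r k a → x :* (r :+ k :* (a :+ x :* con (+ 0))) := x :* r :+ x :* k :* a) refl x _ _ a ⟩
    x * eval (reverse p) x + x * x ^q length p * a
      ≡⟨ cong (_+ x * x ^q length p * a) (eval-reverse p x≢0) ⟩
    x ^q length p * eval p (x ⁻¹) + x * x ^q length p * a
      ≡⟨ solve 4 (λ k v x a → k :* v :+ x :* k :* a := x :* k :* a :+ con (+ 1) :* (k :* v)) refl _ _ x a ⟩
    x * x ^q length p * a + 1q * (x ^q length p * eval p (x ⁻¹))
      ≡⟨ cong (λ o → x * x ^q length p * a + o * (x ^q length p * eval p (x ⁻¹))) (⁻¹-inverse x≢0) ⟨
    x * x ^q length p * a + x * x ⁻¹ * (x ^q length p * eval p (x ⁻¹))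
      ≡⟨ solve 5 (λ x k a i v → x :* k :* a :+ x :* i :* (k :* v) := x :* k :* (a :+ i :* v)) refl x _ a (x ⁻¹) _ ⟩
    x * x ^q length p * (a + x ⁻¹ * eval p (x ⁻¹)) ∎
    where open ≡-Reasoning

  ^q-≢0 : ∀ n → x ≢ 0q → x ^q n ≢ 0q
  ^q-≢0 zero    x≢0 = ι-suc≢0 0
  ^q-≢0 (suc n) x≢0 = *-≢0 x≢0 (^q-≢0 n x≢0)

  module _ (f : ℚ⟨α⟩) {x : ℚ} (x≢0 : x ≢ 0q) where
    open ≡-Reasoning

    private
      shift : ∀ p k → x * eval (replicate k 0ℚ ++ reverse p) x ≡ x ^q k * x ^q length p * eval p (x ⁻¹)
      shift p k = begin
        x * eval (replicate k 0ℚ ++ reverse p) x      ≡⟨ cong (_*_ x) (eval-shift k (reverse p) x) ⟩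
        x * (x ^q k * eval (reverse p) x)             ≡⟨ solve 3 (λ x k r → x :* (k :* r) := k :* (x :* r)) refl x _ _ ⟩
        x ^q k * (x * eval (reverse p) x)             ≡⟨ cong (_*_ _) (eval-reverse p x≢0) ⟩
        x ^q k * (x ^q length p * eval p (x ⁻¹))      ≡⟨ *-assoc _ _ _ ⟨
        x ^q k * x ^q length p * eval p (x ⁻¹)        ∎

    -- Up to the common factor x, numerator and denominator of the substituted fraction acquire the
    -- same power of x by `shift`, and it cancels.
    Value-[1/α] : Value f (x ⁻¹) v → Value (f [1/α]) x v
    Value-[1/α] {v} F = value
      (λ eq → *-≢0 (*-≢0 (^q-≢0 (length (num f)) x≢0) (^q-≢0 (length (den f)) x≢0)) (regular F)
        (trans (sym (shift (den f) (length (num f)))) (trans (cong (_*_ x) eq) (zeroʳ x))))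
      (*-cancelˡ x≢0 (begin
        x * eval (num (f [1/α])) x                                              ≡⟨ shift (num f) (length (den f)) ⟩
        x ^q length (den f) * x ^q length (num f) * eval (num f) (x ⁻¹)         ≡⟨ cong (_*_ _) (equation F) ⟩
        x ^q length (den f) * x ^q length (num f) * (v * eval (den f) (x ⁻¹))   ≡⟨ solve 4 (λ a b v d → a :* b :* (v :* d) := v :* (b :* a :* d)) refl _ _ v _ ⟩
        v * (x ^q length (num f) * x ^q length (den f) * eval (den f) (x ⁻¹))   ≡⟨ cong (_*_ v) (shift (den f) (length (num f))) ⟨
        v * (x * eval (den (f [1/α])) x)                                        ≡⟨ solve 3 (λ v x d → v :* (x :* d) := x :* (v :* d)) refl v x _ ⟩
        x * (v * eval (den (f [1/α])) x)                                        ∎))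

    regular-[1/α] : eval (den (f [1/α])) x ≢ 0q → eval (den f) (x ⁻¹) ≢ 0q
    regular-[1/α] d≢0 eq = *-≢0 x≢0 d≢0 (trans (shift (den f) (length (num f))) (trans (cong (_*_ _) eq) (zeroʳ _)))

  eventually-≢0-ι : Eventually λ N → ι N ≢ 0q
  eventually-≢0-ι = 1 , λ { (suc N) _ → ι-suc≢0 N }

  -- The points 1/N are not large. That f has no pole there follows from the denominator of
  -- `f [1/α]`, a nonzero polynomial, at N.
  eventually-value-inverse : ∀ f → Eventually λ N → ι N ≢ 0q × ∃ λ v → Value f (ι N ⁻¹) v
  eventually-value-inverse f = both eventually-≢0-ι (eventually-≢0 (den≢0 (f [1/α]))) <&> λ {N} (N≢0 , d≢0) →
    N≢0 , eval (num f) (ι N ⁻¹) * eval (den f) (ι N ⁻¹) ⁻¹ , value (regular-[1/α] f N≢0 d≢0)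
      (sym (trans (*-assoc _ _ _) (trans (cong (_*_ _) (⁻¹-inverseˡ (regular-[1/α] f N≢0 d≢0))) (*-identityʳ _))))

-- Contents of a partition and the column heights c

module Contents where
  open Rationals
  open Sums
  open Rook
  open Strips
  open Walks

  private variable
    n : ℕ

  -- The local function of cells can only be named by unification.
  mutual
    rowCells : Partition n → ℕ → List ℕ → List (ℕ × ℕ)
    rowCells = _

    cells≡rowCells : (μ : Partition n) → cells μ ≡ rowCells μ 1 (parts μ)
    cells≡rowCells μ with 1 | parts μ
    ... | j | ls = refl

  rowOf : ℕ → ℕ → List (ℕ × ℕ)
  rowOf j l = map (λ i → suc i , j) (upTo l)

  cellsFrom : ℕ → List ℕ → List (ℕ × ℕ)
  cellsFrom j []       = []
  cellsFrom j (l ∷ ls) = rowOf j l ++ cellsFrom (suc j) ls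

  rowCells≡cellsFrom : (μ : Partition n) → ∀ j ls → rowCells μ j ls ≡ cellsFrom j ls
  rowCells≡cellsFrom μ j []       = refl
  rowCells≡cellsFrom μ j (l ∷ ls) = cong (rowOf j l ++_) (rowCells≡cellsFrom μ (suc j) ls)

  cells≡cellsFrom : (μ : Partition n) → cells μ ≡ cellsFrom 1 (parts μ)
  cells≡cellsFrom μ = trans (cells≡rowCells μ) (rowCells≡cellsFrom μ 1 (parts μ))

  ∏-row : ∀ y l → ∏ (upTo l) (λ i → y + ι i) ≡ rowProduct y l
  ∏-row y zero    = refl
  ∏-row y (suc l) = begin
    ∏ (upTo (suc l)) (λ i → y + ι i)             ≡⟨ cong (λ is → ∏ is (λ i → y + ι i)) (List.upTo-∷ʳ l) ⟨
    ∏ (upTo l ∷ʳ l) (λ i → y + ι i)              ≡⟨ ∏-++ (upTo l) (l ∷ []) _ ⟩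
    ∏ (upTo l) (λ i → y + ι i) * ((y + ι l) * 1q) ≡⟨ cong₂ _*_ (∏-row y l) (*-identityʳ _) ⟩
    rowProduct y l * (y + ι l)                   ∎
    where open ≡-Reasoning

  ιℤ-⊖ : ∀ m n → ιℤ (m ⊖ n) ≡ ι m - ι n
  ιℤ-⊖ m n = trans (cong ιℤ (sym (ℤ.m-n≡m⊖n m n))) (trans (ιℤ-+ (+ m) (ℤ.- + n)) (cong (_+_ (ι m)) (ιℤ-neg (+ n))))

  -- Columns and rows count from 1, so the cell with i cells to its left in row j has content i + 1
  -- - j; hence the base x + 1 - j.
  ∏-cellsFrom : ∀ x j ls → ∏ (cellsFrom j ls) (λ c → x + ιℤ (uncurry _⊖_ c)) ≡ contentProduct (x + 1q - ι j) ls
  ∏-cellsFrom x j []       = refl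
  ∏-cellsFrom x j (l ∷ ls) = begin
    ∏ (rowOf j l ++ cellsFrom (suc j) ls) (λ c → x + ιℤ (uncurry _⊖_ c))
      ≡⟨ ∏-++ (rowOf j l) (cellsFrom (suc j) ls) _ ⟩
    ∏ (rowOf j l) (λ c → x + ιℤ (uncurry _⊖_ c)) * ∏ (cellsFrom (suc j) ls) (λ c → x + ιℤ (uncurry _⊖_ c))
      ≡⟨ cong₂ _*_
           (trans (∏-map (λ i → suc i , j) (upTo l) (λ c → x + ιℤ (uncurry _⊖_ c))) (trans
             (∏-cong (upTo l) λ i → trans (cong (_+_ x) (trans (ιℤ-⊖ (suc i) j) (cong (_- ι j) (ι-suc i))))
               (solve 3 (λ x i j → x :+ (con (+ 1) :+ i :- j) := x :+ con (+ 1) :- j :+ i) refl x (ι i) (ι j)))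
             (∏-row y l)))
           (trans (∏-cellsFrom x (suc j) ls) (cong (λ z → contentProduct z ls) (trans (cong (_-_ (x + 1q)) (ι-suc j))
             (solve 2 (λ x j → x :+ con (+ 1) :- (con (+ 1) :+ j) := x :+ con (+ 1) :- j :- con (+ 1)) refl x (ι j))))) ⟩
    rowProduct y l * contentProduct (y - 1q) ls ∎
    where
    open ≡-Reasoning
    y = x + 1q - ι j

  ∏-contents : ∀ x (μ : Partition n) → ∏ (contents μ) (λ c → x + ιℤ c) ≡ contentProduct x (parts μ)
  ∏-contents x μ = begin
    ∏ (contents μ) (λ c → x + ιℤ c)                                        ≡⟨ ∏-map (uncurry _⊖_) (cells μ) _ ⟩
    ∏ (cells μ) (λ c → x + ιℤ (uncurry _⊖_ c))                             ≡⟨ cong (λ cs → ∏ cs (λ c → x + ιℤ (uncurry _⊖_ c))) (cells≡cellsFrom μ) ⟩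
    ∏ (cellsFrom 1 (parts μ)) (λ c → x + ιℤ (uncurry _⊖_ c))               ≡⟨ ∏-cellsFrom x 1 (parts μ) ⟩
    contentProduct (x + 1q - 1q) (parts μ)                                 ≡⟨ cong (λ y → contentProduct y (parts μ)) (solve 1 (λ x → x :+ con (+ 1) :- con (+ 1) := x) refl x) ⟩
    contentProduct x (parts μ)                                             ∎
    where open ≡-Reasoning

  ∈-row⁻ : ∀ {j l a b} → (a , b) ∈ rowOf j l → ∃ λ i → a ≡ suc i × b ≡ j × i ℕ.< l
  ∈-row⁻ {j} c∈ with ∈.∈-map⁻ (λ i → suc i , j) c∈
  ... | i , i∈ , refl = i , refl , refl , ∈.∈-upTo⁻ i∈

  ∈-row⁺ : ∀ {j l i} → i ℕ.< l → (suc i , j) ∈ rowOf j l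
  ∈-row⁺ {j} i<l = ∈.∈-map⁺ (λ i → suc i , j) (∈.∈-upTo⁺ i<l)

  ∈-cellsFrom⇒positive : ∀ j ls {a b} → (a , b) ∈ cellsFrom j ls → (∃ λ i → a ≡ suc i) × j ℕ.≤ b
  ∈-cellsFrom⇒positive j (l ∷ ls) c∈ with ∈.∈-++⁻ (rowOf j l) c∈
  ... | inj₁ c∈′ with ∈-row⁻ c∈′
  ...   | i , a≡ , refl , _ = (i , a≡) , ℕ.≤-refl
  ∈-cellsFrom⇒positive j (l ∷ ls) c∈ | inj₂ c∈′ with ∈-cellsFrom⇒positive (suc j) ls c∈′
  ...   | a≡ , j<b = a≡ , ℕ.<⇒≤ j<b

  left-cell : ∀ j ls {i b} → (suc (suc i) , b) ∈ cellsFrom j ls → (suc i , b) ∈ cellsFrom j ls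
  left-cell j (l ∷ ls) c∈ with ∈.∈-++⁻ (rowOf j l) c∈
  ... | inj₂ c∈′ = ∈.∈-++⁺ʳ (rowOf j l) (left-cell (suc j) ls c∈′)
  ... | inj₁ c∈′ with ∈-row⁻ c∈′
  ...   | _ , refl , refl , i<l = ∈.∈-++⁺ˡ (∈-row⁺ (ℕ.<⇒≤ i<l))

  lower-cell : ∀ j ls {a b} → Decreasing ls → j ℕ.≤ b → (a , suc b) ∈ cellsFrom j ls → (a , b) ∈ cellsFrom j ls
  lower-cell j (l ∷ ls) dec j≤b c∈ with ∈.∈-++⁻ (rowOf j l) c∈
  ... | inj₁ c∈′ with ∈-row⁻ c∈′
  ...   | _ , _ , refl , _ = contradiction j≤b (ℕ.<-irrefl refl)
  lower-cell j (l ∷ ls) {a} {b} dec j≤b c∈ | inj₂ c∈′ with ℕ.m≤n⇒m<n∨m≡n j≤b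
  ... | inj₁ j<b  = ∈.∈-++⁺ʳ (rowOf j l) (lower-cell (suc j) ls (proj₂ (uncons dec)) j<b c∈′)
  ... | inj₂ refl = ∈.∈-++⁺ˡ (first-row ls (proj₁ (uncons dec)) c∈′)
    where
    first-row : ∀ ls → firstPart ls ℕ.≤ l → (a , suc j) ∈ cellsFrom (suc j) ls → (a , j) ∈ rowOf j l
    first-row (p ∷ ps) p≤l c∈ with ∈.∈-++⁻ (rowOf (suc j) p) c∈
    ... | inj₂ c∈′ = contradiction (proj₂ (∈-cellsFrom⇒positive (suc (suc j)) ps c∈′)) (ℕ.<-irrefl refl)
    ... | inj₁ c∈′ with ∈-row⁻ c∈′
    ...   | _ , refl , _ , i<p = ∈-row⁺ (ℕ.<-≤-trans i<p p≤l)

  module _ (μ : Partition n) where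

    ∈-contents⁻ : ∀ {c} → c ∈ contents μ → ∃ λ i → ∃ λ r → (suc i , suc r) ∈ cellsFrom 1 (parts μ) × c ≡ i ⊖ r
    ∈-contents⁻ c∈ with ∈.∈-map⁻ (uncurry _⊖_) c∈
    ... | (a , b) , ab∈ , refl with subst ((a , b) ∈_) (cells≡cellsFrom μ) ab∈
    ...   | ab∈′ with ∈-cellsFrom⇒positive 1 (parts μ) ab∈′
    ...     | (i , refl) , ℕ.s≤s {n = r} _ = i , r , ab∈′ , ℤ.[1+m]⊖[1+n]≡m⊖n i r

    ∈-contents⁺ : ∀ {i r} → (suc i , suc r) ∈ cellsFrom 1 (parts μ) → i ⊖ r ∈ contents μ
    ∈-contents⁺ {i} {r} c∈ = subst (_∈ contents μ) (ℤ.[1+m]⊖[1+n]≡m⊖n i r)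
      (∈.∈-map⁺ (uncurry _⊖_) (subst ((suc i , suc r) ∈_) (sym (cells≡cellsFrom μ)) c∈))

    -- A positive content puts the cell off the first column, and its left neighbour has content one
    -- less.
    content-pred : ∀ {c} → c ∈ contents μ → + 0 ℤ.< c → ℤ.pred c ∈ contents μ
    content-pred c∈ 0<c with ∈-contents⁻ c∈
    ... | zero  , zero  , _  , refl = contradiction 0<c (ℤ.<-irrefl refl)
    ... | zero  , suc r , _  , refl = contradiction 0<c λ ()
    ... | suc i , r     , ∈c , refl = subst (_∈ contents μ) (pred-⊖ i r) (∈-contents⁺ (left-cell 1 (parts μ) ∈c))
      where
      pred-⊖ : ∀ i r → i ⊖ r ≡ ℤ.pred (suc i ⊖ r)
      pred-⊖ i r = trans (sym (ℤ.pred-suc (i ⊖ r))) (cong ℤ.pred (ℤ.distribʳ-⊖-+-pos 1 i r))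

    -- A negative content puts the cell off the bottom row; the cell below it exists because the
    -- rows decrease, and has content one more.
    content-suc : ∀ {c} → c ∈ contents μ → c ℤ.< + 0 → ℤ.suc c ∈ contents μ
    content-suc c∈ c<0 with ∈-contents⁻ c∈
    ... | i , zero  , _  , refl = contradiction (subst (ℤ._< + 0) (ℤ.⊖-≥ ℕ.z≤n) c<0) λ { (ℤ.+<+ ()) }
    ... | i , suc r , ∈c , refl = subst (_∈ contents μ) (suc-⊖ i r) (∈-contents⁺ (lower-cell 1 (parts μ) (decreasing μ) (ℕ.s≤s ℕ.z≤n) ∈c))
      where
      suc-⊖ : ∀ i r → i ⊖ r ≡ ℤ.suc (i ⊖ suc r)
      suc-⊖ i r = trans (sym (ℤ.[1+m]⊖[1+n]≡m⊖n i r)) (sym (ℤ.distribʳ-⊖-+-pos 1 i (suc r)))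

  zero-content : .{{NonZero n}} → (μ : Partition n) → + 0 ∈ contents μ
  zero-content {suc n} μ@(mkPartition (suc l ∷ ls) _ _ _) = ∈-contents⁺ μ {0} {0} (here refl)
  zero-content {suc n} (mkPartition (zero ∷ ls) _ (() ∷ _) _)
  zero-content {suc n} (mkPartition [] _ _ ())

  -- The contents form an interval of integers around 0, so consecutive terms of
  -- the sorted sequence κ differ by at most 1.
  module SortedContents .{{_ : NonZero n}} (μ : Partition n) (κ : Fin n → ℤ)
    (sorted : ∀ i j → i Fin.≤ j → κ j ℤ.≤ κ i) (contents↭ : tabulate κ ↭ contents μ) where

    κ∈contents : ∀ i → κ i ∈ contents μ
    κ∈contents i = ↭.∈-resp-↭ contents↭ (∈.∈-tabulate⁺ i)

    content⇒κ : ∀ {c} → c ∈ contents μ → ∃ λ i → c ≡ κ i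
    content⇒κ c∈ = ∈.∈-tabulate⁻ (↭.∈-resp-↭ (↭.↭-sym contents↭) c∈)

    no-gap : ∀ i j → toℕ j ≡ suc (toℕ i) → ∀ {c} → c ∈ contents μ → κ j ℤ.< c → c ℤ.< κ i → ⊥
    no-gap i j j≡1+i c∈ κj<c c<κi with content⇒κ c∈
    ... | m , refl with toℕ m ℕ.≤? toℕ i
    ...   | yes m≤i = ℤ.<-irrefl refl (ℤ.<-≤-trans c<κi (sorted m i m≤i))
    ...   | no  m≰i = ℤ.<-irrefl refl (ℤ.<-≤-trans κj<c (sorted j m (subst (ℕ._≤ toℕ m) (sym j≡1+i) (ℕ.≰⇒> m≰i))))

    -- A gap would contain a content: the successor of κ j if κ j is negative; otherwise κ i is
    -- positive and its predecessor is one.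
    adjacent : ∀ i j → toℕ j ≡ suc (toℕ i) → κ i ℤ.≤ ℤ.suc (κ j)
    adjacent i j j≡1+i with κ i ℤ.≤? ℤ.suc (κ j)
    ... | yes le = le
    ... | no ≰ with κ j ℤ.<? + 0
    ...   | yes κj<0 = ⊥-elim (no-gap i j j≡1+i (content-suc μ (κ∈contents j) κj<0) (ℤ.suc[i]≤j⇒i<j ℤ.≤-refl) (ℤ.≰⇒> ≰))
    ...   | no  κj≮0 = ⊥-elim (no-gap i j j≡1+i (content-pred μ (κ∈contents i) 0<κi) κj<pred (ℤ.i≤pred[j]⇒i<j ℤ.≤-refl))
      where
      suc<κi : ℤ.suc (κ j) ℤ.< κ i
      suc<κi = ℤ.≰⇒> ≰
      0<κi : + 0 ℤ.< κ i
      0<κi = ℤ.≤-<-trans (ℤ.≮⇒≥ κj≮0) (ℤ.<-trans (ℤ.suc[i]≤j⇒i<j ℤ.≤-refl) suc<κi)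
      κj<pred : κ j ℤ.< ℤ.pred (κ i)
      κj<pred = ℤ.suc[i]≤j⇒i<j (ℤ.i<j⇒i≤pred[j] suc<κi)

    c : Fin n → ℤ
    c i = κ i ℤ.+ + toℕ i

    -- κ drops by at most 1 where the index gains 1.
    c-step : ∀ i j → toℕ j ≡ suc (toℕ i) → c i ℤ.≤ c j
    c-step i j j≡1+i = ℤ.≤-trans (ℤ.+-monoˡ-≤ (+ toℕ i) (adjacent i j j≡1+i)) (ℤ.≤-reflexive (begin
      ℤ.suc (κ j) ℤ.+ + toℕ i          ≡⟨ cong (ℤ._+ + toℕ i) (ℤ.+-comm (+ 1) (κ j)) ⟩
      κ j ℤ.+ + 1 ℤ.+ + toℕ i          ≡⟨ ℤ.+-assoc (κ j) (+ 1) (+ toℕ i) ⟩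
      κ j ℤ.+ + suc (toℕ i)            ≡⟨ cong (λ k → κ j ℤ.+ + k) j≡1+i ⟨
      c j                              ∎))
      where open ≡-Reasoning

    c-mono-by : ∀ t i j → toℕ j ≡ t ℕ.+ toℕ i → c i ℤ.≤ c j
    c-mono-by zero    i j eq = ℤ.≤-reflexive (cong c (Fin.toℕ-injective (sym eq)))
    c-mono-by (suc t) i j eq = ℤ.≤-trans (c-mono-by t i k (Fin.toℕ-fromℕ< k<n))
      (c-step k j (trans eq (cong suc (sym (Fin.toℕ-fromℕ< k<n)))))
      where
      k<n : t ℕ.+ toℕ i ℕ.< n
      k<n = ℕ.≤-trans (ℕ.≤-reflexive (sym eq)) (ℕ.<⇒≤ (Fin.toℕ<n j))
      k : Fin n
      k = Fin.fromℕ< k<n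

    c-mono : ∀ i j → i Fin.≤ j → c i ℤ.≤ c j
    c-mono i j i≤j = c-mono-by (toℕ j ∸ toℕ i) i j (sym (ℕ.m∸n+n≡m i≤j))

    c-at-zero : ∃ λ m → κ m ≡ + 0
    c-at-zero with content⇒κ (zero-content μ)
    ... | m , eq = m , sym eq

    -- At an index m with κ m = 0, c m is m. Later indices follow by monotonicity of c, earlier ones
    -- have κ at least 0. The upper bound uses the same m with the two cases exchanged.
    c-nonNegative : ∀ i → + 0 ℤ.≤ c i
    c-nonNegative i with c-at-zero
    ... | m , κm≡0 with toℕ m ℕ.≤? toℕ i
    ...   | yes m≤i = ℤ.≤-trans (subst (λ k → + 0 ℤ.≤ k ℤ.+ + toℕ m) (sym κm≡0) (ℤ.+≤+ ℕ.z≤n)) (c-mono m i m≤i)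
    ...   | no  m≰i = ℤ.+-mono-≤ {+ 0} {κ i} {+ 0} (subst (ℤ._≤ κ i) κm≡0 (sorted i m (ℕ.<⇒≤ (ℕ.≰⇒> m≰i)))) (ℤ.+≤+ ℕ.z≤n)

    c-bounded : ∀ i → c i ℤ.≤ + n
    c-bounded i with c-at-zero
    ... | m , κm≡0 with toℕ m ℕ.≤? toℕ i
    ...   | yes m≤i = ℤ.+-mono-≤ {κ i} {+ 0} (subst (κ i ℤ.≤_) κm≡0 (sorted m i m≤i)) (ℤ.+≤+ (ℕ.<⇒≤ (Fin.toℕ<n i)))
    ...   | no  m≰i = ℤ.≤-trans (c-mono i m (ℕ.<⇒≤ (ℕ.≰⇒> m≰i)))
      (subst (λ k → k ℤ.+ + toℕ m ℤ.≤ + n) (sym κm≡0) (ℤ.+≤+ (ℕ.<⇒≤ (Fin.toℕ<n m))))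

    c-∏ : ∀ x → ∏ (allFin n) (λ i → x + (ιℤ (c i) - ι (toℕ i))) ≡ contentProduct x (parts μ)
    c-∏ x = begin
      ∏ (allFin n) (λ i → x + (ιℤ (c i) - ι (toℕ i)))
        ≡⟨ ∏-cong (allFin n) (λ i → cong (_+_ x) (trans (cong (_- ι (toℕ i)) (ιℤ-+ (κ i) (+ toℕ i)))
             (solve 2 (λ k i → k :+ i :- i := k) refl (ιℤ (κ i)) (ι (toℕ i))))) ⟩
      ∏ (allFin n) (λ i → x + ιℤ (κ i))
        ≡⟨ ∏-map κ (allFin n) _ ⟨
      ∏ (map κ (allFin n)) (λ k → x + ιℤ k)
        ≡⟨ cong (λ ks → ∏ ks (λ k → x + ιℤ k)) (List.map-tabulate id κ) ⟩
      ∏ (tabulate κ) (λ k → x + ιℤ k)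
        ≡⟨ ∏-↭ _ contents↭ ⟩
      ∏ (contents μ) (λ k → x + ιℤ k)
        ≡⟨ ∏-contents x μ ⟩
      contentProduct x (parts μ) ∎
      where open ≡-Reasoning

-- ℚ(α) as a discrete field, and positivity in ℚ

module Field where
  open Rationals
  open Sums
  open Rook
  open PowerSums
  open Fractions

  -- Transfers an identity of ℚ in at most three variables to ℚ(α), since finitely many fractions
  -- are regular at all large N. Identities in fewer variables repeat a fraction.
  ≈-from-identity : ∀ f g h (L R : ℚ⟨α⟩) →
    (∀ {x u v w} → Value f x u → Value g x v → Value h x w → ∃ λ y → Value L x y × Value R x y) → L Defs.≈ R
  ≈-from-identity f g h L R identity = ≈-from-values L R
    (both (eventually-value f) (both (eventually-value g) (eventually-value h)) <&> λ ((_ , F) , (_ , G) , (_ , H)) → identity F G H)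

  -- Algebraically this would be cancellation of the denominator of g; values give it through
  -- transitivity in ℚ.
  ≈-trans : ∀ f g h → f Defs.≈ g → g Defs.≈ h → f Defs.≈ h
  ≈-trans f g h f≈g g≈h = ≈-from-identity f g h f h λ F G H →
    _ , F , Value-subst (sym (trans (Value-≈ f≈g F G) (Value-≈ g≈h G H))) H

  +-cong-≈ : ∀ f f′ g g′ → f Defs.≈ f′ → g Defs.≈ g′ → (f Defs.+ g) Defs.≈ (f′ Defs.+ g′)
  +-cong-≈ f f′ g g′ f≈ g≈ = ≈-from-values (f Defs.+ g) (f′ Defs.+ g′)
    (both (both (eventually-value f) (eventually-value f′)) (both (eventually-value g) (eventually-value g′)) <&>
      λ (((_ , F) , (_ , F′)) , ((_ , G) , (_ , G′))) →
        _ , Value-+ F G , Value-subst (sym (cong₂ _+_ (Value-≈ f≈ F F′) (Value-≈ g≈ G G′))) (Value-+ F′ G′))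

  *-cong-≈ : ∀ f f′ g g′ → f Defs.≈ f′ → g Defs.≈ g′ → (f Defs.* g) Defs.≈ (f′ Defs.* g′)
  *-cong-≈ f f′ g g′ f≈ g≈ = ≈-from-values (f Defs.* g) (f′ Defs.* g′)
    (both (both (eventually-value f) (eventually-value f′)) (both (eventually-value g) (eventually-value g′)) <&>
      λ (((_ , F) , (_ , F′)) , ((_ , G) , (_ , G′))) →
        _ , Value-* F G , Value-subst (sym (cong₂ _*_ (Value-≈ f≈ F F′) (Value-≈ g≈ G G′))) (Value-* F′ G′))

  neg-cong-≈ : ∀ f f′ → f Defs.≈ f′ → (Defs.- f) Defs.≈ (Defs.- f′)
  neg-cong-≈ f f′ f≈ = ≈-from-identity f f′ f (Defs.- f) (Defs.- f′) λ F F′ _ →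
    _ , Value-neg F , Value-subst (sym (cong -_ (Value-≈ f≈ F F′))) (Value-neg F′)

  ℚ⟨α⟩-commutativeRing : CommutativeRing 0ℓ 0ℓ
  ℚ⟨α⟩-commutativeRing = record
    { Carrier = ℚ⟨α⟩ ; _≈_ = Defs._≈_ ; _+_ = Defs._+_ ; _*_ = Defs._*_ ; -_ = Defs.-_ ; 0# = Defs.0# ; 1# = Defs.1#
    ; isCommutativeRing = record
      { isRing = record
        { +-isAbelianGroup = record
          { isGroup = record
            { isMonoid = record
              { isSemigroup = record
                { isMagma = record
                  { isEquivalence = record
                    { refl  = λ _ → refl
                    ; sym   = λ eq i → sym (eq i)
                    ; trans = λ {f} {g} {h} → ≈-trans f g h }
                  ; ∙-cong = λ {f} {f′} {g} {g′} → +-cong-≈ f f′ g g′ }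
                ; assoc = λ f g h → ≈-from-identity f g h _ _ λ F G H →
                    _ , Value-+ (Value-+ F G) H , Value-subst (sym (+-assoc _ _ _)) (Value-+ F (Value-+ G H)) }
              ; identity =
                  (λ f → ≈-from-identity f f f _ _ λ F _ _ → _ , Value-+ (Value-0 _) F , Value-subst (sym (+-identityˡ _)) F) ,
                  (λ f → ≈-from-identity f f f _ _ λ F _ _ → _ , Value-+ F (Value-0 _) , Value-subst (sym (+-identityʳ _)) F) }
            ; inverse =
                (λ f → ≈-from-identity f f f _ _ λ F _ _ → _ , Value-+ (Value-neg F) F , Value-subst (sym (-‿inverseˡ _)) (Value-0 _)) ,
                (λ f → ≈-from-identity f f f _ _ λ F _ _ → _ , Value-+ F (Value-neg F) , Value-subst (sym (-‿inverseʳ _)) (Value-0 _))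
            ; ⁻¹-cong = λ {f} {f′} → neg-cong-≈ f f′ }
          ; comm = λ f g → ≈-from-identity f g f _ _ λ F G _ → _ , Value-+ F G , Value-subst (+-comm _ _) (Value-+ G F) }
        ; *-cong = λ {f} {f′} {g} {g′} → *-cong-≈ f f′ g g′
        ; *-assoc = λ f g h → ≈-from-identity f g h _ _ λ F G H →
            _ , Value-* (Value-* F G) H , Value-subst (sym (*-assoc _ _ _)) (Value-* F (Value-* G H))
        ; *-identity =
            (λ f → ≈-from-identity f f f _ _ λ F _ _ → _ , Value-* (Value-1 _) F , Value-subst (sym (*-identityˡ _)) F) ,
            (λ f → ≈-from-identity f f f _ _ λ F _ _ → _ , Value-* F (Value-1 _) , Value-subst (sym (*-identityʳ _)) F)
        ; distrib =
            (λ f g h → ≈-from-identity f g h _ _ λ F G H →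
              _ , Value-* F (Value-+ G H) , Value-subst (sym (distribˡ _ _ _)) (Value-+ (Value-* F G) (Value-* F H))) ,
            (λ f g h → ≈-from-identity f g h _ _ λ F G H →
              _ , Value-* (Value-+ G H) F , Value-subst (sym (distribʳ _ _ _)) (Value-+ (Value-* G F) (Value-* H F))) }
      ; *-comm = λ f g → ≈-from-identity f g f _ _ λ F G _ → _ , Value-* F G , Value-subst (*-comm _ _) (Value-* G F) } }

  1≉0 : ¬ (Defs.1# Defs.≈ Defs.0#)
  1≉0 1≈0 = ι-suc≢0 0 (Value-≈ 1≈0 (Value-1 0q) (Value-0 0q))

  -- Vanishing of the numerator is decidable, and a nonzero numerator may serve as a denominator.
  zeroOrInvertible : ∀ f → f Defs.≈ Defs.0# ⊎ ∃ λ g → (f Defs.* g) Defs.≈ Defs.1#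
  zeroOrInvertible f with zero? (num f)
  ... | inj₁ n≈0 = inj₁ (≈-from-identity f f f f Defs.0# λ {x} F _ _ → 0q ,
        value (Value.regular F) (trans (eval-cong (num f) [] x n≈0) (sym (zeroˡ _))) , Value-0 x)
  ... | inj₂ n≢0 = inj₂ (f⁻¹ , ≈-from-values (f Defs.* f⁻¹) Defs.1#
      (both (eventually-≢0 (den≢0 f)) (eventually-≢0 n≢0) <&> λ {N} (d≢0 , n≢0) → 1q ,
        value (λ eq → *-≢0 d≢0 n≢0 (trans (sym (eval-*ᵖ (den f) (num f) (ι N))) eq))
          (trans (eval-*ᵖ (num f) (den f) (ι N)) (trans (*-comm _ _) (trans (sym (eval-*ᵖ (den f) (num f) (ι N))) (sym (*-identityˡ _))))) ,
        Value-1 (ι N)))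
    where
    f⁻¹ : ℚ⟨α⟩
    f⁻¹ = frac (den f) (num f) n≢0

  eventually-all : ∀ {d} {P : Fin d → ℕ → Set} → (∀ i → Eventually (P i)) → Eventually (λ N → ∀ i → P i N)
  eventually-all {zero}  p = 0 , λ _ _ ()
  eventually-all {suc d} p = both (p Fin.zero) (eventually-all (p ∘ Fin.suc)) <&> λ (p₀ , ps) → λ { Fin.zero → p₀ ; (Fin.suc i) → ps i }

  opaque
    unfolding _+_ ιℤ

    square-nonNegative : ∀ v → 0ℚ ℚ.≤ v * v
    square-nonNegative v with ℚ.≤-total 0ℚ v
    ... | inj₁ 0≤v = subst (ℚ._≤ v ℚ.* v) (ℚ.*-zeroˡ v) (ℚ.*-monoʳ-≤-nonNeg v {{ℚ.nonNegative 0≤v}} 0≤v)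
    ... | inj₂ v≤0 = subst (ℚ._≤ v ℚ.* v) (ℚ.*-zeroˡ v) (ℚ.*-monoʳ-≤-nonPos v {{ℚ.nonPositive v≤0}} v≤0)

    *-nonNegative : ∀ {v w} → 0ℚ ℚ.≤ v → 0ℚ ℚ.≤ w → 0ℚ ℚ.≤ v * w
    *-nonNegative {v} {w} 0≤v 0≤w = subst (ℚ._≤ v ℚ.* w) (ℚ.*-zeroˡ w) (ℚ.*-monoʳ-≤-nonNeg w {{ℚ.nonNegative 0≤w}} 0≤v)

    ι-nonNegative : ∀ n → 0ℚ ℚ.≤ ι n
    ι-nonNegative n = ι-mono {0} {n} ℕ.z≤n

    ∑-nonNegative : ∀ {A : Set} (xs : List A) {f : A → ℚ} → (∀ x → 0ℚ ℚ.≤ f x) → 0ℚ ℚ.≤ ∑ xs f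
    ∑-nonNegative []       0≤f = ℚ.≤-refl
    ∑-nonNegative (x ∷ xs) 0≤f = ℚ.+-mono-≤ (0≤f x) (∑-nonNegative xs 0≤f)

    ∑-nonNegative-zero : ∀ {A : Set} (xs : List A) {f : A → ℚ} → (∀ x → 0ℚ ℚ.≤ f x) → ∑ xs f ≡ 0q → ∀ {x} → x ∈ xs → f x ≡ 0q
    ∑-nonNegative-zero (x ∷ xs) {f} 0≤f ∑≡0 x∈ = case x∈ of λ where
      (here refl) → ℚ.≤-antisym (subst (f x ℚ.≤_) ∑≡0 (subst (ℚ._≤ f x ℚ.+ ∑ xs f) (ℚ.+-identityʳ (f x)) (ℚ.+-monoʳ-≤ (f x) (∑-nonNegative xs 0≤f)))) (0≤f x)
      (there x∈′) → ∑-nonNegative-zero xs 0≤f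
        (ℚ.≤-antisym (subst (∑ xs f ℚ.≤_) ∑≡0 (subst (ℚ._≤ f x ℚ.+ ∑ xs f) (ℚ.+-identityˡ (∑ xs f)) (ℚ.+-monoˡ-≤ (∑ xs f) (0≤f x)))) (∑-nonNegative xs 0≤f)) x∈′

  ^q-nonNegative : ∀ n k → 0ℚ ℚ.≤ ι n ^q k
  ^q-nonNegative n zero    = ι-nonNegative 1
  ^q-nonNegative n (suc k) = *-nonNegative (ι-nonNegative n) (^q-nonNegative n k)

-- The one-row Jack function is αⁿ n! h_n[X/α]

module OneRow where
  open Rationals
  open Sums
  open Rook
  open Walks
  open Partitions
  open PowerSums
  open Fractions
  open Field

  open Orthogonal ℚ⟨α⟩-commutativeRing using (module DiscreteField)
  open DiscreteField zeroOrInvertible 1≉0 using (≉0⇒invertible; module Forms)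
  open import Relation.Binary.Reasoning.Setoid (CommutativeRing.setoid ℚ⟨α⟩-commutativeRing)

  lookup-injective : ∀ {A : Set} {xs : List A} → Unique xs → ∀ i j → lookup xs i ≡ lookup xs j → i ≡ j
  lookup-injective (_ ∷ _)   Fin.zero    Fin.zero    eq = refl
  lookup-injective (x∉ ∷ _)  Fin.zero    (Fin.suc j) eq = contradiction eq (All.lookup x∉ (∈.∈-lookup j))
  lookup-injective (x∉ ∷ _)  (Fin.suc i) Fin.zero    eq = contradiction (sym eq) (All.lookup x∉ (∈.∈-lookup i))
  lookup-injective (_ ∷ u)   (Fin.suc i) (Fin.suc j) eq = cong Fin.suc (lookup-injective u i j eq)

  ∑-lookup : ∀ {A : Set} (xs : List A) (f : A → ℚ) → ∑ (allFin (length xs)) (f ∘ lookup xs) ≡ ∑ xs f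
  ∑-lookup xs f = trans (sym (∑-map (lookup xs) (allFin (length xs)) f))
    (cong (λ ys → ∑ ys f) (trans (List.map-tabulate id (lookup xs)) (List.tabulate-lookup xs)))

  ⁻¹-≢0 : ∀ {x} → x ≢ 0q → x ⁻¹ ≢ 0q
  ⁻¹-≢0 {x} x≢0 eq = ι-suc≢0 0 (trans (sym (⁻¹-inverse x≢0)) (trans (cong (_*_ x) eq) (zeroʳ x)))

  ⁻¹-involutive : ∀ {x} → x ≢ 0q → x ⁻¹ ⁻¹ ≡ x
  ⁻¹-involutive x≢0 = *-cancelˡ (⁻¹-≢0 x≢0) (trans (⁻¹-inverse (⁻¹-≢0 x≢0)) (sym (⁻¹-inverseˡ x≢0)))

  ^q-inverse : ∀ {x} → x ≢ 0q → ∀ k → x ^q k * x ⁻¹ ^q k ≡ 1q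
  ^q-inverse     x≢0 zero    = *-identityˡ 1q
  ^q-inverse {x} x≢0 (suc k) = trans
    (solve 4 (λ x p y q → x :* p :* (y :* q) := x :* y :* (p :* q)) refl x _ (x ⁻¹) _)
    (trans (cong₂ _*_ (⁻¹-inverse x≢0) (^q-inverse x≢0 k)) (*-identityˡ 1q))

  square-weight≡0 : ∀ {v w} → w ≢ 0q → v * v * w ≡ 0q → v ≡ 0q
  square-weight≡0 {v} w≢0 eq with v ℚ.≟ 0q
  ... | yes v≡0 = v≡0
  ... | no  v≢0 = contradiction eq (*-≢0 (*-≢0 v≢0 v≢0) w≢0)

  module _ {n : ℕ} where

    index : Partition n → Fin (length (partitions n))
    index μ = Any.index (∈-partitions μ)

    at : Fin (length (partitions n)) → Partition n
    at = lookup (partitions n)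

    at-index : ∀ μ → at (index μ) ≡ μ
    at-index μ = sym (Any.lookup-index (∈-partitions μ))

    index-at : ∀ i → index (at i) ≡ i
    index-at i = lookup-injective (partitions-unique n) (index (at i)) i (at-index (at i))

    open Forms at index at-index index-at public

    IsBilinear⇒Bilinear : ∀ {⟨_,_⟩} → IsBilinear ⟨_,_⟩ → Bilinear ⟨_,_⟩
    IsBilinear⇒Bilinear bilinear = record
      { cong-form = λ {f} {f′} {g} {g′} → IsBilinear.cong-≈ bilinear {f} {f′} {g} {g′}
      ; +-formˡ   = IsBilinear.+-linearˡ bilinear
      ; +-formʳ   = IsBilinear.+-linearʳ bilinear
      ; *-formˡ   = IsBilinear.·-linearˡ bilinear
      ; *-formʳ   = IsBilinear.·-linearʳ bilinear }

    Value-powerSum : ∀ (ν μ : Partition n) x → Value (powerSum ν μ) x (powerSumCoeff (parts ν) (parts μ))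
    Value-powerSum ν μ x = Value-subst (ι-powerSums (parts ν) (parts μ)) (Value-fromℤ _ x)

  powerSumCoeff-single : ∀ {ks} → All (0 ℕ.<_) ks → powerSumCoeff ks (ℕ.sum ks ∷ []) ≡ 1q
  powerSumCoeff-single []                = refl
  powerSumCoeff-single {k ∷ ks} (_ ∷ ps) = trans (+-identityʳ _) (trans
    (⟦⟧*-true (k ℕ.≤? k ℕ.+ ℕ.sum ks) (ℕ.m≤m+n k _))
    (trans (cong (λ s → powerSumCoeff ks (s ∷ [])) (ℕ.m+n∸m≡n k (ℕ.sum ks))) (powerSumCoeff-single ps)))

  -- h_n[X/α] has coefficient α^(-n) at x₁⋯x_n, each exponent 1 contributing 1/α; this fixes the
  -- power of α in the normalization.
  ∏-multichoose-ones : ∀ {x} → x ≢ 0q → ∀ k → x ^q k * ∏ (replicate k 1) (multichoose (x ⁻¹)) ≡ 1q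
  ∏-multichoose-ones     x≢0 zero    = *-identityˡ 1q
  ∏-multichoose-ones {x} x≢0 (suc k) = trans
    (solve 5 (λ x p y i q → x :* p :* (con (+ 1) :* ((y :+ con (+ 0)) :* i) :* q) := x :* y :* (con (+ 1) :* i) :* (p :* q)) refl x _ (x ⁻¹) (ι 1 ⁻¹) _)
    (trans (cong₂ _*_ (cong₂ _*_ (⁻¹-inverse x≢0) (⁻¹-inverse (ι-suc≢0 0))) (∏-multichoose-ones x≢0 k))
      (solve 0 (con (+ 1) :* con (+ 1) :* con (+ 1) := con (+ 1)) refl))

  oneRow-⊴ : ∀ {n} .{{_ : NonZero n}} (μ : Partition n) → oneRow n ⊴ μ → parts μ ≡ n ∷ []
  oneRow-⊴ {n@(suc _)} (mkPartition [] _ _ ()) top⊴μ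
  oneRow-⊴ {n@(suc _)} (mkPartition (p ∷ []) _ _ total≡) top⊴μ = cong (_∷ []) (trans (sym (ℕ.+-identityʳ p)) total≡)
  oneRow-⊴ {n@(suc _)} (mkPartition (p ∷ q ∷ ps) _ (_ ∷ 0<q ∷ _) total≡) top⊴μ = ⊥-elim (ℕ.<-irrefl refl
    (ℕ.≤-<-trans (top⊴μ 1) (subst₂ ℕ._<_ (sym (ℕ.+-identityʳ p)) (trans total≡ (sym (ℕ.+-identityʳ n)))
      (ℕ.m<m+n p (ℕ.<-≤-trans 0<q (ℕ.m≤m+n q (ℕ.sum ps)))))))

  module OneRowJack (n : ℕ) .{{n≢0 : NonZero n}}
    (⟨_,_⟩α : Λ n → Λ n → ℚ⟨α⟩) (jackProduct : IsJackProduct ⟨_,_⟩α)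
    (J : Partition n → Λ n) (jackFamily : IsJackFamily ⟨_,_⟩α J) where

    open IsJackProduct jackProduct
    open IsJackFamily jackFamily
    open Form ⟨_,_⟩α (IsBilinear⇒Bilinear isBilinear)

    d : ℕ
    d = length (partitions n)

    norm : Partition n → ℚ⟨α⟩
    norm μ = fromℕ (z μ) Defs.* α Defs.^ length (parts μ)

    normValue : Partition n → ℚ → ℚ
    normValue μ x = ι (z μ) * x ^q length (parts μ)

    Value-norm : ∀ μ x → Value (norm μ) x (normValue μ x)
    Value-norm μ x = Value-* (Value-fromℤ (+ z μ) x) (Value-^ (length (parts μ)) (Value-α x))

    normValue≢0 : ∀ μ {x} → x ≢ 0q → normValue μ x ≢ 0q
    normValue≢0 μ x≢0 = *-≢0 (λ eq → z-nonZero μ (ι-injective eq)) (^q-≢0 (length (parts μ)) x≢0)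

    powerSum-nonIsotropic : ∀ μ → ¬ (⟨ powerSum μ , powerSum μ ⟩α Defs.≈ Defs.0#)
    -- Evaluation at α = 1, where the norm is z μ.
    powerSum-nonIsotropic μ pp≈0 = normValue≢0 μ (ι-suc≢0 0) (Value-≈
      {f = norm μ} {g = Defs.0#} (begin
        norm μ                               ≈⟨ powerSum-norm μ ⟨
        ⟨ powerSum μ , powerSum μ ⟩α         ≈⟨ pp≈0 ⟩
        Defs.0#                              ∎)
      (Value-norm μ 1q) (Value-0 1q))

    module P = Basis powerSum (λ μ ν μ≢ν → powerSum-orthog μ ν (μ≢ν ∘ partition-≡)) powerSum-nonIsotropic

    -- The norms of the power sums are positive for large α, so no nonzero sum of
    -- weighted squares vanishes.
    powerSum-definite : ∀ (a : Fin d → ℚ⟨α⟩) →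
      Defs.sum (λ i → a i Defs.* a i Defs.* ⟨ powerSum (at i) , powerSum (at i) ⟩α) Defs.≈ Defs.0# → ∀ i → a i Defs.≈ Defs.0#
    powerSum-definite a sum≈0 i = ≈-from-values (a i) Defs.0# (regular <&> λ {N} (N≢0 , values) →
        0q , Value-subst (value≡0 N N≢0 values) (proj₂ (values i)) , Value-0 (ι N))
      where
      regular : Eventually λ N → ι N ≢ 0q × (∀ i → ∃ λ v → Value (a i) (ι N) v)
      regular = both eventually-≢0-ι (eventually-all (λ i → eventually-value (a i)))

      -- The given form is replaced by the explicit norm, whose value is known at every point.
      term : Fin d → ℚ⟨α⟩
      term i = a i Defs.* a i Defs.* norm (at i)

      sum-term≈0 : Defs.sum term Defs.≈ Defs.0#
      sum-term≈0 = begin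
        Defs.sum term
          ≈⟨ sum-cong-≋ (λ i → *-cong-≈ (a i Defs.* a i) (a i Defs.* a i) (norm (at i)) ⟨ powerSum (at i) , powerSum (at i) ⟩α
               (λ _ → refl) (λ j → sym (powerSum-norm (at i) j))) ⟩
        Defs.sum (λ i → a i Defs.* a i Defs.* ⟨ powerSum (at i) , powerSum (at i) ⟩α)
          ≈⟨ sum≈0 ⟩
        Defs.0# ∎
        where open import Algebra.Properties.CommutativeMonoid.Sum (CommutativeRing.+-commutativeMonoid ℚ⟨α⟩-commutativeRing) using (sum-cong-≋)

      module _ (N : ℕ) (N≢0 : ι N ≢ 0q) (values : ∀ i → ∃ λ v → Value (a i) (ι N) v) where

        v termValue : Fin d → ℚ
        v i = proj₁ (values i)
        termValue i = v i * v i * normValue (at i) (ι N)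

        Value-term : ∀ i → Value (term i) (ι N) (termValue i)
        Value-term i = Value-* {f = a i Defs.* a i} {g = norm (at i)}
          (Value-* {f = a i} {g = a i} (proj₂ (values i)) (proj₂ (values i))) (Value-norm (at i) (ι N))

        ∑-termValue : ∑ (allFin d) termValue ≡ 0q
        ∑-termValue = Value-≈ {f = Defs.sum term} {g = Defs.0#} sum-term≈0 (Value-sum {fs = term} Value-term) (Value-0 (ι N))

        termValue-nonNegative : ∀ i → 0ℚ ℚ.≤ termValue i
        termValue-nonNegative i = *-nonNegative (square-nonNegative (v i))
          (*-nonNegative (ι-nonNegative (z (at i))) (^q-nonNegative N (length (parts (at i)))))

        value≡0 : v i ≡ 0q
        value≡0 = square-weight≡0 (normValue≢0 (at i) N≢0)
          (∑-nonNegative-zero (allFin d) termValue-nonNegative ∑-termValue (∈.∈-allFin i))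

    n! : ℚ⟨α⟩
    n! = fromℕ (n !)

    n!≉0 : ¬ (n! Defs.≈ Defs.0#)
    n!≉0 n!≈0 = ι-!≢0 n (Value-≈ {f = n!} {g = Defs.0#} n!≈0 (Value-fromℤ (+ (n !)) 0q) (Value-0 0q))

    J-bottom≉0 : ∀ μ → ¬ (J μ (oneColumn n) Defs.≈ Defs.0#)
    J-bottom≉0 μ J≈0 = n!≉0 (begin
      n!                      ≈⟨ normalized μ ⟨
      J μ (oneColumn n)       ≈⟨ J≈0 ⟩
      Defs.0#                 ∎)

    -- The coefficient n! at (1ⁿ) makes `J μ` nonzero, and the form is anisotropic.
    J-nonIsotropic : ∀ μ → ¬ (⟨ J μ , J μ ⟩α Defs.≈ Defs.0#)
    J-nonIsotropic μ JJ≈0 = J-bottom≉0 μ (P.anisotropic powerSum-definite (J μ) JJ≈0 (oneColumn n))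

    normInvertible : ∀ i → ∃ λ y → (⟨ powerSum (at i) , powerSum (at i) ⟩α Defs.* y) Defs.≈ Defs.1#
    normInvertible i = ≉0⇒invertible {⟨ powerSum (at i) , powerSum (at i) ⟩α} (powerSum-nonIsotropic (at i))

    normInverse : Fin d → ℚ⟨α⟩
    normInverse i = proj₁ (normInvertible i)

    -- The common value of the pairings of G with the power sums; αⁿ compensates the coefficient
    -- α^(-n) of h_n[X/α] at x₁⋯x_n and n! is the Jack normalization.
    C : ℚ⟨α⟩
    C = n! Defs.* α Defs.^ n

    -- G = αⁿ n! h_n[X/α].
    G : Λ n
    G = combination (λ i → C Defs.* normInverse i) (powerSum ∘ at)

    G-powerSum : ∀ μ → ⟨ G , powerSum μ ⟩α Defs.≈ C
    G-powerSum μ = subst (λ ν → ⟨ G , powerSum ν ⟩α Defs.≈ C) (at-index μ) (begin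
      ⟨ G , p ⟩α                                    ≈⟨ P.combination-form (λ i → C Defs.* normInverse i) k ⟩
      C Defs.* y Defs.* ⟨ p , p ⟩α                  ≈⟨ R.*-assoc C y ⟨ p , p ⟩α ⟩
      C Defs.* (y Defs.* ⟨ p , p ⟩α)                ≈⟨ *-cong-≈ C C (y Defs.* ⟨ p , p ⟩α) Defs.1# (λ _ → refl)
                                                        (≈-trans (y Defs.* ⟨ p , p ⟩α) (⟨ p , p ⟩α Defs.* y) Defs.1# (R.*-comm y ⟨ p , p ⟩α)
                                                          (proj₂ (normInvertible k))) ⟩
      C Defs.* Defs.1#                              ≈⟨ R.*-identityʳ C ⟩
      C                                             ∎)
      where
      module R = CommutativeRing ℚ⟨α⟩-commutativeRing
      k = index μ
      y = normInverse k
      p = powerSum (at k)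

    powerSum-oneRow : ∀ μ → powerSum μ (oneRow n) Defs.≈ Defs.1#
    powerSum-oneRow μ = ≈-from-values (powerSum μ (oneRow n)) Defs.1# (0 , λ N _ → 1q ,
      Value-subst (trans (cong (λ s → powerSumCoeff (parts μ) (s ∷ [])) (sym (total μ))) (powerSumCoeff-single (positive μ)))
        (Value-powerSum μ (oneRow n) (ι N)) ,
      Value-1 (ι N))

    G-orthogonal : ∀ μ → μ ≢ oneRow n → ⟨ G , J μ ⟩α Defs.≈ Defs.0#
    G-orthogonal μ μ≢top = begin
      ⟨ G , J μ ⟩α                ≈⟨ P.form-constant G C (oneRow n) G-powerSum powerSum-oneRow (J μ) ⟩
      C Defs.* J μ (oneRow n)     ≈⟨ *-cong-≈ C C (J μ (oneRow n)) Defs.0# (λ _ → refl)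
                                       (triangular μ (oneRow n) λ top⊴μ → μ≢top (partition-≡ (oneRow-⊴ μ top⊴μ))) ⟩
      C Defs.* Defs.0#            ≈⟨ CommutativeRing.zeroʳ ℚ⟨α⟩-commutativeRing C ⟩
      Defs.0#                     ∎

    module _ {x : ℚ} (x≢0 : x ≢ 0q) (inverseValues : ∀ i → ∃ λ w → Value (normInverse i) x w) where

      -- `normInverse` is whatever inverse the field structure returns; its value is determined by
      -- the product with the explicit norm being 1.
      inverseValue : ∀ i → Value (normInverse i) x (zWeight (x ⁻¹) (at i))
      inverseValue i = Value-subst (*-cancelˡ (normValue≢0 μ x≢0) (trans product≡1 (sym zWeight≡))) (proj₂ (inverseValues i))
        where
        μ : Partition n
        μ = at i

        ℓ : ℕ
        ℓ = length (parts μ)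

        w : ℚ
        w = proj₁ (inverseValues i)

        product≡1 : normValue μ x * w ≡ 1q
        product≡1 = Value-≈ {f = norm μ Defs.* normInverse i} {g = Defs.1#} (begin
            norm μ Defs.* normInverse i
              ≈⟨ *-cong-≈ (norm μ) ⟨ powerSum μ , powerSum μ ⟩α (normInverse i) (normInverse i) (λ j → sym (powerSum-norm μ j)) (λ _ → refl) ⟩
            ⟨ powerSum μ , powerSum μ ⟩α Defs.* normInverse i
              ≈⟨ proj₂ (normInvertible i) ⟩
            Defs.1# ∎)
          (Value-* {f = norm μ} {g = normInverse i} (Value-norm μ x) (proj₂ (inverseValues i))) (Value-1 x)

        zWeight≡ : normValue μ x * zWeight (x ⁻¹) μ ≡ 1q
        zWeight≡ = trans
          (solve 4 (λ z p q i → z :* p :* (q :* i) := z :* i :* (p :* q)) refl (ι (z μ)) (x ^q ℓ) (x ⁻¹ ^q ℓ) (ι (z μ) ⁻¹))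
          (trans (cong₂ _*_ (⁻¹-inverse (λ eq → z-nonZero μ (ι-injective eq))) (^q-inverse x≢0 ℓ)) (*-identityˡ 1q))

      Value-G : ∀ μ → Value (G μ) x (ι (n !) * x ^q n * ∏ (parts μ) (multichoose (x ⁻¹)))
      Value-G μ = Value-subst
        (trans (∑-lookup (partitions n) (λ ν → ι (n !) * x ^q n * zWeight (x ⁻¹) ν * powerSumCoeff (parts ν) (parts μ)))
          (trans (∑-cong (partitions n) λ ν → *-assoc (ι (n !) * x ^q n) (zWeight (x ⁻¹) ν) _)
            (trans (∑-*ˡ (ι (n !) * x ^q n) (partitions n) _)
              (cong (_*_ (ι (n !) * x ^q n)) (powerSum-expansion (x ⁻¹) n (parts μ) (total μ))))))
        (Value-sum {fs = λ i → C Defs.* normInverse i Defs.* powerSum (at i) μ} λ i →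
          Value-* {f = C Defs.* normInverse i} {g = powerSum (at i) μ}
            (Value-* {f = C} {g = normInverse i} (Value-* {f = n!} {g = α Defs.^ n} (Value-fromℤ (+ (n !)) x) (Value-^ {f = α} n (Value-α x))) (inverseValue i))
            (Value-powerSum (at i) μ x))

    regular : Eventually λ N → ι N ≢ 0q × (∀ i → ∃ λ w → Value (normInverse i) (ι N) w)
    regular = both eventually-≢0-ι (eventually-all (λ i → eventually-value (normInverse i)))

    -- For the substitution of 1/α the expansion G has to be evaluated at 1/N, which `regular` does
    -- not cover.
    regular-inverse : Eventually λ N → ∀ i → ι N ≢ 0q × ∃ λ w → Value (normInverse i) (ι N ⁻¹) w
    regular-inverse = eventually-all (λ i → eventually-value-inverse (normInverse i))

    G-bottom : G (oneColumn n) Defs.≈ J (oneRow n) (oneColumn n)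
    G-bottom = begin
      G (oneColumn n)                 ≈⟨ ≈-from-values (G (oneColumn n)) n! (regular <&> λ {N} (N≢0 , values) →
                                           ι (n !) , Value-subst (value≡ N≢0) (Value-G N≢0 values (oneColumn n)) , Value-fromℤ (+ (n !)) (ι N)) ⟩
      n!                              ≈⟨ normalized (oneRow n) ⟨
      J (oneRow n) (oneColumn n)      ∎
      where
      value≡ : ∀ {x} → x ≢ 0q → ι (n !) * x ^q n * ∏ (replicate n 1) (multichoose (x ⁻¹)) ≡ ι (n !)
      value≡ x≢0 = trans (*-assoc _ _ _) (trans (cong (_*_ (ι (n !))) (∏-multichoose-ones x≢0 n)) (*-identityʳ _))

    J-oneRow : ∀ μ → J (oneRow n) μ Defs.≈ G μ
    J-oneRow = orthogonal⇒equal J (λ μ ν μ≢ν → orthogonal μ ν (μ≢ν ∘ partition-≡)) J-nonIsotropic _≟ₚ_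
      (oneRow n) (oneColumn n) G G-orthogonal G-bottom (J-bottom≉0 (oneRow n))

    -- J̃_(n) = n! h_n[α X].
    Value-tilde : ∀ μ → Eventually λ N → Value (tilde (J (oneRow n)) μ) (ι N) (ι (n !) * ∏ (parts μ) (multichoose (ι N)))
    Value-tilde μ = both (eventually-value-inverse (J (oneRow n) μ)) regular-inverse <&>
      λ {N} ((N≢0 , v , V) , inverses) → tilde-at N≢0 V (λ i → proj₂ (inverses i))
      where
      module _ {x v : ℚ} (x≢0 : x ≢ 0q) (V : Value (J (oneRow n) μ) (x ⁻¹) v) (inverses : ∀ i → ∃ λ w → Value (normInverse i) (x ⁻¹) w) where

        -- J is evaluated at 1/x, so the parameter of `multichoose`, the inverse of the point, is x
        -- again.
        J-value : v ≡ ι (n !) * x ⁻¹ ^q n * ∏ (parts μ) (multichoose x)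
        J-value = trans
          (Value-≈ {f = J (oneRow n) μ} {g = G μ} (J-oneRow μ) V (Value-G (⁻¹-≢0 x≢0) inverses μ))
          (cong (λ y → ι (n !) * x ⁻¹ ^q n * ∏ (parts μ) (multichoose y)) (⁻¹-involutive x≢0))

        value≡ : x ^q n * v ≡ ι (n !) * ∏ (parts μ) (multichoose x)
        value≡ = trans (cong (_*_ (x ^q n)) J-value)
          (trans (solve 4 (λ p f q m → p :* (f :* q :* m) := p :* q :* (f :* m)) refl (x ^q n) (ι (n !)) (x ⁻¹ ^q n) _)
            (trans (cong (_* (ι (n !) * ∏ (parts μ) (multichoose x))) (^q-inverse x≢0 n)) (*-identityˡ _)))

        tilde-at : Value (tilde (J (oneRow n)) μ) x (ι (n !) * ∏ (parts μ) (multichoose x))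
        tilde-at = Value-subst value≡ (Value-* {f = α Defs.^ n} {g = J (oneRow n) μ [1/α]}
          (Value-^ {f = α} n (Value-α x)) (Value-[1/α] (J (oneRow n) μ) x≢0 V))

-- Schur coefficients of J̃_(n) and the two rook formulas

module SchurCoefficients where
  open Rationals
  open Sums
  open Rook
  open Strips
  open Tableaux
  open Walks
  open Partitions
  open Fractions
  open Contents
  open Field
  open OneRow

  open import Data.Nat.ListAction.Properties using (sum-↭)
  open import Relation.Binary.Reasoning.Setoid (CommutativeRing.setoid ℚ⟨α⟩-commutativeRing)

  reverse-replicate : ∀ {A : Set} k (x : A) → reverse (replicate k x) ≡ replicate k x
  reverse-replicate zero    x = refl
  reverse-replicate (suc k) x = trans (List.unfold-reverse x (replicate k x))
    (trans (cong (_∷ʳ x) (reverse-replicate k x)) (replicate-∷ʳ k))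
    where
    replicate-∷ʳ : ∀ k → replicate k x ∷ʳ x ≡ x ∷ replicate k x
    replicate-∷ʳ zero    = refl
    replicate-∷ʳ (suc k) = cong (x ∷_) (replicate-∷ʳ k)

  module SchurCoefficient (n : ℕ) .{{n≢0 : NonZero n}}
    (⟨_,_⟩α : Λ n → Λ n → ℚ⟨α⟩) (jackProduct : IsJackProduct ⟨_,_⟩α)
    (⟨_,_⟩ : Λ n → Λ n → ℚ⟨α⟩) (hallProduct : IsHallProduct ⟨_,_⟩)
    (J : Partition n → Λ n) (jackFamily : IsJackFamily ⟨_,_⟩α J) where

    open IsHallProduct hallProduct
    open OneRowJack n ⟨_,_⟩α jackProduct J jackFamily using (Value-tilde)
    open Form ⟨_,_⟩ (IsBilinear⇒Bilinear isBilinear)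

    schur-nonIsotropic : ∀ μ → ¬ (⟨ schur μ , schur μ ⟩ Defs.≈ Defs.0#)
    schur-nonIsotropic μ ss≈0 = 1≉0 (begin
      Defs.1#                     ≈⟨ schur-norm μ ⟨
      ⟨ schur μ , schur μ ⟩       ≈⟨ ss≈0 ⟩
      Defs.0#                     ∎)

    module S = Basis schur (λ μ ν μ≢ν → schur-orthog μ ν (μ≢ν ∘ partition-≡)) schur-nonIsotropic

    contentFactor : Partition n → ℚ⟨α⟩
    contentFactor μ = foldr Defs._*_ Defs.1# (map (λ x → α Defs.+ fromℤ x) (contents μ))

    coefficient : Partition n → ℚ⟨α⟩
    coefficient μ = fromℕ (Kostka μ (replicate n 1)) Defs.* contentFactor μ

    Value-contentFactor : ∀ μ x → Value (contentFactor μ) x (contentProduct x (parts μ))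
    Value-contentFactor μ x = Value-subst (∏-contents x μ)
      (Value-foldr-* {fs = λ c → α Defs.+ fromℤ c} (λ c → Value-+ {f = α} {g = fromℤ c} (Value-α x) (Value-fromℤ c x)) (contents μ))

    Value-coefficient : ∀ μ x → Value (coefficient μ) x (ι (Kostka μ (replicate n 1)) * contentProduct x (parts μ))
    Value-coefficient μ x = Value-* {f = fromℕ (Kostka μ (replicate n 1))} {g = contentFactor μ} (Value-fromℤ _ x) (Value-contentFactor μ x)

    schurSum : Λ n
    schurSum = combination (coefficient ∘ at) (schur ∘ at)

    -- `schur-expansion` at the reversed parts, as `ι-Kostka` demands; the resulting product over
    -- the parts is symmetric, which undoes the reversal.
    Value-schurSum : ∀ μ x → Value (schurSum μ) x (ι (n !) * ∏ (parts μ) (multichoose x))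
    Value-schurSum μ x = Value-subst
      (trans (∑-lookup (partitions n) (λ ν → ι (Kostka ν (replicate n 1)) * contentProduct x (parts ν) * ι (Kostka ν (parts μ))))
        (trans (∑-cong (partitions n) λ ν → cong₂ (λ k l → k * contentProduct x (parts ν) * l)
            (trans (ι-Kostka ν (replicate n 1)) (cong (tableaux (parts ν)) (reverse-replicate n 1))) (ι-Kostka ν (parts μ)))
          (trans (schur-expansion x n (reverse (parts μ)) (trans (sum-↭ (↭.↭-reverse (parts μ))) (total μ)))
            (cong (_*_ (ι (n !))) (∏-↭ (multichoose x) (↭.↭-reverse (parts μ)))))))
      (Value-sum {fs = λ i → coefficient (at i) Defs.* schur (at i) μ} λ i →
        Value-* {f = coefficient (at i)} {g = schur (at i) μ} (Value-coefficient (at i) x) (Value-fromℤ _ x))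

    tilde≈schurSum : tilde (J (oneRow n)) ≈Λ schurSum
    tilde≈schurSum μ = ≈-from-values (tilde (J (oneRow n)) μ) (schurSum μ)
      (Value-tilde μ <&> λ {N} V → ι (n !) * ∏ (parts μ) (multichoose (ι N)) , V , Value-schurSum μ (ι N))

    schur-coefficient : ∀ μ → ⟨ tilde (J (oneRow n)) , schur μ ⟩ Defs.≈ coefficient μ
    schur-coefficient μ = subst (λ ν → ⟨ tilde (J (oneRow n)) , schur ν ⟩ Defs.≈ coefficient ν) (at-index μ) (begin
      ⟨ tilde (J (oneRow n)) , schur ν ⟩              ≈⟨ IsBilinear.cong-≈ isBilinear {tilde (J (oneRow n))} {schurSum} {schur ν} {schur ν} tilde≈schurSum (λ _ _ → refl) ⟩
      ⟨ schurSum , schur ν ⟩                          ≈⟨ S.combination-form (coefficient ∘ at) (index μ) ⟩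
      coefficient ν Defs.* ⟨ schur ν , schur ν ⟩      ≈⟨ *-cong-≈ (coefficient ν) (coefficient ν) ⟨ schur ν , schur ν ⟩ Defs.1# (λ _ → refl) (schur-norm ν) ⟩
      coefficient ν Defs.* Defs.1#                    ≈⟨ CommutativeRing.*-identityʳ ℚ⟨α⟩-commutativeRing (coefficient ν) ⟩
      coefficient ν                                   ∎)
      where
      ν : Partition n
      ν = at (index μ)

    module _ (μ : Partition n) (κ : Fin n → ℤ) (sorted : ∀ i j → i Fin.≤ j → κ j ℤ.≤ κ i) (contents↭ : tabulate κ ↭ contents μ) where

      open SortedContents μ κ sorted contents↭ using (c; c-mono; c-nonNegative; c-bounded; c-∏)

      K : ℕ
      K = Kostka μ (replicate n 1)

      rook-value : ∀ x → ι K * contentProduct x (parts μ) ≡ ∑ (allFin (suc n)) (λ k →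
        ι K * ι (rook (n ∸ toℕ k) (ferrers c)) * choose x (toℕ k) * ι (toℕ k !))
      rook-value x = sym (trans
        (∑-allFin-toℕ (suc n) (λ k → ι K * ι (rook (n ∸ k) (ferrers c)) * choose x k * ι (k !)))
        (trans (∑-cong (upTo (suc n)) λ k → solve 4 (λ K r c f → K :* r :* c :* f := K :* (r :* (c :* f))) refl (ι K) _ _ _)
          (trans (∑-*ˡ (ι K) (upTo (suc n)) _)
            (cong (_*_ (ι K)) (trans (rook-factorization c c-nonNegative c-mono c-bounded x) (c-∏ x))))))

      hit-value : ∀ x → ι K * contentProduct x (parts μ) ≡ ∑ (allFin (suc n)) (λ k →
        ι K * ι (hit (toℕ k) (ferrers c)) * choose (x + ι (toℕ k)) n)
      hit-value x = sym (trans
        (∑-allFin-toℕ (suc n) (λ k → ι K * ι (hit k (ferrers c)) * choose (x + ι k) n))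
        (trans (∑-cong (upTo (suc n)) λ k → *-assoc (ι K) _ _)
          (trans (∑-*ˡ (ι K) (upTo (suc n)) _)
            (cong (_*_ (ι K)) (trans (hit≡rook (ferrers c) x) (trans (rook-factorization c c-nonNegative c-mono c-bounded x) (c-∏ x)))))))

      rookSum hitSum : ℚ⟨α⟩
      rookSum = Defs.sum (λ (k : Fin (suc n)) →
        fromℕ K Defs.* fromℕ (rook (n ∸ toℕ k) (ferrers c)) Defs.* binom α (toℕ k) Defs.* fromℕ (toℕ k !))
      hitSum = Defs.sum (λ (k : Fin (suc n)) →
        fromℕ K Defs.* fromℕ (hit (toℕ k) (ferrers c)) Defs.* binom (α Defs.+ fromℕ (toℕ k)) n)

      Value-rookSum : ∀ x → Value rookSum x (ι K * contentProduct x (parts μ))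
      Value-rookSum x = Value-subst (sym (rook-value x))
        (Value-sum {n = suc n} {fs = λ k → fromℕ K Defs.* fromℕ (rook (n ∸ toℕ k) (ferrers c)) Defs.* binom α (toℕ k) Defs.* fromℕ (toℕ k !)} λ k →
          let r = rook (n ∸ toℕ k) (ferrers c) in
          Value-* {f = fromℕ K Defs.* fromℕ r Defs.* binom α (toℕ k)} {g = fromℕ (toℕ k !)}
            (Value-* {f = fromℕ K Defs.* fromℕ r} {g = binom α (toℕ k)}
              (Value-* {f = fromℕ K} {g = fromℕ r} (Value-fromℤ (+ K) x) (Value-fromℤ (+ r) x))
              (Value-binom {f = α} (toℕ k) (Value-α x)))
            (Value-fromℤ (+ (toℕ k !)) x))

      Value-hitSum : ∀ x → Value hitSum x (ι K * contentProduct x (parts μ))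
      Value-hitSum x = Value-subst (sym (hit-value x))
        (Value-sum {n = suc n} {fs = λ k → fromℕ K Defs.* fromℕ (hit (toℕ k) (ferrers c)) Defs.* binom (α Defs.+ fromℕ (toℕ k)) n} λ k →
          let h = hit (toℕ k) (ferrers c) in
          Value-* {f = fromℕ K Defs.* fromℕ h} {g = binom (α Defs.+ fromℕ (toℕ k)) n}
            (Value-* {f = fromℕ K} {g = fromℕ h} (Value-fromℤ (+ K) x) (Value-fromℤ (+ h) x))
            (Value-binom {f = α Defs.+ fromℕ (toℕ k)} n (Value-+ {f = α} {g = fromℕ (toℕ k)} (Value-α x) (Value-fromℤ (+ toℕ k) x))))

      coefficient≈rookSum : coefficient μ Defs.≈ rookSum
      coefficient≈rookSum = ≈-from-values (coefficient μ) rookSum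
        (0 , λ N _ → ι K * contentProduct (ι N) (parts μ) , Value-coefficient μ (ι N) , Value-rookSum (ι N))

      coefficient≈hitSum : coefficient μ Defs.≈ hitSum
      coefficient≈hitSum = ≈-from-values (coefficient μ) hitSum
        (0 , λ N _ → ι K * contentProduct (ι N) (parts μ) , Value-coefficient μ (ι N) , Value-hitSum (ι N))

      contentProducts : contentFactor μ Defs.≈ Defs.product (λ i → α Defs.+ fromℤ (c i ℤ.- + toℕ i))
      contentProducts = ≈-from-values (contentFactor μ) (Defs.product factor)
        (0 , λ N _ → contentProduct (ι N) (parts μ) , Value-contentFactor μ (ι N) ,
          Value-subst (trans (∏-cong (allFin n) λ i → cong (_+_ (ι N)) (trans (ιℤ-+ (c i) (ℤ.- + toℕ i)) (cong (_+_ (ιℤ (c i))) (ιℤ-neg (+ toℕ i)))))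
                             (c-∏ (ι N)))
            (Value-product {fs = factor} λ i → Value-+ {f = α} {g = fromℤ (c i ℤ.- + toℕ i)} (Value-α (ι N)) (Value-fromℤ _ (ι N))))
        where
        factor : Fin n → ℚ⟨α⟩
        factor i = α Defs.+ fromℤ (c i ℤ.- + toℕ i)

      schur-coefficient-formulas :
        contentFactor μ Defs.≈ Defs.product (λ i → α Defs.+ fromℤ (c i ℤ.- + toℕ i))
        × (∀ i → + 0 ℤ.≤ c i)
        × (∀ i j → i Fin.≤ j → c i ℤ.≤ c j)
        × (∀ i → c i ℤ.≤ + n)
        × ⟨ tilde (J (oneRow n)) , schur μ ⟩ Defs.≈ hitSum
        × ⟨ tilde (J (oneRow n)) , schur μ ⟩ Defs.≈ rookSum
      schur-coefficient-formulas =
        contentProducts , c-nonNegative , c-mono , c-bounded ,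
        ≈-trans ⟨ tilde (J (oneRow n)) , schur μ ⟩ (coefficient μ) hitSum (schur-coefficient μ) coefficient≈hitSum ,
        ≈-trans ⟨ tilde (J (oneRow n)) , schur μ ⟩ (coefficient μ) rookSum (schur-coefficient μ) coefficient≈rookSum

open Defs using (_+_; _*_; _≈_; 1#; sum; product)

theorem3p11 :
  (n : ℕ) → .{{_ : NonZero n}} → (lam : Partition n) →
  (κ : Fin n → ℤ) →
  (∀ i j → i Fin.≤ j → κ j ℤ.≤ κ i) →
  tabulate κ ↭ contents lam →
  (⟨_,_⟩α : Λ n → Λ n → ℚ⟨α⟩) → IsJackProduct ⟨_,_⟩α →
  (⟨_,_⟩ : Λ n → Λ n → ℚ⟨α⟩) → IsHallProduct ⟨_,_⟩ →
  (J : Partition n → Λ n) → IsJackFamily ⟨_,_⟩α J →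
  -- i : Fin n stands for the index i + 1, so c i = κ i + (i + 1) − 1
  let c : Fin n → ℤ
      c i = κ i ℤ.+ + toℕ i
      K = Kostka lam (replicate n 1)
  in
  foldr _*_ 1# (map (λ x → α + fromℤ x) (contents lam))
    ≈ product (λ i → α + fromℤ (c i ℤ.- + toℕ i))
  × (∀ i → + 0 ℤ.≤ c i)
  × (∀ i j → i Fin.≤ j → c i ℤ.≤ c j)
  × (∀ i → c i ℤ.≤ + n)
  × ⟨ tilde (J (oneRow n)) , schur lam ⟩
      ≈ sum (λ (k : Fin (suc n)) →
          fromℕ K * fromℕ (hit (toℕ k) (ferrers c)) * binom (α + fromℕ (toℕ k)) n)
  × ⟨ tilde (J (oneRow n)) , schur lam ⟩
      ≈ sum (λ (k : Fin (suc n)) →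
          fromℕ K * fromℕ (rook (n ∸ toℕ k) (ferrers c)) * binom α (toℕ k) * fromℕ (toℕ k !))
theorem3p11 n lam κ sorted contents↭ ⟨_,_⟩α jackProduct ⟨_,_⟩ hallProduct J jackFamily =
  SchurCoefficient.schur-coefficient-formulas n ⟨_,_⟩α jackProduct ⟨_,_⟩ hallProduct J jackFamily lam κ sorted contents↭
  where open SchurCoefficients
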